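{- Let $\varepsilon>0$ and consider an instance of 2GGK-C. Let $OPT$ be an optimal packing and let $OPT_{L\&C}$ be a most profitable solution that is packed by a guillotine separable $L\&C$ packing. Then $p(OPT_{L\&C})\ge (\frac34-O(\varepsilon))\,p(OPT)$.
   Context: 2GGK-C: items are axis-aligned rectangles with integral width $w(i)$ and height $h(i)$, all of profit $1$; a feasible solution places a subset of items by translation (no rotation) as pairwise disjoint open rectangles in $[0,N]^2$ such that the packing is guillotine separable (a packing in a rectangle $R$ is guillotine separable if it has at most one item or some horizontal/vertical segment spanning $R$ meets no item interior and splits $R$ into two rectangles whose packings are guillotine separable); $p(S)=|S|$. An item is long if $w(i)>N/2$ or $h(i)>N/2$. Containers are pairwise non-overlapping axis-aligned rectangles labeled large, horizontal, vertical or area: a large container contains a single item; in a horizontal container items are stacked on top of each other; in a vertical container items are placed side by side; an area container of size $a\times b$ only contains items with $w(i)\le\varepsilon a$ and $h(i)\le\varepsilon b$. An $L\&C$ packing consists of a boundary-$\boldsymbol{\mathsf{L}}$ region $([0,N]\times[0,N_1])\cup([0,N_2]\times[0,N])$ containing only long items, together with a number of containers bounded by a function of $\varepsilon$ only (through constants $\varepsilon_{large},\varepsilon_{small}$ determined by $\varepsilon$), placed in the part of the knapsack not occupied by the boundary-$\boldsymbol{\mathsf{L}}$, with all items packed in containers; the containers and the items in them must be guillotine separable. $O(\varepsilon)\le c\varepsilon$ for an absolute constant $c$.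
   Formalization: The parameter ε, the positions of the items, the container coordinates, the boundary-L sizes N₁, N₂ and the guillotine cut coordinates are rational numbers instead of real numbers. -}

module Defs where

open import Data.Nat as ℕ using (ℕ; suc)
open import Data.Fin using (Fin)
open import Data.Rational using (ℚ; _≤_; _<_; _+_; _*_; _-_; 0ℚ; _/_)
open import Data.Rational.Properties using (_≤?_)
open import Data.Integer using (+_)
open import Data.List using (List; []; _∷_; length; filter; map; _++_) renaming (allFin to allFinList)
open import Data.Bool.Properties using (T?)
open import Data.List.Membership.Propositional using (_∈_)
open import Data.List.Relation.Unary.All using (All)
open import Data.List.Relation.Unary.AllPairs using (AllPairs)
open import Data.List.Relation.Unary.Unique.Propositional using (Unique)
open import Data.Product using (_×_; Σ)
open import Data.Sum using (_⊎_)
open import Data.Bool using (Bool; true; false; T)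
open import Relation.Binary.PropositionalEquality using (_≡_; _≢_)

ℕ→ℚ : ℕ → ℚ
ℕ→ℚ n = + n / 1

-- Axis-parallel rectangles [x1,x2] × [y1,y2] (considered as open sets)

record Rect : Set where
  constructor rect
  field
    x1 y1 x2 y2 : ℚ
open Rect public

-- interiors of r and s are disjoint (for rectangles of positive area)
Disjoint : Rect → Rect → Set
Disjoint r s = (x2 r ≤ x1 s) ⊎ (x2 s ≤ x1 r) ⊎ (y2 r ≤ y1 s) ⊎ (y2 s ≤ y1 r)

_⊆R_ : Rect → Rect → Set
r ⊆R s = (x1 s ≤ x1 r) × (x2 r ≤ x2 s) × (y1 s ≤ y1 r) × (y2 r ≤ y2 s)

data Guillotine (R : Rect) (rs : List Rect) : Set where
  single : length rs ℕ.≤ 1 → Guillotine R rs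
  vcut   : (x : ℚ) → x1 R < x → x < x2 R →
           All (λ r → (x2 r ≤ x) ⊎ (x ≤ x1 r)) rs →
           Guillotine (rect (x1 R) (y1 R) x (y2 R)) (filter (λ r → x2 r ≤? x) rs) →
           Guillotine (rect x (y1 R) (x2 R) (y2 R)) (filter (λ r → x ≤? x1 r) rs) →
           Guillotine R rs
  hcut   : (y : ℚ) → y1 R < y → y < y2 R →
           All (λ r → (y2 r ≤ y) ⊎ (y ≤ y1 r)) rs →
           Guillotine (rect (x1 R) (y1 R) (x2 R) y) (filter (λ r → y2 r ≤? y) rs) →
           Guillotine (rect (x1 R) y (x2 R) (y2 R)) (filter (λ r → y ≤? y1 r) rs) →
           Guillotine R rs

-- 2GGK-C instances: knapsack [0,N]^2, n items with positive integral
-- width and height, all of profit 1.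

record Instance : Set where
  field
    N     : ℕ
    n     : ℕ
    w h   : Fin n → ℕ
    w-pos : ∀ i → 1 ℕ.≤ w i
    h-pos : ∀ i → 1 ℕ.≤ h i
open Instance public

knapsack : Instance → Rect
knapsack I = rect 0ℚ 0ℚ (ℕ→ℚ (N I)) (ℕ→ℚ (N I))

Long : (I : Instance) → Fin (n I) → Set
Long I i = (N I ℕ.< 2 ℕ.* w I i) ⊎ (N I ℕ.< 2 ℕ.* h I i)

-- A packing: the selected items together with the position (lower-left
-- corner) of every item (only relevant for selected ones).
record Packing (I : Instance) : Set where
  field
    sel   : List (Fin (n I))
    px py : Fin (n I) → ℚ
open Packing public

itemRect : {I : Instance} → Packing I → Fin (n I) → Rect
itemRect {I} P i = rect (px P i) (py P i) (px P i + ℕ→ℚ (w I i)) (py P i + ℕ→ℚ (h I i))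

profit : {I : Instance} → Packing I → ℕ
profit P = length (sel P)

Feasible : (I : Instance) → Packing I → Set
Feasible I P =
  Unique (sel P) ×
  All (λ i → itemRect P i ⊆R knapsack I) (sel P) ×
  AllPairs (λ i j → Disjoint (itemRect P i) (itemRect P j)) (sel P) ×
  Guillotine (knapsack I) (map (itemRect P) (sel P))

Optimal : (I : Instance) → Packing I → Set
Optimal I P = Feasible I P × (∀ (Q : Packing I) → Feasible I Q → profit Q ℕ.≤ profit P)

data Kind : Set where
  large horizontal vertical area : Kind

record Container : Set where
  field
    box  : Rect
    kind : Kind
open Container public

data Loc (m : ℕ) : Set where
  inL : Loc m
  inC : Fin m → Loc m

isL : {m : ℕ} → Loc m → Bool
isL inL     = true
isL (inC _) = false

KindOK : (I : Instance) (ε : ℚ) (P : Packing I) {m : ℕ} (loc : Fin (n I) → Loc m)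
         (k : Fin m) (C : Container) (i : Fin (n I)) → Set
KindOK I ε P loc k C i with kind C
... | large      = ∀ j → j ∈ sel P → loc j ≡ inC k → j ≡ i
... | horizontal = ∀ j → j ∈ sel P → loc j ≡ inC k → j ≢ i →
                     (y2 (itemRect P i) ≤ y1 (itemRect P j)) ⊎ (y2 (itemRect P j) ≤ y1 (itemRect P i))
... | vertical   = ∀ j → j ∈ sel P → loc j ≡ inC k → j ≢ i →
                     (x2 (itemRect P i) ≤ x1 (itemRect P j)) ⊎ (x2 (itemRect P j) ≤ x1 (itemRect P i))
... | area       = (ℕ→ℚ (w I i) ≤ ε * (x2 (box C) - x1 (box C))) ×
                   (ℕ→ℚ (h I i) ≤ ε * (y2 (box C) - y1 (box C)))

record LCPacking (I : Instance) (ε : ℚ) (bound : ℚ → ℕ) : Set where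
  field
    packing    : Packing I
    N₁ N₂      : ℚ
    N₁-range   : (0ℚ ≤ N₁) × (N₁ ≤ ℕ→ℚ (N I))
    N₂-range   : (0ℚ ≤ N₂) × (N₂ ≤ ℕ→ℚ (N I))
    m          : ℕ
    m-bound    : m ℕ.≤ bound ε
    cont       : Fin m → Container
    loc        : Fin (n I) → Loc m
    feasible   : Feasible I packing
    -- containers lie in the knapsack, outside the boundary L
    -- ([0,N]×[0,N₁]) ∪ ([0,N₂]×[0,N]), and are pairwise non-overlapping
    cont-in    : ∀ k → box (cont k) ⊆R knapsack I
    cont-notL  : ∀ k → (N₁ ≤ y1 (box (cont k))) × (N₂ ≤ x1 (box (cont k)))
    cont-disj  : ∀ k l → k ≢ l → Disjoint (box (cont k)) (box (cont l))
    L-long     : ∀ i → i ∈ sel packing → loc i ≡ inL → Long I i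
    L-inside   : ∀ i → i ∈ sel packing → loc i ≡ inL →
                   (y2 (itemRect packing i) ≤ N₁) ⊎ (x2 (itemRect packing i) ≤ N₂)
    C-inside   : ∀ i k → i ∈ sel packing → loc i ≡ inC k →
                   itemRect packing i ⊆R box (cont k)
    C-kind     : ∀ i k → i ∈ sel packing → loc i ≡ inC k →
                   KindOK I ε packing loc k (cont k) i
    guill      : Guillotine (knapsack I)
                   (map (itemRect packing) (filter (λ i → T? (isL (loc i))) (sel packing))
                    ++ map (λ k → box (cont k)) (allFinList m))
open LCPacking public

-- Let d = N / D.  Items with both sides above d are few, items of medium size are
-- rare for one of several scales D, and small items are put back at the end by
-- next-fit decreasing height, since dropping a heavy ε-fraction of the items first
-- leaves enough free area.  What remains are tall and wide items.  Their guillotine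
-- packing is a binary tree of at most 2D² runs: in each run strips of tall items are
-- peeled from the left and strips of wide items from the bottom, until a cut leaves two
-- boxes that are both longer than d.  The strips of a run at a depth between k₁ and k₂
-- are dropped; averaging over the depth makes them rare.  The outer strips of tall
-- items within an η-fraction of the width of the outer part, and those of wide items
-- within an η-fraction of its height, form the corner.  Thus the items fall into four
-- classes: tall or wide, in the corner or not.
--
-- Without the tall corner items there is horizontal slack for moving all other strips
-- into boundedly many boxes of tall items and of wide items.  Without the wide
-- items outside the corner, the tall strips near the left border and the wide corner
-- items are thin in total; those that are almost as long as the knapsack form the
-- boundary L, the others are containers, and the rest again fits into boundedly many
-- boxes.  By symmetry each of the four classes may be dropped, and one has at most a
-- quarter of the items.  A box of tall items becomes boundedly many containers by linear
-- grouping of the heights and merging of columns with equal configurations.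
module Submission where

open import Data.Rational
open import Data.Rational.Properties
open import Tactic.RingSolver using (solve-∀)
open import Data.Nat as ℕ using (ℕ; zero; suc)
import Data.Nat.Properties as ℕₚ
open import Data.List using (List; []; _∷_; _++_; filter; length; map; concat; upTo; allFin)
open import Data.List.Relation.Unary.All as All using (All; []; _∷_)
open import Data.Product using (Σ; ∃; _×_; _,_; proj₁; proj₂)
open import Data.Sum using (_⊎_; inj₁; inj₂; [_,_]′)
open import Data.Empty using (⊥; ⊥-elim)
open import Function using (_∘_; id; case_of_)
open import Relation.Nullary using (¬_; Dec; yes; no)
open import Relation.Nullary.Decidable using (¬?; _×-dec_)
open import Relation.Binary.PropositionalEquality using (_≡_; _≢_; refl; sym; trans; cong; cong₂; subst; subst₂)
open import Tactic.RingSolver.Core.AlmostCommutativeRing using (AlmostCommutativeRing; fromCommutativeRing)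
open import Data.Maybe using (Maybe; just; nothing)
import Data.Integer as ℤ
open import Data.List.Membership.Propositional using (_∈_)
open import Data.List.Membership.Propositional.Properties using (∈-map⁺; ∈-++⁺ˡ; ∈-++⁺ʳ; ∈-upTo⁺; ∈-++⁻; ∈-filter⁻; ∈-map⁻)
open import Data.List.Relation.Unary.Any using (here; there)
import Data.List.Properties as Listₚ
import Data.List.Relation.Unary.All.Properties as Allₚ
open import Relation.Binary.Definitions using (DecidableEquality)
import Data.List.Membership.DecPropositional as DecM
open import Data.Unit using (⊤; tt)
open import Data.List.Relation.Unary.AllPairs using (AllPairs; []; _∷_)
open import Data.List.Relation.Unary.Unique.Propositional using (Unique)
import Data.List.Relation.Unary.AllPairs.Properties as AllPairsₚ
open import Data.List.Properties using (length-map)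
open import Data.Fin as Fin using (Fin; splitAt; _↑ˡ_; _↑ʳ_)
import Data.Fin.Properties as Finₚ
import Data.Rational.Unnormalised as ℚᵘ
import Data.Rational.Unnormalised.Properties as ℚᵘₚ
import Data.Integer.Properties as ℤₚ
open import Data.Bool.Properties using (T?)
import Data.List.Relation.Unary.Unique.Propositional.Properties as Uniqueₚ
open import Data.Sum.Properties using (inj₁-injective; inj₂-injective)
import Tactic.RingSolver.NonReflective as NonReflective

-- The obstacle is that sorting costs room. A run may alternate between tall and wide strips
-- arbitrarily often, and sorting it into boundedly many boxes takes slack in one direction that is
-- a constant fraction of the length to be sorted. A strip of width c that may be shrunk by the
-- factor 1 - e yields e c. Hence every prefix is cut off exactly where the next strip exceeds the
-- remaining depth: that strip and the room before it are thick. The tall strips in the outer parts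
-- of all runs, at most T D k₁ wide together, must fit into the room κ = e (k₂ - k₁) that one run
-- yields; so k₁ has to be smaller than k₂ by a factor depending on T and D, which are fixed before
-- the depths. The boundary L arises where a bottom band and a left column cross. The original
-- packing supplies the order in which the items that reach into the crossing are peeled, because
-- two items wider than N / 2 never lie on different sides of a vertical cut. Coordinates are
-- forgotten until the end: packings are trees of box sizes and lists are compared through weighted
-- sums, so that boxes and strips can be permuted freely.

module RingIdentities where

  -- The identities behind the uses of lin≤ and the rearrangements of sums.

  ℚring : AlmostCommutativeRing _ _
  ℚring = fromCommutativeRing +-*-commutativeRing zero?
    where
    zero? : ∀ x → Maybe (0ℚ ≡ x)
    zero? x with 0ℚ ≟ x
    ... | yes p = just p
    ... | no _  = nothing

  third half quarter : ℚ
  third = ℤ.+ 1 / 3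
  half = ℤ.+ 1 / 2
  quarter = ℤ.+ 1 / 4

  private

    open NonReflective ℚring using (solve; Expr; Κ; ⊝_; _⊕_; _⊗_)

    infixl 6 _⊖_
    _⊖_ : ∀ {n} → Expr ℚ n → Expr ℚ n → Expr ℚ n
    x ⊖ y = x ⊕ (⊝ y)

    infix 4 _⊜_
    pattern _⊜_ x y = x , y

  abstract

    ring-1 : ∀ a → (1ℚ + a) - 1ℚ ≡ a - 0ℚ
    ring-1 = solve 1 (λ a → (Κ 1ℚ ⊕ a) ⊖ Κ 1ℚ ⊜ a ⊖ Κ 0ℚ) refl
    ring-2 : ∀ a b c → a + (b + c) ≡ b + (a + c)
    ring-2 = solve 3 (λ a b c → a ⊕ (b ⊕ c) ⊜ b ⊕ (a ⊕ c)) refl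
    ring-3 : ∀ a b → (a + b) - a ≡ b - 0ℚ
    ring-3 = solve 2 (λ a b → (a ⊕ b) ⊖ a ⊜ b ⊖ Κ 0ℚ) refl
    ring-4 : ∀ a b c d → a * b - (c * d + 0ℚ) ≡ (b * a + c * b) - (b * c + c * d)
    ring-4 = solve 4 (λ a b c d → a ⊗ b ⊖ (c ⊗ d ⊕ Κ 0ℚ) ⊜ (b ⊗ a ⊕ c ⊗ b) ⊖ (b ⊗ c ⊕ c ⊗ d)) refl
    ring-5 : ∀ a b c d e f → a * b - (e + f) ≡ (c * b + (d * b + b * a)) - (e + (f + b * (c + d)))
    ring-5 = solve 6 (λ a b c d e f → a ⊗ b ⊖ (e ⊕ f) ⊜ (c ⊗ b ⊕ (d ⊗ b ⊕ b ⊗ a)) ⊖ (e ⊕ (f ⊕ b ⊗ (c ⊕ d)))) refl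
    ring-6 : ∀ a b c d e f → a * b - (e + f) ≡ (a * c + (a * d + a * b)) - (e + (f + a * (c + d)))
    ring-6 = solve 6 (λ a b c d e f → a ⊗ b ⊖ (e ⊕ f) ⊜ (a ⊗ c ⊕ (a ⊗ d ⊕ a ⊗ b)) ⊖ (e ⊕ (f ⊕ a ⊗ (c ⊕ d)))) refl
    ring-7 : ∀ a b → (a + b) - b ≡ a - 0ℚ
    ring-7 = solve 2 (λ a b → (a ⊕ b) ⊖ b ⊜ a ⊖ Κ 0ℚ) refl
    ring-8 : ∀ a b → a - b + b ≡ a
    ring-8 = solve 2 (λ a b → a ⊖ b ⊕ b ⊜ a) refl
    ring-9 : ∀ a b → ((a + 0ℚ) + b) - b * (1ℚ + 0ℚ) ≡ a - 0ℚ
    ring-9 = solve 2 (λ a b → ((a ⊕ Κ 0ℚ) ⊕ b) ⊖ b ⊗ (Κ 1ℚ ⊕ Κ 0ℚ) ⊜ a ⊖ Κ 0ℚ) refl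
    ring-10 : ∀ a b c → c * (a + 0ℚ) - (b * a + 0ℚ) ≡ a * c - a * b
    ring-10 = solve 3 (λ a b c → c ⊗ (a ⊕ Κ 0ℚ) ⊖ (b ⊗ a ⊕ Κ 0ℚ) ⊜ a ⊗ c ⊖ a ⊗ b) refl
    ring-11 : ∀ a b c d → ((a + (1ℚ + d)) + b) - b * (1ℚ + c) ≡ ((((1ℚ + 0ℚ) + d) + b) + a) - (b * c + b)
    ring-11 = solve 4 (λ a b c d → ((a ⊕ (Κ 1ℚ ⊕ d)) ⊕ b) ⊖ b ⊗ (Κ 1ℚ ⊕ c) ⊜ ((((Κ 1ℚ ⊕ Κ 0ℚ) ⊕ d) ⊕ b) ⊕ a) ⊖ (b ⊗ c ⊕ b)) refl
    ring-12 : ∀ a b c d e f → b * (c + f) - (a * c + (d + e)) ≡ (b * f + c * b) - (((1ℚ + 0ℚ) * d + e) + c * a)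
    ring-12 = solve 6 (λ a b c d e f → b ⊗ (c ⊕ f) ⊖ (a ⊗ c ⊕ (d ⊕ e)) ⊜ (b ⊗ f ⊕ c ⊗ b) ⊖ (((Κ 1ℚ ⊕ Κ 0ℚ) ⊗ d ⊕ e) ⊕ c ⊗ a)) refl
    ring-13 : ∀ a b c → ((1ℚ + a) + c) + b ≡ (a + (1ℚ + c)) + b
    ring-13 = solve 3 (λ a b c → ((Κ 1ℚ ⊕ a) ⊕ c) ⊕ b ⊜ (a ⊕ (Κ 1ℚ ⊕ c)) ⊕ b) refl
    ring-14 : ∀ a b c d e → b - (a * c + (d + e)) ≡ (b + a * d) - (((1ℚ + a) * d + e) + a * c)
    ring-14 = solve 5 (λ a b c d e → b ⊖ (a ⊗ c ⊕ (d ⊕ e)) ⊜ (b ⊕ a ⊗ d) ⊖ (((Κ 1ℚ ⊕ a) ⊗ d ⊕ e) ⊕ a ⊗ c)) refl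
    ring-15 : ∀ a b c d e → b - (a * c + (d + e)) ≡ (b + c) - (((1ℚ + a) * c + e) + d)
    ring-15 = solve 5 (λ a b c d e → b ⊖ (a ⊗ c ⊕ (d ⊕ e)) ⊜ (b ⊕ c) ⊖ (((Κ 1ℚ ⊕ a) ⊗ c ⊕ e) ⊕ d)) refl
    ring-16 : ∀ a → (0ℚ + a) - a * 0ℚ ≡ a - 0ℚ
    ring-16 = solve 1 (λ a → (Κ 0ℚ ⊕ a) ⊖ a ⊗ Κ 0ℚ ⊜ a ⊖ Κ 0ℚ) refl
    ring-17 : ∀ a b → ((1ℚ + 0ℚ) + a) + b ≡ (1ℚ + a) + b
    ring-17 = solve 2 (λ a b → ((Κ 1ℚ ⊕ Κ 0ℚ) ⊕ a) ⊕ b ⊜ (Κ 1ℚ ⊕ a) ⊕ b) refl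
    ring-18 : ∀ a b → a + b ≡ (1ℚ + 0ℚ) * a + b
    ring-18 = solve 2 (λ a b → a ⊕ b ⊜ (Κ 1ℚ ⊕ Κ 0ℚ) ⊗ a ⊕ b) refl
    ring-19 : ∀ a b → 0ℚ - (a - b) ≡ b - a
    ring-19 = solve 2 (λ a b → Κ 0ℚ ⊖ (a ⊖ b) ⊜ b ⊖ a) refl
    ring-20 : ∀ a b c → a - (b + c) ≡ (a - b) - c
    ring-20 = solve 3 (λ a b c → a ⊖ (b ⊕ c) ⊜ (a ⊖ b) ⊖ c) refl
    ring-21 : ∀ a b c d → (c + d) - (a - b) ≡ d - ((a - c) - b)
    ring-21 = solve 4 (λ a b c d → (c ⊕ d) ⊖ (a ⊖ b) ⊜ d ⊖ ((a ⊖ c) ⊖ b)) refl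
    ring-22 : ∀ a b → b + a * b ≡ (1ℚ + a) * b
    ring-22 = solve 2 (λ a b → b ⊕ a ⊗ b ⊜ (Κ 1ℚ ⊕ a) ⊗ b) refl
    ring-23 : ∀ a b c → b + c ≡ a + ((b - a) + c)
    ring-23 = solve 3 (λ a b c → b ⊕ c ⊜ a ⊕ ((b ⊖ a) ⊕ c)) refl
    ring-24 : ∀ a b c d → b * c + d ≡ (a * c + 0ℚ) + ((b - a) * c + d)
    ring-24 = solve 4 (λ a b c d → b ⊗ c ⊕ d ⊜ (a ⊗ c ⊕ Κ 0ℚ) ⊕ ((b ⊖ a) ⊗ c ⊕ d)) refl
    ring-25 : ∀ a b c → c - (a - b) ≡ (b + c) - a
    ring-25 = solve 3 (λ a b c → c ⊖ (a ⊖ b) ⊜ (b ⊕ c) ⊖ a) refl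
    ring-26 : ∀ a b → b + (a - b) ≡ a
    ring-26 = solve 2 (λ a b → b ⊕ (a ⊖ b) ⊜ a) refl
    ring-27 : ∀ a b c → b + ((a - b) + c) ≡ a + c
    ring-27 = solve 3 (λ a b c → b ⊕ ((a ⊖ b) ⊕ c) ⊜ a ⊕ c) refl
    ring-28 : ∀ a → 0ℚ ≡ 0ℚ * a + 0ℚ
    ring-28 = solve 1 (λ a → Κ 0ℚ ⊜ Κ 0ℚ ⊗ a ⊕ Κ 0ℚ) refl
    ring-29 : ∀ a b c d e → a * (b + c) + (d * b + e) ≡ (a + d) * b + (a * c + e)
    ring-29 = solve 5 (λ a b c d e → a ⊗ (b ⊕ c) ⊕ (d ⊗ b ⊕ e) ⊜ (a ⊕ d) ⊗ b ⊕ (a ⊗ c ⊕ e)) refl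
    ring-30 : ∀ a b → b ≡ (a + b) - a
    ring-30 = solve 2 (λ a b → b ⊜ (a ⊕ b) ⊖ a) refl
    ring-31 : ∀ a b c d → (a + b) + (c + d) ≡ (a + c) + (b + d)
    ring-31 = solve 4 (λ a b c d → (a ⊕ b) ⊕ (c ⊕ d) ⊜ (a ⊕ c) ⊕ (b ⊕ d)) refl
    ring-32 : ∀ a → a * 0ℚ + 0ℚ ≡ 0ℚ
    ring-32 = solve 1 (λ a → a ⊗ Κ 0ℚ ⊕ Κ 0ℚ ⊜ Κ 0ℚ) refl
    ring-33 : ∀ a b → b + ((a - b) + 0ℚ) ≡ a
    ring-33 = solve 2 (λ a b → b ⊕ ((a ⊖ b) ⊕ Κ 0ℚ) ⊜ a) refl
    ring-34 : ∀ a b c → b * (c + 0ℚ) + ((a - b) * 0ℚ + 0ℚ) ≡ b * c + 0ℚ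
    ring-34 = solve 3 (λ a b c → b ⊗ (c ⊕ Κ 0ℚ) ⊕ ((a ⊖ b) ⊗ Κ 0ℚ ⊕ Κ 0ℚ) ⊜ b ⊗ c ⊕ Κ 0ℚ) refl
    ring-35 : ∀ a b c → a + (b + ((c - (a + b)) + 0ℚ)) ≡ c
    ring-35 = solve 3 (λ a b c → a ⊕ (b ⊕ ((c ⊖ (a ⊕ b)) ⊕ Κ 0ℚ)) ⊜ c) refl
    ring-36 : ∀ a b c → a + (b + (c * 0ℚ + 0ℚ)) ≡ a + b
    ring-36 = solve 3 (λ a b c → a ⊕ (b ⊕ (c ⊗ Κ 0ℚ ⊕ Κ 0ℚ)) ⊜ a ⊕ b) refl
    ring-37 : ∀ a b → b ≡ 0ℚ * a + b
    ring-37 = solve 2 (λ a b → b ⊜ Κ 0ℚ ⊗ a ⊕ b) refl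
    ring-38 : ∀ a b c d → a * c + (b * c + d) ≡ (a + b) * c + d
    ring-38 = solve 4 (λ a b c d → a ⊗ c ⊕ (b ⊗ c ⊕ d) ⊜ (a ⊕ b) ⊗ c ⊕ d) refl
    ring-39 : ∀ a b c → 0ℚ * (a - b) + c ≡ c
    ring-39 = solve 3 (λ a b c → Κ 0ℚ ⊗ (a ⊖ b) ⊕ c ⊜ c) refl
    ring-40 : ∀ a b c → (a - b) - c ≡ a - (b + c)
    ring-40 = solve 3 (λ a b c → (a ⊖ b) ⊖ c ⊜ a ⊖ (b ⊕ c)) refl
    ring-41 : ∀ a b → a + (b - a) ≡ b
    ring-41 = solve 2 (λ a b → a ⊕ (b ⊖ a) ⊜ b) refl
    ring-42 : ∀ a b c d → a * (b + d) - (a * b + c) ≡ a * d - c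
    ring-42 = solve 4 (λ a b c d → a ⊗ (b ⊕ d) ⊖ (a ⊗ b ⊕ c) ⊜ a ⊗ d ⊖ c) refl
    ring-43 : ∀ a b c d e → ((a + b) * (c - d) + e) ≡ a * (c - d) + (b * (c - d) + e)
    ring-43 = solve 5 (λ a b c d e → ((a ⊕ b) ⊗ (c ⊖ d) ⊕ e) ⊜ a ⊗ (c ⊖ d) ⊕ (b ⊗ (c ⊖ d) ⊕ e)) refl
    ring-44 : ∀ a b c d e → c - e ≡ ((1ℚ * (a - b) + c) + d) - ((d + e) + (a - b))
    ring-44 = solve 5 (λ a b c d e → c ⊖ e ⊜ ((Κ 1ℚ ⊗ (a ⊖ b) ⊕ c) ⊕ d) ⊖ ((d ⊕ e) ⊕ (a ⊖ b))) refl
    ring-45 : ∀ a b c d e → a * (b * d + e) ≡ d * ((a * b + c) - c) + a * e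
    ring-45 = solve 5 (λ a b c d e → a ⊗ (b ⊗ d ⊕ e) ⊜ d ⊗ ((a ⊗ b ⊕ c) ⊖ c) ⊕ a ⊗ e) refl
    ring-46 : ∀ a b c d e → a * b - e ≡ ((1ℚ + a) * b + d) - ((d + e) + ((b + c) - c))
    ring-46 = solve 5 (λ a b c d e → a ⊗ b ⊖ e ⊜ ((Κ 1ℚ ⊕ a) ⊗ b ⊕ d) ⊖ ((d ⊕ e) ⊕ ((b ⊕ c) ⊖ c))) refl
    ring-47 : ∀ a b → a ≡ (a + b) - b
    ring-47 = solve 2 (λ a b → a ⊜ (a ⊕ b) ⊖ b) refl
    ring-48 : ∀ a → 0ℚ ≡ a * 0ℚ + 0ℚ
    ring-48 = solve 1 (λ a → Κ 0ℚ ⊜ a ⊗ Κ 0ℚ ⊕ Κ 0ℚ) refl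
    ring-49 : ∀ a b c d e f → (a * (b + c) + (1ℚ + d)) - (e + f) ≡ (1ℚ + a * b + (a * c + d)) - (e + f)
    ring-49 = solve 6 (λ a b c d e f → (a ⊗ (b ⊕ c) ⊕ (Κ 1ℚ ⊕ d)) ⊖ (e ⊕ f) ⊜ (Κ 1ℚ ⊕ a ⊗ b ⊕ (a ⊗ c ⊕ d)) ⊖ (e ⊕ f)) refl
    ring-50 : ∀ a b c d e f g → (a * b + a * c + (a * d + e)) - ((a * b) * f + g) ≡ (a * (c + b) + (a * d + e)) - (a * (b * f) + g)
    ring-50 = solve 7 (λ a b c d e f g → (a ⊗ b ⊕ a ⊗ c ⊕ (a ⊗ d ⊕ e)) ⊖ ((a ⊗ b) ⊗ f ⊕ g) ⊜ (a ⊗ (c ⊕ b) ⊕ (a ⊗ d ⊕ e)) ⊖ (a ⊗ (b ⊗ f) ⊕ g)) refl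
    ring-51 : ∀ a b c d e → (a + b + c) - (d + e) ≡ (a + b + c) - (1ℚ * d + e)
    ring-51 = solve 5 (λ a b c d e → (a ⊕ b ⊕ c) ⊖ (d ⊕ e) ⊜ (a ⊕ b ⊕ c) ⊖ (Κ 1ℚ ⊗ d ⊕ e)) refl
    ring-52 : ∀ a b c → (1ℚ - a) * (b + c) - b ≡ c - a * (b + c)
    ring-52 = solve 3 (λ a b c → (Κ 1ℚ ⊖ a) ⊗ (b ⊕ c) ⊖ b ⊜ c ⊖ a ⊗ (b ⊕ c)) refl
    ring-53 : ∀ a b c d → (a * b) * c - d ≡ a * (b * c) - d
    ring-53 = solve 4 (λ a b c d → (a ⊗ b) ⊗ c ⊖ d ⊜ a ⊗ (b ⊗ c) ⊖ d) refl
    ring-54 : ∀ a → (1ℚ + a) - a ≡ 1ℚ - 0ℚ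
    ring-54 = solve 1 (λ a → (Κ 1ℚ ⊕ a) ⊖ a ⊜ Κ 1ℚ ⊖ Κ 0ℚ) refl
    ring-55 : ∀ a b c d → c * d - a * b ≡ (b * c + c * d) - (b * a + c * b)
    ring-55 = solve 4 (λ a b c d → c ⊗ d ⊖ a ⊗ b ⊜ (b ⊗ c ⊕ c ⊗ d) ⊖ (b ⊗ a ⊕ c ⊗ b)) refl
    ring-56 : ∀ a b c d e → (a * b * c) * e - b * (d * c) ≡ b * c * (e * a) - b * c * d
    ring-56 = solve 5 (λ a b c d e → (a ⊗ b ⊗ c) ⊗ e ⊖ b ⊗ (d ⊗ c) ⊜ b ⊗ c ⊗ (e ⊗ a) ⊖ b ⊗ c ⊗ d) refl
    ring-57 : ∀ a b c → b * c - a * b ≡ b * c - b * a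
    ring-57 = solve 3 (λ a b c → b ⊗ c ⊖ a ⊗ b ⊜ b ⊗ c ⊖ b ⊗ a) refl
    ring-58 : ∀ a b c d e → c * (e * (a * b)) - b * (d * c) ≡ b * c * (e * a) - b * c * d
    ring-58 = solve 5 (λ a b c d e → c ⊗ (e ⊗ (a ⊗ b)) ⊖ b ⊗ (d ⊗ c) ⊜ b ⊗ c ⊗ (e ⊗ a) ⊖ b ⊗ c ⊗ d) refl
    ring-59 : ∀ a b c d e f → (1ℚ - (a + a)) * f - (1ℚ - (a + a + a)) * e ≡ ((1ℚ - (a + a + a)) * (b * d + c * d) + ((1ℚ - (a + a)) * f + ((1ℚ - (a + a + a)) * d * (a * b) + a * a * (b * d + b * d + b * d)))) - ((1ℚ - (a + a + a)) * e + ((1ℚ - (a + a)) * (b * d) + ((1ℚ - (a + a + a)) * d * c + 0ℚ)))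
    ring-59 = solve 6 (λ a b c d e f → (Κ 1ℚ ⊖ (a ⊕ a)) ⊗ f ⊖ (Κ 1ℚ ⊖ (a ⊕ a ⊕ a)) ⊗ e ⊜ ((Κ 1ℚ ⊖ (a ⊕ a ⊕ a)) ⊗ (b ⊗ d ⊕ c ⊗ d) ⊕ ((Κ 1ℚ ⊖ (a ⊕ a)) ⊗ f ⊕ ((Κ 1ℚ ⊖ (a ⊕ a ⊕ a)) ⊗ d ⊗ (a ⊗ b) ⊕ a ⊗ a ⊗ (b ⊗ d ⊕ b ⊗ d ⊕ b ⊗ d)))) ⊖ ((Κ 1ℚ ⊖ (a ⊕ a ⊕ a)) ⊗ e ⊕ ((Κ 1ℚ ⊖ (a ⊕ a)) ⊗ (b ⊗ d) ⊕ ((Κ 1ℚ ⊖ (a ⊕ a ⊕ a)) ⊗ d ⊗ c ⊕ Κ 0ℚ)))) refl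
    ring-60 : ∀ a b → 0ℚ ≡ a * 0ℚ + 0ℚ * b
    ring-60 = solve 2 (λ a b → Κ 0ℚ ⊜ a ⊗ Κ 0ℚ ⊕ Κ 0ℚ ⊗ b) refl
    ring-61 : ∀ a b c d e → (a * c + b) + (a * d + e * b) ≡ a * (c * 1ℚ + d) + (1ℚ + e) * b
    ring-61 = solve 5 (λ a b c d e → (a ⊗ c ⊕ b) ⊕ (a ⊗ d ⊕ e ⊗ b) ⊜ a ⊗ (c ⊗ Κ 1ℚ ⊕ d) ⊕ (Κ 1ℚ ⊕ e) ⊗ b) refl
    ring-62 : ∀ a b c d e f g h → (a * (d * e + f) + (1ℚ + g) * (b * c)) - ((a * d + b) * e + h) ≡ ((a * f + g * (b * c)) + b * c) - (h + b * e)
    ring-62 = solve 8 (λ a b c d e f g h → (a ⊗ (d ⊗ e ⊕ f) ⊕ (Κ 1ℚ ⊕ g) ⊗ (b ⊗ c)) ⊖ ((a ⊗ d ⊕ b) ⊗ e ⊕ h) ⊜ ((a ⊗ f ⊕ g ⊗ (b ⊗ c)) ⊕ b ⊗ c) ⊖ (h ⊕ b ⊗ e)) refl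
    ring-63 : ∀ a b c d → (a + ((b + 0ℚ) + d)) + c ≡ (a + b) + (c + d)
    ring-63 = solve 4 (λ a b c d → (a ⊕ ((b ⊕ Κ 0ℚ) ⊕ d)) ⊕ c ⊜ (a ⊕ b) ⊕ (c ⊕ d)) refl
    ring-64 : ∀ a b c d e f g → (g + (e + c)) - (a + b) ≡ (c + ((f + d) + (g + e))) - (a + (b + (f + d)))
    ring-64 = solve 7 (λ a b c d e f g → (g ⊕ (e ⊕ c)) ⊖ (a ⊕ b) ⊜ (c ⊕ ((f ⊕ d) ⊕ (g ⊕ e))) ⊖ (a ⊕ (b ⊕ (f ⊕ d)))) refl
    ring-65 : ∀ a b c d e f g h → ((1ℚ - a) * d - (e + f)) - 0ℚ ≡ ((b * d + c * d) + (((1ℚ - (a + a)) * d + g * (c * d)) + ((c * d) * h + d * a))) - (e + (f + ((c * d) * g + d * (h * c + b + c))))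
    ring-65 = solve 8 (λ a b c d e f g h → ((Κ 1ℚ ⊖ a) ⊗ d ⊖ (e ⊕ f)) ⊖ Κ 0ℚ ⊜ ((b ⊗ d ⊕ c ⊗ d) ⊕ (((Κ 1ℚ ⊖ (a ⊕ a)) ⊗ d ⊕ g ⊗ (c ⊗ d)) ⊕ ((c ⊗ d) ⊗ h ⊕ d ⊗ a))) ⊖ (e ⊕ (f ⊕ ((c ⊗ d) ⊗ g ⊕ d ⊗ (h ⊗ c ⊕ b ⊕ c))))) refl
    ring-66 : ∀ a b c → a + (b + (c - (a + b))) ≡ c
    ring-66 = solve 3 (λ a b c → a ⊕ (b ⊕ (c ⊖ (a ⊕ b))) ⊜ c) refl
    ring-67 : ∀ a b c d e f g h i j k m → (j + a * (d * e)) - (f * e + (g + 0ℚ)) ≡ (e * (b * d + c * d) + (h + (((1ℚ - (a + a)) * i + k * ((c * d) * e)) + ((1ℚ - (a + a)) * j + ((c * d) * e * m + (d * e * a + (a + a) * j)))))) - (e * f + (g + (h + ((1ℚ - (a + a)) * i + ((c * d) * e * k + (d * e * (m * c + b + c) + 0ℚ))))))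
    ring-67 = solve 12 (λ a b c d e f g h i j k m → (j ⊕ a ⊗ (d ⊗ e)) ⊖ (f ⊗ e ⊕ (g ⊕ Κ 0ℚ)) ⊜ (e ⊗ (b ⊗ d ⊕ c ⊗ d) ⊕ (h ⊕ (((Κ 1ℚ ⊖ (a ⊕ a)) ⊗ i ⊕ k ⊗ ((c ⊗ d) ⊗ e)) ⊕ ((Κ 1ℚ ⊖ (a ⊕ a)) ⊗ j ⊕ ((c ⊗ d) ⊗ e ⊗ m ⊕ (d ⊗ e ⊗ a ⊕ (a ⊕ a) ⊗ j)))))) ⊖ (e ⊗ f ⊕ (g ⊕ (h ⊕ ((Κ 1ℚ ⊖ (a ⊕ a)) ⊗ i ⊕ ((c ⊗ d) ⊗ e ⊗ k ⊕ (d ⊗ e ⊗ (m ⊗ c ⊕ b ⊕ c) ⊕ Κ 0ℚ))))))) refl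
    ring-68 : ∀ a b → a * (1ℚ + b) - a ≡ a * b - a * 0ℚ
    ring-68 = solve 2 (λ a b → a ⊗ (Κ 1ℚ ⊕ b) ⊖ a ⊜ a ⊗ b ⊖ a ⊗ Κ 0ℚ) refl
    ring-69 : ∀ a → (1ℚ - (a + a)) - 0ℚ ≡ (1ℚ + a) - ((a + a + a) + 0ℚ)
    ring-69 = solve 1 (λ a → (Κ 1ℚ ⊖ (a ⊕ a)) ⊖ Κ 0ℚ ⊜ (Κ 1ℚ ⊕ a) ⊖ ((a ⊕ a ⊕ a) ⊕ Κ 0ℚ)) refl
    ring-70 : ∀ a → (1ℚ - a) - 0ℚ ≡ ((1ℚ - (a + a)) + a) - (0ℚ + 0ℚ)
    ring-70 = solve 1 (λ a → (Κ 1ℚ ⊖ a) ⊖ Κ 0ℚ ⊜ ((Κ 1ℚ ⊖ (a ⊕ a)) ⊕ a) ⊖ (Κ 0ℚ ⊕ Κ 0ℚ)) refl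
    ring-71 : ∀ a b → b ≡ a * 0ℚ + b
    ring-71 = solve 2 (λ a b → b ⊜ a ⊗ Κ 0ℚ ⊕ b) refl
    ring-72 : ∀ a b c d → a + ((b + c) + d) ≡ (b + (a + c)) + d
    ring-72 = solve 4 (λ a b c d → a ⊕ ((b ⊕ c) ⊕ d) ⊜ (b ⊕ (a ⊕ c)) ⊕ d) refl
    ring-73 : ∀ a b c → (1ℚ + 1ℚ) * (b * c) - a * a * ((1ℚ + 0ℚ) + 1ℚ) ≡ (a * c + (a * c + (c * b + c * b))) - (a * a + (a * a + (c * a + c * a)))
    ring-73 = solve 3 (λ a b c → (Κ 1ℚ ⊕ Κ 1ℚ) ⊗ (b ⊗ c) ⊖ a ⊗ a ⊗ ((Κ 1ℚ ⊕ Κ 0ℚ) ⊕ Κ 1ℚ) ⊜ (a ⊗ c ⊕ (a ⊗ c ⊕ (c ⊗ b ⊕ c ⊗ b))) ⊖ (a ⊗ a ⊕ (a ⊗ a ⊕ (c ⊗ a ⊕ c ⊗ a)))) refl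
    ring-74 : ∀ a b c d e f g h → (1ℚ + 1ℚ) * (b * c) - a * a * ((1ℚ + (g + h)) + 1ℚ) ≡ ((1ℚ + 1ℚ) * (d * f) + ((1ℚ + 1ℚ) * (e * f) + (f * b + (f * b + (b * c + b * c))))) - (a * a * (g + 1ℚ) + (a * a * (h + 1ℚ) + (f * (d + e) + (f * (d + e) + (b * f + b * f)))))
    ring-74 = solve 8 (λ a b c d e f g h → (Κ 1ℚ ⊕ Κ 1ℚ) ⊗ (b ⊗ c) ⊖ a ⊗ a ⊗ ((Κ 1ℚ ⊕ (g ⊕ h)) ⊕ Κ 1ℚ) ⊜ ((Κ 1ℚ ⊕ Κ 1ℚ) ⊗ (d ⊗ f) ⊕ ((Κ 1ℚ ⊕ Κ 1ℚ) ⊗ (e ⊗ f) ⊕ (f ⊗ b ⊕ (f ⊗ b ⊕ (b ⊗ c ⊕ b ⊗ c))))) ⊖ (a ⊗ a ⊗ (g ⊕ Κ 1ℚ) ⊕ (a ⊗ a ⊗ (h ⊕ Κ 1ℚ) ⊕ (f ⊗ (d ⊕ e) ⊕ (f ⊗ (d ⊕ e) ⊕ (b ⊗ f ⊕ b ⊗ f)))))) refl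
    ring-75 : ∀ a b c d e f g h → (1ℚ + 1ℚ) * (b * c) - a * a * ((1ℚ + (g + h)) + 1ℚ) ≡ ((1ℚ + 1ℚ) * (f * d) + ((1ℚ + 1ℚ) * (f * e) + (f * c + (f * c + (c * b + c * b))))) - (a * a * (g + 1ℚ) + (a * a * (h + 1ℚ) + (f * (d + e) + (f * (d + e) + (c * f + c * f)))))
    ring-75 = solve 8 (λ a b c d e f g h → (Κ 1ℚ ⊕ Κ 1ℚ) ⊗ (b ⊗ c) ⊖ a ⊗ a ⊗ ((Κ 1ℚ ⊕ (g ⊕ h)) ⊕ Κ 1ℚ) ⊜ ((Κ 1ℚ ⊕ Κ 1ℚ) ⊗ (f ⊗ d) ⊕ ((Κ 1ℚ ⊕ Κ 1ℚ) ⊗ (f ⊗ e) ⊕ (f ⊗ c ⊕ (f ⊗ c ⊕ (c ⊗ b ⊕ c ⊗ b))))) ⊖ (a ⊗ a ⊗ (g ⊕ Κ 1ℚ) ⊕ (a ⊗ a ⊗ (h ⊕ Κ 1ℚ) ⊕ (f ⊗ (d ⊕ e) ⊕ (f ⊗ (d ⊕ e) ⊕ (c ⊗ f ⊕ c ⊗ f)))))) refl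
    ring-76 : ∀ a b c → a + (b - c) ≡ (a + b) - c
    ring-76 = solve 3 (λ a b c → a ⊕ (b ⊖ c) ⊜ (a ⊕ b) ⊖ c) refl
    ring-77 : ∀ a b c d → a - ((b + c) - d) ≡ (a - b) - (c - d)
    ring-77 = solve 4 (λ a b c d → a ⊖ ((b ⊕ c) ⊖ d) ⊜ (a ⊖ b) ⊖ (c ⊖ d)) refl
    ring-78 : ∀ a b → a - (b - b) ≡ a
    ring-78 = solve 2 (λ a b → a ⊖ (b ⊖ b) ⊜ a) refl
    ring-79 : ∀ a b → b - (a - a) ≡ b - 0ℚ
    ring-79 = solve 2 (λ a b → b ⊖ (a ⊖ a) ⊜ b ⊖ Κ 0ℚ) refl
    ring-80 : ∀ a b → a ≡ (a - b) + b
    ring-80 = solve 2 (λ a b → a ⊜ (a ⊖ b) ⊕ b) refl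
    ring-81 : ∀ a b c → (a - c) - b ≡ a - (b + c)
    ring-81 = solve 3 (λ a b c → (a ⊖ c) ⊖ b ⊜ a ⊖ (b ⊕ c)) refl
    ring-82 : ∀ a b → a ≡ b + (a - b)
    ring-82 = solve 2 (λ a b → a ⊜ b ⊕ (a ⊖ b)) refl
    ring-83 : ∀ a b c → ((a - b) - c) - 0ℚ ≡ a - (b + c)
    ring-83 = solve 3 (λ a b c → ((a ⊖ b) ⊖ c) ⊖ Κ 0ℚ ⊜ a ⊖ (b ⊕ c)) refl
    ring-84 : ∀ a b → ((a + (b + 0ℚ)) + 0ℚ) + 0ℚ ≡ a + b
    ring-84 = solve 2 (λ a b → ((a ⊕ (b ⊕ Κ 0ℚ)) ⊕ Κ 0ℚ) ⊕ Κ 0ℚ ⊜ a ⊕ b) refl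
    ring-85 : ∀ a b → (a + (b + 0ℚ)) + 0ℚ ≡ a + b
    ring-85 = solve 2 (λ a b → (a ⊕ (b ⊕ Κ 0ℚ)) ⊕ Κ 0ℚ ⊜ a ⊕ b) refl
    ring-86 : ∀ a → (1ℚ - a) - 0ℚ ≡ (1ℚ + (a + a)) - ((a + a + a) + (0ℚ + 0ℚ))
    ring-86 = solve 1 (λ a → (Κ 1ℚ ⊖ a) ⊖ Κ 0ℚ ⊜ (Κ 1ℚ ⊕ (a ⊕ a)) ⊖ ((a ⊕ a ⊕ a) ⊕ (Κ 0ℚ ⊕ Κ 0ℚ))) refl
    ring-87 : ∀ a b c d → (d + d) * (a * b) - d * (c * b) ≡ (d * b * a + (d * b * a + (d * b * c * 1ℚ + d * b * c * d))) - (d * b * ((1ℚ - d) * c) + (d * b * ((1ℚ - d) * c) + (d * b * c * (d + d + d) + 0ℚ)))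
    ring-87 = solve 4 (λ a b c d → (d ⊕ d) ⊗ (a ⊗ b) ⊖ d ⊗ (c ⊗ b) ⊜ (d ⊗ b ⊗ a ⊕ (d ⊗ b ⊗ a ⊕ (d ⊗ b ⊗ c ⊗ Κ 1ℚ ⊕ d ⊗ b ⊗ c ⊗ d))) ⊖ (d ⊗ b ⊗ ((Κ 1ℚ ⊖ d) ⊗ c) ⊕ (d ⊗ b ⊗ ((Κ 1ℚ ⊖ d) ⊗ c) ⊕ (d ⊗ b ⊗ c ⊗ (d ⊕ d ⊕ d) ⊕ Κ 0ℚ)))) refl
    ring-88 : ∀ a b c d e f g h → (a * (b + c) + (f + (d + e))) - (g + h) ≡ ((a * b + d) + ((a * c + e) + f)) - (g + (h + 0ℚ))
    ring-88 = solve 8 (λ a b c d e f g h → (a ⊗ (b ⊕ c) ⊕ (f ⊕ (d ⊕ e))) ⊖ (g ⊕ h) ⊜ ((a ⊗ b ⊕ d) ⊕ ((a ⊗ c ⊕ e) ⊕ f)) ⊖ (g ⊕ (h ⊕ Κ 0ℚ))) refl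
    ring-89 : ∀ a b c d e f g h i → ((f + g) + (a + a) * (b * c)) - (h + i) ≡ ((f + (a + a) * (d * c)) + ((g + (a + a) * (e * c)) + (a + a) * c * b)) - (h + (i + (a + a) * c * (d + e)))
    ring-89 = solve 9 (λ a b c d e f g h i → ((f ⊕ g) ⊕ (a ⊕ a) ⊗ (b ⊗ c)) ⊖ (h ⊕ i) ⊜ ((f ⊕ (a ⊕ a) ⊗ (d ⊗ c)) ⊕ ((g ⊕ (a ⊕ a) ⊗ (e ⊗ c)) ⊕ (a ⊕ a) ⊗ c ⊗ b)) ⊖ (h ⊕ (i ⊕ (a ⊕ a) ⊗ c ⊗ (d ⊕ e)))) refl
    ring-90 : ∀ a b c d e f g h i → ((f + g) + (a + a) * (b * c)) - (h + i) ≡ ((f + (a + a) * (b * d)) + ((g + (a + a) * (b * e)) + (a + a) * b * c)) - (h + (i + (a + a) * b * (d + e)))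
    ring-90 = solve 9 (λ a b c d e f g h i → ((f ⊕ g) ⊕ (a ⊕ a) ⊗ (b ⊗ c)) ⊖ (h ⊕ i) ⊜ ((f ⊕ (a ⊕ a) ⊗ (b ⊗ d)) ⊕ ((g ⊕ (a ⊕ a) ⊗ (b ⊗ e)) ⊕ (a ⊕ a) ⊗ b ⊗ c)) ⊖ (h ⊕ (i ⊕ (a ⊕ a) ⊗ b ⊗ (d ⊕ e)))) refl
    ring-91 : ∀ a b c d → ((a - b) - (a - (d + c))) - d ≡ c - b
    ring-91 = solve 4 (λ a b c d → ((a ⊖ b) ⊖ (a ⊖ (d ⊕ c))) ⊖ d ⊜ c ⊖ b) refl
    ring-92 : ∀ a b c d e → (e - (a - (d + c))) - d ≡ (0ℚ * e + (c + e)) - ((a - b) + (b + 0ℚ))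
    ring-92 = solve 5 (λ a b c d e → (e ⊖ (a ⊖ (d ⊕ c))) ⊖ d ⊜ (Κ 0ℚ ⊗ e ⊕ (c ⊕ e)) ⊖ ((a ⊖ b) ⊕ (b ⊕ Κ 0ℚ))) refl
    ring-93 : ∀ a b c d e f → f * e - (c - b) ≡ (((1ℚ + f) * e) + d) - ((a - b) + (e - (a - (d + c))))
    ring-93 = solve 6 (λ a b c d e f → f ⊗ e ⊖ (c ⊖ b) ⊜ (((Κ 1ℚ ⊕ f) ⊗ e) ⊕ d) ⊖ ((a ⊖ b) ⊕ (e ⊖ (a ⊖ (d ⊕ c))))) refl
    ring-94 : ∀ a b c d e f → a + (b + (c + (d + (e + f)))) ≡ (a + (c + d)) + ((b + e) + f)
    ring-94 = solve 6 (λ a b c d e f → a ⊕ (b ⊕ (c ⊕ (d ⊕ (e ⊕ f)))) ⊜ (a ⊕ (c ⊕ d)) ⊕ ((b ⊕ e) ⊕ f)) refl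
    ring-95 : ∀ a b → b - (1ℚ - a) * b ≡ a * b - 0ℚ
    ring-95 = solve 2 (λ a b → b ⊖ (Κ 1ℚ ⊖ a) ⊗ b ⊜ a ⊗ b ⊖ Κ 0ℚ) refl
    ring-96 : ∀ a b c → (a - b) + (b + c) ≡ a + c
    ring-96 = solve 3 (λ a b c → (a ⊖ b) ⊕ (b ⊕ c) ⊜ a ⊕ c) refl
    ring-97 : ∀ a b → (a - b) + b ≡ a
    ring-97 = solve 2 (λ a b → (a ⊖ b) ⊕ b ⊜ a) refl
    ring-98 : ∀ a b c → (b + c) - a ≡ c - (a - b)
    ring-98 = solve 3 (λ a b c → (b ⊕ c) ⊖ a ⊜ c ⊖ (a ⊖ b)) refl
    ring-99 : ∀ a b c d e → (c - b) - (a - b) ≡ (e + (c + d)) - (0ℚ + (d + (e + a)))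
    ring-99 = solve 5 (λ a b c d e → (c ⊖ b) ⊖ (a ⊖ b) ⊜ (e ⊕ (c ⊕ d)) ⊖ (Κ 0ℚ ⊕ (d ⊕ (e ⊕ a)))) refl
    ring-100 : ∀ a b c d → b * (c * (d * a)) - a ≡ a * (b * (c * d)) - a * 1ℚ
    ring-100 = solve 4 (λ a b c d → b ⊗ (c ⊗ (d ⊗ a)) ⊖ a ⊜ a ⊗ (b ⊗ (c ⊗ d)) ⊖ a ⊗ Κ 1ℚ) refl
    ring-101 : ∀ a b c d e f → ((a - b) + c * d) - c * (e * f) ≡ (c * d + (a - b) * 1ℚ) - (c * (e * f - (a - b)) + (a - b) * c)
    ring-101 = solve 6 (λ a b c d e f → ((a ⊖ b) ⊕ c ⊗ d) ⊖ c ⊗ (e ⊗ f) ⊜ (c ⊗ d ⊕ (a ⊖ b) ⊗ Κ 1ℚ) ⊖ (c ⊗ (e ⊗ f ⊖ (a ⊖ b)) ⊕ (a ⊖ b) ⊗ c)) refl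
    ring-102 : ∀ a b c d e f g h → a + (b + (c + (d + (e + (f + (g + h)))))) ≡ ((b + d) + f) + ((a + c) + ((e + g) + h))
    ring-102 = solve 8 (λ a b c d e f g h → a ⊕ (b ⊕ (c ⊕ (d ⊕ (e ⊕ (f ⊕ (g ⊕ h)))))) ⊜ ((b ⊕ d) ⊕ f) ⊕ ((a ⊕ c) ⊕ ((e ⊕ g) ⊕ h))) refl
    ring-103 : ∀ a b c d e f → a + ((b + c) + ((d + e) + f)) ≡ a + ((b + e) + ((c + d) + f))
    ring-103 = solve 6 (λ a b c d e f → a ⊕ ((b ⊕ c) ⊕ ((d ⊕ e) ⊕ f)) ⊜ a ⊕ ((b ⊕ e) ⊕ ((c ⊕ d) ⊕ f))) refl
    ring-104 : ∀ a b c d e f → (a + (b + c)) + (d + (e + f)) ≡ (a + d) + ((b + e) + (c + f))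
    ring-104 = solve 6 (λ a b c d e f → (a ⊕ (b ⊕ c)) ⊕ (d ⊕ (e ⊕ f)) ⊜ (a ⊕ d) ⊕ ((b ⊕ e) ⊕ (c ⊕ f))) refl
    ring-105 : ∀ a b c d e f → (b + a * c) - a * (f - e) ≡ (a * c + (a * e + b * 1ℚ)) - (a * (f - (d + b)) + (a * d + b * a))
    ring-105 = solve 6 (λ a b c d e f → (b ⊕ a ⊗ c) ⊖ a ⊗ (f ⊖ e) ⊜ (a ⊗ c ⊕ (a ⊗ e ⊕ b ⊗ Κ 1ℚ)) ⊖ (a ⊗ (f ⊖ (d ⊕ b)) ⊕ (a ⊗ d ⊕ b ⊗ a))) refl
    ring-106 : ∀ a → a ≡ 0ℚ + (0ℚ + a)
    ring-106 = solve 1 (λ a → a ⊜ Κ 0ℚ ⊕ (Κ 0ℚ ⊕ a)) refl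
    ring-107 : ∀ a b c d → a - (b - d) ≡ a - ((b - c) + (c - d))
    ring-107 = solve 4 (λ a b c d → a ⊖ (b ⊖ d) ⊜ a ⊖ ((b ⊖ c) ⊕ (c ⊖ d))) refl
    ring-108 : ∀ a b c d e f g → c - (a - b) ≡ (b + (c + (d + (e + (f + g))))) - (0ℚ + (d + (e + (f + ((g + a) + 0ℚ)))))
    ring-108 = solve 7 (λ a b c d e f g → c ⊖ (a ⊖ b) ⊜ (b ⊕ (c ⊕ (d ⊕ (e ⊕ (f ⊕ g))))) ⊖ (Κ 0ℚ ⊕ (d ⊕ (e ⊕ (f ⊕ ((g ⊕ a) ⊕ Κ 0ℚ)))))) refl
    ring-109 : ∀ a b c d → a + (b + (c + d)) ≡ c + ((a + b) + d)
    ring-109 = solve 4 (λ a b c d → a ⊕ (b ⊕ (c ⊕ d)) ⊜ c ⊕ ((a ⊕ b) ⊕ d)) refl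
    ring-110 : ∀ a b c d → (1ℚ - a) * c + (d + (b + a * c)) ≡ b + (c + d)
    ring-110 = solve 4 (λ a b c d → (Κ 1ℚ ⊖ a) ⊗ c ⊕ (d ⊕ (b ⊕ a ⊗ c)) ⊜ b ⊕ (c ⊕ d)) refl
    ring-111 : ∀ a b c d → (a - ((a - b) + d)) - (c - d) ≡ b - c
    ring-111 = solve 4 (λ a b c d → (a ⊖ ((a ⊖ b) ⊕ d)) ⊖ (c ⊖ d) ⊜ b ⊖ c) refl
    ring-112 : ∀ a b c d → (a - b) - c ≡ d - (b - (a - (d + c)))
    ring-112 = solve 4 (λ a b c d → (a ⊖ b) ⊖ c ⊜ d ⊖ (b ⊖ (a ⊖ (d ⊕ c)))) refl
    ring-113 : ∀ a b → a - b ≡ (a - b) - 0ℚ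
    ring-113 = solve 2 (λ a b → a ⊖ b ⊜ (a ⊖ b) ⊖ Κ 0ℚ) refl
    ring-114 : ∀ a b → a - (a - b) ≡ b - 0ℚ
    ring-114 = solve 2 (λ a b → a ⊖ (a ⊖ b) ⊜ b ⊖ Κ 0ℚ) refl
    ring-115 : ∀ a b c d e f → (b - f) - ((1ℚ - a) * (d - e) + (e - f)) ≡ (c + (b + a * (d - e))) - (d + (c + 0ℚ))
    ring-115 = solve 6 (λ a b c d e f → (b ⊖ f) ⊖ ((Κ 1ℚ ⊖ a) ⊗ (d ⊖ e) ⊕ (e ⊖ f)) ⊜ (c ⊕ (b ⊕ a ⊗ (d ⊖ e))) ⊖ (d ⊕ (c ⊕ Κ 0ℚ))) refl
    ring-116 : ∀ a b c d e f g → (c + c) * g - ((a + b) + (a + b)) ≡ (c * (d - e) + (c * (d - e) + (c * f + (c * f + ((c + c) * e + (c + c) * g))))) - (a + (a + (b + (b + ((c + c) * f + (c + c) * d)))))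
    ring-116 = solve 7 (λ a b c d e f g → (c ⊕ c) ⊗ g ⊖ ((a ⊕ b) ⊕ (a ⊕ b)) ⊜ (c ⊗ (d ⊖ e) ⊕ (c ⊗ (d ⊖ e) ⊕ (c ⊗ f ⊕ (c ⊗ f ⊕ ((c ⊕ c) ⊗ e ⊕ (c ⊕ c) ⊗ g))))) ⊖ (a ⊕ (a ⊕ (b ⊕ (b ⊕ ((c ⊕ c) ⊗ f ⊕ (c ⊕ c) ⊗ d)))))) refl
    ring-117 : ∀ a b c d e f → (b - f) - ((1ℚ - a) * (d - e) + e) ≡ (((c - d) + a * (d - e)) + b) - (f + c)
    ring-117 = solve 6 (λ a b c d e f → (b ⊖ f) ⊖ ((Κ 1ℚ ⊖ a) ⊗ (d ⊖ e) ⊕ e) ⊜ (((c ⊖ d) ⊕ a ⊗ (d ⊖ e)) ⊕ b) ⊖ (f ⊕ c)) refl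
    ring-118 : ∀ a b c d e f g h i → a * (e - f) - a * 0ℚ ≡ (f + (a * (h - g) + (a * g + (a * b + (a * i + (c - d) * 1ℚ))))) - (((c - d) + a * (d - e)) + (f + (a * (b - c) + (a * i + (a * (h + f) + (c - d) * a)))))
    ring-118 = solve 9 (λ a b c d e f g h i → a ⊗ (e ⊖ f) ⊖ a ⊗ Κ 0ℚ ⊜ (f ⊕ (a ⊗ (h ⊖ g) ⊕ (a ⊗ g ⊕ (a ⊗ b ⊕ (a ⊗ i ⊕ (c ⊖ d) ⊗ Κ 1ℚ))))) ⊖ (((c ⊖ d) ⊕ a ⊗ (d ⊖ e)) ⊕ (f ⊕ (a ⊗ (b ⊖ c) ⊕ (a ⊗ i ⊕ (a ⊗ (h ⊕ f) ⊕ (c ⊖ d) ⊗ a)))))) refl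
    ring-119 : ∀ a b c d e → (a - e) - (d - e) ≡ (c + (b + a)) - (d + (c + b))
    ring-119 = solve 5 (λ a b c d e → (a ⊖ e) ⊖ (d ⊖ e) ⊜ (c ⊕ (b ⊕ a)) ⊖ (d ⊕ (c ⊕ b))) refl
    ring-120 : ∀ a b c d → a - ((a - b) + c) ≡ (d + b) - (c + d)
    ring-120 = solve 4 (λ a b c d → a ⊖ ((a ⊖ b) ⊕ c) ⊜ (d ⊕ b) ⊖ (c ⊕ d)) refl
    ring-121 : ∀ a b c d → (c + d) - ((a + b) + (a + b)) ≡ (c + d) - ((a + a) + (b + b))
    ring-121 = solve 4 (λ a b c d → (c ⊕ d) ⊖ ((a ⊕ b) ⊕ (a ⊕ b)) ⊜ (c ⊕ d) ⊖ ((a ⊕ a) ⊕ (b ⊕ b))) refl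
    ring-122 : ∀ a b c d e f g h i → ((c - d) + a * (d - e)) - a * (i - h) ≡ (a * g + (a * f + (a * h + (c - d) * 1ℚ))) - (a * (i - (b - d)) + (a * e + (a * (b - c) + (c - d) * a))) + a * (d - (g + f))
    ring-122 = solve 9 (λ a b c d e f g h i → ((c ⊖ d) ⊕ a ⊗ (d ⊖ e)) ⊖ a ⊗ (i ⊖ h) ⊜ (a ⊗ g ⊕ (a ⊗ f ⊕ (a ⊗ h ⊕ (c ⊖ d) ⊗ Κ 1ℚ))) ⊖ (a ⊗ (i ⊖ (b ⊖ d)) ⊕ (a ⊗ e ⊕ (a ⊗ (b ⊖ c) ⊕ (c ⊖ d) ⊗ a))) ⊕ a ⊗ (d ⊖ (g ⊕ f))) refl
    ring-123 : ∀ a b c d → a - b + c * (d - d) ≡ a - b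
    ring-123 = solve 4 (λ a b c d → a ⊖ b ⊕ c ⊗ (d ⊖ d) ⊜ a ⊖ b) refl
    ring-124 : ∀ a b → b - a ≡ (b + a) - ((a + a) + 0ℚ)
    ring-124 = solve 2 (λ a b → b ⊖ a ⊜ (b ⊕ a) ⊖ ((a ⊕ a) ⊕ Κ 0ℚ)) refl
    ring-125 : ∀ a b c d e → (a - d) - b ≡ (a + (e + c)) - ((b + c) + (d + e))
    ring-125 = solve 5 (λ a b c d e → (a ⊖ d) ⊖ b ⊜ (a ⊕ (e ⊕ c)) ⊖ ((b ⊕ c) ⊕ (d ⊕ e))) refl
    ring-126 : ∀ a b c d → (1ℚ + 1ℚ) * d - (1ℚ + 1ℚ) * (a + b) ≡ (c + (d + d)) - ((a + a) + ((b + b) + c))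
    ring-126 = solve 4 (λ a b c d → (Κ 1ℚ ⊕ Κ 1ℚ) ⊗ d ⊖ (Κ 1ℚ ⊕ Κ 1ℚ) ⊗ (a ⊕ b) ⊜ (c ⊕ (d ⊕ d)) ⊖ ((a ⊕ a) ⊕ ((b ⊕ b) ⊕ c))) refl
    ring-127 : ∀ a b → ((a - 0ℚ) - b) - 0ℚ ≡ a - b
    ring-127 = solve 2 (λ a b → ((a ⊖ Κ 0ℚ) ⊖ b) ⊖ Κ 0ℚ ⊜ a ⊖ b) refl
    ring-128 : ∀ a b c d → a * b * c - a * d ≡ a * (b * c) - a * d
    ring-128 = solve 4 (λ a b c d → a ⊗ b ⊗ c ⊖ a ⊗ d ⊜ a ⊗ (b ⊗ c) ⊖ a ⊗ d) refl
    ring-129 : ∀ a b c → c - (a + a) ≡ (b * c + (b * c + c * 1ℚ)) - (a + (a + c * (b + b)))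
    ring-129 = solve 3 (λ a b c → c ⊖ (a ⊕ a) ⊜ (b ⊗ c ⊕ (b ⊗ c ⊕ c ⊗ Κ 1ℚ)) ⊖ (a ⊕ (a ⊕ c ⊗ (b ⊕ b)))) refl
    ring-130 : ∀ a b c d e f → c * d - (a + b) ≡ (c * (d - e) + (c * f + c * e)) - (a + (b + c * f))
    ring-130 = solve 6 (λ a b c d e f → c ⊗ d ⊖ (a ⊕ b) ⊜ (c ⊗ (d ⊖ e) ⊕ (c ⊗ f ⊕ c ⊗ e)) ⊖ (a ⊕ (b ⊕ c ⊗ f))) refl
    ring-131 : ∀ a b c d e f → (1ℚ + f) * (c * e) - (a + b) ≡ (c * d + (c * e + f * (c * e))) - (a + (c * d + b))
    ring-131 = solve 6 (λ a b c d e f → (Κ 1ℚ ⊕ f) ⊗ (c ⊗ e) ⊖ (a ⊕ b) ⊜ (c ⊗ d ⊕ (c ⊗ e ⊕ f ⊗ (c ⊗ e))) ⊖ (a ⊕ (c ⊗ d ⊕ b))) refl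
    ring-132 : ∀ a b c d e → a + ((b + c) + (d + e)) ≡ (a + c) + (b + (d + e))
    ring-132 = solve 5 (λ a b c d e → a ⊕ ((b ⊕ c) ⊕ (d ⊕ e)) ⊜ (a ⊕ c) ⊕ (b ⊕ (d ⊕ e))) refl
    ring-133 : ∀ a b c d e f g → (a + (b + c)) + (d + ((e + f) + g)) ≡ (e + ((f + a) + d)) + (b + (c + g))
    ring-133 = solve 7 (λ a b c d e f g → (a ⊕ (b ⊕ c)) ⊕ (d ⊕ ((e ⊕ f) ⊕ g)) ⊜ (e ⊕ ((f ⊕ a) ⊕ d)) ⊕ (b ⊕ (c ⊕ g))) refl
    ring-134 : ∀ a b → b ≡ a - (a - b)
    ring-134 = solve 2 (λ a b → b ⊜ a ⊖ (a ⊖ b)) refl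
    ring-135 : ∀ a b c → (a + (b + c)) + 0ℚ ≡ a + (c + b)
    ring-135 = solve 3 (λ a b c → (a ⊕ (b ⊕ c)) ⊕ Κ 0ℚ ⊜ a ⊕ (c ⊕ b)) refl
    ring-136 : ∀ a b c → b * c - a * c ≡ c * b - c * a
    ring-136 = solve 3 (λ a b c → b ⊗ c ⊖ a ⊗ c ⊜ c ⊗ b ⊖ c ⊗ a) refl
    ring-137 : ∀ a b c d → c * (d * b) - a * b ≡ b * (d * c) - b * a
    ring-137 = solve 4 (λ a b c d → c ⊗ (d ⊗ b) ⊖ a ⊗ b ⊜ b ⊗ (d ⊗ c) ⊖ b ⊗ a) refl
    ring-138 : ∀ a b c d → c * (d * b) - b * a ≡ b * (d * c) - b * a
    ring-138 = solve 4 (λ a b c d → c ⊗ (d ⊗ b) ⊖ b ⊗ a ⊜ b ⊗ (d ⊗ c) ⊖ b ⊗ a) refl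
    ring-139 : ∀ a b c → a - (c + (a - b)) ≡ (b + c) - ((c + c) + 0ℚ)
    ring-139 = solve 3 (λ a b c → a ⊖ (c ⊕ (a ⊖ b)) ⊜ (b ⊕ c) ⊖ ((c ⊕ c) ⊕ Κ 0ℚ)) refl
    ring-140 : ∀ a b c d → ((a - 0ℚ) - c) - (d + (a - b)) ≡ b - (c + d)
    ring-140 = solve 4 (λ a b c d → ((a ⊖ Κ 0ℚ) ⊖ c) ⊖ (d ⊕ (a ⊖ b)) ⊜ b ⊖ (c ⊕ d)) refl
    ring-141 : ∀ a b c → ((a - 0ℚ) - c) - (a - b) ≡ (b + c) - ((c + c) + 0ℚ)
    ring-141 = solve 3 (λ a b c → ((a ⊖ Κ 0ℚ) ⊖ c) ⊖ (a ⊖ b) ⊜ (b ⊕ c) ⊖ ((c ⊕ c) ⊕ Κ 0ℚ)) refl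
    ring-142 : ∀ a b → a + ((b - 0ℚ) - a) ≡ b - 0ℚ
    ring-142 = solve 2 (λ a b → a ⊕ ((b ⊖ Κ 0ℚ) ⊖ a) ⊜ b ⊖ Κ 0ℚ) refl
    ring-143 : ∀ a b c d → (a - d) - ((b - d) + c) ≡ a - (b + c)
    ring-143 = solve 4 (λ a b c d → (a ⊖ d) ⊖ ((b ⊖ d) ⊕ c) ⊜ a ⊖ (b ⊕ c)) refl
    ring-144 : ∀ a b c d e f → (a + (b + (c + d))) + (0ℚ + (e + f)) ≡ (b + (a + e)) + (d + (c + f))
    ring-144 = solve 6 (λ a b c d e f → (a ⊕ (b ⊕ (c ⊕ d))) ⊕ (Κ 0ℚ ⊕ (e ⊕ f)) ⊜ (b ⊕ (a ⊕ e)) ⊕ (d ⊕ (c ⊕ f))) refl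
    ring-145 : ∀ a b c d e → (a - (d + e)) - ((b - d) + (c - e)) ≡ a - (b + c)
    ring-145 = solve 5 (λ a b c d e → (a ⊖ (d ⊕ e)) ⊖ ((b ⊖ d) ⊕ (c ⊖ e)) ⊜ a ⊖ (b ⊕ c)) refl
    ring-146 : ∀ a b c d e f → c * d - (a + b) ≡ (c * e + (c * f + c * d)) - (a + (b + c * (e + f)))
    ring-146 = solve 6 (λ a b c d e f → c ⊗ d ⊖ (a ⊕ b) ⊜ (c ⊗ e ⊕ (c ⊗ f ⊕ c ⊗ d)) ⊖ (a ⊕ (b ⊕ c ⊗ (e ⊕ f)))) refl
    ring-147 : ∀ a b c d e f → (a + b) + ((c + d) + (e + f)) ≡ (a + (c + e)) + (b + (d + f))
    ring-147 = solve 6 (λ a b c d e f → (a ⊕ b) ⊕ ((c ⊕ d) ⊕ (e ⊕ f)) ⊜ (a ⊕ (c ⊕ e)) ⊕ (b ⊕ (d ⊕ f))) refl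
    ring-148 : ∀ a b c d e f → (f + f) - ((a + a) + (b + b)) ≡ ((c + (c + (d + (d + (e + e))))) + (f + f)) - ((a + (a + (b + (b + ((c + d) + (c + d)))))) + (e + e))
    ring-148 = solve 6 (λ a b c d e f → (f ⊕ f) ⊖ ((a ⊕ a) ⊕ (b ⊕ b)) ⊜ ((c ⊕ (c ⊕ (d ⊕ (d ⊕ (e ⊕ e))))) ⊕ (f ⊕ f)) ⊖ ((a ⊕ (a ⊕ (b ⊕ (b ⊕ ((c ⊕ d) ⊕ (c ⊕ d)))))) ⊕ (e ⊕ e))) refl
    ring-149 : ∀ a → a - 0ℚ ≡ a
    ring-149 = solve 1 (λ a → a ⊖ Κ 0ℚ ⊜ a) refl
    ring-150 : ∀ a b c → (a - b) - c ≡ a - (c + b)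
    ring-150 = solve 3 (λ a b c → (a ⊖ b) ⊖ c ⊜ a ⊖ (c ⊕ b)) refl
    ring-151 : ∀ a → a ≡ a - 0ℚ
    ring-151 = solve 1 (λ a → a ⊜ a ⊖ Κ 0ℚ) refl
    ring-152 : ∀ a b c d e → (a - e) - c ≡ (d + (b + a)) - (e + ((c + d) + b))
    ring-152 = solve 5 (λ a b c d e → (a ⊖ e) ⊖ c ⊜ (d ⊕ (b ⊕ a)) ⊖ (e ⊕ ((c ⊕ d) ⊕ b))) refl
    ring-153 : ∀ a b c d e → (a - e) - d ≡ (c + (b + a)) - (e + ((c + d) + b))
    ring-153 = solve 5 (λ a b c d e → (a ⊖ e) ⊖ d ⊜ (c ⊕ (b ⊕ a)) ⊖ (e ⊕ ((c ⊕ d) ⊕ b))) refl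
    ring-154 : ∀ a b c d e → a + (b + (c + (d + e))) ≡ (b + (c + d)) + (a + e)
    ring-154 = solve 5 (λ a b c d e → a ⊕ (b ⊕ (c ⊕ (d ⊕ e))) ⊜ (b ⊕ (c ⊕ d)) ⊕ (a ⊕ e)) refl
    ring-155 : ∀ a b c d e f g → (b + (c * e + g)) - (a + b) ≡ ((c * d + f) + (c * e + g)) - (a + (c * d + f))
    ring-155 = solve 7 (λ a b c d e f g → (b ⊕ (c ⊗ e ⊕ g)) ⊖ (a ⊕ b) ⊜ ((c ⊗ d ⊕ f) ⊕ (c ⊗ e ⊕ g)) ⊖ (a ⊕ (c ⊗ d ⊕ f))) refl
    ring-156 : ∀ a b c d e → (d + (e + e + e + e) * (b * b)) - (a + (b * b - b * b)) ≡ ((c + (e + e) * (b * b)) + (d + (e + e) * (b * b))) - (a + (c + 0ℚ))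
    ring-156 = solve 5 (λ a b c d e → (d ⊕ (e ⊕ e ⊕ e ⊕ e) ⊗ (b ⊗ b)) ⊖ (a ⊕ (b ⊗ b ⊖ b ⊗ b)) ⊜ ((c ⊕ (e ⊕ e) ⊗ (b ⊗ b)) ⊕ (d ⊕ (e ⊕ e) ⊗ (b ⊗ b))) ⊖ (a ⊕ (c ⊕ Κ 0ℚ))) refl
    ring-157 : ∀ a b c d → a + (b + (c + d)) ≡ (a + (b + c)) + d
    ring-157 = solve 4 (λ a b c d → a ⊕ (b ⊕ (c ⊕ d)) ⊜ (a ⊕ (b ⊕ c)) ⊕ d) refl
    ring-158 : ∀ a b c d e f → (a + ((b + c) + (d + e))) + f ≡ (d + b) + (a + (e + (c + f)))
    ring-158 = solve 6 (λ a b c d e f → (a ⊕ ((b ⊕ c) ⊕ (d ⊕ e))) ⊕ f ⊜ (d ⊕ b) ⊕ (a ⊕ (e ⊕ (c ⊕ f)))) refl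
    ring-159 : ∀ a b c → (c + c) - a ≡ ((c + c) + a) - (((a - b) + (a - b)) + (b + b))
    ring-159 = solve 3 (λ a b c → (c ⊕ c) ⊖ a ⊜ ((c ⊕ c) ⊕ a) ⊖ (((a ⊖ b) ⊕ (a ⊖ b)) ⊕ (b ⊕ b))) refl
    ring-160 : ∀ a b c → (a - c) - (a - b) ≡ (b - c) - 0ℚ
    ring-160 = solve 3 (λ a b c → (a ⊖ c) ⊖ (a ⊖ b) ⊜ (b ⊖ c) ⊖ Κ 0ℚ) refl
    ring-161 : ∀ a b c → (a - b) + (c - a) ≡ c - b
    ring-161 = solve 3 (λ a b c → (a ⊖ b) ⊕ (c ⊖ a) ⊜ c ⊖ b) refl
    ring-162 : ∀ a b c d e f → a + ((b + c) + (d + (e + f))) ≡ (a + (d + (e + b))) + (c + f)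
    ring-162 = solve 6 (λ a b c d e f → a ⊕ ((b ⊕ c) ⊕ (d ⊕ (e ⊕ f))) ⊜ (a ⊕ (d ⊕ (e ⊕ b))) ⊕ (c ⊕ f)) refl
    ring-163 : ∀ a b c d e f g h i j k → (j + (h + h + h + h) * (b * b)) - (((c - g) * (b - f) + ((b - c) * (d - f) + (0ℚ + a))) + (b * b - (b - g) * (b - f))) ≡ ((i + (h + h) * ((b - c) * (b - e))) + (j + (b * (h * b) + (b * (k * b) + (b * b * h + (c * d + ((h + h) * (b - e) * b + (h + h) * b * b))))))) - (a + (i + (b * c + (b * d + (b * b * k + (0ℚ + ((h + h) * (b - e) * (b - c) + (h + h) * b * (b - e))))))))
    ring-163 = solve 11 (λ a b c d e f g h i j k → (j ⊕ (h ⊕ h ⊕ h ⊕ h) ⊗ (b ⊗ b)) ⊖ (((c ⊖ g) ⊗ (b ⊖ f) ⊕ ((b ⊖ c) ⊗ (d ⊖ f) ⊕ (Κ 0ℚ ⊕ a))) ⊕ (b ⊗ b ⊖ (b ⊖ g) ⊗ (b ⊖ f))) ⊜ ((i ⊕ (h ⊕ h) ⊗ ((b ⊖ c) ⊗ (b ⊖ e))) ⊕ (j ⊕ (b ⊗ (h ⊗ b) ⊕ (b ⊗ (k ⊗ b) ⊕ (b ⊗ b ⊗ h ⊕ (c ⊗ d ⊕ ((h ⊕ h) ⊗ (b ⊖ e) ⊗ b ⊕ (h ⊕ h) ⊗ b ⊗ b))))))) ⊖ (a ⊕ (i ⊕ (b ⊗ c ⊕ (b ⊗ d ⊕ (b ⊗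 b ⊗ k ⊕ (Κ 0ℚ ⊕ ((h ⊕ h) ⊗ (b ⊖ e) ⊗ (b ⊖ c) ⊕ (h ⊕ h) ⊗ b ⊗ (b ⊖ e))))))))) refl
    ring-164 : ∀ a b c d e → c * (d + e) - (a - b) * c ≡ c * e - c * ((a - d) - b)
    ring-164 = solve 5 (λ a b c d e → c ⊗ (d ⊕ e) ⊖ (a ⊖ b) ⊗ c ⊜ c ⊗ e ⊖ c ⊗ ((a ⊖ d) ⊖ b)) refl
    ring-165 : ∀ a b c → a * b - c * a ≡ a * b - a * c
    ring-165 = solve 3 (λ a b c → a ⊗ b ⊖ c ⊗ a ⊜ a ⊗ b ⊖ a ⊗ c) refl
    ring-166 : ∀ a b → b - a * b ≡ b * 1ℚ - b * a
    ring-166 = solve 2 (λ a b → b ⊖ a ⊗ b ⊜ b ⊗ Κ 1ℚ ⊖ b ⊗ a) refl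
    ring-167 : ∀ a b c d → (c + c + c) * d - a * b ≡ (d * c + (a * d + (c + c) * d)) - (d * a + (a * b + 0ℚ))
    ring-167 = solve 4 (λ a b c d → (c ⊕ c ⊕ c) ⊗ d ⊖ a ⊗ b ⊜ (d ⊗ c ⊕ (a ⊗ d ⊕ (c ⊕ c) ⊗ d)) ⊖ (d ⊗ a ⊕ (a ⊗ b ⊕ Κ 0ℚ))) refl
    ring-168 : ∀ a b c d e f → (d + (e + e + e) * f) - a * b ≡ (d + (a * e + (a * e + (b * e + (e * f + (e * f + (e * f + (c * c + c * c)))))))) - ((a - c) * ((b - c) - c) + (a * c + (a * c + (b * c + (e * a + (e * a + (e * b + (0ℚ + 0ℚ))))))))
    ring-168 = solve 6 (λ a b c d e f → (d ⊕ (e ⊕ e ⊕ e) ⊗ f) ⊖ a ⊗ b ⊜ (d ⊕ (a ⊗ e ⊕ (a ⊗ e ⊕ (b ⊗ e ⊕ (e ⊗ f ⊕ (e ⊗ f ⊕ (e ⊗ f ⊕ (c ⊗ c ⊕ c ⊗ c)))))))) ⊖ ((a ⊖ c) ⊗ ((b ⊖ c) ⊖ c) ⊕ (a ⊗ c ⊕ (a ⊗ c ⊕ (b ⊗ c ⊕ (e ⊗ a ⊕ (e ⊗ a ⊕ (e ⊗ b ⊕ (Κ 0ℚ ⊕ Κ 0ℚ))))))))) refl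
    ring-169 : ∀ a b c d e → 0ℚ - (a - b) * ((c - e) - d) ≡ ((a - b) * e + (a - b) * d) - ((a - b) * c + 0ℚ)
    ring-169 = solve 5 (λ a b c d e → Κ 0ℚ ⊖ (a ⊖ b) ⊗ ((c ⊖ e) ⊖ d) ⊜ ((a ⊖ b) ⊗ e ⊕ (a ⊖ b) ⊗ d) ⊖ ((a ⊖ b) ⊗ c ⊕ Κ 0ℚ)) refl
    ring-170 : ∀ a b c d → a + (b + (c + d)) ≡ ((a + b) + c) + d
    ring-170 = solve 4 (λ a b c d → a ⊕ (b ⊕ (c ⊕ d)) ⊜ ((a ⊕ b) ⊕ c) ⊕ d) refl
    ring-171 : ∀ a b c d e f g h → (h + g) - (a - b) * ((c - e) - d) ≡ (g + h) - ((a - b) * (((c - e) - f) - d) + (a - b) * f)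
    ring-171 = solve 8 (λ a b c d e f g h → (h ⊕ g) ⊖ (a ⊖ b) ⊗ ((c ⊖ e) ⊖ d) ⊜ (g ⊕ h) ⊖ ((a ⊖ b) ⊗ (((c ⊖ e) ⊖ f) ⊖ d) ⊕ (a ⊖ b) ⊗ f)) refl
    ring-172 : ∀ a b c d e → (a - b) * ((c - e) - d) - (a - b) * ((c - d) - d) ≡ (a - b) * d - (a - b) * e
    ring-172 = solve 5 (λ a b c d e → (a ⊖ b) ⊗ ((c ⊖ e) ⊖ d) ⊖ (a ⊖ b) ⊗ ((c ⊖ d) ⊖ d) ⊜ (a ⊖ b) ⊗ d ⊖ (a ⊖ b) ⊗ e) refl
    ring-173 : ∀ a → a ≡ 0ℚ + (1ℚ + 0ℚ) * a
    ring-173 = solve 1 (λ a → a ⊜ Κ 0ℚ ⊕ (Κ 1ℚ ⊕ Κ 0ℚ) ⊗ a) refl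
    ring-174 : ∀ a b → a + b ≡ a + (1ℚ + 0ℚ) * b
    ring-174 = solve 2 (λ a b → a ⊕ b ⊜ a ⊕ (Κ 1ℚ ⊕ Κ 0ℚ) ⊗ b) refl
    ring-175 : ∀ a b c d e f g h i j → ((f + g) + (h + i) * j) - ((a + b) * c - (d + e)) ≡ ((f + h * j) + (g + i * j)) - ((a * c - d) + (b * c - e))
    ring-175 = solve 10 (λ a b c d e f g h i j → ((f ⊕ g) ⊕ (h ⊕ i) ⊗ j) ⊖ ((a ⊕ b) ⊗ c ⊖ (d ⊕ e)) ⊜ ((f ⊕ h ⊗ j) ⊕ (g ⊕ i ⊗ j)) ⊖ ((a ⊗ c ⊖ d) ⊕ (b ⊗ c ⊖ e))) refl
    ring-176 : ∀ a b c d e f g h i j → ((f + g) + (h + i) * j) - (c * (a + b) - (d + e)) ≡ ((f + h * j) + (g + i * j)) - ((c * a - d) + (c * b - e))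
    ring-176 = solve 10 (λ a b c d e f g h i j → ((f ⊕ g) ⊕ (h ⊕ i) ⊗ j) ⊖ (c ⊗ (a ⊕ b) ⊖ (d ⊕ e)) ⊜ ((f ⊕ h ⊗ j) ⊕ (g ⊕ i ⊗ j)) ⊖ ((c ⊗ a ⊖ d) ⊕ (c ⊗ b ⊖ e))) refl
    ring-177 : ∀ a b c → ((a + b) + c) - (a + c) ≡ b - 0ℚ
    ring-177 = solve 3 (λ a b c → ((a ⊕ b) ⊕ c) ⊖ (a ⊕ c) ⊜ b ⊖ Κ 0ℚ) refl
    ring-178 : ∀ a b c d → (b - a) - d ≡ (c + b) - (a + (c + d))
    ring-178 = solve 4 (λ a b c d → (b ⊖ a) ⊖ d ⊜ (c ⊕ b) ⊖ (a ⊕ (c ⊕ d))) refl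
    ring-179 : ∀ a b c → (c - a) + (b - c) ≡ b - a
    ring-179 = solve 3 (λ a b c → (c ⊖ a) ⊕ (b ⊖ c) ⊜ b ⊖ a) refl
    ring-180 : ∀ a b c → c - (a + b) ≡ (c - a) - b
    ring-180 = solve 3 (λ a b c → c ⊖ (a ⊕ b) ⊜ (c ⊖ a) ⊖ b) refl
    ring-181 : ∀ a b c d → (b - (a + c)) - d ≡ (b - a) - (c + d)
    ring-181 = solve 4 (λ a b c d → (b ⊖ (a ⊕ c)) ⊖ d ⊜ (b ⊖ a) ⊖ (c ⊕ d)) refl
    ring-182 : ∀ a b → (a + b) - a ≡ b
    ring-182 = solve 2 (λ a b → (a ⊕ b) ⊖ a ⊜ b) refl
    ring-183 : ∀ a b → b - a ≡ (b - a) - 0ℚ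
    ring-183 = solve 2 (λ a b → b ⊖ a ⊜ (b ⊖ a) ⊖ Κ 0ℚ) refl
    ring-184 : ∀ a b c d → b - (a + c) ≡ (d + (b - a)) - (0ℚ + (c + d))
    ring-184 = solve 4 (λ a b c d → b ⊖ (a ⊕ c) ⊜ (d ⊕ (b ⊖ a)) ⊖ (Κ 0ℚ ⊕ (c ⊕ d))) refl
    ring-185 : ∀ a b c → (b - a) - c ≡ b - (a + c)
    ring-185 = solve 3 (λ a b c → (b ⊖ a) ⊖ c ⊜ b ⊖ (a ⊕ c)) refl
    ring-186 : ∀ a b c → (a - b) - (a - c) ≡ c - b
    ring-186 = solve 3 (λ a b c → (a ⊖ b) ⊖ (a ⊖ c) ⊜ c ⊖ b) refl
    ring-187 : ∀ a b c → (a - (b + c)) + b ≡ a - c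
    ring-187 = solve 3 (λ a b c → (a ⊖ (b ⊕ c)) ⊕ b ⊜ a ⊖ c) refl
    ring-188 : ∀ a b c → a - ((a - c) + b) ≡ c - b
    ring-188 = solve 3 (λ a b c → a ⊖ ((a ⊖ c) ⊕ b) ⊜ c ⊖ b) refl
    ring-189 : ∀ a b c → (b - c) - (a - c) ≡ b - a
    ring-189 = solve 3 (λ a b c → (b ⊖ c) ⊖ (a ⊖ c) ⊜ b ⊖ a) refl
    ring-190 : ∀ a b c d e f g h → a + ((b + c) + (d + ((e + f) + (g + h)))) ≡ (((a + b) + g) + c) + (((d + e) + h) + f)
    ring-190 = solve 8 (λ a b c d e f g h → a ⊕ ((b ⊕ c) ⊕ (d ⊕ ((e ⊕ f) ⊕ (g ⊕ h)))) ⊜ (((a ⊕ b) ⊕ g) ⊕ c) ⊕ (((d ⊕ e) ⊕ h) ⊕ f)) refl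
    ring-191 : ∀ a b c d → b + d ≡ ((a + b) + (c + d)) - (a + c)
    ring-191 = solve 4 (λ a b c d → b ⊕ d ⊜ ((a ⊕ b) ⊕ (c ⊕ d)) ⊖ (a ⊕ c)) refl
    ring-192 : ∀ a b c d e f g h i j → (a + f) + ((b + g) + ((c + h) + ((d + i) + (e + j)))) ≡ (a + (b + (c + (d + e)))) + (f + (g + (h + (i + j))))
    ring-192 = solve 10 (λ a b c d e f g h i j → (a ⊕ f) ⊕ ((b ⊕ g) ⊕ ((c ⊕ h) ⊕ ((d ⊕ i) ⊕ (e ⊕ j)))) ⊜ (a ⊕ (b ⊕ (c ⊕ (d ⊕ e)))) ⊕ (f ⊕ (g ⊕ (h ⊕ (i ⊕ j))))) refl
    ring-193 : ∀ a b c d → (a - b) + (c - d) ≡ (a + c) - (b + d)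
    ring-193 = solve 4 (λ a b c d → (a ⊖ b) ⊕ (c ⊖ d) ⊜ (a ⊕ c) ⊖ (b ⊕ d)) refl
    ring-194 : ∀ a b c d e → a * (b - d) - (1ℚ + e) * b ≡ (a * (b - c) + a * (c - d)) - (e * b + b)
    ring-194 = solve 5 (λ a b c d e → a ⊗ (b ⊖ d) ⊖ (Κ 1ℚ ⊕ e) ⊗ b ⊜ (a ⊗ (b ⊖ c) ⊕ a ⊗ (c ⊖ d)) ⊖ (e ⊗ b ⊕ b)) refl
    ring-195 : ∀ a b → 0ℚ * b ≡ a * (b - b)
    ring-195 = solve 2 (λ a b → Κ 0ℚ ⊗ b ⊜ a ⊗ (b ⊖ b)) refl
    ring-196 : ∀ a b c → a * b - a * (b - c) ≡ a * c - 0ℚ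
    ring-196 = solve 3 (λ a b c → a ⊗ b ⊖ a ⊗ (b ⊖ c) ⊜ a ⊗ c ⊖ Κ 0ℚ) refl
    ring-197 : ∀ a b c → a * (b * c) ≡ b * (c * a)
    ring-197 = solve 3 (λ a b c → a ⊗ (b ⊗ c) ⊜ b ⊗ (c ⊗ a)) refl
    ring-198 : ∀ a b c → c - a * (c - b) ≡ ((c - b) * 1ℚ + b) - ((c - b) * a + 0ℚ)
    ring-198 = solve 3 (λ a b c → c ⊖ a ⊗ (c ⊖ b) ⊜ ((c ⊖ b) ⊗ Κ 1ℚ ⊕ b) ⊖ ((c ⊖ b) ⊗ a ⊕ Κ 0ℚ)) refl
    ring-199 : ∀ a b c → a * b - (a * c + a * c) ≡ (a * (half * b) + a * (half * b)) - (a * c + a * c)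
    ring-199 = solve 3 (λ a b c → a ⊗ b ⊖ (a ⊗ c ⊕ a ⊗ c) ⊜ (a ⊗ (Κ half ⊗ b) ⊕ a ⊗ (Κ half ⊗ b)) ⊖ (a ⊗ c ⊕ a ⊗ c)) refl
    ring-200 : ∀ a b c d → c - (b - a) ≡ (d + (c + (a + b))) - ((b + b) + (d + (0ℚ + 0ℚ)))
    ring-200 = solve 4 (λ a b c d → c ⊖ (b ⊖ a) ⊜ (d ⊕ (c ⊕ (a ⊕ b))) ⊖ ((b ⊕ b) ⊕ (d ⊕ (Κ 0ℚ ⊕ Κ 0ℚ)))) refl
    ring-201 : ∀ a b c d → a * (b * (c * (half * d))) + a * (b * (c * (half * d))) ≡ b * c * (d * a)
    ring-201 = solve 4 (λ a b c d → a ⊗ (b ⊗ (c ⊗ (Κ half ⊗ d))) ⊕ a ⊗ (b ⊗ (c ⊗ (Κ half ⊗ d))) ⊜ b ⊗ c ⊗ (d ⊗ a)) refl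
    ring-202 : ∀ a b c → a - c ≡ (a * 1ℚ + (b * a + c)) - (a * b + ((c + c) + 0ℚ))
    ring-202 = solve 3 (λ a b c → a ⊖ c ⊜ (a ⊗ Κ 1ℚ ⊕ (b ⊗ a ⊕ c)) ⊖ (a ⊗ b ⊕ ((c ⊕ c) ⊕ Κ 0ℚ))) refl
    ring-203 : ∀ a b c d e → b * (c * (a * d - a * e)) - a ≡ a * (b * (c * (d - e))) - a * 1ℚ
    ring-203 = solve 5 (λ a b c d e → b ⊗ (c ⊗ (a ⊗ d ⊖ a ⊗ e)) ⊖ a ⊜ a ⊗ (b ⊗ (c ⊗ (d ⊖ e))) ⊖ a ⊗ Κ 1ℚ) refl
    ring-204 : ∀ a b c d e f → d * (a * e - a * f) - b * (c * (a * f)) ≡ a * (d * (e - f)) - a * (b * c * f)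
    ring-204 = solve 6 (λ a b c d e f → d ⊗ (a ⊗ e ⊖ a ⊗ f) ⊖ b ⊗ (c ⊗ (a ⊗ f)) ⊜ a ⊗ (d ⊗ (e ⊖ f)) ⊖ a ⊗ (b ⊗ c ⊗ f)) refl
    ring-205 : ∀ a b → a - a * b ≡ a * 1ℚ - a * b
    ring-205 = solve 2 (λ a b → a ⊖ a ⊗ b ⊜ a ⊗ Κ 1ℚ ⊖ a ⊗ b) refl
    ring-206 : ∀ a b c d → a * (b * c) + d + b * c ≡ b * (c * (1ℚ + a)) + d
    ring-206 = solve 4 (λ a b c d → a ⊗ (b ⊗ c) ⊕ d ⊕ b ⊗ c ⊜ b ⊗ (c ⊗ (Κ 1ℚ ⊕ a)) ⊕ d) refl
    ring-207 : ∀ a → a - (a * (quarter * a) * 1ℚ + quarter * a) ≡ ((quarter * a) * 1ℚ + half * a) - ((quarter * a) * a + 0ℚ)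
    ring-207 = solve 1 (λ a → a ⊖ (a ⊗ (Κ quarter ⊗ a) ⊗ Κ 1ℚ ⊕ Κ quarter ⊗ a) ⊜ ((Κ quarter ⊗ a) ⊗ Κ 1ℚ ⊕ Κ half ⊗ a) ⊖ ((Κ quarter ⊗ a) ⊗ a ⊕ Κ 0ℚ)) refl
    ring-208 : ∀ a b c d → b * (a - a * (b * c)) - d * (a * (b * c)) ≡ (a * (b * c) * 1ℚ - a * (b * c) * b) + a * (b - b * (c * (1ℚ + d)))
    ring-208 = solve 4 (λ a b c d → b ⊗ (a ⊖ a ⊗ (b ⊗ c)) ⊖ d ⊗ (a ⊗ (b ⊗ c)) ⊜ (a ⊗ (b ⊗ c) ⊗ Κ 1ℚ ⊖ a ⊗ (b ⊗ c) ⊗ b) ⊕ a ⊗ (b ⊖ b ⊗ (c ⊗ (Κ 1ℚ ⊕ d)))) refl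
    ring-209 : ∀ a b c → a + b * (c - c) ≡ a
    ring-209 = solve 3 (λ a b c → a ⊕ b ⊗ (c ⊖ c) ⊜ a) refl
    ring-210 : ∀ a b c → a * c - b * a ≡ a * c - a * b
    ring-210 = solve 3 (λ a b c → a ⊗ c ⊖ b ⊗ a ⊜ a ⊗ c ⊖ a ⊗ b) refl
    ring-211 : ∀ a b c → c * a - b * a ≡ a * c - a * b
    ring-211 = solve 3 (λ a b c → c ⊗ a ⊖ b ⊗ a ⊜ a ⊗ c ⊖ a ⊗ b) refl
    ring-212 : ∀ a → third * a + third * a + third * a ≡ a
    ring-212 = solve 1 (λ a → Κ third ⊗ a ⊕ Κ third ⊗ a ⊕ Κ third ⊗ a ⊜ a) refl
    ring-213 : ∀ a → 1ℚ - a ≡ (1ℚ + (a + a)) - ((a + a + a) + (0ℚ + 0ℚ))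
    ring-213 = solve 1 (λ a → Κ 1ℚ ⊖ a ⊜ (Κ 1ℚ ⊕ (a ⊕ a)) ⊖ ((a ⊕ a ⊕ a) ⊕ (Κ 0ℚ ⊕ Κ 0ℚ))) refl
    ring-214 : ∀ a b → (a + a + a + a) * b ≡ a * (b + (b + (b + b)))
    ring-214 = solve 2 (λ a b → (a ⊕ a ⊕ a ⊕ a) ⊗ b ⊜ a ⊗ (b ⊕ (b ⊕ (b ⊕ b)))) refl
    ring-215 : ∀ a b → a * (1ℚ + b) - a ≡ a * b - 0ℚ
    ring-215 = solve 2 (λ a b → a ⊗ (Κ 1ℚ ⊕ b) ⊖ a ⊜ a ⊗ b ⊖ Κ 0ℚ) refl
    ring-216 : ∀ a b c d e → quarter * (a + (b + (c + (d + e)))) - d ≡ (a + (b + (c + e))) - (quarter * (a + (b + (c + (d + e)))) + (quarter * (a + (b + (c + (d + e)))) + (quarter * (a + (b + (c + (d + e)))) + 0ℚ)))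
    ring-216 = solve 5 (λ a b c d e → Κ quarter ⊗ (a ⊕ (b ⊕ (c ⊕ (d ⊕ e)))) ⊖ d ⊜ (a ⊕ (b ⊕ (c ⊕ e))) ⊖ (Κ quarter ⊗ (a ⊕ (b ⊕ (c ⊕ (d ⊕ e)))) ⊕ (Κ quarter ⊗ (a ⊕ (b ⊕ (c ⊕ (d ⊕ e)))) ⊕ (Κ quarter ⊗ (a ⊕ (b ⊕ (c ⊕ (d ⊕ e)))) ⊕ Κ 0ℚ)))) refl
    ring-217 : ∀ a b c d e → a + (b + (c + (d + e))) ≡ c + (d + (a + (b + e)))
    ring-217 = solve 5 (λ a b c d e → a ⊕ (b ⊕ (c ⊕ (d ⊕ e))) ⊜ c ⊕ (d ⊕ (a ⊕ (b ⊕ e)))) refl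
    ring-218 : ∀ a b c d e f g → ((quarter + d + d) * e + g) - ((a + b) + (c * e + f)) ≡ (quarter * e + (d * e + (e * d + g))) - (a + (b + (e * c + f)))
    ring-218 = solve 7 (λ a b c d e f g → ((Κ quarter ⊕ d ⊕ d) ⊗ e ⊕ g) ⊖ ((a ⊕ b) ⊕ (c ⊗ e ⊕ f)) ⊜ (Κ quarter ⊗ e ⊕ (d ⊗ e ⊕ (e ⊗ d ⊕ g))) ⊖ (a ⊕ (b ⊕ (e ⊗ c ⊕ f)))) refl
    ring-219 : ∀ a → (a + 1ℚ) - a ≡ 1ℚ - 0ℚ
    ring-219 = solve 1 (λ a → (a ⊕ Κ 1ℚ) ⊖ a ⊜ Κ 1ℚ ⊖ Κ 0ℚ) refl
    ring-220 : ∀ a b → (1ℚ + 1ℚ) * ((a * b) * (a * b)) ≡ b * b * ((1ℚ + (1ℚ + 0ℚ)) * (a * a))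
    ring-220 = solve 2 (λ a b → (Κ 1ℚ ⊕ Κ 1ℚ) ⊗ ((a ⊗ b) ⊗ (a ⊗ b)) ⊜ b ⊗ b ⊗ ((Κ 1ℚ ⊕ (Κ 1ℚ ⊕ Κ 0ℚ)) ⊗ (a ⊗ a))) refl
    ring-221 : ∀ a b → a - a * b ≡ (a * half + a * half) - (0ℚ + a * b)
    ring-221 = solve 2 (λ a b → a ⊖ a ⊗ b ⊜ (a ⊗ Κ half ⊕ a ⊗ Κ half) ⊖ (Κ 0ℚ ⊕ a ⊗ b)) refl
    ring-222 : ∀ a → (a + a + a + a) - a ≡ (a + a + a) - 0ℚ
    ring-222 = solve 1 (λ a → (a ⊕ a ⊕ a ⊕ a) ⊖ a ⊜ (a ⊕ a ⊕ a) ⊖ Κ 0ℚ) refl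
    ring-223 : ∀ a b c → c * a - a * b ≡ a * c - a * b
    ring-223 = solve 3 (λ a b c → c ⊗ a ⊖ a ⊗ b ⊜ a ⊗ c ⊖ a ⊗ b) refl
    ring-224 : ∀ a b c d → (a + (b + (c + d))) - c ≡ (a + (b + d)) - (0ℚ + (0ℚ + 0ℚ))
    ring-224 = solve 4 (λ a b c d → (a ⊕ (b ⊕ (c ⊕ d))) ⊖ c ⊜ (a ⊕ (b ⊕ d)) ⊖ (Κ 0ℚ ⊕ (Κ 0ℚ ⊕ Κ 0ℚ))) refl
    ring-225 : ∀ a b c → a * (b * c) ≡ b * (a * c)
    ring-225 = solve 3 (λ a b c → a ⊗ (b ⊗ c) ⊜ b ⊗ (a ⊗ c)) refl
    ring-226 : ∀ a b c d e → (e + e + e) * (c * c) - a * ((c * d + c * d + c * d) * c) ≡ ((c * c + c * c + c * c) * d * b + (c * c + c * c + c * c) * e) - ((c * c + c * c + c * c) * d * a + (c * c + c * c + c * c) * (b * d))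
    ring-226 = solve 5 (λ a b c d e → (e ⊕ e ⊕ e) ⊗ (c ⊗ c) ⊖ a ⊗ ((c ⊗ d ⊕ c ⊗ d ⊕ c ⊗ d) ⊗ c) ⊜ ((c ⊗ c ⊕ c ⊗ c ⊕ c ⊗ c) ⊗ d ⊗ b ⊕ (c ⊗ c ⊕ c ⊗ c ⊕ c ⊗ c) ⊗ e) ⊖ ((c ⊗ c ⊕ c ⊗ c ⊕ c ⊗ c) ⊗ d ⊗ a ⊕ (c ⊗ c ⊕ c ⊗ c ⊕ c ⊗ c) ⊗ (b ⊗ d))) refl
    ring-227 : ∀ a b c d e f g → (c - d) - (a + b) ≡ (g * f + ((e + (g + g + g + g) * f) + ((f - ((g + g + g) + (g + g + g) + (g + g + g) + (g + g + g)) * f) + ((g + g + g) * f + (g * f + (g * f + (g * f + g * f))))))) - (0ℚ + ((d + (f - c)) + ((a + e) + (b + (g * 0ℚ + (g * 0ℚ + (g * 0ℚ + g * 0ℚ)))))))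
    ring-227 = solve 7 (λ a b c d e f g → (c ⊖ d) ⊖ (a ⊕ b) ⊜ (g ⊗ f ⊕ ((e ⊕ (g ⊕ g ⊕ g ⊕ g) ⊗ f) ⊕ ((f ⊖ ((g ⊕ g ⊕ g) ⊕ (g ⊕ g ⊕ g) ⊕ (g ⊕ g ⊕ g) ⊕ (g ⊕ g ⊕ g)) ⊗ f) ⊕ ((g ⊕ g ⊕ g) ⊗ f ⊕ (g ⊗ f ⊕ (g ⊗ f ⊕ (g ⊗ f ⊕ g ⊗ f))))))) ⊖ (Κ 0ℚ ⊕ ((d ⊕ (f ⊖ c)) ⊕ ((a ⊕ e) ⊕ (b ⊕ (g ⊗ Κ 0ℚ ⊕ (g ⊗ Κ 0ℚ ⊕ (g ⊗ Κ 0ℚ ⊕ g ⊗ Κ 0ℚ)))))))) refl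
    ring-228 : ∀ a b c d e f → a + (b + (((c + d) + e) + f)) ≡ (c + (d + a)) + (b + (e + f))
    ring-228 = solve 6 (λ a b c d e f → a ⊕ (b ⊕ (((c ⊕ d) ⊕ e) ⊕ f)) ⊜ (c ⊕ (d ⊕ a)) ⊕ (b ⊕ (e ⊕ f))) refl
    ring-229 : ∀ a b c d e f g h i j k → (a + (e + (f * g + k))) - (a + (b + (c + d))) ≡ (e + ((f * h + j) + (i + (f * g + k)))) - (b + (c + (d + (f * h + (i + j)))))
    ring-229 = solve 11 (λ a b c d e f g h i j k → (a ⊕ (e ⊕ (f ⊗ g ⊕ k))) ⊖ (a ⊕ (b ⊕ (c ⊕ d))) ⊜ (e ⊕ ((f ⊗ h ⊕ j) ⊕ (i ⊕ (f ⊗ g ⊕ k)))) ⊖ (b ⊕ (c ⊕ (d ⊕ (f ⊗ h ⊕ (i ⊕ j)))))) refl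
    ring-230 : ∀ a b c d → (a + (b + (c + d))) - (a + c) ≡ (b + d) - (0ℚ + 0ℚ)
    ring-230 = solve 4 (λ a b c d → (a ⊕ (b ⊕ (c ⊕ d))) ⊖ (a ⊕ c) ⊜ (b ⊕ d) ⊖ (Κ 0ℚ ⊕ Κ 0ℚ)) refl
    ring-231 : ∀ a b c → b * c - a * a * 1ℚ ≡ (a * b + b * c) - (a * a + b * a)
    ring-231 = solve 3 (λ a b c → b ⊗ c ⊖ a ⊗ a ⊗ Κ 1ℚ ⊜ (a ⊗ b ⊕ b ⊗ c) ⊖ (a ⊗ a ⊕ b ⊗ a)) refl
    ring-232 : ∀ a b c d → (a + (b + (c + d))) - d ≡ (a + (b + c)) - (0ℚ + (0ℚ + 0ℚ))
    ring-232 = solve 4 (λ a b c d → (a ⊕ (b ⊕ (c ⊕ d))) ⊖ d ⊜ (a ⊕ (b ⊕ c)) ⊖ (Κ 0ℚ ⊕ (Κ 0ℚ ⊕ Κ 0ℚ))) refl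
    ring-233 : ∀ a b → (a * b) * (a * b) ≡ b * b * (a * a)
    ring-233 = solve 2 (λ a b → (a ⊗ b) ⊗ (a ⊗ b) ⊜ b ⊗ b ⊗ (a ⊗ a)) refl
    ring-234 : ∀ a b c d → a + (b + (c + d)) ≡ c + (a + (b + d))
    ring-234 = solve 4 (λ a b c d → a ⊕ (b ⊕ (c ⊕ d)) ⊜ c ⊕ (a ⊕ (b ⊕ d))) refl
    ring-235 : ∀ a b c d → (a - b * a) - c ≡ (1ℚ * d + (1ℚ - b) * a) - (b * (c + d) + (1ℚ - b) * (c + d))
    ring-235 = solve 4 (λ a b c d → (a ⊖ b ⊗ a) ⊖ c ⊜ (Κ 1ℚ ⊗ d ⊕ (Κ 1ℚ ⊖ b) ⊗ a) ⊖ (b ⊗ (c ⊕ d) ⊕ (Κ 1ℚ ⊖ b) ⊗ (c ⊕ d))) refl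
    ring-236 : ∀ a b c d e → (b + (quarter + (a + a + a + a + a)) * (c + d)) - (c + d) ≡ ((b + (a * c + ((quarter + a + a) * c + e))) + ((a * (c + d) + 1ℚ) + ((a + (quarter + a + a)) * (c + d) + a * (c + d)))) - (c + (d + ((a + (quarter + a + a)) * c + (1ℚ + e))))
    ring-236 = solve 5 (λ a b c d e → (b ⊕ (Κ quarter ⊕ (a ⊕ a ⊕ a ⊕ a ⊕ a)) ⊗ (c ⊕ d)) ⊖ (c ⊕ d) ⊜ ((b ⊕ (a ⊗ c ⊕ ((Κ quarter ⊕ a ⊕ a) ⊗ c ⊕ e))) ⊕ ((a ⊗ (c ⊕ d) ⊕ Κ 1ℚ) ⊕ ((a ⊕ (Κ quarter ⊕ a ⊕ a)) ⊗ (c ⊕ d) ⊕ a ⊗ (c ⊕ d)))) ⊖ (c ⊕ (d ⊕ ((a ⊕ (Κ quarter ⊕ a ⊕ a)) ⊗ c ⊕ (Κ 1ℚ ⊕ e))))) refl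
    ring-237 : ∀ a b c → (c - a) - b ≡ c - (a + b)
    ring-237 = solve 3 (λ a b c → (c ⊖ a) ⊖ b ⊜ c ⊖ (a ⊕ b)) refl

open RingIdentities

-- Linear inequalities, multisets as weighted sums, guillotine packings as trees of sizes

module Packings where

  infixr 5 _⊕_
  infixr 6 _⊛_

  abstract

    ≤⇒0≤ : ∀ {p q} → p ≤ q → 0ℚ ≤ q - p
    ≤⇒0≤ {p} {q} p≤q = subst (_≤ q - p) (+-inverseʳ p) (+-monoˡ-≤ (- p) p≤q)

    0≤⇒≤ : ∀ {p q} → 0ℚ ≤ q - p → p ≤ q
    0≤⇒≤ {p} {q} x = subst₂ _≤_ (+-identityˡ p) (ring-8 q p) (+-monoˡ-≤ p x)

    <⇒0< : ∀ {p q} → p < q → 0ℚ < q - p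
    <⇒0< {p} {q} p<q = subst (_< q - p) (+-inverseʳ p) (+-monoˡ-< (- p) p<q)

    0<⇒< : ∀ {p q} → 0ℚ < q - p → p < q
    0<⇒< {p} {q} x = subst₂ _<_ (+-identityˡ p) (ring-8 q p) (+-monoˡ-< p x)

    -- An inequality follows from another one when the two differences agree;
    -- the hypothesis is a nonnegative combination of the available facts.
    lin≤ : ∀ {l r L R} → l ≤ r → R - L ≡ r - l → L ≤ R
    lin≤ l≤r eq = 0≤⇒≤ (subst (0ℚ ≤_) (sym eq) (≤⇒0≤ l≤r))

    lin< : ∀ {l r L R} → l < r → R - L ≡ r - l → L < R
    lin< l<r eq = 0<⇒< (subst (0ℚ <_) (sym eq) (<⇒0< l<r))

    <⇒≱ : ∀ {p q} → p < q → ¬ q ≤ p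
    <⇒≱ p<q q≤p = <-irrefl refl (<-≤-trans p<q q≤p)

    _⊕_ : ∀ {a b c d} → a ≤ b → c ≤ d → a + c ≤ b + d
    _⊕_ = +-mono-≤

    0≤* : ∀ {p q} → 0ℚ ≤ p → 0ℚ ≤ q → 0ℚ ≤ p * q
    0≤* {p} {q} x y = subst (_≤ p * q) (*-zeroʳ p) (*-monoˡ-≤-nonNeg p ⦃ nonNegative x ⦄ y)

    0<* : ∀ {p q} → 0ℚ < p → 0ℚ < q → 0ℚ < p * q
    0<* {p} {q} x y = subst (_< p * q) (*-zeroʳ p) (*-monoʳ-<-pos p ⦃ positive x ⦄ y)

    0≤+ : ∀ {p q} → 0ℚ ≤ p → 0ℚ ≤ q → 0ℚ ≤ p + q
    0≤+ = +-mono-≤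

    _⊛_ : ∀ {p a b} → 0ℚ ≤ p → a ≤ b → p * a ≤ p * b
    _⊛_ {p} 0≤p a≤b = *-monoˡ-≤-nonNeg p ⦃ nonNegative 0≤p ⦄ a≤b

    *-cancel-≤ : ∀ {p a b} → 0ℚ < p → p * a ≤ p * b → a ≤ b
    *-cancel-≤ {p} 0<p x = *-cancelˡ-≤-pos p ⦃ positive 0<p ⦄ x

    0≤1 : 0ℚ ≤ 1ℚ
    0≤1 = nonNegative⁻¹ 1ℚ

  -- Lists of items stand for multisets; they are compared through all sums of weights.

  module Sums {Item : Set} where

    sum : (Item → ℚ) → List Item → ℚ
    sum f []       = 0ℚ
    sum f (i ∷ is) = f i + sum f is

    card : List Item → ℚ
    card = sum (λ _ → 1ℚ)

    sum-++ : ∀ f xs ys → sum f (xs ++ ys) ≡ sum f xs + sum f ys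
    sum-++ f [] ys = sym (+-identityˡ _)
    sum-++ f (x ∷ xs) ys = trans (cong (f x +_) (sum-++ f xs ys)) (sym (+-assoc (f x) (sum f xs) (sum f ys)))

    sum-nonneg : ∀ {f} → (∀ i → 0ℚ ≤ f i) → ∀ xs → 0ℚ ≤ sum f xs
    sum-nonneg p [] = ≤-refl
    sum-nonneg p (x ∷ xs) = 0≤+ (p x) (sum-nonneg p xs)

    card-nonneg : ∀ xs → 0ℚ ≤ card xs
    card-nonneg = sum-nonneg (λ _ → 0≤1)

    sum-mono : ∀ {f g} xs → All (λ i → f i ≤ g i) xs → sum f xs ≤ sum g xs
    sum-mono [] [] = ≤-refl
    sum-mono (x ∷ xs) (p ∷ ps) = p ⊕ sum-mono xs ps

    sum-scale : ∀ c f xs → sum (λ i → c * f i) xs ≡ c * sum f xs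
    sum-scale c f [] = sym (*-zeroʳ c)
    sum-scale c f (x ∷ xs) = trans (cong (_+_ (c * f x)) (sum-scale c f xs)) (sym (*-distribˡ-+ c (f x) (sum f xs)))

    -- Cardinality, width, area and multiplicity are all instances of the weight `f`, and
    -- rearrangements of several parts reduce to ring identities between sums.
    Split : List Item → List Item → List Item → Set
    Split S A B = ∀ f → sum f S ≡ sum f A + sum f B

    split-++ : ∀ A B → Split (A ++ B) A B
    split-++ A B f = sum-++ f A B

    split-[]ˡ : ∀ S → Split S [] S
    split-[]ˡ S f = sym (+-identityˡ _)

    split-[]ʳ : ∀ S → Split S S []
    split-[]ʳ S f = sym (+-identityʳ _)

    split-swap : ∀ {S A B} → Split S A B → Split S B A
    split-swap {A = A} {B} s f = trans (s f) (+-comm (sum f A) (sum f B))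

    split-≤ˡ : ∀ {S A B f} → Split S A B → (∀ i → 0ℚ ≤ f i) → sum f A ≤ sum f S
    split-≤ˡ {S} {A} {B} {f} s p = ≤-trans (lin≤ (sum-nonneg p B) (ring-3 (sum f A) (sum f B))) (≤-reflexive (sym (s f)))

    ind : {P : Item → Set} → (∀ i → Dec (P i)) → Item → ℚ
    ind P? i with P? i
    ... | yes _ = 1ℚ
    ... | no  _ = 0ℚ

    module _ {P : Item → Set} (P? : ∀ i → Dec (P i)) where

      ind-nonneg : ∀ i → 0ℚ ≤ ind P? i
      ind-nonneg i with P? i
      ... | yes _ = 0≤1
      ... | no  _ = ≤-refl

      sum-filter : ∀ f xs → sum f (filter P? xs) ≡ sum (λ i → ind P? i * f i) xs
      sum-filter f [] = refl
      sum-filter f (x ∷ xs) with P? x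
      ... | yes _ = cong₂ _+_ (sym (*-identityˡ (f x))) (sum-filter f xs)
      ... | no  _ = trans (sum-filter f xs) (sym (trans (cong (_+ _) (*-zeroˡ (f x))) (+-identityˡ _)))

      split-filter : ∀ {S A B} → Split S A B → Split (filter P? S) (filter P? A) (filter P? B)
      split-filter {S} {A} {B} s f = trans (sum-filter f S) (trans (s _) (sym (cong₂ _+_ (sum-filter f A) (sum-filter f B))))

      split-partition : ∀ S → Split S (filter P? S) (filter (¬? ∘ P?) S)
      split-partition [] f = refl
      split-partition (x ∷ xs) f with P? x
      ... | yes _ = trans (cong (_+_ (f x)) (split-partition xs f)) (sym (+-assoc (f x) (sum f (filter P? xs)) (sum f (filter (¬? ∘ P?) xs))))
      ... | no  _ = trans (cong (_+_ (f x)) (split-partition xs f)) (ring-2 (f x) (sum f (filter P? xs)) (sum f (filter (¬? ∘ P?) xs)))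

      private
        out : Item → ℚ
        out i with P? i
        ... | yes _ = 0ℚ
        ... | no  _ = 1ℚ

        out-nonneg : ∀ i → 0ℚ ≤ out i
        out-nonneg i with P? i
        ... | yes _ = ≤-refl
        ... | no  _ = 0≤1

        out-All : ∀ {xs} → All P xs → sum out xs ≡ 0ℚ
        out-All [] = refl
        out-All {x ∷ xs} (p ∷ ps) with P? x
        ... | yes _ = trans (+-identityˡ _) (out-All ps)
        ... | no ¬p = ⊥-elim (¬p p)

        All-out : ∀ xs → sum out xs ≤ 0ℚ → All P xs
        All-out [] _ = []
        All-out (x ∷ xs) le with P? x
        ... | yes p = p ∷ All-out xs (subst (_≤ 0ℚ) (+-identityˡ _) le)
        ... | no _ = ⊥-elim (<⇒≱ (<-≤-trans (positive⁻¹ 1ℚ) (lin≤ (sum-nonneg out-nonneg xs) (ring-1 (sum out xs)))) le)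

      -- Only sums are comparable along a `Split`, so a decidable predicate is recovered from the
      -- sum of `out`, the indicator of its failures: it vanishes exactly when the predicate holds
      -- throughout.
      All-splitˡ : ∀ {S A B} → Split S A B → All P S → All P A
      All-splitˡ {S} {A} {B} s p = All-out A (≤-trans (lin≤ (sum-nonneg out-nonneg B) (ring-3 (sum out A) (sum out B)))
                                                 (≤-reflexive (trans (sym (s out)) (out-All p))))

      All-splitʳ : ∀ {S A B} → Split S A B → All P S → All P B
      All-splitʳ {S} {A} {B} s = All-splitˡ {S} {B} {A} (split-swap {S} {A} {B} s)

      All-merge : ∀ {S A B} → Split S A B → All P A → All P B → All P S
      All-merge {S} s p q = All-out S (≤-reflexive (trans (s out) (cong₂ _+_ (out-All p) (out-All q))))

  open Sums public

  -- Guillotine packings without coordinates: only the sizes of the boxes are recorded.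

  module _ {Item : Set} where

    data Pack (w h : Item → ℚ) (a b : ℚ) : List Item → Set where
      nil  : Pack w h a b []
      one  : ∀ {i} → w i ≤ a → h i ≤ b → Pack w h a b (i ∷ [])
      vcmp : ∀ {a₁ a₂ S S₁ S₂} → 0ℚ ≤ a₁ → 0ℚ ≤ a₂ → a₁ + a₂ ≤ a → Split S S₁ S₂ →
             Pack w h a₁ b S₁ → Pack w h a₂ b S₂ → Pack w h a b S
      hcmp : ∀ {b₁ b₂ S S₁ S₂} → 0ℚ ≤ b₁ → 0ℚ ≤ b₂ → b₁ + b₂ ≤ b → Split S S₁ S₂ →
             Pack w h a b₁ S₁ → Pack w h a b₂ S₂ → Pack w h a b S

    transposeP : ∀ {w h a b S} → Pack w h a b S → Pack h w b a S
    transposeP nil = nil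
    transposeP (one p q) = one q p
    transposeP (vcmp p q r s P Q) = hcmp p q r s (transposeP P) (transposeP Q)
    transposeP (hcmp p q r s P Q) = vcmp p q r s (transposeP P) (transposeP Q)

    module _ {w h : Item → ℚ} where

      widen : ∀ {a a′ b b′ S} → a ≤ a′ → b ≤ b′ → Pack w h a b S → Pack w h a′ b′ S
      widen p q nil = nil
      widen p q (one x y) = one (≤-trans x p) (≤-trans y q)
      widen p q (vcmp x y z s P Q) = vcmp x y (≤-trans z p) s (widen ≤-refl q P) (widen ≤-refl q Q)
      widen p q (hcmp x y z s P Q) = hcmp x y (≤-trans z q) s (widen p ≤-refl P) (widen p ≤-refl Q)

      restrictP : ∀ {P : Item → Set} (P? : ∀ i → Dec (P i)) {a b S} → Pack w h a b S → Pack w h a b (filter P? S)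
      restrictP P? nil = nil
      restrictP P? (one {i} x y) with P? i
      ... | yes _ = one x y
      ... | no  _ = nil
      restrictP P? (vcmp {S = S} {A} {B} x y z s P Q) = vcmp x y z (split-filter P? {S} {A} {B} s) (restrictP P? P) (restrictP P? Q)
      restrictP P? (hcmp {S = S} {A} {B} x y z s P Q) = hcmp x y z (split-filter P? {S} {A} {B} s) (restrictP P? P) (restrictP P? Q)

      private
        area : Item → ℚ
        area i = w i * h i

      area≤ : (∀ i → 0ℚ < w i) → (∀ i → 0ℚ < h i) → ∀ {a b S} → 0ℚ ≤ a → 0ℚ ≤ b → Pack w h a b S → sum area S ≤ a * b
      area≤ wp hp 0≤a 0≤b nil = 0≤* 0≤a 0≤b
      area≤ wp hp {a} {b} 0≤a 0≤b (one {i} x y) = lin≤ ((0≤b ⊛ x) ⊕ (<⇒≤ (wp i) ⊛ y)) (ring-4 a b (w i) (h i))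
      area≤ wp hp {a} {b} 0≤a 0≤b (vcmp {a₁} {a₂} {S₁ = A} {B} x y z s P Q) =
        ≤-trans (≤-reflexive (s area)) (lin≤ (area≤ wp hp x 0≤b P ⊕ area≤ wp hp y 0≤b Q ⊕ 0≤b ⊛ z) (ring-5 a b a₁ a₂ (sum area A) (sum area B)))
      area≤ wp hp {a} {b} 0≤a 0≤b (hcmp {b₁} {b₂} {S₁ = A} {B} x y z s P Q) =
        ≤-trans (≤-reflexive (s area)) (lin≤ (area≤ wp hp 0≤a x P ⊕ area≤ wp hp 0≤a y Q ⊕ 0≤a ⊛ z) (ring-6 a b b₁ b₂ (sum area A) (sum area B)))

      fits : ∀ {a b S} → Pack w h a b S → All (λ i → w i ≤ a × h i ≤ b) S
      fits nil = []
      fits (one x y) = (x , y) ∷ []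
      fits {a} {b} (vcmp {a₁} {a₂} {S} {A} {B} x y z s P Q) = All-merge (λ i → (w i ≤? a) ×-dec (h i ≤? b)) {S} {A} {B} s
        (All.map (λ (p , q) → ≤-trans p (≤-trans (lin≤ y (ring-3 a₁ a₂)) z) , q) (fits P))
        (All.map (λ (p , q) → ≤-trans p (≤-trans (lin≤ x (ring-7 a₁ a₂)) z) , q) (fits Q))
      fits {a} {b} (hcmp {b₁} {b₂} {S} {A} {B} x y z s P Q) = All-merge (λ i → (w i ≤? a) ×-dec (h i ≤? b)) {S} {A} {B} s
        (All.map (λ (p , q) → p , ≤-trans q (≤-trans (lin≤ y (ring-3 b₁ b₂)) z)) (fits P))
        (All.map (λ (p , q) → p , ≤-trans q (≤-trans (lin≤ x (ring-7 b₁ b₂)) z)) (fits Q))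

-- Natural numbers as rationals, dropping of heavy items, sorting and greedy prefixes

module Counting where

  open Packings

  -- Defined by recursion so that a successor unfolds to `1ℚ + ⟦ n ⟧` and ring identities apply;
  -- `ℕ→ℚ≡⟦⟧` relates it to the embedding in the statement.
  ⟦_⟧ : ℕ → ℚ
  ⟦ zero ⟧  = 0ℚ
  ⟦ suc n ⟧ = 1ℚ + ⟦ n ⟧

  0≤⟦⟧ : ∀ n → 0ℚ ≤ ⟦ n ⟧
  0≤⟦⟧ zero    = ≤-refl
  0≤⟦⟧ (suc n) = 0≤+ 0≤1 (0≤⟦⟧ n)

  0<1 : 0ℚ < 1ℚ
  0<1 = positive⁻¹ 1ℚ

  0<⟦suc⟧ : ∀ n → 0ℚ < ⟦ suc n ⟧
  0<⟦suc⟧ n = +-mono-<-≤ 0<1 (0≤⟦⟧ n)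

  ⟦⟧-mono : ∀ {m n} → m ℕ.≤ n → ⟦ m ⟧ ≤ ⟦ n ⟧
  ⟦⟧-mono {n = n} ℕ.z≤n = 0≤⟦⟧ n
  ⟦⟧-mono (ℕ.s≤s p) = ≤-refl {1ℚ} ⊕ ⟦⟧-mono p

  ⟦⟧-+ : ∀ m n → ⟦ m ℕ.+ n ⟧ ≡ ⟦ m ⟧ + ⟦ n ⟧
  ⟦⟧-+ zero n = sym (+-identityˡ ⟦ n ⟧)
  ⟦⟧-+ (suc m) n = trans (cong (_+_ 1ℚ) (⟦⟧-+ m n)) (sym (+-assoc 1ℚ ⟦ m ⟧ ⟦ n ⟧))

  ⟦⟧-* : ∀ m n → ⟦ m ℕ.* n ⟧ ≡ ⟦ m ⟧ * ⟦ n ⟧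
  ⟦⟧-* zero n = sym (*-zeroˡ ⟦ n ⟧)
  ⟦⟧-* (suc m) n = trans (⟦⟧-+ n (m ℕ.* n)) (trans (cong (_+_ ⟦ n ⟧) (⟦⟧-* m n)) (ring-22 ⟦ m ⟧ ⟦ n ⟧))

  ⟦⟧-cancel : ∀ {m n} → ⟦ m ⟧ < ⟦ suc n ⟧ → m ℕ.≤ n
  ⟦⟧-cancel {m} {n} p with m ℕ.≤? n
  ... | yes q = q
  ... | no ¬q = ⊥-elim (<⇒≱ p (⟦⟧-mono (ℕₚ.≰⇒> ¬q)))

  module _ {Item : Set} where

    card≡length : (S : List Item) → card S ≡ ⟦ length S ⟧
    card≡length [] = refl
    card≡length (x ∷ S) = cong (_+_ 1ℚ) (card≡length S)

    -- Of every Q consecutive items, the heaviest one is dropped.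
    drop-heavy : (f : Item → ℚ) → (∀ i → 0ℚ ≤ f i) → (Q : ℕ) (S : List Item) →
      ∃ λ A → ∃ λ B → Split S A B × ⟦ suc Q ⟧ * card B ≤ card S + ⟦ suc Q ⟧ × sum f S ≤ ⟦ suc Q ⟧ * sum f B
    drop-heavy f f≥0 Q [] = [] , [] , (λ _ → refl) ,
      lin≤ (<⇒≤ (0<⟦suc⟧ Q)) (ring-16 ⟦ suc Q ⟧) , ≤-reflexive (sym (*-zeroʳ ⟦ suc Q ⟧))
    drop-heavy f f≥0 Q (x ∷ S) = let (A , B , s , c , g) = go 1 (ℕ.s≤s ℕ.z≤n) (ℕ.s≤s ℕ.z≤n) x S in
      A , B , s , ≤-trans c (≤-reflexive (ring-17 (card S) ⟦ suc Q ⟧)) ,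
      ≤-trans (≤-reflexive (ring-18 (f x) (sum f S))) g
      where
      -- `r` counts the items of the current group seen so far and `m` is the heaviest of them, so
      -- `⟦ r ⟧ * f m` bounds their total weight.
      go : ∀ r → 1 ℕ.≤ r → r ℕ.≤ suc Q → (m : Item) (xs : List Item) →
        ∃ λ A → ∃ λ B → Split (m ∷ xs) A B × ⟦ suc Q ⟧ * card B ≤ (⟦ r ⟧ + card xs) + ⟦ suc Q ⟧ ×
          ⟦ r ⟧ * f m + sum f xs ≤ ⟦ suc Q ⟧ * sum f B
      -- An incomplete last group loses its heaviest item too; this is what the extra `⟦ suc Q ⟧` in
      -- the bound on `card B` pays for.
      go r 1≤r r≤ m [] = [] , m ∷ [] , split-[]ˡ (m ∷ []) , lin≤ (0≤⟦⟧ r) (ring-9 ⟦ r ⟧ ⟦ suc Q ⟧) ,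
        lin≤ (f≥0 m ⊛ ⟦⟧-mono r≤) (ring-10 (f m) ⟦ r ⟧ ⟦ suc Q ⟧)
      go r 1≤r r≤ m (y ∷ ys) with r ℕ.≤? Q
      -- The group is full: `m` is dropped and `y` opens the next group.
      ... | no ¬p = let (A , B , s , c , g) = go 1 (ℕ.s≤s ℕ.z≤n) (ℕ.s≤s ℕ.z≤n) y ys in
        A , m ∷ B ,
        (λ k → trans (cong (_+_ (k m)) (s k)) (ring-2 (k m) (sum k A) (sum k B))) ,
        lin≤ (c ⊕ ⟦⟧-mono (ℕₚ.≰⇒> ¬p)) (ring-11 ⟦ r ⟧ ⟦ suc Q ⟧ (card B) (card ys)) ,
        lin≤ (g ⊕ f≥0 m ⊛ ⟦⟧-mono r≤) (ring-12 ⟦ r ⟧ ⟦ suc Q ⟧ (f m) (f y) (sum f ys) (sum f B))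
      ... | yes p with ≤-total (f m) (f y)
      ...   | inj₁ m≤y = let (A , B , s , c , g) = go (suc r) (ℕ.s≤s ℕ.z≤n) (ℕ.s≤s p) y ys in
        m ∷ A , B ,
        (λ k → trans (cong (_+_ (k m)) (s k)) (sym (+-assoc (k m) (sum k A) (sum k B)))) ,
        ≤-trans c (≤-reflexive (ring-13 ⟦ r ⟧ ⟦ suc Q ⟧ (card ys))) ,
        lin≤ (g ⊕ 0≤⟦⟧ r ⊛ m≤y) (ring-14 ⟦ r ⟧ (⟦ suc Q ⟧ * sum f B) (f m) (f y) (sum f ys))
      ...   | inj₂ y≤m = let (A , B , s , c , g) = go (suc r) (ℕ.s≤s ℕ.z≤n) (ℕ.s≤s p) m ys in
        y ∷ A , B ,
        (λ k → trans (ring-2 (k m) (k y) (sum k ys)) (trans (cong (_+_ (k y)) (s k)) (sym (+-assoc (k y) (sum k A) (sum k B))))) ,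
        ≤-trans c (≤-reflexive (ring-13 ⟦ r ⟧ ⟦ suc Q ⟧ (card ys))) ,
        lin≤ (g ⊕ y≤m) (ring-15 ⟦ r ⟧ (⟦ suc Q ⟧ * sum f B) (f m) (f y) (sum f ys))

    data Desc (k : Item → ℚ) : List Item → Set where
      []  : Desc k []
      _∷_ : ∀ {x xs} → All (λ y → k y ≤ k x) xs → Desc k xs → Desc k (x ∷ xs)

    module _ (k : Item → ℚ) where

      insertD : Item → List Item → List Item
      insertD x [] = x ∷ []
      insertD x (y ∷ ys) with ≤-total (k y) (k x)
      ... | inj₁ _ = x ∷ y ∷ ys
      ... | inj₂ _ = y ∷ insertD x ys

      sortD : List Item → List Item
      sortD [] = []
      sortD (x ∷ xs) = insertD x (sortD xs)

      sum-insertD : ∀ f x ys → sum f (insertD x ys) ≡ f x + sum f ys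
      sum-insertD f x [] = refl
      sum-insertD f x (y ∷ ys) with ≤-total (k y) (k x)
      ... | inj₁ _ = refl
      ... | inj₂ _ = trans (cong (_+_ (f y)) (sum-insertD f x ys)) (ring-2 (f y) (f x) (sum f ys))

      sum-sortD : ∀ f xs → sum f (sortD xs) ≡ sum f xs
      sum-sortD f [] = refl
      sum-sortD f (x ∷ xs) = trans (sum-insertD f x (sortD xs)) (cong (_+_ (f x)) (sum-sortD f xs))

      All-insertD : ∀ {P : Item → Set} {x ys} → P x → All P ys → All P (insertD x ys)
      All-insertD px [] = px ∷ []
      All-insertD {x = x} {y ∷ ys} px (py ∷ pys) with ≤-total (k y) (k x)
      ... | inj₁ _ = px ∷ py ∷ pys
      ... | inj₂ _ = py ∷ All-insertD px pys

      All-sortD : ∀ {P : Item → Set} {xs} → All P xs → All P (sortD xs)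
      All-sortD [] = []
      All-sortD (p ∷ ps) = All-insertD p (All-sortD ps)

      Desc-insertD : ∀ x {ys} → Desc k ys → Desc k (insertD x ys)
      Desc-insertD x [] = [] ∷ []
      Desc-insertD x {y ∷ ys} (q ∷ d) with ≤-total (k y) (k x)
      ... | inj₁ y≤x = (y≤x ∷ All.map (λ p → ≤-trans p y≤x) q) ∷ (q ∷ d)
      ... | inj₂ x≤y = All-insertD x≤y q ∷ Desc-insertD x d

      Desc-sortD : ∀ xs → Desc k (sortD xs)
      Desc-sortD [] = []
      Desc-sortD (x ∷ xs) = Desc-insertD x (Desc-sortD xs)

    -- The first item that no longer fits weighs at most `m`, so unless everything fits, less than
    -- `m` of the capacity is wasted.
    greedy : (f : Item → ℚ) {m : ℚ} {xs : List Item} → All (λ i → f i ≤ m) xs → ∀ g → 0ℚ ≤ g →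
      ∃ λ A → ∃ λ B → xs ≡ A ++ B × sum f A ≤ g × (B ≡ [] ⊎ g - m < sum f A)
    greedy f {m} {[]} [] g 0≤g = [] , [] , refl , 0≤g , inj₁ refl
    greedy f {m} {x ∷ xs} (p ∷ ps) g 0≤g with f x ≤? g
    ... | no ¬q = [] , x ∷ xs , refl , 0≤g , inj₂ (lin< (<-≤-trans (≰⇒> ¬q) p) (ring-19 g m))
    ... | yes q with greedy f ps (g - f x) (≤⇒0≤ q)
    ...   | A , B , eq , le , alt = x ∷ A , B , cong (x ∷_) eq , lin≤ le (ring-20 g (f x) (sum f A)) , alt′ alt
      where
      alt′ : (B ≡ [] ⊎ g - f x - m < sum f A) → (B ≡ [] ⊎ g - m < f x + sum f A)
      alt′ (inj₁ e) = inj₁ e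
      alt′ (inj₂ l) = inj₂ (lin< l (ring-21 g m (f x) (sum f A)))

-- Trees of containers, and columns as a fractional form of a packing

module ContainerTrees where

  open Packings
  open Counting

  -- Container packings without coordinates: hst, vst and ars are horizontal, vertical
  -- and area containers, free is unused space.

  module _ {Item : Set} where

    data CTree (ea : ℚ) (w h : Item → ℚ) (a b : ℚ) (S : List Item) : Set where
      free : S ≡ [] → CTree ea w h a b S
      hst  : All (λ i → w i ≤ a) S → sum h S ≤ b → CTree ea w h a b S
      vst  : All (λ i → h i ≤ b) S → sum w S ≤ a → CTree ea w h a b S
      ars  : All (λ i → w i ≤ ea * a × h i ≤ ea * b) S → Pack w h a b S → CTree ea w h a b S
      vs   : ∀ {a₁ a₂ S₁ S₂} → 0ℚ ≤ a₁ → 0ℚ ≤ a₂ → a₁ + a₂ ≡ a → Split S S₁ S₂ →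
             CTree ea w h a₁ b S₁ → CTree ea w h a₂ b S₂ → CTree ea w h a b S
      hs   : ∀ {b₁ b₂ S₁ S₂} → 0ℚ ≤ b₁ → 0ℚ ≤ b₂ → b₁ + b₂ ≡ b → Split S S₁ S₂ →
             CTree ea w h a b₁ S₁ → CTree ea w h a b₂ S₂ → CTree ea w h a b S

    module _ {ea : ℚ} where

      transposeC : ∀ {w h a b S} → CTree ea w h a b S → CTree ea h w b a S
      transposeC (free e) = free e
      transposeC (hst p q) = vst p q
      transposeC (vst p q) = hst p q
      transposeC (ars p q) = ars (All.map (λ (x , y) → y , x) p) (transposeP q)
      transposeC (vs p q r s A B) = hs p q r s (transposeC A) (transposeC B)
      transposeC (hs p q r s A B) = vs p q r s (transposeC A) (transposeC B)

      leaves : ∀ {w h a b S} → CTree ea w h a b S → ℕ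
      leaves (vs _ _ _ _ A B) = leaves A ℕ.+ leaves B
      leaves (hs _ _ _ _ A B) = leaves A ℕ.+ leaves B
      leaves _ = 1

      -- A leaf that is not `free` counts with its whole box. Since the cuts of a `CTree` are exact,
      -- `a * b` minus this is precisely the area of the free leaves, which small items will get.
      used : ∀ {w h a b S} → CTree ea w h a b S → ℚ
      used (free _) = 0ℚ
      used {a = a} {b} (hst _ _) = a * b
      used {a = a} {b} (vst _ _) = a * b
      used {a = a} {b} (ars _ _) = a * b
      used (vs _ _ _ _ A B) = used A + used B
      used (hs _ _ _ _ A B) = used A + used B

      leaves-transposeC : ∀ {w h a b S} (T : CTree ea w h a b S) → leaves (transposeC T) ≡ leaves T
      leaves-transposeC (free _) = refl
      leaves-transposeC (hst _ _) = refl
      leaves-transposeC (vst _ _) = refl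
      leaves-transposeC (ars _ _) = refl
      leaves-transposeC (vs _ _ _ _ A B) = cong₂ ℕ._+_ (leaves-transposeC A) (leaves-transposeC B)
      leaves-transposeC (hs _ _ _ _ A B) = cong₂ ℕ._+_ (leaves-transposeC A) (leaves-transposeC B)

      used-transposeC : ∀ {w h a b S} (T : CTree ea w h a b S) → used (transposeC T) ≡ used T
      used-transposeC (free _) = refl
      used-transposeC {a = a} {b} (hst _ _) = *-comm b a
      used-transposeC {a = a} {b} (vst _ _) = *-comm b a
      used-transposeC {a = a} {b} (ars _ _) = *-comm b a
      used-transposeC (vs _ _ _ _ A B) = cong₂ _+_ (used-transposeC A) (used-transposeC B)
      used-transposeC (hs _ _ _ _ A B) = cong₂ _+_ (used-transposeC A) (used-transposeC B)

  -- Vertical sections of a packing: a column of width x meets the items of L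

  module Columns {Item : Set} (w h : Item → ℚ) (w>0 : ∀ i → 0ℚ < w i) where

    Col : Set
    Col = ℚ × List Item

    ctot : List Col → ℚ
    ctot [] = 0ℚ
    ctot ((x , _) ∷ cs) = x + ctot cs

    cint : (List Item → ℚ) → List Col → ℚ
    cint F [] = 0ℚ
    cint F ((x , L) ∷ cs) = x * F L + cint F cs

    Ok : (Item → Set) → ℚ → Col → Set
    Ok P b (x , L) = 0ℚ ≤ x × sum h L ≤ b × All P L

    ctot-nonneg : ∀ {P b cs} → All (Ok P b) cs → 0ℚ ≤ ctot cs
    ctot-nonneg [] = ≤-refl
    ctot-nonneg ((p , _) ∷ ps) = 0≤+ p (ctot-nonneg ps)

    ctot-++ : ∀ cs ds → ctot (cs ++ ds) ≡ ctot cs + ctot ds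
    ctot-++ [] ds = sym (+-identityˡ _)
    ctot-++ ((x , L) ∷ cs) ds = trans (cong (_+_ x) (ctot-++ cs ds)) (sym (+-assoc x (ctot cs) (ctot ds)))

    cint-++ : ∀ F cs ds → cint F (cs ++ ds) ≡ cint F cs + cint F ds
    cint-++ F [] ds = sym (+-identityˡ _)
    cint-++ F ((x , L) ∷ cs) ds = trans (cong (_+_ (x * F L)) (cint-++ F cs ds)) (sym (+-assoc (x * F L) (cint F cs) (cint F ds)))

    All-++ : ∀ {P : Col → Set} {cs ds} → All P cs → All P ds → All P (cs ++ ds)
    All-++ [] q = q
    All-++ (p ∷ ps) q = p ∷ All-++ ps q

    cutC : ∀ {P b} q → All (Ok P b) q → ∀ x → 0ℚ ≤ x → x ≤ ctot q →
      ∃ λ q₁ → ∃ λ q₂ → All (Ok P b) q₁ × All (Ok P b) q₂ × ctot q₁ ≡ x × ctot q ≡ x + ctot q₂ ×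
        (∀ F → cint F q ≡ cint F q₁ + cint F q₂)
    cutC [] [] x p q = [] , [] , [] , [] , ≤-antisym p q , trans (≤-antisym p q) (sym (+-identityʳ x)) , (λ _ → refl)
    cutC ((y , L) ∷ q) ((py , pL) ∷ ok) x 0≤x x≤ with x ≤? y
    ... | yes x≤y = (x , L) ∷ [] , (y - x , L) ∷ q , (0≤x , pL) ∷ [] , (≤⇒0≤ x≤y , pL) ∷ ok , +-identityʳ x ,
          ring-23 x y (ctot q) , (λ F → ring-24 x y (F L) (cint F q))
    ... | no x≰y = let (q₁ , q₂ , o₁ , o₂ , t₁ , t , I) = cutC q ok (x - y) (≤⇒0≤ (<⇒≤ (≰⇒> x≰y))) (lin≤ x≤ (ring-25 x y (ctot q))) in
            (y , L) ∷ q₁ , q₂ , (py , pL) ∷ o₁ , o₂ ,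
            trans (cong (_+_ y) t₁) (ring-26 x y) , trans (cong (_+_ y) t) (ring-27 x y (ctot q₂)) ,
            (λ F → trans (cong (_+_ (y * F L)) (I F)) (sym (+-assoc (y * F L) (cint F q₁) (cint F q₂))))

    addL : List Item → List Col → List Col
    addL L [] = []
    addL L ((y , M) ∷ q) = (y , L ++ M) ∷ addL L q

    ctot-addL : ∀ L q → ctot (addL L q) ≡ ctot q
    ctot-addL L [] = refl
    ctot-addL L ((y , M) ∷ q) = cong (_+_ y) (ctot-addL L q)

    cint-addL : ∀ f L q → cint (sum f) (addL L q) ≡ ctot q * sum f L + cint (sum f) q
    cint-addL f L [] = ring-28 (sum f L)
    cint-addL f L ((y , M) ∷ q) = trans (cong₂ _+_ (cong (y *_) (sum-++ f L M)) (cint-addL f L q))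
                                        (ring-29 y (sum f L) (sum f M) (ctot q) (cint (sum f) q))

    All-++ᵢ : ∀ {P : Item → Set} {cs ds} → All P cs → All P ds → All P (cs ++ ds)
    All-++ᵢ [] q = q
    All-++ᵢ (p ∷ ps) q = p ∷ All-++ᵢ ps q

    ok-addL : ∀ {P b₁ b₂} L q → sum h L ≤ b₁ → All P L → All (Ok P b₂) q → All (Ok P (b₁ + b₂)) (addL L q)
    ok-addL L [] l p [] = []
    ok-addL L ((y , M) ∷ q) l p ((a , b , c) ∷ ok) =
      (a , ≤-trans (≤-reflexive (sum-++ h L M)) (l ⊕ b) , All-++ᵢ p c) ∷ ok-addL L q l p ok

    overlay : ∀ {P b₁ b₂} → 0ℚ ≤ b₁ → ∀ p q → All (Ok P b₁) p → All (Ok P b₂) q → ctot p ≡ ctot q →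
      ∃ λ r → All (Ok P (b₁ + b₂)) r × ctot r ≡ ctot q × (∀ f → cint (sum f) r ≡ cint (sum f) p + cint (sum f) q)
    overlay {b₁ = b₁} {b₂} 0≤b₁ [] q _ ok t = q , All.map (λ (x , y , z) → x , ≤-trans y (lin≤ 0≤b₁ (ring-7 b₁ b₂)) , z) ok , refl ,
                               (λ f → sym (+-identityˡ _))
    overlay 0≤b₁ ((x , L) ∷ p) q ((a , b , c) ∷ okp) okq t =
      let (q₁ , q₂ , o₁ , o₂ , t₁ , t₂ , I) = cutC q okq x a (subst (x ≤_) t (lin≤ (ctot-nonneg okp) (ring-3 x (ctot p))))
          (r , ok , tr , J) = overlay 0≤b₁ p q₂ okp o₂ (trans (ring-30 x (ctot p)) (trans (cong (_- x) (trans t t₂)) (sym (ring-30 x (ctot q₂)))))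
      in    addL L q₁ ++ r , All-++ (ok-addL L q₁ b c o₁) ok ,
            trans (ctot-++ (addL L q₁) r) (trans (cong₂ _+_ (trans (ctot-addL L q₁) t₁) tr) (sym t₂)) ,
            (λ f → trans (cint-++ (sum f) (addL L q₁) r)
                   (trans (cong₂ _+_ (trans (cint-addL f L q₁) (cong (λ u → u * sum f L + cint (sum f) q₁) t₁)) (J f))
                   (trans (ring-31 (x * sum f L) (cint (sum f) q₁) (cint (sum f) p) (cint (sum f) q₂))
                          (cong (_+_ (x * sum f L + cint (sum f) p)) (sym (I (sum f)))))))

    -- An item meets columns of total width `w i`, so integrating a weight over the columns
    -- multiplies the weight of each item by its width. Which column an item belongs to is
    -- forgotten; only this fractional information is needed for filling the slots later.
    columns : ∀ {P : Item → Set} (P? : ∀ i → Dec (P i)) {c b S} → 0ℚ ≤ c → 0ℚ ≤ b → All P S → Pack w h c b S →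
      ∃ λ q → All (Ok P b) q × ctot q ≡ c × (∀ f → cint (sum f) q ≡ sum (λ i → w i * f i) S)
    columns P? {c} 0≤c 0≤b _ nil = (c , []) ∷ [] , (0≤c , 0≤b , []) ∷ [] , +-identityʳ c , (λ f → ring-32 c)
    columns P? {c} {b} 0≤c 0≤b (p ∷ []) (one {i} x y) = (w i , i ∷ []) ∷ (c - w i , []) ∷ [] ,
      (<⇒≤ (w>0 i) , ≤-trans (≤-reflexive (+-identityʳ (h i))) y , p ∷ []) ∷ (≤⇒0≤ x , 0≤b , []) ∷ [] ,
      ring-33 c (w i) , (λ f → ring-34 c (w i) (f i))
    columns P? {c} {b} {S} 0≤c 0≤b al (vcmp {a₁} {a₂} {S₁ = A} {B} x y z s PA PB)
      = let (q₁ , o₁ , t₁ , I₁) = columns P? x 0≤b (All-splitˡ P? {S} {A} {B} s al) PA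
            (q₂ , o₂ , t₂ , I₂) = columns P? y 0≤b (All-splitʳ P? {S} {A} {B} s al) PB in
      q₁ ++ q₂ ++ (c - (a₁ + a₂) , []) ∷ [] , All-++ o₁ (All-++ o₂ ((≤⇒0≤ z , 0≤b , []) ∷ [])) ,
      trans (ctot-++ q₁ (q₂ ++ _)) (trans (cong₂ _+_ t₁ (trans (ctot-++ q₂ _) (cong (_+ _) t₂))) (ring-35 a₁ a₂ c)) ,
      (λ f → trans (cint-++ (sum f) q₁ (q₂ ++ _)) (trans (cong₂ _+_ (I₁ f) (trans (cint-++ (sum f) q₂ _) (cong (_+ _) (I₂ f))))
             (trans (ring-36 (sum (λ i → w i * f i) A) (sum (λ i → w i * f i) B) (c - (a₁ + a₂))) (sym (s (λ i → w i * f i))))))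
    columns P? {c} {b} {S} 0≤c 0≤b al (hcmp {b₁} {b₂} {S₁ = A} {B} x y z s PA PB)
      = let (q₁ , o₁ , t₁ , I₁) = columns P? 0≤c x (All-splitˡ P? {S} {A} {B} s al) PA
            (q₂ , o₂ , t₂ , I₂) = columns P? 0≤c y (All-splitʳ P? {S} {A} {B} s al) PB
            (r , ok , t , I) = overlay x q₁ q₂ o₁ o₂ (trans t₁ (sym t₂)) in
        r , All.map (λ (u , v , k) → u , ≤-trans v z , k) ok , trans t t₂ ,
            (λ f → trans (I f) (trans (cong₂ _+_ (I₁ f) (I₂ f)) (sym (s (λ i → w i * f i)))))

-- Configurations of height classes, and filling their slots

module Configurations where

  open Packings
  open Counting
  open ContainerTrees

  consAll : List ℕ → List (List ℕ) → List (List ℕ)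
  consAll [] us = []
  consAll (k ∷ ks) us = map (k ∷_) us ++ consAll ks us

  configs : ℕ → ℕ → List (List ℕ)
  configs G zero    = [] ∷ []
  configs G (suc D) = [] ∷ consAll (upTo G) (configs G D)

  ∈-consAll : ∀ {k u ks us} → k ∈ ks → u ∈ us → (k ∷ u) ∈ consAll ks us
  ∈-consAll {ks = k ∷ ks} {us} (here refl) q = ∈-++⁺ˡ (∈-map⁺ (k ∷_) q)
  ∈-consAll {ks = k ∷ ks} {us} (there p) q = ∈-++⁺ʳ (map (k ∷_) us) (∈-consAll p q)

  ∈-configs : ∀ {G} D {u} → All (ℕ._< G) u → length u ℕ.≤ D → u ∈ configs G D
  ∈-configs zero {[]} _ _ = here refl
  ∈-configs (suc D) {[]} _ _ = here refl
  ∈-configs (suc D) {k ∷ u} (p ∷ ps) (ℕ.s≤s q) = there (∈-consAll (∈-upTo⁺ p) (∈-configs D ps q))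

  configs-length : ∀ G D → All (λ u → length u ℕ.≤ D) (configs G D)
  configs-length G zero = ℕ.z≤n ∷ []
  configs-length G (suc D) = ℕ.z≤n ∷ go (upTo G)
    where
    go : ∀ ks → All (λ u → length u ℕ.≤ suc D) (consAll ks (configs G D))
    go [] = []
    go (k ∷ ks) = Allₚ.++⁺ (Allₚ.map⁺ (All.map ℕ.s≤s (configs-length G D))) (go ks)

  -- Columns with the same labels are merged into blocks.

  Block : Set
  Block = ℚ × List ℕ

  bint : (List ℕ → ℚ) → List Block → ℚ
  bint F [] = 0ℚ
  bint F ((X , u) ∷ bs) = X * F u + bint F bs

  sumℕ : (ℕ → ℚ) → List ℕ → ℚ
  sumℕ = sum

  module Aggregate {Item : Set} (w h : Item → ℚ) (w>0 : ∀ i → 0ℚ < w i) (lab : Item → ℕ) (lo : ℕ → ℚ) where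
    open Columns w h w>0

    GoodBlock : ℚ → Block → Set
    GoodBlock b (X , u) = 0ℚ ≤ X × sumℕ lo u ≤ b

    -- Heights are rounded down to `lo`, so that the slots of a column are never higher than its
    -- items and still fit below `b`.
    P₁ : Item → Set
    P₁ i = lo (lab i) ≤ h i

    sumℕ-map : ∀ f L → sumℕ f (map lab L) ≡ sum (f ∘ lab) L
    sumℕ-map f [] = refl
    sumℕ-map f (x ∷ L) = cong (_+_ (f (lab x))) (sumℕ-map f L)

    lo≤ : ∀ {b} L → sum h L ≤ b → All P₁ L → sumℕ lo (map lab L) ≤ b
    lo≤ L p q = ≤-trans (≤-reflexive (sumℕ-map lo L)) (≤-trans (sum-mono L q) p)

    -- A configuration `u` that no column has may be too high for the box, hence the alternative:
    -- either its total width is zero or some column proves that it fits.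
    merge : ∀ {b} (u : List ℕ) cs → All (Ok P₁ b) cs → ∀ {us} → All (λ (_ , L) → map lab L ∈ u ∷ us) cs →
      ∃ λ X → ∃ λ ds → 0ℚ ≤ X × (X ≡ 0ℚ ⊎ sumℕ lo u ≤ b) × All (Ok P₁ b) ds × All (λ (_ , L) → map lab L ∈ us) ds ×
        (∀ F → cint (F ∘ map lab) cs ≡ X * F u + cint (F ∘ map lab) ds)
    merge u [] [] [] = 0ℚ , [] , ≤-refl , inj₁ refl , [] , [] , (λ F → ring-28 (F u))
    merge u ((x , L) ∷ cs) ((0≤x , p , q) ∷ ok) (m ∷ ms) with Listₚ.≡-dec ℕ._≟_ (map lab L) u
    ... | yes e = let (X , ds , 0≤X , alt , okd , md , I) = merge u cs ok ms in
      x + X , ds , 0≤+ 0≤x 0≤X , inj₂ (subst (λ v → sumℕ lo v ≤ _) e (lo≤ L p q)) , okd , md ,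
      (λ F → trans (cong₂ _+_ (cong (λ v → x * F v) e) (I F)) (ring-38 x X (F u) (cint (F ∘ map lab) ds)))
    ... | no ¬e = let (X , ds , 0≤X , alt , okd , md , I) = merge u cs ok ms in
      X , (x , L) ∷ ds , 0≤X , alt , (0≤x , p , q) ∷ okd , tail m ∷ md ,
      (λ F → trans (cong (_+_ (x * F (map lab L))) (I F)) (ring-2 (x * F (map lab L)) (X * F u) (cint (F ∘ map lab) ds)))
      where
      tail : ∀ {us} → map lab L ∈ u ∷ us → map lab L ∈ us
      tail (here e) = ⊥-elim (¬e e)
      tail (there r) = r

    aggregate : ∀ {b} {R : List ℕ → Set} {us} → All R us → ∀ cs → All (Ok P₁ b) cs → All (λ (_ , L) → map lab L ∈ us) cs →
      ∃ λ bs → All (GoodBlock b) bs × (length bs ℕ.≤ length us × All (λ (_ , u) → R u) bs) × (∀ F → bint F bs ≡ cint (F ∘ map lab) cs)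
    aggregate [] [] _ _ = [] , [] , (ℕ.z≤n , []) , (λ F → refl)
    aggregate [] (_ ∷ _) _ (() ∷ _)
    aggregate {R = R} {u ∷ us} (r ∷ rs) cs ok ms = let (X , ds , 0≤X , alt , okd , md , I) = merge u cs ok ms
                                                       (bs , g , len , J) = aggregate rs ds okd md in
      add X 0≤X alt bs g len (λ F → trans (cong (_+_ (X * F u)) (J F)) (sym (I F)))
      where
      -- A configuration of width zero is left out rather than turned into an empty block, as
      -- nothing bounds its height.
      add : ∀ {b} X → 0ℚ ≤ X → X ≡ 0ℚ ⊎ sumℕ lo u ≤ b → ∀ bs → All (GoodBlock b) bs → length bs ℕ.≤ length us × All (λ (_ , u) → R u) bs →
        (∀ F → X * F u + bint F bs ≡ cint (F ∘ map lab) cs) →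
        ∃ λ bs → All (GoodBlock b) bs × (length bs ℕ.≤ suc (length us) × All (λ (_ , u) → R u) bs) × (∀ F → bint F bs ≡ cint (F ∘ map lab) cs)
      add X 0≤X (inj₁ refl) bs g (len , q) e = bs , g , (ℕₚ.m≤n⇒m≤1+n len , q) , (λ F → trans (ring-37 (F u) (bint F bs)) (e F))
      add X 0≤X (inj₂ q) bs g (len , p) e = (X , u) ∷ bs , (0≤X , q) ∷ g , (ℕ.s≤s len , r ∷ p) , e

  isLab : ℕ → ℕ → ℚ
  isLab j k with j ℕ.≟ k
  ... | yes _ = 1ℚ
  ... | no  _ = 0ℚ

  isLab-refl : ∀ k → isLab k k ≡ 1ℚ
  isLab-refl k with k ℕ.≟ k
  ... | yes _ = refl
  ... | no ¬p = ⊥-elim (¬p refl)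

  isLab-≢ : ∀ {j k} → j ≢ k → isLab j k ≡ 0ℚ
  isLab-≢ {j} {k} p with j ℕ.≟ k
  ... | yes e = ⊥-elim (p e)
  ... | no _ = refl

  isLab≥0 : ∀ j k → 0ℚ ≤ isLab j k
  isLab≥0 j k with j ℕ.≟ k
  ... | yes _ = 0≤1
  ... | no  _ = ≤-refl

  at : {Item : Set} → List (List Item) → ℕ → List Item
  at [] _ = []
  at (L ∷ Ls) zero = L
  at (L ∷ Ls) (suc k) = at Ls k

  module Fill {Item : Set} (ea : ℚ) (w h : Item → ℚ) (w>0 : ∀ i → 0ℚ < w i) (lo : ℕ → ℚ) (lo≥0 : ∀ k → 0ℚ ≤ lo k) (μ : ℚ) where

    mult : ℕ → List ℕ → ℚ
    mult k = sumℕ (isLab k)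

    -- `at pend k` holds the items destined for slots labelled `k`. In the application these come
    -- from the class below class `k`, which is why they are no higher than `lo k`.
    PendOk : List (List Item) → Set
    PendOk pend = ∀ k → All (λ i → h i ≤ lo k × w i ≤ μ) (at pend k)

    set : List (List Item) → ℕ → List Item → List (List Item)
    set [] _ _ = []
    set (L ∷ Ls) zero M = M ∷ Ls
    set (L ∷ Ls) (suc k) M = L ∷ set Ls k M

    at-set-≢ : ∀ Ls {j k} M → j ≢ k → at (set Ls k M) j ≡ at Ls j
    at-set-≢ [] M p = refl
    at-set-≢ (L ∷ Ls) {zero} {zero} M p = ⊥-elim (p refl)
    at-set-≢ (L ∷ Ls) {suc j} {zero} M p = refl
    at-set-≢ (L ∷ Ls) {zero} {suc k} M p = refl
    at-set-≢ (L ∷ Ls) {suc j} {suc k} M p = at-set-≢ Ls M (p ∘ cong suc)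

    split-set : ∀ Ls k A M → at Ls k ≡ A ++ M → Split (concat Ls) A (concat (set Ls k M)) × at (set Ls k M) k ≡ M
    split-set [] k [] [] e = (λ f → refl) , refl
    split-set (L ∷ Ls) zero A M refl = (λ f → trans (sum-++ f (A ++ M) (concat Ls)) (trans (cong (_+ sum f (concat Ls)) (sum-++ f A M))
                  (trans (+-assoc (sum f A) (sum f M) (sum f (concat Ls))) (cong (_+_ (sum f A)) (sym (sum-++ f M (concat Ls))))))) , refl
    split-set (L ∷ Ls) (suc k) A M e = let (s , t) = split-set Ls k A M e in
      (λ f → trans (sum-++ f L (concat Ls)) (trans (cong (_+_ (sum f L)) (s f))
             (trans (ring-2 (sum f L) (sum f A) (sum f (concat (set Ls k M))))
                    (cong (_+_ (sum f A)) (sym (sum-++ f L (concat (set Ls k M)))))))) , t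

    All-++⁻ : ∀ {P : Item → Set} A {B} → All P (A ++ B) → All P A × All P B
    All-++⁻ [] p = [] , p
    All-++⁻ (x ∷ A) (p ∷ ps) = let (q , r) = All-++⁻ A ps in p ∷ q , r

    -- Each slot takes greedily from its pending class and wastes less than `μ` of the width `X`
    -- unless the class runs out. So a slot lowers the demand of its class by `X - μ`; `c` is the
    -- demand that later blocks will absorb.
    fillCol : ∀ {X} → μ ≤ X → 0ℚ ≤ μ → ∀ u {b} → sumℕ lo u ≤ b → ∀ pend → PendOk pend → (c : ℕ → ℚ) → (∀ k → 0ℚ ≤ c k) →
      (∀ k → sum w (at pend k) ≤ mult k u * (X - μ) + c k) →
      ∃ λ A → ∃ λ pend′ → Split (concat pend) A (concat pend′) × PendOk pend′ × (∀ k → sum w (at pend′ k) ≤ c k) ×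
        Σ (CTree ea w h X b A) λ T → leaves T ≡ suc (length u) × used T ≤ X * sumℕ lo u
    fillCol {X} μ≤X 0≤μ [] {b} q pend ok c c≥0 cap = [] , pend , split-[]ˡ (concat pend) , ok ,
      (λ k → ≤-trans (cap k) (≤-reflexive (ring-39 X μ (c k)))) , free refl , refl , ≤-reflexive (sym (*-zeroʳ X))
    fillCol {X} μ≤X 0≤μ (k ∷ u) {b} q pend ok c c≥0 cap =
      let (A , M , e , A≤X , alt) = greedy w (All.map proj₂ (ok k)) X (≤-trans 0≤μ μ≤X)
          (s , atk) = split-set pend k A M e
          (okA , okM) = All-++⁻ A (subst (All _) e (ok k))
          pend₁ = set pend k M
          ok₁ : PendOk pend₁
          ok₁ j = helper₁ A M e j
          cap₁ : ∀ j → sum w (at pend₁ j) ≤ mult j u * (X - μ) + c j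
          cap₁ j = helper₂ A M e A≤X alt j
          (A₂ , pend₂ , s₂ , ok₂ , cap₂ , T₂ , lv , us) = fillCol μ≤X 0≤μ u {b - lo k} (lin≤ q (ring-40 b (lo k) (sumℕ lo u))) pend₁ ok₁ c c≥0 cap₁
      in A ++ A₂ , pend₂ ,
         (λ f → trans (s f) (trans (cong (_+_ (sum f A)) (s₂ f)) (trans (sym (+-assoc (sum f A) (sum f A₂) (sum f (concat pend₂))))
                  (cong (_+ sum f (concat pend₂)) (sym (sum-++ f A A₂)))))) ,
         ok₂ , cap₂ ,
         hs (lo≥0 k) (≤⇒0≤ (≤-trans (lin≤ (sum-nonneg lo≥0 u) (ring-3 (lo k) (sumℕ lo u))) q)) (ring-41 (lo k) b) (split-++ A A₂)
            (vst (All.map proj₁ okA) A≤X) T₂ ,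
         cong suc lv , lin≤ us (ring-42 X (lo k) (used T₂) (sumℕ lo u))
      where
      helper₁ : ∀ A M → at pend k ≡ A ++ M → PendOk (set pend k M)
      helper₁ A M e j with j ℕ.≟ k
      ... | yes refl = subst (All _) (sym (proj₂ (split-set pend k A M e))) (proj₂ (All-++⁻ A (subst (All _) e (ok k))))
      ... | no p = subst (All _) (sym (at-set-≢ pend M p)) (ok j)
      cap-split : ∀ j → sum w (at pend j) ≤ isLab j k * (X - μ) + (mult j u * (X - μ) + c j)
      cap-split j = ≤-trans (cap j) (≤-reflexive (ring-43 (isLab j k) (mult j u) X μ (c j)))
      helper₂ : ∀ A M → at pend k ≡ A ++ M → sum w A ≤ X → M ≡ [] ⊎ X - μ < sum w A → ∀ j → sum w (at (set pend k M) j) ≤ mult j u * (X - μ) + c j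
      helper₂ A M e A≤X alt j with j ℕ.≟ k
      ... | no p = subst₂ _≤_ (cong (sum w) (sym (at-set-≢ pend M p)))
                     (trans (cong (λ z → z * (X - μ) + (mult j u * (X - μ) + c j)) (isLab-≢ p)) (sym (ring-37 (X - μ) (mult j u * (X - μ) + c j))))
                     (cap-split j)
      ... | yes refl with alt
      ...   | inj₁ refl = subst (_≤ mult k u * (X - μ) + c k) (cong (sum w) (sym (proj₂ (split-set pend k A [] e))))
                            (0≤+ (0≤* (sum-nonneg (λ i → isLab≥0 k i) u) (≤⇒0≤ μ≤X)) (c≥0 k))
      ...   | inj₂ lt = subst (_≤ mult k u * (X - μ) + c k) (cong (sum w) (sym (proj₂ (split-set pend k A M e))))
                          (lin≤ (subst₂ _≤_ (trans (cong (sum w) e) (sum-++ w A M))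
                                   (cong (λ z → z * (X - μ) + (mult k u * (X - μ) + c k)) (isLab-refl k)) (cap-split k) ⊕ <⇒≤ lt)
                                (ring-44 X μ (mult k u * (X - μ) + c k) (sum w A) (sum w M)))

    -- every block is widened from X to t X + μ
    btot : ℚ → List Block → ℚ
    btot t [] = 0ℚ
    btot t ((X , _) ∷ bs) = (t * X + μ) + btot t bs

    -- Each block has one leaf above its slots, and an empty leaf ends the row of blocks.
    slotNo : List Block → ℕ
    slotNo [] = 1
    slotNo ((_ , u) ∷ bs) = suc (length u) ℕ.+ slotNo bs

    barea : ℚ → List Block → ℚ
    barea t [] = 0ℚ
    barea t ((X , u) ∷ bs) = (t * X + μ) * sumℕ lo u + barea t bs

    -- A block of width `t * X + μ` has the effective capacity `t * X` per slot, which makes the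
    -- total capacity for class `k` equal to `t * bint (mult k) bs`.
    fillBlocks : ∀ {t b} → 0ℚ ≤ t → 0ℚ ≤ μ → ∀ bs → All (λ (X , u) → 0ℚ ≤ X × sumℕ lo u ≤ b) bs → ∀ pend → PendOk pend →
      (∀ k → sum w (at pend k) ≤ t * bint (mult k) bs) →
      ∃ λ A → Split (concat pend) A [] × 0ℚ ≤ btot t bs × Σ (CTree ea w h (btot t bs) b A) λ T → leaves T ≡ slotNo bs × used T ≤ barea t bs
    fillBlocks {t} 0≤t 0≤μ [] _ pend ok cap = [] , (λ f → cong (sum f) (empty pend λ k → ≤-trans (cap k) (≤-reflexive (*-zeroʳ t)))) , ≤-refl , free refl , refl , ≤-refl
      where
      empty : ∀ pend → (∀ k → sum w (at pend k) ≤ 0ℚ) → concat pend ≡ []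
      empty [] _ = refl
      empty ([] ∷ Ls) p = empty Ls (p ∘ suc)
      empty ((i ∷ is) ∷ Ls) p = ⊥-elim (<⇒≱ (+-mono-<-≤ (w>0 i) (sum-nonneg (<⇒≤ ∘ w>0) is)) (p zero))
    fillBlocks {t} {b} 0≤t 0≤μ ((X , u) ∷ bs) ((0≤X , q) ∷ good) pend ok cap =
      let (A , pend₁ , s , ok₁ , cap₁ , T , lv , us) = fillCol {t * X + μ} (lin≤ (0≤* 0≤t 0≤X) (ring-7 (t * X) μ)) 0≤μ u q pend ok
              (λ k → t * bint (mult k) bs) (λ k → 0≤* 0≤t (bint≥0 k bs good))
              (λ k → ≤-trans (cap k) (≤-reflexive (ring-45 t X μ (mult k u) (bint (mult k) bs))))
          (A₂ , s₂ , nn , T₂ , lv₂ , us₂) = fillBlocks 0≤t 0≤μ bs good pend₁ ok₁ cap₁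
      in A ++ A₂ , (λ f → trans (s f) (trans (cong (_+_ (sum f A)) (s₂ f)) (trans (sym (+-assoc (sum f A) (sum f A₂) 0ℚ)) (cong (_+ 0ℚ) (sym (sum-++ f A A₂)))))) ,
         0≤+ (0≤+ (0≤* 0≤t 0≤X) 0≤μ) nn ,
         vs (0≤+ (0≤* 0≤t 0≤X) 0≤μ) nn refl (split-++ A A₂) T T₂ , cong₂ ℕ._+_ lv lv₂ , us ⊕ us₂
      where
      bint≥0 : ∀ k bs → All (λ (X , u) → 0ℚ ≤ X × sumℕ lo u ≤ b) bs → 0ℚ ≤ bint (mult k) bs
      bint≥0 k [] [] = ≤-refl
      bint≥0 k ((X , u) ∷ bs) ((p , _) ∷ ps) = 0≤+ (0≤* p (sum-nonneg (isLab≥0 k) u)) (bint≥0 k bs ps)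

-- Linear grouping by height

module SizeClasses where

  open Packings
  open Counting
  open ContainerTrees
  open Configurations

  module Classes {Item : Set} (_≟I_ : DecidableEquality Item) (w h : Item → ℚ) (w>0 : ∀ i → 0ℚ < w i) (h>0 : ∀ i → 0ℚ < h i) where

    open DecM _≟I_ using (_∈?_)

    -- Distinctness in terms of multiplicities, so that it is inherited along a `Split`. It lets
    -- membership in a list single out exactly that part of a multiset.
    Once : List Item → Set
    Once S = ∀ i → sum (ind (_≟I i)) S ≤ 1ℚ

    0≤w : ∀ i → 0ℚ ≤ w i
    0≤w i = <⇒≤ (w>0 i)

    sum≡0⇒[] : ∀ S → sum w S ≤ 0ℚ → S ≡ []
    sum≡0⇒[] [] _ = refl
    sum≡0⇒[] (i ∷ S) p = ⊥-elim (<⇒≱ (+-mono-<-≤ (w>0 i) (sum-nonneg 0≤w S)) p)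

    data Chop (g m : ℚ) : List (List Item) → Set where
      []   : Chop g m []
      last : ∀ {C} → sum w C ≤ g + m → Chop g m (C ∷ [])
      cons : ∀ {C C′ Cs} → g ≤ sum w C → sum w C ≤ g + m → All (λ i → All (λ j → h j ≤ h i) (concat (C′ ∷ Cs))) C →
             Chop g m (C′ ∷ Cs) → Chop g m (C ∷ C′ ∷ Cs)

    desc-++ : ∀ A {B} → Desc h (A ++ B) → All (λ i → All (λ j → h j ≤ h i) B) A × Desc h B
    desc-++ [] d = [] , d
    desc-++ (x ∷ A) {B} (p ∷ d) = let (q , r) = desc-++ A d in suffix A p ∷ q , r
      where
      suffix : ∀ {P : Item → Set} A → All P (A ++ B) → All P B
      suffix [] q = q
      suffix (_ ∷ A) (_ ∷ q) = suffix A q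

    chop : ∀ {g m} → 0ℚ ≤ g → 0ℚ ≤ m → ∀ n xs → Desc h xs → All (λ i → w i ≤ m) xs → sum w xs ≤ ⟦ n ⟧ * g →
      ∃ λ Cs → concat Cs ≡ xs × length Cs ℕ.≤ n × Chop g m Cs
    chop {g} 0≤g 0≤m zero xs d p q = [] , sym (sum≡0⇒[] xs (≤-trans q (≤-reflexive (*-zeroˡ g)))) , ℕ.z≤n , []
    -- The capacity is `g + m`: a group that is cut off has lost less than `m` and is therefore
    -- wider than `g`.
    chop {g} {m} 0≤g 0≤m (suc n) xs d p q with greedy w p (g + m) (0≤+ 0≤g 0≤m)
    ... | A , B , refl , A≤ , inj₁ refl = A ∷ [] , refl , ℕ.s≤s ℕ.z≤n , last A≤
    ... | A , B , refl , A≤ , inj₂ A> = step (chop 0≤g 0≤m n B (proj₂ (desc-++ A d)) (suffix A p) B≤)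
      where
      suffix : ∀ {P : Item → Set} A → All P (A ++ B) → All P B
      suffix [] q = q
      suffix (_ ∷ A) (_ ∷ q) = suffix A q
      B≤ : sum w B ≤ ⟦ n ⟧ * g
      B≤ = lin≤ (subst (_≤ ⟦ suc n ⟧ * g) (sum-++ w A B) q ⊕ <⇒≤ A>) (ring-46 ⟦ n ⟧ g m (sum w A) (sum w B))
      step : (∃ λ Cs → concat Cs ≡ B × length Cs ℕ.≤ n × Chop g m Cs) → ∃ λ Cs → concat Cs ≡ A ++ B × length Cs ℕ.≤ suc n × Chop g m Cs
      step ([] , e , _ , _) = A ∷ [] , cong (A ++_) e , ℕ.s≤s ℕ.z≤n , last A≤
      step (C ∷ Cs , e , len , ch) = A ∷ C ∷ Cs , cong (A ++_) e , ℕ.s≤s len ,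
        cons (≤-trans (≤-reflexive (ring-47 g m)) (<⇒≤ A>)) A≤ (subst (λ z → All (λ i → All (λ j → h j ≤ h i) z) A) (sym e) (proj₁ (desc-++ A d))) ch

    mx : List Item → ℚ
    mx [] = 0ℚ
    mx (x ∷ xs) = h x ⊔ mx xs

    ≤mx : ∀ xs → All (λ i → h i ≤ mx xs) xs
    ≤mx [] = []
    ≤mx (x ∷ xs) = p≤p⊔q (h x) (mx xs) ∷ All.map (λ p → ≤-trans p (p≤q⊔p (h x) (mx xs))) (≤mx xs)

    0≤mx : ∀ xs → 0ℚ ≤ mx xs
    0≤mx [] = ≤-refl
    0≤mx (x ∷ xs) = ≤-trans (0≤mx xs) (p≤q⊔p (h x) (mx xs))

    mx≤ : ∀ {y} xs → 0ℚ ≤ y → All (λ i → h i ≤ y) xs → mx xs ≤ y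
    mx≤ [] p _ = p
    mx≤ (x ∷ xs) p (q ∷ qs) = ⊔-lub q (mx≤ xs p qs)

    lab : List (List Item) → Item → ℕ
    lab [] i = zero
    lab (C ∷ Cs) i with i ∈? C
    ... | yes _ = zero
    ... | no  _ = suc (lab Cs i)

    lab-∈ : ∀ (Cs : List (List Item)) {i} → i ∈ concat Cs → lab Cs i ℕ.< length Cs × i ∈ at Cs (lab Cs i)
    lab-∈ (C ∷ Cs) {i} p with i ∈? C
    ... | yes q = ℕ.s≤s ℕ.z≤n , q
    ... | no ¬q with ∈-++⁻ C p
    ...   | inj₁ q = ⊥-elim (¬q q)
    ...   | inj₂ q = let (a , b) = lab-∈ Cs q in ℕ.s≤s a , b

    at-∈ : ∀ (Cs : List (List Item)) k {i} → i ∈ at Cs k → i ∈ concat Cs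
    at-∈ (C ∷ Cs) zero p = ∈-++⁺ˡ p
    at-∈ (C ∷ Cs) (suc k) p = ∈-++⁺ʳ C (at-∈ Cs k p)

    -- Heights descend from class to class, so the place of an item of class `k` is high enough for
    -- every item of the next class. After the last class the maximum is that of the empty list,
    -- which is zero.
    lo≤h : ∀ {g m Cs} → Chop g m Cs → ∀ k {i} → i ∈ at Cs k → mx (at Cs (suc k)) ≤ h i
    lo≤h (last _) zero {i} p = <⇒≤ (h>0 i)
    lo≤h {Cs = C ∷ C′ ∷ Cs} (cons _ _ q _) zero {i} p = mx≤ C′ (<⇒≤ (h>0 i)) (All.tabulate (λ {j} j∈ → All.lookup (All.lookup q p) (∈-++⁺ˡ j∈)))
    lo≤h (cons _ _ _ ch) (suc k) p = lo≤h ch k p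

    class-≥ : ∀ {g m Cs} → Chop g m Cs → ∀ k → suc k ℕ.< length Cs → g ≤ sum w (at Cs k)
    class-≥ (last _) zero (ℕ.s≤s ())
    class-≥ (cons p _ _ _) zero _ = p
    class-≥ (last _) (suc k) (ℕ.s≤s ())
    class-≥ (cons _ _ _ ch) (suc k) (ℕ.s≤s q) = class-≥ ch k q

    class-≤ : ∀ {g m Cs} → 0ℚ ≤ g → 0ℚ ≤ m → Chop g m Cs → ∀ k → sum w (at Cs k) ≤ g + m
    class-≤ 0≤g 0≤m [] k = 0≤+ 0≤g 0≤m
    class-≤ 0≤g 0≤m (last p) zero = p
    class-≤ 0≤g 0≤m (last _) (suc k) = 0≤+ 0≤g 0≤m
    class-≤ 0≤g 0≤m (cons _ p _ _) zero = p
    class-≤ 0≤g 0≤m (cons _ _ _ ch) (suc k) = class-≤ 0≤g 0≤m ch k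

    sum-at : ∀ {f : Item → ℚ} → (∀ i → 0ℚ ≤ f i) → ∀ Cs k → sum f (at Cs k) ≤ sum f (concat Cs)
    sum-at p [] k = ≤-refl
    sum-at {f} p (C ∷ Cs) zero = ≤-trans (lin≤ (sum-nonneg p (concat Cs)) (ring-3 (sum f C) (sum f (concat Cs)))) (≤-reflexive (sym (sum-++ f C (concat Cs))))
    sum-at {f} p (C ∷ Cs) (suc k) = ≤-trans (sum-at {f} p Cs k) (≤-trans (lin≤ (sum-nonneg p C) (ring-7 (sum f C) (sum f (concat Cs)))) (≤-reflexive (sym (sum-++ f C (concat Cs)))))

    ind-∈ : ∀ {i} S → i ∈ S → 1ℚ ≤ sum (ind (_≟I i)) S
    ind-∈ {i} (x ∷ S) (here refl) with x ≟I x
    ... | yes _ = lin≤ (sum-nonneg (ind-nonneg (_≟I x)) S) (ring-1 (sum (ind (_≟I x)) S))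
    ... | no ¬p = ⊥-elim (¬p refl)
    ind-∈ {i} (x ∷ S) (there p) = ≤-trans (ind-∈ S p) (lin≤ (ind-nonneg (_≟I i) x) (ring-7 (ind (_≟I i) x) (sum (ind (_≟I i)) S)))

    once-disjoint : ∀ {A B i} → Once (A ++ B) → i ∈ A → ¬ i ∈ B
    once-disjoint {A} {B} {i} o p q = <⇒≱ (+-mono-<-≤ 0<1 (≤-refl {1ℚ}))
      (≤-trans (ind-∈ A p ⊕ ind-∈ B q) (≤-trans (≤-reflexive (sym (sum-++ (ind (_≟I i)) A B))) (≤-trans (o i) (≤-reflexive refl))))

    once-subˡ : ∀ {S A B} → Split S A B → Once S → Once A
    once-subˡ {S} {A} {B} s o i = ≤-trans (split-≤ˡ {S = S} {A} {B} s (ind-nonneg (_≟I i))) (o i)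

    once-tail : ∀ A {B} → Once (A ++ B) → Once B
    once-tail A {B} o i = ≤-trans (lin≤ (sum-nonneg (ind-nonneg (_≟I i)) A) (ring-7 (sum (ind (_≟I i)) A) (sum (ind (_≟I i)) B)))
                                  (≤-trans (≤-reflexive (sym (sum-++ (ind (_≟I i)) A B))) (o i))

    lab-at : ∀ Cs → Once (concat Cs) → ∀ k {i} → i ∈ at Cs k → lab Cs i ≡ k
    lab-at (C ∷ Cs) o zero {i} p with i ∈? C
    ... | yes _ = refl
    ... | no ¬q = ⊥-elim (¬q p)
    lab-at (C ∷ Cs) o (suc k) {i} p with i ∈? C
    ... | yes q = ⊥-elim (once-disjoint {C} {concat Cs} o q (at-∈ Cs k p))
    ... | no _ = cong suc (lab-at Cs (once-tail C o) k p)

    -- From every class a chunk is dropped that contains its share of the total width.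
    thin : ∀ (e : ℚ) Q → 0ℚ ≤ e → e * ⟦ suc Q ⟧ ≡ 1ℚ → ∀ Ds →
      ∃ λ pend → ∃ λ B → Split (concat Ds) (concat pend) B × card B ≤ e * card (concat Ds) + ⟦ length Ds ⟧ ×
        (∀ k → sum w (at pend k) ≤ (1ℚ - e) * sum w (at Ds k)) ×
        (∀ k {P : Item → Set} → (∀ i → Dec (P i)) → All P (at Ds k) → All P (at pend k))
    thin e Q 0≤e eQ [] = [] , [] , (λ _ → refl) , ≤-reflexive (ring-48 e) , (λ k → ≤-reflexive (sym (*-zeroʳ (1ℚ - e)))) , (λ k _ _ → [])
    thin e Q 0≤e eQ (C ∷ Ds) =
      let (A , B , s , cB , sB) = drop-heavy w 0≤w Q C
          (pend , B′ , s′ , cB′ , sP , pP) = thin e Q 0≤e eQ Ds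
      in A ∷ pend , B ++ B′ ,
         (λ f → trans (sum-++ f C (concat Ds)) (trans (cong₂ _+_ (s f) (s′ f))
           (trans (ring-31 (sum f A) (sum f B) (sum f (concat pend)) (sum f B′)) (sym (cong₂ _+_ (sum-++ f A (concat pend)) (sum-++ f B B′)))))) ,
         subst₂ _≤_ (sym (sum-++ _ B B′)) (cong (λ z → e * z + (1ℚ + ⟦ length Ds ⟧)) (sym (sum-++ _ C (concat Ds))))
           (lin≤ ((0≤e ⊛ cB) ⊕ cB′) (trans (ring-49 e (card C) (card (concat Ds)) ⟦ length Ds ⟧ (card B) (card B′)) (l₄ ⟦ suc Q ⟧ eQ (card C) (card (concat Ds)) ⟦ length Ds ⟧ (card B) (card B′)))) ,
         (λ { zero → lin≤ (0≤e ⊛ sB) (trans (cong (λ z → (1ℚ - e) * z - sum w A) (s w)) (trans (l₅ ⟦ suc Q ⟧ eQ (sum w A) (sum w B)) (cong (λ z → e * (⟦ suc Q ⟧ * sum w B) - e * z) (sym (s w)))))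
            ; (suc k) → sP k }) ,
         (λ { zero P? p → All-splitˡ P? {C} {A} {B} s p ; (suc k) P? p → pP k P? p })
      where
      abstract
        l₄ : ∀ q → e * q ≡ 1ℚ → ∀ c d n b b′ → (1ℚ + e * c + (e * d + n)) - (b + b′) ≡ (e * (c + q) + (e * d + n)) - (e * (q * b) + b′)
        l₄ q p c d n b b′ = trans (ring-51 1ℚ (e * c) (e * d + n) b b′) (trans (cong (λ z → (z + e * c + (e * d + n)) - (z * b + b′)) (sym p)) (ring-50 e q c d n b b′))
        l₅ : ∀ q → e * q ≡ 1ℚ → ∀ a b → (1ℚ - e) * (a + b) - a ≡ e * (q * b) - e * (a + b)
        l₅ q p a b = trans (ring-52 e a b) (trans (cong (_- e * (a + b)) (trans (sym (*-identityˡ b)) (cong (_* b) (sym p)))) (ring-53 e q b (e * (a + b))))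

-- A box of tall items becomes boundedly many containers

module TallBoxes where

  open Packings
  open Counting
  open ContainerTrees
  open Configurations
  open SizeClasses

  tl : {A : Set} → List A → List A
  tl [] = []
  tl (_ ∷ xs) = xs

  length-tl : {A : Set} (xs : List A) → length (tl xs) ℕ.≤ length xs
  length-tl [] = ℕ.z≤n
  length-tl (_ ∷ xs) = ℕₚ.n≤1+n (length xs)

  module _ {Item : Set} where

    at-tl : (Cs : List (List Item)) → ∀ k → at (tl Cs) k ≡ at Cs (suc k)
    at-tl [] k = refl
    at-tl (_ ∷ _) k = refl

    concat-tl : (Cs : List (List Item)) → concat Cs ≡ at Cs 0 ++ concat (tl Cs)
    concat-tl [] = refl
    concat-tl (_ ∷ _) = refl

    at-beyond : (Cs : List (List Item)) → ∀ k → length Cs ℕ.≤ k → at Cs k ≡ []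
    at-beyond [] k _ = refl
    at-beyond (_ ∷ Cs) (suc k) (ℕ.s≤s p) = at-beyond Cs k p

    All-at : ∀ {P : Item → Set} Cs → All P (concat Cs) → ∀ k → All P (at Cs k)
    All-at [] _ k = []
    All-at (C ∷ Cs) p zero = proj₁ (Allₚ.++⁻ C p)
    All-at (C ∷ Cs) p (suc k) = All-at Cs (proj₂ (Allₚ.++⁻ C p)) k

    sum-const : ∀ (c : ℚ) (xs : List Item) → sum (λ _ → c) xs ≡ c * card xs
    sum-const c xs = trans (lemma xs) (sum-scale c (λ _ → 1ℚ) xs)
      where
      lemma : ∀ xs → sum (λ (_ : Item) → c) xs ≡ sum (λ _ → c * 1ℚ) xs
      lemma [] = refl
      lemma (x ∷ xs) = cong₂ _+_ (sym (*-identityʳ c)) (lemma xs)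

    sum-cong : ∀ {f g : Item → ℚ} {xs} → All (λ i → f i ≡ g i) xs → sum f xs ≡ sum g xs
    sum-cong [] = refl
    sum-cong (p ∷ ps) = cong₂ _+_ p (sum-cong ps)

  -- `D` bounds the number of tall items above each other, `n` the number of height classes, and
  -- `Cw` the number of items wider than the fraction `μ` of the box. `γ` is the relative width of a
  -- class and `e` the fraction of the width that is saved; saving it costs three times this
  -- fraction of the items.
  record BoxParams : Set where
    field
      D n Q Cw : ℕ
      e γ μ : ℚ
      0<e : 0ℚ < e
      0<γ : 0ℚ < γ
      0<μ : 0ℚ < μ
      eQ : (e + e + e) * ⟦ suc Q ⟧ ≡ 1ℚ
      μ≤ : μ ≤ e * γ
      D≤n : ⟦ D ⟧ ≤ ⟦ n ⟧ * γ
      D≤Cw : ⟦ D ⟧ ≤ ⟦ Cw ⟧ * μ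
      -- Every block is widened by `μ`, and the first class stands apart with a width of at most
      -- `γ + μ`. Both must fit into the difference between 1 - 2 e, the width of the shrunk blocks,
      -- and 1 - e.
      small : ⟦ length (configs n D) ⟧ * μ + γ + μ ≤ e

  module VBox {Item : Set} (_≟I_ : DecidableEquality Item) (ea : ℚ) (bp : BoxParams) where

    open BoxParams bp

    leafBound : ℕ
    leafBound = length (configs n D) ℕ.* suc D ℕ.+ 3

    dropBound : ℕ
    dropBound = n ℕ.+ Cw

    private
      0≤e : 0ℚ ≤ e
      0≤e = <⇒≤ 0<e
      abstract
        e3≤1 : e + e + e ≤ 1ℚ
        e3≤1 = ≤-trans (lin≤ (0≤+ (0≤+ 0≤e 0≤e) 0≤e ⊛ 0≤⟦⟧ Q) (ring-68 (e + e + e) ⟦ Q ⟧)) (≤-reflexive eQ)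
        0≤t : 0ℚ ≤ 1ℚ - (e + e)
        0≤t = lin≤ (e3≤1 ⊕ 0≤e) (ring-69 e)
        0≤1-3e : 0ℚ ≤ 1ℚ - (e + e + e)
        0≤1-3e = ≤⇒0≤ e3≤1
        0≤1-e : 0ℚ ≤ 1ℚ - e
        0≤1-e = lin≤ (0≤t ⊕ 0≤e) (ring-70 e)

    module _ (w h : Item → ℚ) (w>0 : ∀ i → 0ℚ < w i) (h>0 : ∀ i → 0ℚ < h i) where
      open Classes _≟I_ w h w>0 h>0
      open Columns w h w>0

      private
        area : Item → ℚ
        area i = w i * h i
        0≤area : ∀ i → 0ℚ ≤ area i
        0≤area i = 0≤* (<⇒≤ (w>0 i)) (<⇒≤ (h>0 i))

      Result : ℚ → ℚ → List Item → Set
      Result c b S = ∃ λ S′ → ∃ λ B → Split S S′ B × card B ≤ (e + e + e) * card S + ⟦ dropBound ⟧ ×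
        Σ (CTree ea w h ((1ℚ - e) * c) b S′) λ T → leaves T ℕ.≤ leafBound × used T ≤ sum area S + e * (c * b)

      cint-cong : ∀ {F G} cs → (∀ L → F L ≡ G L) → cint F cs ≡ cint G cs
      cint-cong [] p = refl
      cint-cong ((x , L) ∷ cs) p = cong₂ _+_ (cong (x *_) (p L)) (cint-cong cs p)

      cint-1 : ∀ cs → cint (λ _ → 1ℚ) cs ≡ ctot cs
      cint-1 [] = refl
      cint-1 ((x , L) ∷ cs) = cong₂ _+_ (*-identityʳ x) (cint-1 cs)

      module Main (c b d : ℚ) (0<c : 0ℚ < c) (0≤b : 0ℚ ≤ b) (0<d : 0ℚ < d) (b≤ : b ≤ ⟦ D ⟧ * d)
        (S : List Item) (pk : Pack w h c b S) (tall : All (λ i → d ≤ h i) S) (once : Once S) where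

        0≤c : 0ℚ ≤ c
        0≤c = <⇒≤ 0<c
        g m t : ℚ
        g = γ * c
        m = μ * c
        t = 1ℚ - (e + e)
        0≤m : 0ℚ ≤ m
        0≤m = 0≤* (<⇒≤ 0<μ) 0≤c
        0≤g : 0ℚ ≤ g
        0≤g = 0≤* (<⇒≤ 0<γ) 0≤c

        thin? : ∀ i → Dec (w i ≤ m)
        thin? i = w i ≤? m
        S₀ B₀ : List Item
        S₀ = filter thin? S
        B₀ = filter (¬? ∘ thin?) S

        sp₀ : Split S S₀ B₀
        sp₀ = split-partition thin? S

        cb≤ : c * b ≤ c * (⟦ D ⟧ * d)
        cb≤ = 0≤c ⊛ b≤

        abstract
          -- Each of these items covers an area of at least `m * d`, that is μ c d, in a box of area
          -- at most c D d.
          wide≤ : card B₀ ≤ ⟦ Cw ⟧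
          wide≤ = *-cancel-≤ (0<* (0<* 0<μ 0<c) 0<d)
            (≤-trans (≤-reflexive (sym (sum-const (m * d) B₀)))
            (≤-trans (sum-mono B₀ (All.zipWith (λ {i} (p , q) → lin≤ ((<⇒≤ 0<d ⊛ <⇒≤ (≰⇒> p)) ⊕ (<⇒≤ (w>0 i) ⊛ q)) (ring-55 m d (w i) (h i)))
                       (Allₚ.all-filter (¬? ∘ thin?) S , Allₚ.filter⁺ (¬? ∘ thin?) tall)))
            (≤-trans (area≤ w>0 h>0 0≤c 0≤b (restrictP (¬? ∘ thin?) pk))
            (≤-trans cb≤ (lin≤ (0≤* 0≤c (<⇒≤ 0<d) ⊛ D≤Cw) (ring-56 μ c d ⟦ D ⟧ ⟦ Cw ⟧))))))

          width≤ : sum w S₀ ≤ ⟦ n ⟧ * g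
          width≤ = *-cancel-≤ 0<d
            (≤-trans (≤-reflexive (sym (sum-scale d w S₀)))
            (≤-trans (sum-mono S₀ (All.map (λ {i} q → lin≤ (<⇒≤ (w>0 i) ⊛ q) (ring-57 d (w i) (h i))) (Allₚ.filter⁺ thin? tall)))
            (≤-trans (area≤ w>0 h>0 0≤c 0≤b (restrictP thin? pk))
            (≤-trans cb≤ (lin≤ (0≤* 0≤c (<⇒≤ 0<d) ⊛ D≤n) (ring-58 γ c d ⟦ D ⟧ ⟦ n ⟧))))))

        xs : List Item
        xs = sortD h S₀

        abstract
          chopped : ∃ λ Cs → concat Cs ≡ xs × length Cs ℕ.≤ n × Chop g m Cs
          chopped = chop 0≤g 0≤m n xs (Desc-sortD h S₀) (All-sortD h (Allₚ.all-filter thin? S)) (≤-trans (≤-reflexive (sum-sortD h w S₀)) width≤)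

        Cs Ds : List (List Item)
        Cs = proj₁ chopped
        -- The shift of linear grouping: class k + 1 will occupy the slots of class `k`, so `Ds` is
        -- numbered by the class whose slots it takes, and the first class needs a container of its
        -- own.
        Ds = tl Cs

        sumC : ∀ f → sum f (concat Cs) ≡ sum f S₀
        sumC f = trans (cong (sum f) (proj₁ (proj₂ chopped))) (sum-sortD h f S₀)

        S₀≤S : ∀ {f} → (∀ i → 0ℚ ≤ f i) → sum f S₀ ≤ sum f S
        S₀≤S {f} p = ≤-trans (lin≤ (sum-nonneg p B₀) (ring-3 (sum f S₀) (sum f B₀))) (≤-reflexive (sym (sp₀ f)))

        abstract
          onceC : Once (concat Cs)
          onceC i = ≤-trans (≤-reflexive (sumC _)) (≤-trans (S₀≤S (ind-nonneg (_≟I i))) (once i))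

        ch : Chop g m Cs
        ch = proj₂ (proj₂ (proj₂ chopped))

        lb : Item → ℕ
        lb = lab Cs
        lo : ℕ → ℚ
        lo k = mx (at Ds k)
        lo≥0 : ∀ k → 0ℚ ≤ lo k
        lo≥0 k = 0≤mx (at Ds k)

        P : Item → Set
        P i = lb i ℕ.< n × lo (lb i) ≤ h i × d ≤ h i
        P? : ∀ i → Dec (P i)
        P? i = (lb i ℕ.<? n) ×-dec ((lo (lb i) ≤? h i) ×-dec (d ≤? h i))

        tallC : All (λ i → d ≤ h i) (concat Cs)
        tallC = All-splitʳ (λ i → d ≤? h i) {S₀} {[]} {concat Cs} (λ f → trans (sym (sumC f)) (sym (+-identityˡ _))) (Allₚ.filter⁺ thin? tall)

        thinC : All (λ i → w i ≤ m) (concat Cs)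
        thinC = All-splitʳ thin? {S₀} {[]} {concat Cs} (λ f → trans (sym (sumC f)) (sym (+-identityˡ _))) (Allₚ.all-filter thin? S)

        abstract
          allP : All P S₀
          allP = All-merge P? {S₀} {concat Cs} {[]} (λ f → trans (sym (sumC f)) (sym (+-identityʳ _)))
                   (All.tabulate (λ {i} i∈ → let (p , q) = lab-∈ Cs i∈ in
                      ℕₚ.<-≤-trans p (proj₁ (proj₂ (proj₂ chopped))) ,
                      subst (λ z → mx z ≤ h i) (sym (at-tl Cs (lb i))) (lo≤h ch (lb i) q) ,
                      All.lookup tallC i∈))
                   []

        abstract
          cols : ∃ λ q → All (Ok P b) q × ctot q ≡ c × (∀ f → cint (sum f) q ≡ sum (λ i → w i * f i) S₀)
          cols = columns P? 0≤c 0≤b allP (restrictP thin? pk)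
        cs : List Col
        cs = proj₁ cols

        open Aggregate w h w>0 lb lo
        open Fill ea w h w>0 lo lo≥0 m

        abstract
          short : ∀ L → sum h L ≤ b → All P L → length (map lb L) ℕ.≤ D
          short L p q = ℕₚ.≤-trans (ℕₚ.≤-reflexive (Listₚ.length-map lb L)) (⟦⟧-cancel (≤-<-trans len≤ (lin< 0<1 (ring-54 ⟦ D ⟧))))
            where
            len≤ : ⟦ length L ⟧ ≤ ⟦ D ⟧
            len≤ = *-cancel-≤ 0<d (≤-trans (≤-reflexive (trans (cong (d *_) (sym (card≡length L))) (sym (sum-const d L))))
                     (≤-trans (sum-mono L (All.map (proj₂ ∘ proj₂) q)) (≤-trans p (≤-trans b≤ (≤-reflexive (*-comm ⟦ D ⟧ d))))))

        abstract
          agg : ∃ λ bs → All (GoodBlock b) bs × (length bs ℕ.≤ length (configs n D) × All (λ (_ , u) → length u ℕ.≤ D) bs) × (∀ F → bint F bs ≡ cint (F ∘ map lb) cs)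
          agg = aggregate (configs-length n D) cs (All.map (λ (x , y , z) → x , y , All.map (proj₁ ∘ proj₂) z) (proj₁ (proj₂ cols)))
                  (All.map (λ { {_ , L} (_ , y , z) → ∈-configs D (Allₚ.map⁺ (All.map proj₁ z)) (short L y z) }) (proj₁ (proj₂ cols)))
        bs : List Block
        bs = proj₁ agg

        bint-sum : ∀ f → bint (sumℕ f) bs ≡ sum (λ i → w i * f (lb i)) S₀
        bint-sum f = trans (proj₂ (proj₂ (proj₂ agg)) (sumℕ f)) (trans (cint-cong cs (λ L → sumℕ-map f L)) (proj₂ (proj₂ (proj₂ cols)) (f ∘ lb)))

        abstract
          -- The columns count every item with its width, so the slots labelled `k` have in total
          -- the width of the items with label `k`.
          cap : ∀ k → sum w (at Cs k) ≤ bint (mult k) bs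
          cap k = ≤-trans (≤-reflexive (sum-cong {g = λ i → w i * isLab k (lb i)} (All.tabulate (λ {i} i∈ →
                    trans (sym (*-identityʳ (w i))) (cong (w i *_) (sym (trans (cong (isLab k) (lab-at Cs onceC k i∈)) (isLab-refl k))))))))
                  (≤-trans (sum-at (λ i → 0≤* (0≤w i) (isLab≥0 k (lb i))) Cs k)
                  (≤-reflexive (trans (sumC _) (sym (bint-sum (isLab k))))))

        abstract
          thn : ∃ λ pend → ∃ λ B → Split (concat Ds) (concat pend) B × card B ≤ (e + e + e) * card (concat Ds) + ⟦ length Ds ⟧ ×
              (∀ k → sum w (at pend k) ≤ (1ℚ - (e + e + e)) * sum w (at Ds k)) ×
              (∀ k {P : Item → Set} → (∀ i → Dec (P i)) → All P (at Ds k) → All P (at pend k))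
          thn = thin (e + e + e) Q (0≤+ (0≤+ 0≤e 0≤e) 0≤e) eQ Ds
        pend : List (List Item)
        pend = proj₁ thn
        B₁ : List Item
        B₁ = proj₁ (proj₂ thn)

        abstract
          pendOk : PendOk pend
          pendOk k = proj₂ (proj₂ (proj₂ (proj₂ (proj₂ thn)))) k (λ i → (h i ≤? lo k) ×-dec (w i ≤? m))
            (All.zip (≤mx (at Ds k) , subst (All _) (sym (at-tl Cs k)) (All-at Cs thinC (suc k))))

        bint≥0 : ∀ k bs → All (GoodBlock b) bs → 0ℚ ≤ bint (mult k) bs
        bint≥0 k [] [] = ≤-refl
        bint≥0 k ((X , u) ∷ bs) ((p , _) ∷ ps) = 0≤+ (0≤* p (sum-nonneg (isLab≥0 k) u)) (bint≥0 k bs ps)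

        -- Class k + 1 is at most `g + m` wide and class `k` at least `g`, where `m` is at most
        -- `e * g`. Thinning by 3 e compensates both this spread and the shrinking of the blocks, as
        -- (1 - 3 e)(1 + e) ≤ 1 - 2 e.
        pendCap : ∀ k → sum w (at pend k) ≤ t * bint (mult k) bs
        pendCap k with suc k ℕ.<? length Cs
        ... | yes p = ≤-trans (proj₁ (proj₂ (proj₂ (proj₂ (proj₂ thn)))) k)
                (lin≤ ((0≤1-3e ⊛ subst (λ z → sum w z ≤ g + m) (sym (at-tl Cs k)) (class-≤ 0≤g 0≤m ch (suc k)))
                       ⊕ (0≤t ⊛ ≤-trans (class-≥ ch k p) (cap k))
                       ⊕ (0≤* 0≤1-3e 0≤c ⊛ μ≤) ⊕ 0≤* (0≤* 0≤e 0≤e) (0≤+ (0≤+ 0≤g 0≤g) 0≤g))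
                      (ring-59 e γ μ c (sum w (at Ds k)) (bint (mult k) bs)))
        ... | no ¬p = ≤-trans (proj₁ (proj₂ (proj₂ (proj₂ (proj₂ thn)))) k)
                (≤-trans (≤-reflexive (trans (cong (λ z → (1ℚ - (e + e + e)) * sum w z) (trans (at-tl Cs k) (at-beyond Cs (suc k) (ℕₚ.≮⇒≥ ¬p)))) (*-zeroʳ (1ℚ - (e + e + e)))))
                         (0≤* 0≤t (bint≥0 k bs (proj₁ (proj₂ agg)))))

        abstract
          filled : ∃ λ A → Split (concat pend) A [] × 0ℚ ≤ btot t bs × Σ (CTree ea w h (btot t bs) b A) λ T → leaves T ≡ slotNo bs × used T ≤ barea t bs
          filled = fillBlocks 0≤t 0≤m bs (proj₁ (proj₂ agg)) pend pendOk pendCap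

        btot-eq : ∀ bs → btot t bs ≡ t * bint (λ _ → 1ℚ) bs + ⟦ length bs ⟧ * m
        btot-eq [] = ring-60 t m
        btot-eq ((X , u) ∷ bs) = trans (cong (_+_ (t * X + m)) (btot-eq bs)) (ring-61 t m X (bint (λ _ → 1ℚ) bs) ⟦ length bs ⟧)

        barea-≤ : ∀ bs → All (GoodBlock b) bs → barea t bs ≤ t * bint (sumℕ lo) bs + ⟦ length bs ⟧ * (m * b)
        barea-≤ [] [] = ≤-reflexive (ring-60 t (m * b))
        barea-≤ ((X , u) ∷ bs) ((_ , p) ∷ ps) = lin≤ (barea-≤ bs ps ⊕ 0≤m ⊛ p) (ring-62 t m b X (sumℕ lo u) (bint (sumℕ lo) bs) ⟦ length bs ⟧ (barea t bs))

        slotNo-≤ : ∀ bs → All (λ (X , u) → length u ℕ.≤ D) bs → slotNo bs ℕ.≤ length bs ℕ.* suc D ℕ.+ 1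
        slotNo-≤ [] [] = ℕₚ.≤-refl
        slotNo-≤ ((X , u) ∷ bs) (p ∷ ps) = ℕₚ.≤-trans (ℕₚ.+-mono-≤ (ℕ.s≤s p) (slotNo-≤ bs ps)) (ℕₚ.≤-reflexive (sym (ℕₚ.+-assoc (suc D) (length bs ℕ.* suc D) 1)))

        A : List Item
        A = proj₁ filled
        W₀ rest : ℚ
        W₀ = sum w (at Cs 0)
        rest = (1ℚ - e) * c - (W₀ + btot t bs)

        splitAll : Split S (at Cs 0 ++ A) (B₀ ++ B₁)
        splitAll f = trans (sp₀ f) (trans (cong (_+ sum f B₀) (trans (sym (sumC f)) (trans (cong (sum f) (concat-tl Cs)) (trans (sum-++ f (at Cs 0) (concat Ds))
          (cong (_+_ (sum f (at Cs 0))) (trans (proj₁ (proj₂ (proj₂ thn)) f) (cong (_+ sum f B₁) (proj₁ (proj₂ filled) f))))))))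
          (trans (ring-63 (sum f (at Cs 0)) (sum f A) (sum f B₀) (sum f B₁)) (sym (cong₂ _+_ (sum-++ f (at Cs 0) A) (sum-++ f B₀ B₁)))))

        abstract
          cardDs≤ : card (concat Ds) ≤ card S
          cardDs≤ = ≤-trans (lin≤ (card-nonneg (at Cs 0)) (ring-7 (card (at Cs 0)) (card (concat Ds))))
                    (≤-trans (≤-reflexive (trans (sym (sum-++ _ (at Cs 0) (concat Ds))) (trans (cong card (sym (concat-tl Cs))) (sumC _)))) (S₀≤S (λ _ → 0≤1)))

          dropped≤ : card (B₀ ++ B₁) ≤ (e + e + e) * card S + ⟦ dropBound ⟧
          dropped≤ = ≤-trans (≤-reflexive (sum-++ _ B₀ B₁))
            (≤-trans (lin≤ (wide≤ ⊕ proj₁ (proj₂ (proj₂ (proj₂ thn))) ⊕ (0≤+ (0≤+ 0≤e 0≤e) 0≤e ⊛ cardDs≤) ⊕ ⟦⟧-mono (ℕₚ.≤-trans (length-tl Cs) (proj₁ (proj₂ (proj₂ chopped)))))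
                        (ring-64 (card B₀) (card B₁) ⟦ Cw ⟧ ⟦ length Ds ⟧ ⟦ n ⟧ ((e + e + e) * card (concat Ds)) ((e + e + e) * card S)))
                     (≤-reflexive (cong (_+_ ((e + e + e) * card S)) (sym (⟦⟧-+ n Cw)))))

          btot≡ : btot t bs ≡ t * c + ⟦ length bs ⟧ * m
          btot≡ = trans (btot-eq bs) (cong (λ z → t * z + ⟦ length bs ⟧ * m)
                    (trans (proj₂ (proj₂ (proj₂ agg)) (λ _ → 1ℚ)) (trans (cint-1 cs) (proj₁ (proj₂ (proj₂ cols))))))

          len≤ : ⟦ length bs ⟧ ≤ ⟦ length (configs n D) ⟧
          len≤ = ⟦⟧-mono (proj₁ (proj₁ (proj₂ (proj₂ agg))))

          -- The first class takes at most (γ + μ) c and the blocks (1 - 2 e) c plus `m` for each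
          -- configuration; by `small` this is within (1 - e) c.
          0≤rest : 0ℚ ≤ rest
          0≤rest = lin≤ (class-≤ 0≤g 0≤m ch 0 ⊕ ≤-reflexive btot≡ ⊕ (0≤m ⊛ len≤) ⊕ (0≤c ⊛ small))
                        (ring-65 e γ μ c W₀ (btot t bs) ⟦ length bs ⟧ ⟦ length (configs n D) ⟧)

          fitsC : All (λ i → h i ≤ b) (at Cs 0)
          fitsC = All-at Cs (All-splitʳ (λ i → h i ≤? b) {S₀} {[]} {concat Cs} (λ f → trans (sym (sumC f)) (sym (+-identityˡ _)))
                    (Allₚ.filter⁺ thin? (All.map proj₂ (fits pk)))) 0

        tree : CTree ea w h ((1ℚ - e) * c) b (at Cs 0 ++ A)
        tree = vs {S₁ = at Cs 0} {S₂ = A} (sum-nonneg 0≤w (at Cs 0)) (0≤+ (proj₁ (proj₂ (proj₂ filled))) 0≤rest) (ring-66 W₀ (btot t bs) ((1ℚ - e) * c)) (split-++ (at Cs 0) A)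
                 (vst fitsC ≤-refl)
                 (vs {S₁ = A} {S₂ = []} (proj₁ (proj₂ (proj₂ filled))) 0≤rest refl (split-[]ʳ A) (proj₁ (proj₂ (proj₂ (proj₂ filled)))) (free refl))

        abstract
          tree-leaves : leaves tree ℕ.≤ leafBound
          tree-leaves = ℕₚ.≤-trans (ℕ.s≤s (ℕₚ.+-monoˡ-≤ 1 (ℕₚ.≤-trans (ℕₚ.≤-reflexive (proj₁ (proj₂ (proj₂ (proj₂ (proj₂ filled))))))
              (ℕₚ.≤-trans (slotNo-≤ bs (proj₂ (proj₁ (proj₂ (proj₂ agg))))) (ℕₚ.+-monoˡ-≤ 1 (ℕₚ.*-monoˡ-≤ (suc D) (proj₁ (proj₁ (proj₂ (proj₂ agg))))))))))
            (ℕₚ.≤-reflexive (l (length (configs n D) ℕ.* suc D)))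
            where
            l : ∀ x → suc (x ℕ.+ 1 ℕ.+ 1) ≡ x ℕ.+ 3
            l x = trans (cong suc (ℕₚ.+-assoc x 1 1)) (sym (ℕₚ.+-suc x 2))

          -- Slot heights are rounded down, so the slots before widening cover at most the area of
          -- the items. Only the first class and the widening add to it.
          tree-used : used tree ≤ sum area S + e * (c * b)
          tree-used = lin≤ ((0≤b ⊛ class-≤ 0≤g 0≤m ch 0)
                            ⊕ proj₂ (proj₂ (proj₂ (proj₂ (proj₂ filled))))
                            ⊕ barea-≤ bs (proj₁ (proj₂ agg))
                            ⊕ (0≤t ⊛ ≤-trans (≤-reflexive (bint-sum lo)) (≤-trans (sum-mono S₀ (All.map (λ {i} (_ , q , _) → 0≤w i ⊛ q) allP)) (S₀≤S 0≤area)))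
                            ⊕ (0≤* 0≤m 0≤b ⊛ len≤) ⊕ (0≤* 0≤c 0≤b ⊛ small) ⊕ 0≤* (0≤+ 0≤e 0≤e) (sum-nonneg 0≤area S))
                           (ring-67 e γ μ c b W₀ (used (proj₁ (proj₂ (proj₂ (proj₂ filled))))) (barea t bs) (bint (sumℕ lo) bs) (sum area S) ⟦ length bs ⟧ ⟦ length (configs n D) ⟧)

        result : Result c b S
        result = at Cs 0 ++ A , B₀ ++ B₁ , splitAll , dropped≤ , tree , tree-leaves , tree-used

      vbox : ∀ {c b d S} → 0ℚ ≤ c → 0ℚ ≤ b → 0ℚ < d → b ≤ ⟦ D ⟧ * d → Pack w h c b S → All (λ i → d ≤ h i) S → Once S → Result c b S
      vbox {c} {b} {d} {S} 0≤c 0≤b 0<d b≤ pk tall once with 0ℚ <? c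
      ... | yes 0<c = Main.result c b d 0<c 0≤b 0<d b≤ S pk tall once
      -- A box without width contains nothing, since widths are positive; so dropping all of `S`
      -- drops no item.
      ... | no ¬p = [] , S , split-[]ˡ S ,
            subst (λ z → card z ≤ (e + e + e) * card z + ⟦ dropBound ⟧) (sym S≡[]) (≤-trans (0≤⟦⟧ dropBound) (≤-reflexive (ring-71 (e + e + e) ⟦ dropBound ⟧))) ,
            free refl , ℕₚ.≤-trans (ℕ.s≤s ℕ.z≤n) (ℕₚ.m≤n+m 3 (length (configs n D) ℕ.* suc D)) ,
            0≤+ (sum-nonneg 0≤area S) (0≤* 0≤e (0≤* 0≤c 0≤b))
        where
        S≡[] : S ≡ []
        S≡[] = none S (fits pk)
          where
          none : ∀ S → All (λ i → w i ≤ c × h i ≤ b) S → S ≡ []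
          none [] _ = refl
          none (i ∷ S) ((p , _) ∷ _) = ⊥-elim (¬p (<-≤-trans (w>0 i) p))

-- Runs of peeled strips and the binary tree of runs

module PeelingRuns where

  open Packings
  open Counting

  -- Peeling strips of tall items from the left and strips of wide items from the bottom

  module _ {Item : Set} where

    data Peels (w h : Item → ℚ) (d : ℚ) : (a b a′ b′ : ℚ) → Set where
      []   : ∀ {a b} → Peels w h d a b a b
      pv   : ∀ {a₀ a b a′ b′ c S} → 0ℚ ≤ c → Pack w h c b S → All (λ i → d ≤ h i) S → a₀ ≡ c + a →
             Peels w h d a b a′ b′ → Peels w h d a₀ b a′ b′
      ph   : ∀ {a b₀ b a′ b′ c S} → 0ℚ ≤ c → Pack w h a c S → All (λ i → d ≤ w i) S → b₀ ≡ c + b →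
             Peels w h d a b a′ b′ → Peels w h d a b₀ a′ b′

    transposeS : ∀ {w h d a b a′ b′} → Peels w h d a b a′ b′ → Peels h w d b a b′ a′
    transposeS [] = []
    transposeS (pv p q r s t) = ph p (transposeP q) r s (transposeS t)
    transposeS (ph p q r s t) = pv p (transposeP q) r s (transposeS t)

    vI hI : ∀ {w h d a b a′ b′} → Peels w h d a b a′ b′ → List Item
    vI [] = []
    vI (pv {S = S} _ _ _ _ p) = S ++ vI p
    vI (ph _ _ _ _ p) = vI p
    hI [] = []
    hI (pv _ _ _ _ p) = hI p
    hI (ph {S = S} _ _ _ _ p) = S ++ hI p

    vI-transposeS : ∀ {w h d a b a′ b′} (p : Peels w h d a b a′ b′) → vI (transposeS p) ≡ hI p
    vI-transposeS [] = refl
    vI-transposeS (pv _ _ _ _ p) = vI-transposeS p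
    vI-transposeS (ph {S = S} _ _ _ _ p) = cong (S ++_) (vI-transposeS p)

    hI-transposeS : ∀ {w h d a b a′ b′} (p : Peels w h d a b a′ b′) → hI (transposeS p) ≡ vI p
    hI-transposeS [] = refl
    hI-transposeS (pv {S = S} _ _ _ _ p) = cong (S ++_) (hI-transposeS p)
    hI-transposeS (ph _ _ _ _ p) = hI-transposeS p

    abstract
      +-≥ˡ : ∀ {x y z} → x ≡ y + z → 0ℚ ≤ y → z ≤ x
      +-≥ˡ {x} {y} {z} refl p = lin≤ p (ring-7 y z)

    module _ {w h : Item → ℚ} {d : ℚ} where

      a′≤a : ∀ {a b a′ b′} → Peels w h d a b a′ b′ → a′ ≤ a
      a′≤a [] = ≤-refl
      a′≤a (pv p _ _ e t) = ≤-trans (a′≤a t) (+-≥ˡ e p)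
      a′≤a (ph _ _ _ _ t) = a′≤a t

      b′≤b : ∀ {a b a′ b′} → Peels w h d a b a′ b′ → b′ ≤ b
      b′≤b [] = ≤-refl
      b′≤b (pv _ _ _ _ t) = b′≤b t
      b′≤b (ph p _ _ e t) = ≤-trans (b′≤b t) (+-≥ˡ e p)

      vAll : ∀ {a b a′ b′} (p : Peels w h d a b a′ b′) → All (λ i → d ≤ h i) (vI p)
      vAll [] = []
      vAll (pv _ _ q _ t) = Allₚ.++⁺ q (vAll t)
      vAll (ph _ _ _ _ t) = vAll t

      hAll : ∀ {a b a′ b′} (p : Peels w h d a b a′ b′) → All (λ i → d ≤ w i) (hI p)
      hAll [] = []
      hAll (pv _ _ _ _ t) = hAll t
      hAll (ph _ _ q _ t) = Allₚ.++⁺ q (hAll t)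

      vPack : ∀ {a b a′ b′} (p : Peels w h d a b a′ b′) → Pack w h (a - a′) b (vI p)
      vPack [] = nil
      vPack {a} {b} {a′} (pv {a = a₁} {c = c} {S = S} p q r e t) = vcmp p (≤⇒0≤ (a′≤a t)) (≤-reflexive (trans (ring-76 c a₁ a′) (cong (_- a′) (sym e)))) (split-++ S (vI t)) q (vPack t)
      vPack (ph p q r e t) = widen ≤-refl (+-≥ˡ e p) (vPack t)

      hPack : ∀ {a b a′ b′} (p : Peels w h d a b a′ b′) → Pack w h a (b - b′) (hI p)
      hPack [] = nil
      hPack {a} {b} {a′} {b′} (ph {b = b₁} {c = c} {S = S} p q r e t) = hcmp p (≤⇒0≤ (b′≤b t)) (≤-reflexive (trans (ring-76 c b₁ b′) (cong (_- b′) (sym e)))) (split-++ S (hI t)) q (hPack t)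
      hPack (pv p q r e t) = widen (+-≥ˡ e p) ≤-refl (hPack t)

      -- the maximal prefix of depth at most kx horizontally and ky vertically

      Stop : ∀ {a b a′ b′} → ℚ → ℚ → Peels w h d a b a′ b′ → Set
      Stop kx ky [] = ⊤
      Stop kx ky (pv {c = c} _ _ _ _ _) = kx < c
      Stop kx ky (ph {c = c} _ _ _ _ _) = ky < c

      record Cut (kx ky : ℚ) {a b a′ b′ : ℚ} (p : Peels w h d a b a′ b′) : Set where
        field
          {am bm} : ℚ
          pre  : Peels w h d a b am bm
          post : Peels w h d am bm a′ b′
          x≤   : a - am ≤ kx
          y≤   : b - bm ≤ ky
          stop : Stop (kx - (a - am)) (ky - (b - bm)) post
          veq  : vI p ≡ vI pre ++ vI post
          heq  : hI p ≡ hI pre ++ hI post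

      Stop-resp : ∀ {a b a′ b′ kx ky kx′ ky′} (p : Peels w h d a b a′ b′) → kx′ ≡ kx → ky′ ≡ ky → Stop kx ky p → Stop kx′ ky′ p
      Stop-resp p refl refl s = s

      cut : ∀ {a b a′ b′} (kx ky : ℚ) → 0ℚ ≤ kx → 0ℚ ≤ ky → (p : Peels w h d a b a′ b′) → Cut kx ky p
      cut {a} {b} kx ky 0≤kx 0≤ky [] = record { pre = [] ; post = [] ; x≤ = lin≤ 0≤kx (ring-79 a kx) ; y≤ = lin≤ 0≤ky (ring-79 b ky) ; stop = tt ; veq = refl ; heq = refl }
      cut {a₀} {b₀} kx ky 0≤kx 0≤ky (pv {a = a} {c = c} {S = S} p q r refl t) with c ≤? kx
      ... | no ¬p = record { pre = [] ; post = pv p q r refl t ; x≤ = lin≤ 0≤kx (ring-79 (c + a) kx) ; y≤ = lin≤ 0≤ky (ring-79 b₀ ky)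
                           ; stop = subst (_< c) (sym (ring-78 kx (c + a))) (≰⇒> ¬p) ; veq = refl ; heq = refl }
      ... | yes c≤ = let open Cut (cut (kx - c) ky (≤⇒0≤ c≤) 0≤ky t) in
          record { pre = pv p q r refl pre ; post = post ; x≤ = lin≤ x≤ (ring-77 kx c a am) ; y≤ = y≤
                 ; stop = Stop-resp post (ring-77 kx c a am) refl stop
                 ; veq = trans (cong (S ++_) veq) (sym (++-assoc S (vI pre) (vI post))) ; heq = heq }
        where open import Data.List.Properties using (++-assoc)
      cut {a₀} {b₀} kx ky 0≤kx 0≤ky (ph {b = b} {c = c} {S = S} p q r refl t) with c ≤? ky
      ... | no ¬p = record { pre = [] ; post = ph p q r refl t ; x≤ = lin≤ 0≤kx (ring-79 a₀ kx) ; y≤ = lin≤ 0≤ky (ring-79 (c + b) ky)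
                           ; stop = subst (_< c) (sym (ring-78 ky (c + b))) (≰⇒> ¬p) ; veq = refl ; heq = refl }
      ... | yes c≤ = let open Cut (cut kx (ky - c) 0≤kx (≤⇒0≤ c≤) t) in
          record { pre = ph p q r refl pre ; post = post ; x≤ = x≤ ; y≤ = lin≤ y≤ (ring-77 ky c b bm)
                 ; stop = Stop-resp post refl (ring-77 ky c b bm) stop
                 ; veq = veq ; heq = trans (cong (S ++_) heq) (sym (++-assoc S (hI pre) (hI post))) }
        where open import Data.List.Properties using (++-assoc)

      -- Carries neither the nonnegativity proofs nor the intermediate sizes of `cut`, so that
      -- counts at different depths can be compared directly; `preSum` relates the two.
      preItems : ∀ {a b a′ b′} (kx ky : ℚ) → Peels w h d a b a′ b′ → List Item
      preItems kx ky [] = []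
      preItems kx ky (pv {c = c} {S = S} _ _ _ _ t) with c ≤? kx
      ... | no _  = []
      ... | yes _ = S ++ preItems (kx - c) ky t
      preItems kx ky (ph {c = c} {S = S} _ _ _ _ t) with c ≤? ky
      ... | no _  = []
      ... | yes _ = S ++ preItems kx (ky - c) t

    mutual
      data Run (w h : Item → ℚ) (d : ℚ) (a b : ℚ) : Set where
        run : ∀ {a′ b′} → d < a → d < b → Peels w h d a b a′ b′ → End w h d a′ b′ → Run w h d a b

      data End (w h : Item → ℚ) (d : ℚ) (a b : ℚ) : Set where
        term : 0ℚ ≤ a → 0ℚ ≤ b → End w h d a b
        vbr  : ∀ {a₁ a₂} → a₁ + a₂ ≤ a → Run w h d a₁ b → Run w h d a₂ b → End w h d a b
        hbr  : ∀ {b₁ b₂} → b₁ + b₂ ≤ b → Run w h d a b₁ → Run w h d a b₂ → End w h d a b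

    mutual
      transposeR : ∀ {w h d a b} → Run w h d a b → Run h w d b a
      transposeR (run p q s e) = run q p (transposeS s) (transposeE e)
      transposeE : ∀ {w h d a b} → End w h d a b → End h w d b a
      transposeE (term p q) = term q p
      transposeE (vbr p q r) = hbr p (transposeR q) (transposeR r)
      transposeE (hbr p q r) = vbr p (transposeR q) (transposeR r)

    mutual
      runs : ∀ {w h d a b} → Run w h d a b → ℕ
      runs (run _ _ _ e) = suc (runsE e)
      runsE : ∀ {w h d a b} → End w h d a b → ℕ
      runsE (term _ _) = 0
      runsE (vbr _ p q) = runs p ℕ.+ runs q
      runsE (hbr _ p q) = runs p ℕ.+ runs q

    mutual
      items : ∀ {w h d a b} → Run w h d a b → List Item
      items (run _ _ s e) = (vI s ++ hI s) ++ itemsE e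
      itemsE : ∀ {w h d a b} → End w h d a b → List Item
      itemsE (term _ _) = []
      itemsE (vbr _ p q) = items p ++ items q
      itemsE (hbr _ p q) = items p ++ items q

    module _ {w h : Item → ℚ} {d : ℚ} (0≤d : 0ℚ ≤ d) where

      VorH : Item → Set
      VorH i = (d < h i × w i ≤ d) ⊎ (d < w i × h i ≤ d)

      VorH? : ∀ i → Dec (VorH i)
      VorH? i = ((d <? h i) ×-dec (w i ≤? d)) ⊎-dec ((d <? w i) ×-dec (h i ≤? d))
        where open import Relation.Nullary.Decidable using (_⊎-dec_)

      private
        -- A wide item is longer than `d` and does not fit into a box of width at most `d`, so
        -- everything in it is tall.
        allV : ∀ {a b S} → a ≤ d → Pack w h a b S → All VorH S → All (λ i → d ≤ h i) S
        allV a≤ P al = All.zipWith (λ { ((p , _) , inj₁ (q , _)) → <⇒≤ q ; ((p , _) , inj₂ (q , _)) → ⊥-elim (<⇒≱ q (≤-trans p a≤)) }) (fits P , al)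

        allH : ∀ {a b S} → b ≤ d → Pack w h a b S → All VorH S → All (λ i → d ≤ w i) S
        allH b≤ P al = All.zipWith (λ { ((_ , p) , inj₂ (q , _)) → <⇒≤ q ; ((_ , p) , inj₁ (q , _)) → ⊥-elim (<⇒≱ q (≤-trans p b≤)) }) (fits P , al)

        prependV : ∀ {a a₂ b S₁ S₂ S} (c : ℚ) → 0ℚ ≤ c → d < a → Pack w h c b S₁ → All (λ i → d ≤ h i) S₁ → a ≡ c + a₂ → Split S S₁ S₂ →
          Σ (Run w h d a₂ b) (λ R → ∀ f → sum f S₂ ≡ sum f (items R)) → Σ (Run w h d a b) λ R → ∀ f → sum f S ≡ sum f (items R)
        prependV {S₁ = S₁} {S₂} c 0≤c d<a P al e s (run _ q t E , I) = run d<a q (pv 0≤c P al e t) E ,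
          (λ f → trans (s f) (trans (cong (_+_ (sum f S₁)) (I f)) (eq f)))
          where
          eq : ∀ f → sum f S₁ + sum f ((vI t ++ hI t) ++ itemsE E) ≡ sum f (((S₁ ++ vI t) ++ hI t) ++ itemsE E)
          eq f = sym (trans (cong (sum f) (trans (cong (_++ itemsE E) (++-assoc S₁ (vI t) (hI t))) (++-assoc S₁ (vI t ++ hI t) (itemsE E)))) (sum-++ f S₁ _))
            where open import Data.List.Properties using (++-assoc)

        prependH : ∀ {a b b₂ S₁ S₂ S} (c : ℚ) → 0ℚ ≤ c → d < b → Pack w h a c S₁ → All (λ i → d ≤ w i) S₁ → b ≡ c + b₂ → Split S S₁ S₂ →
          Σ (Run w h d a b₂) (λ R → ∀ f → sum f S₂ ≡ sum f (items R)) → Σ (Run w h d a b) λ R → ∀ f → sum f S ≡ sum f (items R)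
        prependH {S₁ = S₁} {S₂} c 0≤c d<b P al e s (run q _ t E , I) = run q d<b (ph 0≤c P al e t) E ,
          (λ f → trans (s f) (trans (cong (_+_ (sum f S₁)) (I f)) (eq f)))
          where
          eq : ∀ f → sum f S₁ + sum f ((vI t ++ hI t) ++ itemsE E) ≡ sum f ((vI t ++ (S₁ ++ hI t)) ++ itemsE E)
          eq f = trans (cong (_+_ (sum f S₁)) (trans (sum-++ f (vI t ++ hI t) (itemsE E)) (cong (_+ sum f (itemsE E)) (sum-++ f (vI t) (hI t)))))
                   (trans (ring-72 (sum f S₁) (sum f (vI t)) (sum f (hI t)) (sum f (itemsE E)))
                     (sym (trans (sum-++ f (vI t ++ (S₁ ++ hI t)) (itemsE E)) (cong (_+ sum f (itemsE E)) (trans (sum-++ f (vI t) (S₁ ++ hI t)) (cong (_+_ (sum f (vI t))) (sum-++ f S₁ (hI t))))))))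

      -- If one side of a cut has width or height at most `d`, it is a strip of one kind. As
      -- positions are not recorded, the strip may be taken to lie at the left or at the bottom, on
      -- whichever side of the cut it was.
      build : ∀ {a b S} → d < a → d < b → Pack w h a b S → All VorH S → Σ (Run w h d a b) λ R → ∀ f → sum f S ≡ sum f (items R)
      build {a} {b} d<a d<b nil al = run d<a d<b [] (term (≤-trans 0≤d (<⇒≤ d<a)) (≤-trans 0≤d (<⇒≤ d<b))) , (λ f → refl)
      build {a} {b} d<a d<b (one p q) (inj₁ (x , _) ∷ []) =
        run d<a d<b (pv (≤-trans 0≤d (<⇒≤ d<a)) (one p q) (<⇒≤ x ∷ []) (ring-82 a a) []) (term (≤-reflexive (sym (+-inverseʳ a))) (≤-trans 0≤d (<⇒≤ d<b))) , (λ f → refl)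
      build {a} {b} d<a d<b (one p q) (inj₂ (x , _) ∷ []) =
        run d<a d<b (ph (≤-trans 0≤d (<⇒≤ d<b)) (one p q) (<⇒≤ x ∷ []) (ring-82 b b) []) (term (≤-trans 0≤d (<⇒≤ d<a)) (≤-reflexive (sym (+-inverseʳ b)))) , (λ f → refl)
      build {a} {b} {S} d<a d<b (vcmp {a₁} {a₂} {S₁ = A} {B} 0≤a₁ 0≤a₂ le s P Q) al with d <? a₁ | d <? a₂
      ... | yes p | yes q = let (R₁ , I₁) = build p d<b P (All-splitˡ VorH? {S} {A} {B} s al)
                                (R₂ , I₂) = build q d<b Q (All-splitʳ VorH? {S} {A} {B} s al) in
            run d<a d<b [] (vbr le R₁ R₂) , (λ f → trans (s f) (trans (cong₂ _+_ (I₁ f) (I₂ f)) (sym (sum-++ f (items R₁) (items R₂)))))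
      ... | no p | yes q = prependV {S₁ = A} {B} {S} (a - a₂) (≤-trans 0≤a₁ (lin≤ le (ring-81 a a₁ a₂))) d<a (widen (lin≤ le (ring-81 a a₁ a₂)) ≤-refl P)
                             (allV (≮⇒≥ p) P (All-splitˡ VorH? {S} {A} {B} s al)) (ring-80 a a₂) s (build q d<b Q (All-splitʳ VorH? {S} {A} {B} s al))
      ... | yes p | no q = prependV {S₁ = B} {A} {S} (a - a₁) (≤-trans 0≤a₂ (lin≤ le (ring-40 a a₁ a₂))) d<a (widen (lin≤ le (ring-40 a a₁ a₂)) ≤-refl Q)
                             (allV (≮⇒≥ q) Q (All-splitʳ VorH? {S} {A} {B} s al)) (ring-80 a a₁) (split-swap {S = S} {A} {B} s) (build p d<b P (All-splitˡ VorH? {S} {A} {B} s al))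
      ... | no p | no q = run d<a d<b (pv 0≤a₁ P (allV (≮⇒≥ p) P (All-splitˡ VorH? {S} {A} {B} s al)) (ring-82 a a₁)
                                (pv 0≤a₂ Q (allV (≮⇒≥ q) Q (All-splitʳ VorH? {S} {A} {B} s al)) (ring-82 (a - a₁) a₂) []))
                            (term (lin≤ le (ring-83 a a₁ a₂)) (≤-trans 0≤d (<⇒≤ d<b))) ,
            (λ f → trans (s f) (sym (trans (sum-++ f (((A ++ (B ++ [])) ++ [])) []) (trans (cong (_+ 0ℚ) (trans (sum-++ f (A ++ (B ++ [])) []) (cong (_+ 0ℚ) (trans (sum-++ f A (B ++ [])) (cong (_+_ (sum f A)) (sum-++ f B []))))))
                   (ring-84 (sum f A) (sum f B))))))
      build {a} {b} {S} d<a d<b (hcmp {b₁} {b₂} {S₁ = A} {B} 0≤b₁ 0≤b₂ le s P Q) al with d <? b₁ | d <? b₂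
      ... | yes p | yes q = let (R₁ , I₁) = build d<a p P (All-splitˡ VorH? {S} {A} {B} s al)
                                (R₂ , I₂) = build d<a q Q (All-splitʳ VorH? {S} {A} {B} s al) in
            run d<a d<b [] (hbr le R₁ R₂) , (λ f → trans (s f) (trans (cong₂ _+_ (I₁ f) (I₂ f)) (sym (sum-++ f (items R₁) (items R₂)))))
      ... | no p | yes q = prependH {S₁ = A} {B} {S} (b - b₂) (≤-trans 0≤b₁ (lin≤ le (ring-81 b b₁ b₂))) d<b (widen ≤-refl (lin≤ le (ring-81 b b₁ b₂)) P)
                             (allH (≮⇒≥ p) P (All-splitˡ VorH? {S} {A} {B} s al)) (ring-80 b b₂) s (build d<a q Q (All-splitʳ VorH? {S} {A} {B} s al))
      ... | yes p | no q = prependH {S₁ = B} {A} {S} (b - b₁) (≤-trans 0≤b₂ (lin≤ le (ring-40 b b₁ b₂))) d<b (widen ≤-refl (lin≤ le (ring-40 b b₁ b₂)) Q)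
                             (allH (≮⇒≥ q) Q (All-splitʳ VorH? {S} {A} {B} s al)) (ring-80 b b₁) (split-swap {S = S} {A} {B} s) (build d<a p P (All-splitˡ VorH? {S} {A} {B} s al))
      ... | no p | no q = run d<a d<b (ph 0≤b₁ P (allH (≮⇒≥ p) P (All-splitˡ VorH? {S} {A} {B} s al)) (ring-82 b b₁)
                                (ph 0≤b₂ Q (allH (≮⇒≥ q) Q (All-splitʳ VorH? {S} {A} {B} s al)) (ring-82 (b - b₁) b₂) []))
                            (term (≤-trans 0≤d (<⇒≤ d<a)) (lin≤ le (ring-83 b b₁ b₂))) ,
            (λ f → trans (s f) (sym (trans (sum-++ f (A ++ (B ++ [])) []) (trans (cong (_+ 0ℚ) (trans (sum-++ f A (B ++ [])) (cong (_+_ (sum f A)) (sum-++ f B []))))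
                   (ring-85 (sum f A) (sum f B))))))

    -- every run that ends in a leaf owns a box of area more than d²
    module _ {w h : Item → ℚ} {d : ℚ} (0<d : 0ℚ < d) where
      mutual
        -- Runs that end in a leaf own disjoint boxes of area more than `d * d`, and a binary tree
        -- with l leaves has 2 l - 1 nodes, whence the factor two and the summand one.
        runs-≤ : ∀ {a b} (R : Run w h d a b) → d * d * (⟦ runs R ⟧ + 1ℚ) ≤ (1ℚ + 1ℚ) * (a * b)
        runs-≤ {a} {b} (run p q s (term _ _)) = lin≤ ((0≤d ⊛ <⇒≤ q) ⊕ (0≤d ⊛ <⇒≤ q) ⊕ (0≤b ⊛ <⇒≤ p) ⊕ (0≤b ⊛ <⇒≤ p)) (ring-73 d a b)
          where
          0≤d = <⇒≤ 0<d
          0≤b = ≤-trans 0≤d (<⇒≤ q)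
        runs-≤ {a} {b} (run {a′} {b′} p q s (vbr {a₁} {a₂} le R₁ R₂)) = lin≤ (runs-≤ R₁ ⊕ runs-≤ R₂ ⊕ (0≤b′ ⊛ ≤-trans le (a′≤a s)) ⊕ (0≤b′ ⊛ ≤-trans le (a′≤a s)) ⊕ (0≤a ⊛ b′≤b s) ⊕ (0≤a ⊛ b′≤b s))
            (trans (cong (λ z → (1ℚ + 1ℚ) * (a * b) - d * d * ((1ℚ + z) + 1ℚ)) (⟦⟧-+ (runs R₁) (runs R₂))) (ring-74 d a b a₁ a₂ b′ ⟦ runs R₁ ⟧ ⟦ runs R₂ ⟧))
          where
          0≤a = ≤-trans (<⇒≤ 0<d) (<⇒≤ p)
          0≤b′ = ≤-trans (<⇒≤ 0<d) (<⇒≤ (fatb R₁))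
        runs-≤ {a} {b} (run {a′} {b′} p q s (hbr {b₁} {b₂} le R₁ R₂)) = lin≤ (runs-≤ R₁ ⊕ runs-≤ R₂ ⊕ (0≤a′ ⊛ ≤-trans le (b′≤b s)) ⊕ (0≤a′ ⊛ ≤-trans le (b′≤b s)) ⊕ (0≤b ⊛ a′≤a s) ⊕ (0≤b ⊛ a′≤a s))
            (trans (cong (λ z → (1ℚ + 1ℚ) * (a * b) - d * d * ((1ℚ + z) + 1ℚ)) (⟦⟧-+ (runs R₁) (runs R₂))) (ring-75 d a b b₁ b₂ a′ ⟦ runs R₁ ⟧ ⟦ runs R₂ ⟧))
          where
          0≤b = ≤-trans (<⇒≤ 0<d) (<⇒≤ q)
          0≤a′ = ≤-trans (<⇒≤ 0<d) (<⇒≤ (fata R₁))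

        fata : ∀ {a b} → Run w h d a b → d < a
        fata (run p _ _ _) = p
        fatb : ∀ {a b} → Run w h d a b → d < b
        fatb (run _ q _ _) = q

-- Trees of boxes with tall items only or wide items only

module BoxTrees where

  open Packings
  open Counting
  open ContainerTrees
  open Configurations
  open SizeClasses
  open TallBoxes
  open PeelingRuns

  -- Packings of boxes that contain tall items only or wide items only; such a
  -- box may exceed its place by the factor 1 / (1 - e).

  module _ {Item : Set} where

    data BTree (w h : Item → ℚ) (d e a b : ℚ) (S : List Item) : Set where
      bfree : S ≡ [] → BTree w h d e a b S
      bv    : ∀ {c} → 0ℚ ≤ c → Pack w h c b S → All (λ i → d ≤ h i) S → (1ℚ - e) * c ≤ a → BTree w h d e a b S
      bh    : ∀ {c} → 0ℚ ≤ c → Pack w h a c S → All (λ i → d ≤ w i) S → (1ℚ - e) * c ≤ b → BTree w h d e a b S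
      bvs   : ∀ {a₁ a₂ S₁ S₂} → 0ℚ ≤ a₁ → 0ℚ ≤ a₂ → a₁ + a₂ ≤ a → Split S S₁ S₂ →
              BTree w h d e a₁ b S₁ → BTree w h d e a₂ b S₂ → BTree w h d e a b S
      bhs   : ∀ {b₁ b₂ S₁ S₂} → 0ℚ ≤ b₁ → 0ℚ ≤ b₂ → b₁ + b₂ ≤ b → Split S S₁ S₂ →
              BTree w h d e a b₁ S₁ → BTree w h d e a b₂ S₂ → BTree w h d e a b S

    transposeB : ∀ {w h d e a b S} → BTree w h d e a b S → BTree h w d e b a S
    transposeB (bfree p) = bfree p
    transposeB (bv p q r s) = bh p (transposeP q) r s
    transposeB (bh p q r s) = bv p (transposeP q) r s
    transposeB (bvs p q r s A B) = bhs p q r s (transposeB A) (transposeB B)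
    transposeB (bhs p q r s A B) = bvs p q r s (transposeB A) (transposeB B)

    -- Inner nodes are counted as well, because each of them may produce a free leaf when its parts
    -- do not fill it.
    bl : ∀ {w h d e a b S} → BTree w h d e a b S → ℕ
    bl (bvs _ _ _ _ A B) = suc (bl A ℕ.+ bl B)
    bl (bhs _ _ _ _ A B) = suc (bl A ℕ.+ bl B)
    bl _ = 1

    bl-transposeB : ∀ {w h d e a b S} (T : BTree w h d e a b S) → bl (transposeB T) ≡ bl T
    bl-transposeB (bfree p) = refl
    bl-transposeB (bv p q r s) = refl
    bl-transposeB (bh p q r s) = refl
    bl-transposeB (bvs p q r s A B) = cong suc (cong₂ ℕ._+_ (bl-transposeB A) (bl-transposeB B))
    bl-transposeB (bhs p q r s A B) = cong suc (cong₂ ℕ._+_ (bl-transposeB A) (bl-transposeB B))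

    widenB : ∀ {w h d e a b a′ b′ S} → a ≤ a′ → b ≤ b′ → (T : BTree w h d e a b S) → Σ (BTree w h d e a′ b′ S) λ T′ → bl T′ ≡ bl T
    widenB p q (bfree e) = bfree e , refl
    widenB p q (bv x y z k) = bv x (widen ≤-refl q y) z (≤-trans k p) , refl
    widenB p q (bh x y z k) = bh x (widen p ≤-refl y) z (≤-trans k q) , refl
    widenB p q (bvs x y z s A B) = let (A′ , e) = widenB ≤-refl q A ; (B′ , f) = widenB ≤-refl q B in bvs x y (≤-trans z p) s A′ B′ , cong suc (cong₂ ℕ._+_ e f)
    widenB p q (bhs x y z s A B) = let (A′ , e) = widenB p ≤-refl A ; (B′ , f) = widenB p ≤-refl B in bhs x y (≤-trans z q) s A′ B′ , cong suc (cong₂ ℕ._+_ e f)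

    extendV : ∀ {ea a a′ b} {w h : Item → ℚ} {S} → 0ℚ ≤ a → a ≤ a′ → (T : CTree ea w h a b S) → Σ (CTree ea w h a′ b S) λ T′ → leaves T′ ≡ suc (leaves T) × used T′ ≡ used T
    extendV {a = a} {a′} {S = S} 0≤a p T = vs {S₁ = S} {S₂ = []} 0≤a (≤⇒0≤ p) (ring-41 a a′) (split-[]ʳ S) T (free refl) , ℕₚ.+-comm (leaves T) 1 , +-identityʳ (used T)

    extendH : ∀ {ea a b b′} {w h : Item → ℚ} {S} → 0ℚ ≤ b → b ≤ b′ → (T : CTree ea w h a b S) → Σ (CTree ea w h a b′ S) λ T′ → leaves T′ ≡ suc (leaves T) × used T′ ≡ used T
    extendH {b = b} {b′} {S = S} 0≤b p T = hs {S₁ = S} {S₂ = []} 0≤b (≤⇒0≤ p) (ring-41 b b′) (split-[]ʳ S) T (free refl) , ℕₚ.+-comm (leaves T) 1 , +-identityʳ (used T)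

  module ToC {Item : Set} (_≟I_ : DecidableEquality Item) (ea : ℚ) (bp : BoxParams)
    (w h : Item → ℚ) (w>0 : ∀ i → 0ℚ < w i) (h>0 : ∀ i → 0ℚ < h i) (d : ℚ) (0<d : 0ℚ < d) where

    open BoxParams bp
    open VBox _≟I_ ea bp
    open Classes _≟I_ w h w>0 h>0 using (Once)

    leafC : ℕ
    leafC = suc leafBound

    private
      area : Item → ℚ
      area i = w i * h i
      0≤e : 0ℚ ≤ e
      0≤e = <⇒≤ 0<e
      abstract
        e3≤1 : e + e + e ≤ 1ℚ
        e3≤1 = ≤-trans (lin≤ (0≤+ (0≤+ 0≤e 0≤e) 0≤e ⊛ 0≤⟦⟧ Q) (ring-68 (e + e + e) ⟦ Q ⟧)) (≤-reflexive eQ)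
        0≤1-e : 0ℚ ≤ 1ℚ - e
        0≤1-e = lin≤ (e3≤1 ⊕ 0≤e ⊕ 0≤e) (ring-86 e)
        -- e c ≤ 2 e a when (1 - e) c ≤ a
        waste : ∀ {a b c} → 0ℚ ≤ c → 0ℚ ≤ b → (1ℚ - e) * c ≤ a → e * (c * b) ≤ (e + e) * (a * b)
        waste {a} {b} {c} 0≤c 0≤b p = lin≤ ((0≤* 0≤e 0≤b ⊛ p) ⊕ (0≤* 0≤e 0≤b ⊛ p) ⊕ (0≤* (0≤* 0≤e 0≤b) 0≤c ⊛ e3≤1) ⊕ 0≤* (0≤* (0≤* 0≤e 0≤b) 0≤c) 0≤e) (ring-87 a b c e)

    TC : ℚ → ℚ → List Item → ℕ → Set
    TC a b S k = ∃ λ S′ → ∃ λ B → Split S S′ B × card B ≤ (e + e + e) * card S + ⟦ k ℕ.* dropBound ⟧ ×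
      Σ (CTree ea w h a b S′) λ T → leaves T ℕ.≤ k ℕ.* suc leafC × used T ≤ sum area S + (e + e) * (a * b)

    private
      onceˡ : ∀ {S A B : List Item} → Split S A B → Once S → Once A
      onceˡ {S} {A} {B} s o i = ≤-trans (lin≤ (sum-nonneg (ind-nonneg (_≟I i)) B) (ring-3 (sum (ind (_≟I i)) A) (sum (ind (_≟I i)) B))) (≤-trans (≤-reflexive (sym (s (ind (_≟I i))))) (o i))
      onceʳ : ∀ {S A B : List Item} → Split S A B → Once S → Once B
      onceʳ {S} {A} {B} s = onceˡ {S} {B} {A} (split-swap {S = S} {A} {B} s)

      one* : ∀ k → k ≡ 1 ℕ.* k
      one* k = sym (ℕₚ.+-identityʳ k)

      joinSplit : ∀ {S A B A′ X B′ Y : List Item} → Split S A B → Split A A′ X → Split B B′ Y → Split S (A′ ++ B′) (X ++ Y)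
      joinSplit {S} {A} {B} {A′} {X} {B′} {Y} s p q f = trans (s f) (trans (cong₂ _+_ (p f) (q f)) (trans (ring-31 (sum f A′) (sum f X) (sum f B′) (sum f Y))
          (sym (cong₂ _+_ (sum-++ f A′ B′) (sum-++ f X Y)))))

      joinCard : ∀ {S A B X Y : List Item} k₁ k₂ → Split S A B → card X ≤ (e + e + e) * card A + ⟦ k₁ ℕ.* dropBound ⟧ → card Y ≤ (e + e + e) * card B + ⟦ k₂ ℕ.* dropBound ⟧ →
        card (X ++ Y) ≤ (e + e + e) * card S + ⟦ suc (k₁ ℕ.+ k₂) ℕ.* dropBound ⟧
      joinCard {S} {A} {B} {X} {Y} k₁ k₂ s p q = ≤-trans (≤-reflexive (sum-++ _ X Y))
        (lin≤ (p ⊕ q ⊕ 0≤⟦⟧ dropBound) (trans (cong₂ (λ u v → ((e + e + e) * u + v) - (card X + card Y)) (s _) kk) (l (e + e + e) (card A) (card B) ⟦ k₁ ℕ.* dropBound ⟧ ⟦ k₂ ℕ.* dropBound ⟧ ⟦ dropBound ⟧ (card X + card Y) (card X) (card Y) refl)))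
        where
        kk : ⟦ suc (k₁ ℕ.+ k₂) ℕ.* dropBound ⟧ ≡ ⟦ dropBound ⟧ + (⟦ k₁ ℕ.* dropBound ⟧ + ⟦ k₂ ℕ.* dropBound ⟧)
        kk = trans (⟦⟧-+ dropBound _) (cong (_+_ ⟦ dropBound ⟧) (trans (cong ⟦_⟧ (ℕₚ.*-distribʳ-+ dropBound k₁ k₂)) (⟦⟧-+ (k₁ ℕ.* dropBound) (k₂ ℕ.* dropBound))))
        abstract
          l : ∀ e a b k k′ n z x y → z ≡ x + y → (e * (a + b) + (n + (k + k′))) - z ≡ ((e * a + k) + ((e * b + k′) + n)) - (x + (y + 0ℚ))
          l e a b k k′ n z x y refl = ring-88 e a b k k′ n x y

      joinLeaves : ∀ {x y} k₁ k₂ → x ℕ.≤ k₁ ℕ.* suc leafC → y ℕ.≤ k₂ ℕ.* suc leafC → suc (x ℕ.+ y) ℕ.≤ suc (k₁ ℕ.+ k₂) ℕ.* suc leafC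
      joinLeaves {x} {y} k₁ k₂ p q = ℕ.s≤s (ℕₚ.≤-trans (ℕₚ.+-mono-≤ p q) (ℕₚ.≤-trans (ℕₚ.≤-reflexive (sym (ℕₚ.*-distribʳ-+ (suc leafC) k₁ k₂))) (ℕₚ.m≤n+m _ leafC)))

    -- The wasted area of a box is proportional to its own area, so all boxes together waste at most
    -- 2 e times the whole, however many there are. Only the number of leaves and the additive part
    -- of the dropped items grow with the number of boxes.
    toC : ∀ {a b S} → 0ℚ ≤ a → 0ℚ ≤ b → a ≤ ⟦ D ⟧ * d → b ≤ ⟦ D ⟧ * d → Once S → (T : BTree w h d e a b S) → TC a b S (bl T)
    toC {a} {b} 0≤a 0≤b a≤ b≤ o (bfree refl) = [] , [] , (λ _ → refl) , ≤-trans (0≤⟦⟧ (1 ℕ.* dropBound)) (≤-reflexive (ring-71 (e + e + e) _)) , free refl , ℕ.s≤s ℕ.z≤n ,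
        ≤-trans (0≤* (0≤+ 0≤e 0≤e) (0≤* 0≤a 0≤b)) (≤-reflexive (sym (+-identityˡ _)))
    toC {a} {b} {S} 0≤a 0≤b a≤ b≤ o (bv {c} 0≤c P al p) =
      let (S′ , B , s , cB , T , lv , us) = vbox w h w>0 h>0 0≤c 0≤b 0<d b≤ P al o
          (T′ , lv′ , us′) = extendV (0≤* 0≤1-e 0≤c) p T
      in S′ , B , s , ≤-trans cB (≤-reflexive (cong (λ z → (e + e + e) * card S + ⟦ z ⟧) (one* dropBound))) , T′ ,
         ℕₚ.≤-trans (ℕₚ.≤-reflexive lv′) (ℕₚ.≤-trans (ℕ.s≤s lv) (ℕₚ.≤-trans (ℕₚ.n≤1+n leafC) (ℕₚ.≤-reflexive (one* (suc leafC))))) ,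
         ≤-trans (≤-reflexive us′) (≤-trans us (≤-refl {sum area S} ⊕ waste 0≤c 0≤b p))
    toC {a} {b} {S} 0≤a 0≤b a≤ b≤ o (bh {c} 0≤c P al p) =
      let (S′ , B , s , cB , T , lv , us) = vbox h w h>0 w>0 0≤c 0≤a 0<d a≤ (transposeP P) al o
          (T′ , lv′ , us′) = extendH (0≤* 0≤1-e 0≤c) p (transposeC T)
      in S′ , B , s , ≤-trans cB (≤-reflexive (cong (λ z → (e + e + e) * card S + ⟦ z ⟧) (one* dropBound))) , T′ ,
         ℕₚ.≤-trans (ℕₚ.≤-reflexive (trans lv′ (cong suc (leaves-transposeC T)))) (ℕₚ.≤-trans (ℕ.s≤s lv) (ℕₚ.≤-trans (ℕₚ.n≤1+n leafC) (ℕₚ.≤-reflexive (one* (suc leafC))))) ,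
         ≤-trans (≤-reflexive (trans us′ (used-transposeC T))) (≤-trans us (≤-reflexive (swapA S) ⊕ ≤-trans (waste 0≤c 0≤a p) (≤-reflexive (cong ((e + e) *_) (*-comm b a)))))
      where
      swapA : ∀ S → sum (λ i → h i * w i) S ≡ sum area S
      swapA [] = refl
      swapA (i ∷ S) = cong₂ _+_ (*-comm (h i) (w i)) (swapA S)
    toC {a} {b} {S} 0≤a 0≤b a≤ b≤ o (bvs {a₁} {a₂} {A} {B} 0≤a₁ 0≤a₂ le s T₁ T₂) =
      let (A′ , X , s₁ , c₁ , U₁ , lv₁ , us₁) = toC 0≤a₁ 0≤b (≤-trans (≤-trans (lin≤ 0≤a₂ (ring-3 a₁ a₂)) le) a≤) b≤ (onceˡ {S} {A} {B} s o) T₁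
          (B′ , Y , s₂ , c₂ , U₂ , lv₂ , us₂) = toC 0≤a₂ 0≤b (≤-trans (≤-trans (lin≤ 0≤a₁ (ring-7 a₁ a₂)) le) a≤) b≤ (onceʳ {S} {A} {B} s o) T₂
          (T , lv , us) = extendV (0≤+ 0≤a₁ 0≤a₂) le (vs 0≤a₁ 0≤a₂ refl (split-++ A′ B′) U₁ U₂)
      in A′ ++ B′ , X ++ Y , joinSplit {S} {A} {B} {A′} {X} {B′} {Y} s s₁ s₂ , joinCard {S} {A} {B} {X} {Y} (bl T₁) (bl T₂) s c₁ c₂ , T ,
         ℕₚ.≤-trans (ℕₚ.≤-reflexive lv) (joinLeaves (bl T₁) (bl T₂) lv₁ lv₂) ,
         ≤-trans (≤-reflexive us) (lin≤ (us₁ ⊕ us₂ ⊕ (0≤* (0≤+ 0≤e 0≤e) 0≤b ⊛ le)) (trans (cong (λ z → (z + (e + e) * (a * b)) - (used U₁ + used U₂)) (s area)) (ring-89 e a b a₁ a₂ (sum area A) (sum area B) (used U₁) (used U₂))))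
    toC {a} {b} {S} 0≤a 0≤b a≤ b≤ o (bhs {b₁} {b₂} {A} {B} 0≤b₁ 0≤b₂ le s T₁ T₂) =
      let (A′ , X , s₁ , c₁ , U₁ , lv₁ , us₁) = toC 0≤a 0≤b₁ a≤ (≤-trans (≤-trans (lin≤ 0≤b₂ (ring-3 b₁ b₂)) le) b≤) (onceˡ {S} {A} {B} s o) T₁
          (B′ , Y , s₂ , c₂ , U₂ , lv₂ , us₂) = toC 0≤a 0≤b₂ a≤ (≤-trans (≤-trans (lin≤ 0≤b₁ (ring-7 b₁ b₂)) le) b≤) (onceʳ {S} {A} {B} s o) T₂
          (T , lv , us) = extendH (0≤+ 0≤b₁ 0≤b₂) le (hs 0≤b₁ 0≤b₂ refl (split-++ A′ B′) U₁ U₂)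
      in A′ ++ B′ , X ++ Y , joinSplit {S} {A} {B} {A′} {X} {B′} {Y} s s₁ s₂ , joinCard {S} {A} {B} {X} {Y} (bl T₁) (bl T₂) s c₁ c₂ , T ,
         ℕₚ.≤-trans (ℕₚ.≤-reflexive lv) (joinLeaves (bl T₁) (bl T₂) lv₁ lv₂) ,
         ≤-trans (≤-reflexive us) (lin≤ (us₁ ⊕ us₂ ⊕ (0≤* (0≤+ 0≤e 0≤e) 0≤a ⊛ le)) (trans (cong (λ z → (z + (e + e) * (a * b)) - (used U₁ + used U₂)) (s area)) (ring-90 e a b b₁ b₂ (sum area A) (sum area B) (used U₁) (used U₂))))

-- Corners of runs, and shifting strips within a given slack

module DecoratedRuns where

  open Packings
  open Counting
  open PeelingRuns
  open BoxTrees

  module _ {Item : Set} where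

    -- Stricter than `Stop`: a strip of the other kind is excluded. The corner is cut off in one
    -- direction only, so nothing else can end it.
    VStop HStop : ∀ {w h : Item → ℚ} {d a b a′ b′} → ℚ → Peels w h d a b a′ b′ → Set
    VStop k [] = ⊤
    VStop k (pv {c = c} _ _ _ _ _) = k < c
    VStop k (ph _ _ _ _ _) = ⊥
    HStop k [] = ⊤
    HStop k (pv _ _ _ _ _) = ⊥
    HStop k (ph {c = c} _ _ _ _ _) = k < c

    -- A run of peels is divided into an outer part F, a part G to be dropped, and
    -- the rest R.  The strips of tall items in Fx and those of wide items in Fy
    -- form the corner.
    record Deco (w h : Item → ℚ) (d k₁ k₂ η a b a′ b′ : ℚ) : Set where
      field
        {am₁ bm₁ am₂ bm₂ ax bx ay by} : ℚ
        F   : Peels w h d a b am₁ bm₁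
        G   : Peels w h d am₁ bm₁ am₂ bm₂
        R   : Peels w h d am₂ bm₂ a′ b′
        Fx  : Peels w h d a b ax bx
        Fx′ : Peels w h d ax bx am₁ bm₁
        Fy  : Peels w h d a b ay by
        Fy′ : Peels w h d ay by am₁ bm₁
        F-x : a - am₁ ≤ k₁
        F-y : b - bm₁ ≤ k₁
        stopR : Stop (k₂ - (a - am₂)) (k₂ - (b - bm₂)) R
        Fx≤ : a - ax ≤ η * (a - am₁)
        Fy≤ : b - by ≤ η * (b - bm₁)
        stopX : VStop (η * (a - am₁) - (a - ax)) Fx′
        stopY : HStop (η * (b - bm₁) - (b - by)) Fy′
        vFx : ∀ f → sum f (vI F) ≡ sum f (vI Fx) + sum f (vI Fx′)
        hFx : ∀ f → sum f (hI F) ≡ sum f (hI Fx) + sum f (hI Fx′)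
        vFy : ∀ f → sum f (vI F) ≡ sum f (vI Fy) + sum f (vI Fy′)
        hFy : ∀ f → sum f (hI F) ≡ sum f (hI Fy) + sum f (hI Fy′)

    transposeD : ∀ {w h d k₁ k₂ η a b a′ b′} → Deco w h d k₁ k₂ η a b a′ b′ → Deco h w d k₁ k₂ η b a b′ a′
    transposeD {w} {h} {d} D = record
      { F = transposeS F ; G = transposeS G ; R = transposeS R ; Fx = transposeS Fy ; Fx′ = transposeS Fy′ ; Fy = transposeS Fx ; Fy′ = transposeS Fx′
      ; F-x = F-y ; F-y = F-x ; stopR = stop R stopR ; Fx≤ = Fy≤ ; Fy≤ = Fx≤ ; stopX = h→v Fy′ stopY ; stopY = v→h Fx′ stopX
      ; vFx = λ f → conv₂ f F Fy Fy′ (hFy f) ; hFx = λ f → conv₁ f F Fy Fy′ (vFy f)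
      ; vFy = λ f → conv₂ f F Fx Fx′ (hFx f) ; hFy = λ f → conv₁ f F Fx Fx′ (vFx f) }
      where
      open Deco D
      stop : ∀ {a b a′ b′ kx ky} (p : Peels w h d a b a′ b′) → Stop kx ky p → Stop ky kx (transposeS p)
      stop [] s = s
      stop (pv _ _ _ _ _) s = s
      stop (ph _ _ _ _ _) s = s
      h→v : ∀ {a b a′ b′ k} (p : Peels w h d a b a′ b′) → HStop k p → VStop k (transposeS p)
      h→v [] s = s
      h→v (ph _ _ _ _ _) s = s
      v→h : ∀ {a b a′ b′ k} (p : Peels w h d a b a′ b′) → VStop k p → HStop k (transposeS p)
      v→h [] s = s
      v→h (pv _ _ _ _ _) s = s
      conv₁ : ∀ f {a b a′ b′ x y u v x′ y′ u′ v′} (p : Peels w h d a b a′ b′) (q : Peels w h d x y u v) (r : Peels w h d x′ y′ u′ v′) →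
        sum f (vI p) ≡ sum f (vI q) + sum f (vI r) → sum f (hI (transposeS p)) ≡ sum f (hI (transposeS q)) + sum f (hI (transposeS r))
      conv₁ f p q r e = trans (cong (sum f) (hI-transposeS p)) (trans e (sym (cong₂ _+_ (cong (sum f) (hI-transposeS q)) (cong (sum f) (hI-transposeS r)))))
      conv₂ : ∀ f {a b a′ b′ x y u v x′ y′ u′ v′} (p : Peels w h d a b a′ b′) (q : Peels w h d x y u v) (r : Peels w h d x′ y′ u′ v′) →
        sum f (hI p) ≡ sum f (hI q) + sum f (hI r) → sum f (vI (transposeS p)) ≡ sum f (vI (transposeS q)) + sum f (vI (transposeS r))
      conv₂ f p q r e = trans (cong (sum f) (vI-transposeS p)) (trans e (sym (cong₂ _+_ (cong (sum f) (vI-transposeS q)) (cong (sum f) (vI-transposeS r)))))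

    mutual
      data DRun (w h : Item → ℚ) (d k₁ k₂ η a b : ℚ) : Set where
        run : ∀ {a′ b′} → d < a → d < b → Deco w h d k₁ k₂ η a b a′ b′ → DEnd w h d k₁ k₂ η a′ b′ → DRun w h d k₁ k₂ η a b

      data DEnd (w h : Item → ℚ) (d k₁ k₂ η a b : ℚ) : Set where
        term : 0ℚ ≤ a → 0ℚ ≤ b → DEnd w h d k₁ k₂ η a b
        vbr  : ∀ {a₁ a₂} → a₁ + a₂ ≤ a → DRun w h d k₁ k₂ η a₁ b → DRun w h d k₁ k₂ η a₂ b → DEnd w h d k₁ k₂ η a b
        hbr  : ∀ {b₁ b₂} → b₁ + b₂ ≤ b → DRun w h d k₁ k₂ η a b₁ → DRun w h d k₁ k₂ η a b₂ → DEnd w h d k₁ k₂ η a b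

    mutual
      transposeDR : ∀ {w h d k₁ k₂ η a b} → DRun w h d k₁ k₂ η a b → DRun h w d k₁ k₂ η b a
      transposeDR (run p q s e) = run q p (transposeD s) (transposeDE e)
      transposeDE : ∀ {w h d k₁ k₂ η a b} → DEnd w h d k₁ k₂ η a b → DEnd h w d k₁ k₂ η b a
      transposeDE (term p q) = term q p
      transposeDE (vbr p q r) = hbr p (transposeDR q) (transposeDR r)
      transposeDE (hbr p q r) = vbr p (transposeDR q) (transposeDR r)

    mutual
      druns : ∀ {w h d k₁ k₂ η a b} → DRun w h d k₁ k₂ η a b → ℕ
      druns (run _ _ _ e) = suc (drunsE e)
      drunsE : ∀ {w h d k₁ k₂ η a b} → DEnd w h d k₁ k₂ η a b → ℕ
      drunsE (term _ _) = 0
      drunsE (vbr _ p q) = druns p ℕ.+ druns q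
      drunsE (hbr _ p q) = druns p ℕ.+ druns q

    Selector : Set
    Selector = ∀ {w h d k₁ k₂ η a b a′ b′} → (f : Item → ℚ) → Deco w h d k₁ k₂ η a b a′ b′ → ℚ

    -- weights of the corner strips and of the other strips
    vc hc vr hr gg : Selector
    vc f D = sum f (vI (Deco.Fx D))
    hc f D = sum f (hI (Deco.Fy D))
    vr f D = sum f (vI (Deco.Fx′ D)) + sum f (vI (Deco.R D))
    hr f D = sum f (hI (Deco.Fy′ D)) + sum f (hI (Deco.R D))
    gg f D = sum f (vI (Deco.G D)) + sum f (hI (Deco.G D))

    mutual
      total : Selector → ∀ {w h d k₁ k₂ η a b} → (Item → ℚ) → DRun w h d k₁ k₂ η a b → ℚ
      total s f (run _ _ D e) = s f D + totalE s f e
      totalE : Selector → ∀ {w h d k₁ k₂ η a b} → (Item → ℚ) → DEnd w h d k₁ k₂ η a b → ℚ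
      totalE s f (term _ _) = 0ℚ
      totalE s f (vbr _ p q) = total s f p + total s f q
      totalE s f (hbr _ p q) = total s f p + total s f q

    mutual
      total-transpose : (s s′ : Selector) → (∀ {w h d k₁ k₂ η a b a′ b′} f (D : Deco w h d k₁ k₂ η a b a′ b′) → s f (transposeD D) ≡ s′ f D) →
        ∀ {w h d k₁ k₂ η a b} f (R : DRun w h d k₁ k₂ η a b) → total s f (transposeDR R) ≡ total s′ f R
      total-transpose s s′ eq f (run _ _ D e) = cong₂ _+_ (eq f D) (total-transposeE s s′ eq f e)
      total-transposeE : (s s′ : Selector) → (∀ {w h d k₁ k₂ η a b a′ b′} f (D : Deco w h d k₁ k₂ η a b a′ b′) → s f (transposeD D) ≡ s′ f D) →
        ∀ {w h d k₁ k₂ η a b} f (R : DEnd w h d k₁ k₂ η a b) → totalE s f (transposeDE R) ≡ totalE s′ f R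
      total-transposeE s s′ eq f (term _ _) = refl
      total-transposeE s s′ eq f (vbr _ p q) = cong₂ _+_ (total-transpose s s′ eq f p) (total-transpose s s′ eq f q)
      total-transposeE s s′ eq f (hbr _ p q) = cong₂ _+_ (total-transpose s s′ eq f p) (total-transpose s s′ eq f q)

    druns-transpose : ∀ {w h d k₁ k₂ η a b} (R : DRun w h d k₁ k₂ η a b) → druns (transposeDR R) ≡ druns R
    druns-transposeE : ∀ {w h d k₁ k₂ η a b} (R : DEnd w h d k₁ k₂ η a b) → drunsE (transposeDE R) ≡ drunsE R
    druns-transpose (run _ _ _ e) = cong suc (druns-transposeE e)
    druns-transposeE (term _ _) = refl
    druns-transposeE (vbr _ p q) = cong₂ ℕ._+_ (druns-transpose p) (druns-transpose q)
    druns-transposeE (hbr _ p q) = cong₂ ℕ._+_ (druns-transpose p) (druns-transpose q)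

    vc-transpose : ∀ {w h d k₁ k₂ η a b a′ b′} f (D : Deco w h d k₁ k₂ η a b a′ b′) → vc f (transposeD D) ≡ hc f D
    vc-transpose f D = cong (sum f) (vI-transposeS (Deco.Fy D))
    hc-transpose : ∀ {w h d k₁ k₂ η a b a′ b′} f (D : Deco w h d k₁ k₂ η a b a′ b′) → hc f (transposeD D) ≡ vc f D
    hc-transpose f D = cong (sum f) (hI-transposeS (Deco.Fx D))
    vr-transpose : ∀ {w h d k₁ k₂ η a b a′ b′} f (D : Deco w h d k₁ k₂ η a b a′ b′) → vr f (transposeD D) ≡ hr f D
    vr-transpose f D = cong₂ _+_ (cong (sum f) (vI-transposeS (Deco.Fy′ D))) (cong (sum f) (vI-transposeS (Deco.R D)))
    hr-transpose : ∀ {w h d k₁ k₂ η a b a′ b′} f (D : Deco w h d k₁ k₂ η a b a′ b′) → hr f (transposeD D) ≡ vr f D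
    hr-transpose f D = cong₂ _+_ (cong (sum f) (hI-transposeS (Deco.Fx′ D))) (cong (sum f) (hI-transposeS (Deco.R D)))

    module Shift (w h : Item → ℚ) (d e : ℚ) (0≤e : 0ℚ ≤ e) (0≤1-e : 0ℚ ≤ 1ℚ - e) where

      BT : ℚ → ℚ → List Item → Set
      BT = BTree w h d e

      abstract
        shrink : ∀ {c} → 0ℚ ≤ c → (1ℚ - e) * c ≤ c
        shrink {c} p = lin≤ (0≤* 0≤e p) (ring-95 e c)

      -- one stage: the strips of tall items are moved in front of the strips of wide items
      stage : ∀ {A B Am Bm Δ S} → 0ℚ ≤ Δ → 0ℚ ≤ Am → 0ℚ ≤ Bm → (p : Peels w h d A B Am Bm) → A - Am ≤ Δ → (T : BT (Am + Δ) Bm S) →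
        Σ (BT (A + Δ) B (vI p ++ (hI p ++ S))) λ T′ → bl T′ ≡ 4 ℕ.+ bl T
      stage {A} {B} {Am} {Bm} {Δ} {S} 0≤Δ 0≤Am 0≤Bm p x≤ T =
        bvs {S₁ = vI p} {S₂ = hI p ++ S} (≤⇒0≤ (a′≤a p)) (0≤+ 0≤Am 0≤Δ) (≤-reflexive (ring-96 A Am Δ)) (split-++ (vI p) (hI p ++ S))
          (bv (≤⇒0≤ (a′≤a p)) (vPack p) (vAll p) (shrink (≤⇒0≤ (a′≤a p))))
          (bhs {S₁ = hI p} {S₂ = S} (≤⇒0≤ (b′≤b p)) 0≤Bm (≤-reflexive (ring-97 B Bm)) (split-++ (hI p) S)
            -- The wide strips of the stage may be as wide as `A`. Behind the tall ones the width
            -- `Am + Δ` is left, which is at least `A` because the stage has consumed at most `Δ`.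
            (bh (≤⇒0≤ (b′≤b p)) (widen (lin≤ x≤ (ring-98 A Am Δ)) ≤-refl (hPack p)) (hAll p) (shrink (≤⇒0≤ (b′≤b p))))
            T) , refl

      ShiftResult : ∀ {A B A′ B′} → ℕ → Peels w h d A B A′ B′ → ℚ → List Item → ℕ → Set
      ShiftResult {A} {B} m Q Δ Sin k = ∃ λ S → (∀ f → sum f S ≡ sum f (vI Q) + (sum f (hI Q) + sum f Sin)) ×
        Σ (BT (A + Δ) B S) λ T → bl T ℕ.≤ suc m ℕ.* 6 ℕ.+ k

      mutual
        -- A stage ends at a tall strip that would exceed the slack, so the stage and this strip
        -- together consume more than `Δ`; after at most `m` such steps the whole width is used up.
        -- A stage adds four nodes, and the strip, which becomes a box of its own, adds two.
        shift : ∀ m {A B A′ B′ Δ Sin} → 0ℚ ≤ Δ → 0ℚ ≤ A′ → 0ℚ ≤ B′ → (Q : Peels w h d A B A′ B′) → A - A′ ≤ ⟦ m ⟧ * Δ →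
          (T : BT (A′ + Δ) B′ Sin) → ShiftResult m Q Δ Sin (bl T)
        shift m {A} {B} {A′} {B′} {Δ} {Sin} 0≤Δ 0≤A′ 0≤B′ Q A≤ T =
          -- The vertical limit `B - B′` is the whole height of the run, so only the horizontal
          -- limit can stop the cut.
          let C = cut Δ (B - B′) 0≤Δ (≤⇒0≤ (b′≤b Q)) Q
              open Cut C
              (S , eq , T′ , b≤) = shiftPost m 0≤Δ 0≤A′ 0≤B′ pre post x≤ stop A≤ T
          in S , (λ f → trans (eq f) (sym (cong₂ (λ u v → sum f u + (sum f v + sum f Sin)) veq heq))) , T′ , b≤

        shiftPost : ∀ m {A B Am Bm A′ B′ Δ Sin} → 0ℚ ≤ Δ → 0ℚ ≤ A′ → 0ℚ ≤ B′ → (pre : Peels w h d A B Am Bm) (post : Peels w h d Am Bm A′ B′) → A - Am ≤ Δ →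
          Stop (Δ - (A - Am)) ((B - B′) - (B - Bm)) post → A - A′ ≤ ⟦ m ⟧ * Δ → (T : BT (A′ + Δ) B′ Sin) →
          ∃ λ S → (∀ f → sum f S ≡ sum f (vI pre ++ vI post) + (sum f (hI pre ++ hI post) + sum f Sin)) ×
            Σ (BT (A + Δ) B S) λ T′ → bl T′ ℕ.≤ suc m ℕ.* 6 ℕ.+ bl T
        shiftPost m {Sin = Sin} 0≤Δ 0≤A′ 0≤B′ pre [] x≤ _ A≤ T = let (T′ , b≡) = stage 0≤Δ 0≤A′ 0≤B′ pre x≤ T in
          vI pre ++ (hI pre ++ Sin) , eq , T′ ,
          ℕₚ.≤-trans (ℕₚ.≤-reflexive b≡) (ℕₚ.+-monoˡ-≤ (bl T) (ℕₚ.≤-trans (ℕ.s≤s (ℕ.s≤s (ℕ.s≤s (ℕ.s≤s ℕ.z≤n)))) (ℕₚ.m≤m+n 6 (m ℕ.* 6))))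
          where
          eq : ∀ f → sum f (vI pre ++ (hI pre ++ Sin)) ≡ sum f (vI pre ++ []) + (sum f (hI pre ++ []) + sum f Sin)
          eq f = trans (sum-++ f (vI pre) _) (cong₂ _+_ (sym (trans (sum-++ f (vI pre) []) (+-identityʳ (sum f (vI pre)))))
                   (trans (sum-++ f (hI pre) Sin) (cong (_+ sum f Sin) (sym (trans (sum-++ f (hI pre) []) (+-identityʳ (sum f (hI pre))))))))
        shiftPost m {A} {B} {Am} {Bm} {A′} {B′} {Δ} 0≤Δ 0≤A′ 0≤B′ pre (ph {b = b₂} {c = c} p q r e t) x≤ st A≤ T =
          ⊥-elim (<⇒≱ st (lin≤ (b′≤b t) (trans (cong (λ z → ((B - B′) - (B - z)) - c) e) (ring-91 B B′ b₂ c))))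
        -- The stage and the strip would be wider than `Δ`, but for m = 0 the run consumes no width
        -- at all.
        shiftPost zero {A} {B} {Am} {Bm} {A′} {B′} {Δ} 0≤Δ 0≤A′ 0≤B′ pre (pv {a = A₂} {c = c} p q r e t) x≤ st A≤ T =
          ⊥-elim (<⇒≱ st (lin≤ (A≤ ⊕ a′≤a t ⊕ 0≤Δ) (trans (cong (λ z → (Δ - (A - z)) - c) e) (ring-92 A A′ A₂ c Δ))))
        shiftPost (suc m) {A} {B} {Am} {Bm} {A′} {B′} {Δ} {Sin} 0≤Δ 0≤A′ 0≤B′ pre (pv {a = A₂} {c = c} {S = Sc} p q r e t) x≤ st A≤ T =
          let (S₂ , eq₂ , T₂ , b₂) = shift m 0≤Δ 0≤A′ 0≤B′ t (lin≤ (A≤ ⊕ <⇒≤ st) (trans (ring-93 A A′ A₂ c Δ ⟦ m ⟧) (cong (λ z → (((1ℚ + ⟦ m ⟧) * Δ) + c) - ((A - A′) + (Δ - (A - z)))) (sym e)))) T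
              0≤A₂ = ≤-trans 0≤A′ (a′≤a t)
              T₁ = bvs {S₁ = Sc} {S₂ = S₂} p (0≤+ 0≤A₂ 0≤Δ) (≤-reflexive (trans (sym (+-assoc c A₂ Δ)) (cong (_+ Δ) (sym e)))) (split-++ Sc S₂) (bv p q r (shrink p)) T₂
              (T′ , b≡) = stage {S = Sc ++ S₂} 0≤Δ (≤-trans 0≤A₂ (+-≥ˡ {Item} e p)) (≤-trans 0≤B′ (b′≤b t)) pre x≤ T₁
          in vI pre ++ (hI pre ++ (Sc ++ S₂)) , eq S₂ eq₂ , T′ ,
             ℕₚ.≤-trans (ℕₚ.≤-reflexive b≡) (ℕₚ.+-monoʳ-≤ 6 b₂)
          where
          eq : ∀ S₂ → (∀ f → sum f S₂ ≡ sum f (vI t) + (sum f (hI t) + sum f Sin)) → ∀ f →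
            sum f (vI pre ++ (hI pre ++ (Sc ++ S₂))) ≡ sum f (vI pre ++ (Sc ++ vI t)) + (sum f (hI pre ++ hI t) + sum f Sin)
          eq S₂ eq₂ f = trans (sum-++ f (vI pre) _) (trans (cong (_+_ (sum f (vI pre))) (trans (sum-++ f (hI pre) _) (cong (_+_ (sum f (hI pre))) (trans (sum-++ f Sc S₂) (cong (_+_ (sum f Sc)) (eq₂ f))))))
            (trans (ring-94 (sum f (vI pre)) (sum f (hI pre)) (sum f Sc) (sum f (vI t)) (sum f (hI t)) (sum f Sin))
              (sym (cong₂ _+_ (trans (sum-++ f (vI pre) (Sc ++ vI t)) (cong (_+_ (sum f (vI pre))) (sum-++ f Sc (vI t)))) (cong (_+ sum f Sin) (sum-++ f (hI pre) (hI t)))))))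

-- Everything except the tall corner items and the dropped depth range

module WithoutCorner where

  open Packings
  open Counting
  open TallBoxes
  open PeelingRuns
  open BoxTrees
  open DecoratedRuns

  -- The strips at a depth between k₁ and k₂ are dropped; T bounds the number of runs.
  record DepthParams (bp : BoxParams) : Set where
    open BoxParams bp
    field
      d N k₁ k₂ η κ : ℚ
      m₁ m₂ T : ℕ
      0<d : 0ℚ < d
      N≤ : N ≤ ⟦ D ⟧ * d
      0≤N : 0ℚ ≤ N
      e≤1 : e ≤ 1ℚ
      0≤k₁ : 0ℚ ≤ k₁
      k₁≤k₂ : k₁ ≤ k₂
      0≤η : 0ℚ ≤ η
      -- The width gained from room and tall strips that reach from a depth of at most `k₁` beyond
      -- depth `k₂`, when the strips are shrunk by the factor 1 - e.
      κ≡ : κ ≡ e * (k₂ - k₁)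
      k₂+κ≤d : k₂ + κ ≤ d
      -- Stacked on top of each other, the wide strips of a corner are at most `⟦ D ⟧ * η` times as
      -- high as the outer part. Twice this height must fit into the outer part itself, and by `η₂`
      -- also into the depth `k₂`.
      η₁ : ⟦ D ⟧ * η + ⟦ D ⟧ * η ≤ 1ℚ
      η₂ : (⟦ D ⟧ * η + ⟦ D ⟧ * η) * N ≤ k₂
      η₃ : ⟦ D ⟧ * η ≤ e
      hm₁ : 1ℚ ≤ ⟦ m₁ ⟧ * (e * η)
      hm₂ : N ≤ ⟦ m₂ ⟧ * (e * (k₂ - k₁))
      -- The tall strips of the outer parts of all runs, put side by side, fit into `κ`.
      Tk₁ : ⟦ T ⟧ * (⟦ D ⟧ * k₁) ≤ κ
      κ≤N : κ + κ ≤ N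
      κ≤e : κ ≤ e * N

  module _ {Item : Set} where

    -- A strip p of tall items, shrunk by the factor 1 - e, together with the room x in
    -- front of it, provides the slack for shifting all later strips.
    stepV : ∀ {w h : Item → ℚ} {d e x c A₂ B a′ b′ Sc Sin} m → 0ℚ ≤ e → 0ℚ ≤ 1ℚ - e → 0ℚ ≤ x → 0ℚ ≤ c → 0ℚ ≤ a′ → 0ℚ ≤ b′ →
      Pack w h c B Sc → All (λ i → d ≤ h i) Sc → (t : Peels w h d A₂ B a′ b′) → A₂ - a′ ≤ ⟦ m ⟧ * (x + e * c) → (T : BTree w h d e a′ b′ Sin) →
      ∃ λ S → (∀ f → sum f S ≡ sum f Sc + (sum f (vI t) + (sum f (hI t) + sum f Sin))) ×
        Σ (BTree w h d e (x + (c + A₂)) B S) λ T′ → bl T′ ℕ.≤ 2 ℕ.+ (suc m ℕ.* 6 ℕ.+ bl T)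
    stepV {w} {h} {d} {e} {x} {c} {A₂} {B} {a′} {b′} {Sc} m 0≤e 0≤1-e 0≤x 0≤c 0≤a′ 0≤b′ P al t A≤ T =
      let Δ = x + e * c
          0≤Δ = 0≤+ 0≤x (0≤* 0≤e 0≤c)
          (T₁ , b₁) = widenB (lin≤ 0≤Δ (ring-3 a′ Δ)) ≤-refl T
          (S , eq , T₂ , b₂) = Shift.shift w h d e 0≤e 0≤1-e m 0≤Δ 0≤a′ 0≤b′ t A≤ T₁
      in Sc ++ S , (λ f → trans (sum-++ f Sc S) (cong (_+_ (sum f Sc)) (eq f))) ,
         bvs (0≤* 0≤1-e 0≤c) (0≤+ (≤-trans 0≤a′ (a′≤a t)) 0≤Δ) (≤-reflexive (ring-110 e x c A₂)) (split-++ Sc S) (bv 0≤c P al ≤-refl) T₂ ,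
         ℕ.s≤s (ℕ.s≤s (ℕₚ.≤-trans b₂ (ℕₚ.≤-reflexive (cong (suc m ℕ.* 6 ℕ.+_) b₁))))

    module BV (w h : Item → ℚ) {bp : BoxParams} (dp : DepthParams bp) where

      open BoxParams bp using (e; 0<e)
      open DepthParams dp

      private
        0≤d : 0ℚ ≤ d
        0≤d = <⇒≤ 0<d
        0≤e : 0ℚ ≤ e
        0≤e = <⇒≤ 0<e
        0≤1-e : 0ℚ ≤ 1ℚ - e
        0≤1-e = ≤⇒0≤ e≤1
        BT : ℚ → ℚ → List Item → Set
        BT = BTree w h d e

      K′ KB : ℕ
      K′ = (2 ℕ.+ suc m₁ ℕ.* 6) ℕ.+ (2 ℕ.+ (2 ℕ.+ suc m₂ ℕ.* 6))
      KB = suc K′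

      abstract
        -- At most `k₁` of depth precedes the room `x`, and the strip `c` behind it ends beyond
        -- `k₂`, so x + c exceeds k₂ - k₁. Shrinking alone turns this into the slack e (k₂ - k₁), of
        -- which `m₂` copies cover the knapsack.
        slackR : ∀ {xF x c A a} → 0ℚ ≤ c → xF ≤ k₁ → k₂ - (xF + x) < c → A - a ≤ N → 0ℚ ≤ x → A - a ≤ ⟦ m₂ ⟧ * (x + e * c)
        slackR {xF} {x} {c} {A} {a} 0≤c p q r 0≤x = ≤-trans r (≤-trans hm₂ (0≤⟦⟧ m₂ ⊛ lin≤ ((0≤e ⊛ <⇒≤ q) ⊕ (0≤e ⊛ p) ⊕ (0≤x ⊛ e≤1)) (ring-105 e x c xF k₁ k₂)))

      -- the tree of the part after F, in the box where F ends
      restTree : ∀ {a b a′ b′ am₁ bm₁ am₂ bm₂ Sin} → a ≤ N → b ≤ N → 0ℚ ≤ a′ → 0ℚ ≤ b′ → am₂ ≤ am₁ → bm₂ ≤ bm₁ → am₁ ≤ a → bm₁ ≤ b → a - am₁ ≤ k₁ → b - bm₁ ≤ k₁ →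
        (R : Peels w h d am₂ bm₂ a′ b′) → Stop (k₂ - (a - am₂)) (k₂ - (b - bm₂)) R → (T : BT a′ b′ Sin) →
        ∃ λ S → (∀ f → sum f S ≡ sum f (vI R) + (sum f (hI R) + sum f Sin)) × Σ (BT am₁ bm₁ S) λ T′ → bl T′ ℕ.≤ (2 ℕ.+ suc m₂ ℕ.* 6) ℕ.+ bl T
      restTree {Sin = Sin} _ _ _ _ p q _ _ _ _ [] _ T = let (T′ , e) = widenB p q T in
        Sin , (λ f → ring-106 (sum f Sin)) , T′ , ℕₚ.≤-trans (ℕₚ.≤-reflexive e) (ℕₚ.m≤n+m (bl T) _)
      restTree {a} {b} {a′} {b′} {am₁} {bm₁} {am₂} {bm₂} {Sin} a≤N b≤N 0≤a′ 0≤b′ p q am≤ bm≤ kx ky (pv {a = A₂} {c = c} {S = Sc} u v r eq t) st T =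
        let (S , I , T₁ , b₁) = stepV {x = am₁ - am₂} m₂ 0≤e 0≤1-e (≤⇒0≤ p) u 0≤a′ 0≤b′ v r t
               (slackR {a - am₁} {A = A₂} {a′} u kx (subst (_< c) (ring-107 k₂ a am₁ am₂) st) (lin≤ (0≤a′ ⊕ a≤N ⊕ am≤ ⊕ p ⊕ ≤-reflexive (sym eq) ⊕ u) (ring-108 A₂ a′ N a am₁ am₂ c)) (≤⇒0≤ p)) T
            (T₂ , b₂) = widenB (≤-reflexive (trans (cong (_+_ (am₁ - am₂)) (sym eq)) (ring-97 am₁ am₂))) q T₁
        in S , (λ f → trans (I f) (trans (sym (+-assoc (sum f Sc) (sum f (vI t)) _)) (cong (_+ (sum f (hI t) + sum f Sin)) (sym (sum-++ f Sc (vI t)))))) , T₂ , ℕₚ.≤-trans (ℕₚ.≤-reflexive b₂) b₁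
      restTree {a} {b} {a′} {b′} {am₁} {bm₁} {am₂} {bm₂} {Sin} a≤N b≤N 0≤a′ 0≤b′ p q am≤ bm≤ kx ky (ph {b = A₂} {c = c} {S = Sc} u v r eq t) st T =
        let (S , I , T₁ , b₁) = stepV {x = bm₁ - bm₂} m₂ 0≤e 0≤1-e (≤⇒0≤ q) u 0≤b′ 0≤a′ (transposeP v) r (transposeS t)
               (slackR {b - bm₁} {A = A₂} {b′} u ky (subst (_< c) (ring-107 k₂ b bm₁ bm₂) st) (lin≤ (0≤b′ ⊕ b≤N ⊕ bm≤ ⊕ q ⊕ ≤-reflexive (sym eq) ⊕ u) (ring-108 A₂ b′ N b bm₁ bm₂ c)) (≤⇒0≤ q)) (transposeB T)
            (T₂ , b₂) = widenB p (≤-reflexive (trans (cong (_+_ (bm₁ - bm₂)) (sym eq)) (ring-97 bm₁ bm₂))) (transposeB T₁)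
        in S , (λ f → trans (I f) (trans (cong (_+_ (sum f Sc)) (cong₂ (λ x y → sum f x + (sum f y + sum f Sin)) (vI-transposeS t) (hI-transposeS t)))
                     (trans (ring-109 (sum f Sc) (sum f (hI t)) (sum f (vI t)) (sum f Sin)) (cong (λ z → sum f (vI t) + (z + sum f Sin)) (sym (sum-++ f Sc (hI t))))))) , T₂ ,
           ℕₚ.≤-trans (ℕₚ.≤-reflexive (trans b₂ (bl-transposeB T₁))) (ℕₚ.≤-trans b₁ (ℕₚ.≤-reflexive (cong (λ z → 2 ℕ.+ (suc m₂ ℕ.* 6 ℕ.+ z)) (bl-transposeB T))))

      -- the tree of F without the strips of tall items in the corner
      cornerTree : ∀ {a b ax bx am₁ bm₁ Sin} → 0ℚ ≤ am₁ → 0ℚ ≤ bm₁ →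
        (Fx : Peels w h d a b ax bx) (Fx′ : Peels w h d ax bx am₁ bm₁) → VStop (η * (a - am₁) - (a - ax)) Fx′ → (T : BT am₁ bm₁ Sin) →
        ∃ λ S → (∀ f → sum f S ≡ sum f (hI Fx) + (sum f (vI Fx′) + (sum f (hI Fx′) + sum f Sin))) × Σ (BT a b S) λ T′ → bl T′ ℕ.≤ (2 ℕ.+ suc m₁ ℕ.* 6) ℕ.+ (2 ℕ.+ bl T)
      cornerTree {a} {b} {ax} {bx} {am₁} {bm₁} {Sin} 0≤am 0≤bm Fx Fx′ st T =
        let (S , I , T₁ , b₁) = inner Fx′ st in
        hI Fx ++ S , (λ f → trans (sum-++ f (hI Fx) S) (cong (_+_ (sum f (hI Fx))) (I f))) ,
        -- With the tall corner strips gone, the wide strips between them can be stacked at the full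
        -- width `a`, and the room `a - ax` in front of `Fx′` is free.
        bhs (≤⇒0≤ (b′≤b Fx)) (≤-trans 0≤bm (b′≤b Fx′)) (≤-reflexive (ring-97 b bx)) (split-++ (hI Fx) S)
          (bh (≤⇒0≤ (b′≤b Fx)) (hPack Fx) (hAll Fx) (Shift.shrink w h d e 0≤e 0≤1-e (≤⇒0≤ (b′≤b Fx)))) T₁ ,
        ℕₚ.≤-trans (ℕ.s≤s (ℕ.s≤s b₁)) (ℕₚ.≤-reflexive (cong (suc ∘ suc) (ℕₚ.+-assoc (suc m₁ ℕ.* 6) 2 (bl T))))
        where
        inner : (Fx′ : Peels w h d ax bx am₁ bm₁) → VStop (η * (a - am₁) - (a - ax)) Fx′ →
          ∃ λ S → (∀ f → sum f S ≡ sum f (vI Fx′) + (sum f (hI Fx′) + sum f Sin)) × Σ (BT a bx S) λ T′ → bl T′ ℕ.≤ (suc m₁ ℕ.* 6 ℕ.+ 2) ℕ.+ bl T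
        inner [] _ = let (T′ , e) = widenB (a′≤a Fx) ≤-refl T in Sin , (λ f → ring-106 (sum f Sin)) , T′ , ℕₚ.≤-trans (ℕₚ.≤-reflexive e) (ℕₚ.m≤n+m (bl T) _)
        inner (pv {a = A₂} {c = c} {S = Sc} u v r eq t) st =
          let (S , I , T₁ , b₁) = stepV {x = a - ax} m₁ 0≤e 0≤1-e (≤⇒0≤ (a′≤a Fx)) u 0≤am 0≤bm v r t slack T
              (T₂ , b₂) = widenB (≤-reflexive (trans (cong (_+_ (a - ax)) (sym eq)) (ring-97 a ax))) ≤-refl T₁
          in S , (λ f → trans (I f) (trans (sym (+-assoc (sum f Sc) (sum f (vI t)) _)) (cong (_+ (sum f (hI t) + sum f Sin)) (sym (sum-++ f Sc (vI t)))))) , T₂ ,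
             ℕₚ.≤-trans (ℕₚ.≤-reflexive b₂) (ℕₚ.≤-trans b₁ (ℕₚ.≤-reflexive (lem′ (suc m₁ ℕ.* 6) (bl T))))
          where
          lem′ : ∀ x y → 2 ℕ.+ (x ℕ.+ y) ≡ (x ℕ.+ 2) ℕ.+ y
          lem′ x y = cong (ℕ._+ y) (ℕₚ.+-comm 2 x)
          X = a - am₁
          0≤X : 0ℚ ≤ X
          0≤X = ≤⇒0≤ (≤-trans (a′≤a t) (≤-trans (+-≥ˡ {Item} eq u) (a′≤a Fx)))
          abstract
            -- The emptied corner and the next tall strip together are wider than η X for the width
            -- `X` of the outer part, so the slack exceeds e η X, and `m₁` copies of it cover `X`.
            slack : A₂ - am₁ ≤ ⟦ m₁ ⟧ * ((a - ax) + e * c)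
            slack = ≤-trans (lin≤ (u ⊕ a′≤a Fx ⊕ ≤-reflexive (sym eq)) (ring-99 A₂ am₁ a ax c))
                    (≤-trans (lin≤ (0≤X ⊛ hm₁) (ring-100 X ⟦ m₁ ⟧ e η))
                             (0≤⟦⟧ m₁ ⊛ lin≤ ((0≤e ⊛ <⇒≤ st) ⊕ (≤⇒0≤ (a′≤a Fx) ⊛ e≤1)) (ring-101 a ax e c η X)))

      mutual
        bV : ∀ {a b} → (R : DRun w h d k₁ k₂ η a b) → a ≤ N → b ≤ N →
          ∃ λ S → (∀ f → sum f S ≡ total vr f R + (total hc f R + total hr f R)) × Σ (BT a b S) λ T → bl T ℕ.≤ druns R ℕ.* KB
        bV {a} {b} (run {a′} {b′} d<a d<b D E) a≤N b≤N =
          let open Deco D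
              a′≤ = ≤-trans (a′≤a R) (≤-trans (a′≤a G) (a′≤a F))
              b′≤ = ≤-trans (b′≤b R) (≤-trans (b′≤b G) (b′≤b F))
              0≤a′ = endA E
              0≤b′ = endB E
              (Sₑ , Iₑ , Tₑ , bₑ) = bVE E (≤-trans a′≤ a≤N) (≤-trans b′≤ b≤N)
              (S₁ , I₁ , T₁ , b₁) = restTree a≤N b≤N 0≤a′ 0≤b′ (a′≤a G) (b′≤b G) (a′≤a F) (b′≤b F) F-x F-y R stopR Tₑ
              (S₂ , I₂ , T₂ , b₂) = cornerTree (≤-trans 0≤a′ (≤-trans (a′≤a R) (a′≤a G))) (≤-trans 0≤b′ (≤-trans (b′≤b R) (b′≤b G))) Fx Fx′ stopX T₁
          in S₂ , (λ f → trans (I₂ f) (trans (cong (λ z → sum f (hI Fx) + (sum f (vI Fx′) + (sum f (hI Fx′) + z))) (trans (I₁ f) (cong (λ z → sum f (vI R) + (sum f (hI R) + z)) (Iₑ f))))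
                     (trans (ring-102 (sum f (hI Fx)) (sum f (vI Fx′)) (sum f (hI Fx′)) (sum f (vI R)) (sum f (hI R)) (totalE vr f E) (totalE hc f E) (totalE hr f E))
                       -- The tree divides the wide strips of `F` at the end of `Fx`, whereas their
                       -- classes divide them at the end of `Fy`; both divisions have the same sum.
                       (trans (cong (λ z → (sum f (vI Fx′) + sum f (vI R) + totalE vr f E) + (z + (sum f (hI R) + totalE hc f E + totalE hr f E))) (trans (sym (hFx f)) (hFy f)))
                          (ring-103 (sum f (vI Fx′) + sum f (vI R) + totalE vr f E) (sum f (hI Fy)) (sum f (hI Fy′)) (sum f (hI R)) (totalE hc f E) (totalE hr f E)))))) ,
             T₂ , ℕₚ.≤-trans b₂ (ℕₚ.≤-trans (ℕₚ.+-monoʳ-≤ (2 ℕ.+ suc m₁ ℕ.* 6) (ℕₚ.+-monoʳ-≤ 2 (ℕₚ.≤-trans b₁ (ℕₚ.+-monoʳ-≤ (2 ℕ.+ suc m₂ ℕ.* 6) bₑ))))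
                      (ℕₚ.≤-reflexive (lem (2 ℕ.+ suc m₁ ℕ.* 6) (2 ℕ.+ suc m₂ ℕ.* 6) (drunsE E ℕ.* KB))))
          where
          lem : ∀ x y z → x ℕ.+ (2 ℕ.+ (y ℕ.+ suc z)) ≡ suc ((x ℕ.+ (2 ℕ.+ y)) ℕ.+ z)
          lem x y z = trans (cong (λ t → x ℕ.+ (2 ℕ.+ t)) (ℕₚ.+-suc y z)) (trans (ℕₚ.+-suc x (suc (suc (y ℕ.+ z)))) (cong suc (sym (ℕₚ.+-assoc x (2 ℕ.+ y) z))))

        bVE : ∀ {a b} → (E : DEnd w h d k₁ k₂ η a b) → a ≤ N → b ≤ N →
          ∃ λ S → (∀ f → sum f S ≡ totalE vr f E + (totalE hc f E + totalE hr f E)) × Σ (BT a b S) λ T → bl T ℕ.≤ suc (drunsE E ℕ.* KB)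
        bVE (term _ _) _ _ = [] , (λ f → refl) , bfree refl , ℕ.s≤s ℕ.z≤n
        bVE {a} {b} (vbr {a₁} {a₂} le R₁ R₂) a≤N b≤N =
          let (S₁ , I₁ , T₁ , b₁) = bV R₁ (≤-trans (≤-trans (lin≤ (posA R₂) (ring-3 a₁ a₂)) le) a≤N) b≤N
              (S₂ , I₂ , T₂ , b₂) = bV R₂ (≤-trans (≤-trans (lin≤ (posA R₁) (ring-7 a₁ a₂)) le) a≤N) b≤N
          in S₁ ++ S₂ , (λ f → trans (sum-++ f S₁ S₂) (trans (cong₂ _+_ (I₁ f) (I₂ f)) (ring-104 (total vr f R₁) (total hc f R₁) (total hr f R₁) (total vr f R₂) (total hc f R₂) (total hr f R₂)))) ,
             bvs (posA R₁) (posA R₂) le (split-++ S₁ S₂) T₁ T₂ , ℕ.s≤s (ℕₚ.≤-trans (ℕₚ.+-mono-≤ b₁ b₂) (ℕₚ.≤-reflexive (sym (ℕₚ.*-distribʳ-+ KB (druns R₁) (druns R₂)))))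
        bVE {a} {b} (hbr {b₁} {b₂} le R₁ R₂) a≤N b≤N =
          let (S₁ , I₁ , T₁ , c₁) = bV R₁ a≤N (≤-trans (≤-trans (lin≤ (posB R₂) (ring-3 b₁ b₂)) le) b≤N)
              (S₂ , I₂ , T₂ , c₂) = bV R₂ a≤N (≤-trans (≤-trans (lin≤ (posB R₁) (ring-7 b₁ b₂)) le) b≤N)
          in S₁ ++ S₂ , (λ f → trans (sum-++ f S₁ S₂) (trans (cong₂ _+_ (I₁ f) (I₂ f)) (ring-104 (total vr f R₁) (total hc f R₁) (total hr f R₁) (total vr f R₂) (total hc f R₂) (total hr f R₂)))) ,
             bhs (posB R₁) (posB R₂) le (split-++ S₁ S₂) T₁ T₂ , ℕ.s≤s (ℕₚ.≤-trans (ℕₚ.+-mono-≤ c₁ c₂) (ℕₚ.≤-reflexive (sym (ℕₚ.*-distribʳ-+ KB (druns R₁) (druns R₂)))))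

        posA : ∀ {a b} → DRun w h d k₁ k₂ η a b → 0ℚ ≤ a
        posA (run p _ _ _) = ≤-trans 0≤d (<⇒≤ p)
        posB : ∀ {a b} → DRun w h d k₁ k₂ η a b → 0ℚ ≤ b
        posB (run _ p _ _) = ≤-trans 0≤d (<⇒≤ p)

        endA : ∀ {a b} → DEnd w h d k₁ k₂ η a b → 0ℚ ≤ a
        endA (term p _) = p
        endA (vbr le R₁ R₂) = ≤-trans (0≤+ (posA R₁) (posA R₂)) le
        endA (hbr le R₁ R₂) = posA R₁
        endB : ∀ {a b} → DEnd w h d k₁ k₂ η a b → 0ℚ ≤ b
        endB (term _ p) = p
        endB (vbr le R₁ R₂) = posB R₁
        endB (hbr le R₁ R₂) = ≤-trans (0≤+ (posB R₁) (posB R₂)) le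

-- Everything except the wide items outside the corners and the dropped depth range

module WithCorner where

  open Packings
  open Counting
  open TallBoxes
  open PeelingRuns
  open BoxTrees
  open DecoratedRuns
  open WithoutCorner

  module _ {Item : Set} where

    stackH : ∀ {w h : Item → ℚ} {a} → (∀ i → 0ℚ < h i) → ∀ S → All (λ i → w i ≤ a) S → Pack w h a (sum h S) S
    stackH h>0 [] [] = nil
    stackH h>0 (i ∷ S) (p ∷ ps) = hcmp {S₁ = i ∷ []} {S₂ = S} (<⇒≤ (h>0 i)) (sum-nonneg (<⇒≤ ∘ h>0) S) ≤-refl (λ f → cong (_+ sum f S) (sym (+-identityʳ (f i)))) (one p ≤-refl) (stackH h>0 S ps)

    -- The tall items of the corners are moved away, the wide items of the corners
    -- that are almost as wide as the box become homeless, all other wide items are dropped.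
    module AH (w h : Item → ℚ) (w>0 : ∀ i → 0ℚ < w i) (h>0 : ∀ i → 0ℚ < h i) {bp : BoxParams} (dp : DepthParams bp) where

      open BoxParams bp using (D; e; 0<e)
      open DepthParams dp

      private
        0≤d : 0ℚ ≤ d
        0≤d = <⇒≤ 0<d
        0≤e : 0ℚ ≤ e
        0≤e = <⇒≤ 0<e
        0≤1-e : 0ℚ ≤ 1ℚ - e
        0≤1-e = ≤⇒0≤ e≤1
        0≤κ : 0ℚ ≤ κ
        0≤κ = ≤-trans (0≤* 0≤e (≤⇒0≤ k₁≤k₂)) (≤-reflexive (sym κ≡))
        0≤k₂ : 0ℚ ≤ k₂
        0≤k₂ = ≤-trans 0≤k₁ k₁≤k₂
        abstract
          κ≤d : κ ≤ d
          κ≤d = ≤-trans (lin≤ 0≤k₂ (ring-7 k₂ κ)) k₂+κ≤d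
        η′ : ℚ
        η′ = ⟦ D ⟧ * η
        0≤η′ : 0ℚ ≤ η′
        0≤η′ = 0≤* (0≤⟦⟧ D) 0≤η

      BT : ℚ → ℚ → List Item → Set
      BT = BTree w h d e

      abstract
        -- Each item covers at least `d` of a width of at most D d, so by area, stacking all of them
        -- raises the height by at most the factor `D`.
        stack≤ : ∀ {a y S} → 0ℚ ≤ a → a ≤ N → 0ℚ ≤ y → Pack w h a y S → All (λ i → d ≤ w i) S → sum h S ≤ ⟦ D ⟧ * y
        stack≤ {a} {y} {S} 0≤a a≤N 0≤y P al = *-cancel-≤ 0<d
          (≤-trans (≤-reflexive (sym (sum-scale d h S)))
          (≤-trans (sum-mono S (All.map (λ {i} q → lin≤ (<⇒≤ (h>0 i) ⊛ q) (ring-136 d (w i) (h i))) al))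
          (≤-trans (area≤ w>0 h>0 0≤a 0≤y P) (lin≤ (0≤y ⊛ ≤-trans a≤N N≤) (ring-137 a y d ⟦ D ⟧)))))
        stackV≤ : ∀ {x b S} → 0ℚ ≤ x → 0ℚ ≤ b → b ≤ N → Pack w h x b S → All (λ i → d ≤ h i) S → sum w S ≤ ⟦ D ⟧ * x
        stackV≤ {x} {b} {S} 0≤x 0≤b b≤N P al = *-cancel-≤ 0<d
          (≤-trans (≤-reflexive (sym (sum-scale d w S)))
          (≤-trans (sum-mono S (All.map (λ {i} q → lin≤ (<⇒≤ (w>0 i) ⊛ q) (ring-57 d (w i) (h i))) al))
          (≤-trans (area≤ w>0 h>0 0≤x 0≤b P) (lin≤ (0≤x ⊛ ≤-trans b≤N N≤) (ring-138 b x d ⟦ D ⟧)))))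

      -- The invariant of a pass from the leaves of the tree to its root. `content` leaves free a
      -- column of width `κ` and a band of height `Y`. The column is handed upwards, for the tall
      -- strips `FV` of the outer parts, or is given up to bring homeless items home. The band has
      -- room for `HS` twice; the second half is spent when two boxes are joined side by side.
      record State (a b : ℚ) (tot : (Item → ℚ) → ℚ) (r k : ℕ) : Set where
        field
          Y : ℚ
          C HS FV : List Item
          content : BT (a - κ) (b - Y) C
          0≤Y : 0ℚ ≤ Y
          Y≤b : Y ≤ b
          wHS : All (λ i → w i ≤ a) HS
          dHS : All (λ i → d ≤ w i) HS
          2HS : sum h HS + sum h HS ≤ Y
          HS≤ : sum h HS ≤ η′ * b
          hFV : All (λ i → h i ≤ b) FV
          FV≤ : sum w FV ≤ ⟦ r ⟧ * (⟦ D ⟧ * k₁)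
          sums : ∀ f → sum f C + (sum f HS + sum f FV) ≡ tot f
          bl≤ : bl content ℕ.≤ k

      -- the homeless items are put below the content
      home : ∀ {a b tot r k} (s : State a b tot r k) → Σ (BT a (sum h (State.HS s) + (b - State.Y s)) (State.HS s ++ State.C s)) λ T → bl T ℕ.≤ 2 ℕ.+ k
      home {a} {b} s = let (T , e′) = widenB (lin≤ 0≤κ (ring-114 a κ)) ≤-refl content in
        bhs 0≤HS (≤⇒0≤ Y≤b) ≤-refl (split-++ HS C)
          (bh 0≤HS (stackH h>0 HS wHS) dHS (Shift.shrink w h d e 0≤e 0≤1-e 0≤HS)) T ,
        ℕ.s≤s (ℕ.s≤s (ℕₚ.≤-trans (ℕₚ.≤-reflexive e′) bl≤))
        where
        open State s
        0≤HS : 0ℚ ≤ sum h HS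
        0≤HS = sum-nonneg (<⇒≤ ∘ h>0) HS

      homeBox : ∀ {a b tot r k} (s : State a b tot r k) → Σ (BT a b (State.HS s ++ State.C s)) λ T → bl T ℕ.≤ 2 ℕ.+ k
      homeBox {a} {b} s = let (T , b≤) = home s ; (T′ , e′) = widenB ≤-refl (lin≤ (2HS ⊕ 0≤HS) (ring-139 b Y (sum h HS))) T in T′ , ℕₚ.≤-trans (ℕₚ.≤-reflexive e′) b≤
        where
        open State s
        0≤HS : 0ℚ ≤ sum h HS
        0≤HS = sum-nonneg (<⇒≤ ∘ h>0) HS

      -- the homeless items of the child with the smaller Y span both children
      joinV : ∀ {a b a₁ a₂ t₁ t₂ r₁ r₂ k₁ k₂} → d < a₁ → d < a₂ → a₁ + a₂ ≤ a → 0ℚ ≤ b → (s₁ : State a₁ b t₁ r₁ k₁) (s₂ : State a₂ b t₂ r₂ k₂) → State.Y s₁ ≤ State.Y s₂ →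
        State a b (λ f → t₁ f + t₂ f) (r₁ ℕ.+ r₂) (k₁ ℕ.+ k₂ ℕ.+ 6)
      joinV {a} {b} {a₁} {a₂} {t₁} {t₂} {r₁} {r₂} {n₁} {n₂} d<a₁ d<a₂ le 0≤b s₁ s₂ Y≤ =
        let (T₂ , b₂) = home s₂
            (T₂′ , b₂′) = widenB ≤-refl (lin≤ st≤ (ring-140 b S₂.Y (sum h S₁.HS) (sum h S₂.HS))) T₂
            (T₁′ , b₁′) = widenB ≤-refl (lin≤ (S₁.2HS ⊕ 0≤H₁) (ring-141 b S₁.Y (sum h S₁.HS))) S₁.content
            T = bhs {S₁ = S₁.HS} {S₂ = S₁.C ++ (S₂.HS ++ S₂.C)} 0≤H₁ 0≤top (≤-reflexive (ring-142 (sum h S₁.HS) b)) (split-++ S₁.HS (S₁.C ++ (S₂.HS ++ S₂.C)))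
                  (bh 0≤H₁ (stackH h>0 S₁.HS (All.map (λ p → ≤-trans p a₁≤) S₁.wHS)) S₁.dHS (Shift.shrink w h d e 0≤e 0≤1-e 0≤H₁))
                  -- The column of the first child becomes the column of the whole box. The second
                  -- child gives up its own, as its homeless items span its full width.
                  (bvs (≤⇒0≤ (≤-trans κ≤d (<⇒≤ d<a₁))) (≤-trans 0≤d (<⇒≤ d<a₂)) (lin≤ le (ring-143 a a₁ a₂ κ)) (split-++ S₁.C (S₂.HS ++ S₂.C)) T₁′ T₂′)
        in record
          { Y = 0ℚ ; C = S₁.HS ++ (S₁.C ++ (S₂.HS ++ S₂.C)) ; HS = [] ; FV = S₁.FV ++ S₂.FV
          ; content = T
          ; 0≤Y = ≤-refl ; Y≤b = 0≤b ; wHS = [] ; dHS = [] ; 2HS = ≤-refl ; HS≤ = 0≤* 0≤η′ 0≤b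
          ; hFV = Allₚ.++⁺ S₁.hFV S₂.hFV
          ; FV≤ = subst₂ _≤_ (sym (sum-++ w S₁.FV S₂.FV)) (trans (sym (*-distribʳ-+ (⟦ D ⟧ * k₁) ⟦ r₁ ⟧ ⟦ r₂ ⟧)) (cong (_* (⟦ D ⟧ * k₁)) (sym (⟦⟧-+ r₁ r₂)))) (S₁.FV≤ ⊕ S₂.FV≤)
          ; sums = λ f → trans (cong₂ (λ u v → u + (0ℚ + v)) (trans (sum-++ f S₁.HS _) (cong (_+_ (sum f S₁.HS)) (trans (sum-++ f S₁.C _) (cong (_+_ (sum f S₁.C)) (sum-++ f S₂.HS S₂.C))))) (sum-++ f S₁.FV S₂.FV))
                     (trans (ring-144 (sum f S₁.HS) (sum f S₁.C) (sum f S₂.HS) (sum f S₂.C) (sum f S₁.FV) (sum f S₂.FV)) (cong₂ _+_ (S₁.sums f) (S₂.sums f)))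
          ; bl≤ = ℕₚ.≤-trans (ℕ.s≤s (ℕ.s≤s (ℕ.s≤s (ℕₚ.+-mono-≤ (ℕₚ.≤-trans (ℕₚ.≤-reflexive b₁′) S₁.bl≤) (ℕₚ.≤-trans (ℕₚ.≤-reflexive b₂′) b₂)))))
                    (nat n₁ n₂) }
        where
        module S₁ = State s₁
        module S₂ = State s₂
        0≤H₁ : 0ℚ ≤ sum h S₁.HS
        0≤H₁ = sum-nonneg (<⇒≤ ∘ h>0) S₁.HS
        nat : ∀ n₁ n₂ → 3 ℕ.+ (n₁ ℕ.+ (2 ℕ.+ n₂)) ℕ.≤ n₁ ℕ.+ n₂ ℕ.+ 6
        nat n₁ n₂ = ℕₚ.≤-trans (ℕₚ.≤-reflexive (trans (cong (3 ℕ.+_) (trans (sym (ℕₚ.+-assoc n₁ 2 n₂)) (trans (cong (ℕ._+ n₂) (ℕₚ.+-comm n₁ 2)) refl))) (ℕₚ.+-comm 5 (n₁ ℕ.+ n₂)))) (ℕₚ.+-monoʳ-≤ (n₁ ℕ.+ n₂) (ℕₚ.n≤1+n 5))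
        abstract
          H₁≤Y : sum h S₁.HS ≤ S₁.Y
          H₁≤Y = lin≤ (S₁.2HS ⊕ 0≤H₁) (ring-124 (sum h S₁.HS) S₁.Y)
          a₁≤ : a₁ ≤ a - κ
          a₁≤ = lin≤ (le ⊕ κ≤d ⊕ <⇒≤ d<a₂) (ring-125 a a₁ a₂ κ d)
          -- Here the factor two of `2HS` is spent: the spanning items take at most half of the
          -- smaller band, hence at most half of the larger one, and the homeless items of the other
          -- child take at most its other half.
          st≤ : sum h S₁.HS + sum h S₂.HS ≤ S₂.Y
          st≤ = *-cancel-≤ {1ℚ + 1ℚ} (+-mono-<-≤ 0<1 0≤1) (lin≤ (S₁.2HS ⊕ S₂.2HS ⊕ Y≤) (ring-126 (sum h S₁.HS) (sum h S₂.HS) S₁.Y S₂.Y))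
          0≤top : 0ℚ ≤ (b - 0ℚ) - sum h S₁.HS
          0≤top = lin≤ (≤-trans H₁≤Y S₁.Y≤b) (ring-127 b (sum h S₁.HS))

      swapState : ∀ {a b t t′ r r′ k k′} → (∀ f → t f ≡ t′ f) → r ≡ r′ → k ≡ k′ → State a b t r k → State a b t′ r′ k′
      swapState p refl refl s = record { State s ; sums = λ f → trans (State.sums s f) (p f) }

      stateV : ∀ {a b a₁ a₂ t₁ t₂ r₁ r₂ k₁ k₂} → d < a₁ → d < a₂ → a₁ + a₂ ≤ a → 0ℚ ≤ b → State a₁ b t₁ r₁ k₁ → State a₂ b t₂ r₂ k₂ →
        State a b (λ f → t₁ f + t₂ f) (r₁ ℕ.+ r₂) (k₁ ℕ.+ k₂ ℕ.+ 6)
      stateV {a} {b} {a₁} {a₂} {t₁} {t₂} {r₁} {r₂} {n₁} {n₂} p q le 0≤b s₁ s₂ with ≤-total (State.Y s₁) (State.Y s₂)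
      ... | inj₁ y = joinV p q le 0≤b s₁ s₂ y
      ... | inj₂ y = swapState (λ f → +-comm (t₂ f) (t₁ f)) (ℕₚ.+-comm r₂ r₁) (cong (ℕ._+ 6) (ℕₚ.+-comm n₂ n₁))
                       (joinV q p (≤-trans (≤-reflexive (+-comm a₂ a₁)) le) 0≤b s₂ s₁ y)

      stateH : ∀ {a b b₁ b₂ t₁ t₂ r₁ r₂ k₁ k₂} → 0ℚ ≤ b₁ → 0ℚ ≤ b₂ → b₁ + b₂ ≤ b → State a b₁ t₁ r₁ k₁ → State a b₂ t₂ r₂ k₂ →
        State a b (λ f → t₁ f + t₂ f) (r₁ ℕ.+ r₂) (k₁ ℕ.+ k₂ ℕ.+ 6)
      stateH {a} {b} {b₁} {b₂} {t₁} {t₂} {r₁} {r₂} {n₁} {n₂} 0≤b₁ 0≤b₂ le s₁ s₂ = record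
        { Y = S₁.Y + S₂.Y ; C = S₁.C ++ S₂.C ; HS = S₁.HS ++ S₂.HS ; FV = S₁.FV ++ S₂.FV
        ; content = bhs (≤⇒0≤ S₁.Y≤b) (≤⇒0≤ S₂.Y≤b) (lin≤ le (ring-145 b b₁ b₂ S₁.Y S₂.Y)) (split-++ S₁.C S₂.C) S₁.content S₂.content
        ; 0≤Y = 0≤+ S₁.0≤Y S₂.0≤Y ; Y≤b = ≤-trans (S₁.Y≤b ⊕ S₂.Y≤b) le
        ; wHS = Allₚ.++⁺ S₁.wHS S₂.wHS ; dHS = Allₚ.++⁺ S₁.dHS S₂.dHS
        ; 2HS = ≤-trans (≤-reflexive (cong₂ _+_ (sum-++ h S₁.HS S₂.HS) (sum-++ h S₁.HS S₂.HS))) (lin≤ (S₁.2HS ⊕ S₂.2HS) (ring-121 (sum h S₁.HS) (sum h S₂.HS) S₁.Y S₂.Y))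
        ; HS≤ = ≤-trans (≤-reflexive (sum-++ h S₁.HS S₂.HS)) (lin≤ (S₁.HS≤ ⊕ S₂.HS≤ ⊕ 0≤η′ ⊛ le) (ring-146 (sum h S₁.HS) (sum h S₂.HS) η′ b b₁ b₂))
        ; hFV = Allₚ.++⁺ (All.map (λ p → ≤-trans p b₁≤) S₁.hFV) (All.map (λ p → ≤-trans p b₂≤) S₂.hFV)
        ; FV≤ = subst₂ _≤_ (sym (sum-++ w S₁.FV S₂.FV)) (trans (sym (*-distribʳ-+ (⟦ D ⟧ * k₁) ⟦ r₁ ⟧ ⟦ r₂ ⟧)) (cong (_* (⟦ D ⟧ * k₁)) (sym (⟦⟧-+ r₁ r₂)))) (S₁.FV≤ ⊕ S₂.FV≤)
        ; sums = λ f → trans (cong₂ _+_ (sum-++ f S₁.C S₂.C) (cong₂ _+_ (sum-++ f S₁.HS S₂.HS) (sum-++ f S₁.FV S₂.FV)))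
                   (trans (ring-147 (sum f S₁.C) (sum f S₂.C) (sum f S₁.HS) (sum f S₂.HS) (sum f S₁.FV) (sum f S₂.FV)) (cong₂ _+_ (S₁.sums f) (S₂.sums f)))
        ; bl≤ = ℕₚ.≤-trans (ℕ.s≤s (ℕₚ.+-mono-≤ S₁.bl≤ S₂.bl≤)) (ℕₚ.≤-trans (ℕₚ.≤-reflexive (ℕₚ.+-comm 1 (n₁ ℕ.+ n₂))) (ℕₚ.+-monoʳ-≤ (n₁ ℕ.+ n₂) (ℕ.s≤s ℕ.z≤n))) }
        where
        module S₁ = State s₁
        module S₂ = State s₂
        abstract
          b₁≤ : b₁ ≤ b
          b₁≤ = ≤-trans (lin≤ 0≤b₂ (ring-3 b₁ b₂)) le
          b₂≤ : b₂ ≤ b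
          b₂≤ = ≤-trans (lin≤ 0≤b₁ (ring-7 b₁ b₂)) le

      stateTerm : ∀ {a b} → 0ℚ ≤ b → State a b (λ _ → 0ℚ) 0 6
      stateTerm {a} {b} 0≤b = record
        { Y = 0ℚ ; C = [] ; HS = [] ; FV = [] ; content = bfree refl ; 0≤Y = ≤-refl ; Y≤b = 0≤b ; wHS = [] ; dHS = [] ; 2HS = ≤-refl
        ; HS≤ = 0≤* 0≤η′ 0≤b ; hFV = [] ; FV≤ = ≤-reflexive (sym (*-zeroˡ (⟦ D ⟧ * k₁))) ; sums = λ f → refl ; bl≤ = ℕ.s≤s ℕ.z≤n }

      acr : Selector {Item}
      acr f D = vc f D + (vr f D + hc f D)

      module RunState {a b a′ b′ t′ r′ k′} (d<a : d < a) (d<b : d < b) (a≤N : a ≤ N) (b≤N : b ≤ N) (Dc : Deco w h d k₁ k₂ η a b a′ b′)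
        (0≤a′ : 0ℚ ≤ a′) (0≤b′ : 0ℚ ≤ b′) (s : State a′ b′ t′ r′ k′) where
        open Deco Dc
        module S = State s

        0≤a : 0ℚ ≤ a
        0≤a = ≤-trans 0≤d (<⇒≤ d<a)
        0≤b : 0ℚ ≤ b
        0≤b = ≤-trans 0≤d (<⇒≤ d<b)
        a′≤am₂ : a′ ≤ am₂
        a′≤am₂ = a′≤a R
        b′≤bm₁ : b′ ≤ bm₁
        b′≤bm₁ = ≤-trans (b′≤b R) (b′≤b G)
        YF : ℚ
        YF = b - bm₁
        0≤YF : 0ℚ ≤ YF
        0≤YF = ≤⇒0≤ (b′≤b F)
        HC : List Item
        HC = hI Fy

        abstract
          HC≤ : sum h HC ≤ η′ * YF
          HC≤ = ≤-trans (stack≤ 0≤a a≤N (≤⇒0≤ (b′≤b Fy)) (hPack Fy) (hAll Fy)) (lin≤ (0≤⟦⟧ D ⊛ Fy≤) (ring-128 ⟦ D ⟧ η YF (b - by)))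
          2HC≤ : sum h HC + sum h HC ≤ YF
          2HC≤ = lin≤ (HC≤ ⊕ HC≤ ⊕ 0≤YF ⊛ η₁) (ring-129 (sum h HC) η′ YF)

        Result : ℕ → Set
        Result k = State a b (λ f → acr f Dc + t′ f) (suc r′) k

        mk : ∀ Y C HS″ {k} (T : BT (a - κ) (b - Y) C) → 0ℚ ≤ Y → Y ≤ b → All (λ i → w i ≤ a) HS″ → All (λ i → d ≤ w i) HS″ →
          (sum h HC + sum h HS″) + (sum h HC + sum h HS″) ≤ Y → sum h HS″ ≤ η′ * b′ →
          (∀ f → sum f C + sum f HS″ ≡ sum f (vI R) + (sum f S.C + sum f S.HS)) → bl T ℕ.≤ k → Result k
        mk Y C HS″ T 0≤Y Y≤b wH dH 2H HS≤ sm bl≤ = record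
          { Y = Y ; C = C ; HS = HC ++ HS″ ; FV = vI F ++ S.FV ; content = T ; 0≤Y = 0≤Y ; Y≤b = Y≤b
          ; wHS = Allₚ.++⁺ (All.map proj₁ (fits (hPack Fy))) wH ; dHS = Allₚ.++⁺ (hAll Fy) dH
          ; 2HS = ≤-trans (≤-reflexive (cong₂ _+_ (sum-++ h HC HS″) (sum-++ h HC HS″))) 2H
          ; HS≤ = ≤-trans (≤-reflexive (sum-++ h HC HS″)) (lin≤ (HC≤ ⊕ HS≤ ⊕ 0≤η′ ⊛ b′≤bm₁) (ring-130 (sum h HC) (sum h HS″) η′ b bm₁ b′))
          ; hFV = Allₚ.++⁺ (All.map proj₂ (fits (vPack F))) (All.map (λ p → ≤-trans p (≤-trans b′≤bm₁ (b′≤b F))) S.hFV)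
          ; FV≤ = ≤-trans (≤-reflexive (sum-++ w (vI F) S.FV)) (lin≤ (stackV≤ (≤⇒0≤ (a′≤a F)) 0≤b b≤N (vPack F) (vAll F) ⊕ 0≤⟦⟧ D ⊛ F-x ⊕ S.FV≤) (ring-131 (sum w (vI F)) (sum w S.FV) ⟦ D ⟧ (a - am₁) k₁ ⟦ r′ ⟧))
          ; sums = λ f → trans (cong₂ (λ u v → sum f C + (u + v)) (sum-++ f HC HS″) (sum-++ f (vI F) S.FV))
                     (trans (ring-132 (sum f C) (sum f HC) (sum f HS″) (sum f (vI F)) (sum f S.FV)) (trans (cong (λ z → z + (sum f HC + (sum f (vI F) + sum f S.FV))) (sm f))
                     (trans (cong (λ z → (sum f (vI R) + (sum f S.C + sum f S.HS)) + (sum f HC + (z + sum f S.FV))) (vFx f))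
                     (trans (ring-133 (sum f (vI R)) (sum f S.C) (sum f S.HS) (sum f HC) (sum f (vI Fx)) (sum f (vI Fx′)) (sum f S.FV)) (cong (_+_ (acr f Dc)) (S.sums f))))))
          ; bl≤ = bl≤ }

        xR xG : ℚ
        xR = am₂ - a′
        xG = am₁ - am₂
        0≤xR : 0ℚ ≤ xR
        0≤xR = ≤⇒0≤ a′≤am₂

        -- Dropping `G` and shrinking the tall strips of `R` yields a new column of width `κ`, so
        -- the child can give up its own column and take its homeless items back. Only the wide
        -- items of the new corner remain homeless, in the band that the outer part leaves free.
        thick : κ ≤ xG + e * xR → Result (k′ ℕ.+ 4)
        thick κ≤ = let (T₁ , b₁) = homeBox s
                       (T₂ , b₂) = widenB ≤-refl (≤-trans b′≤bm₁ (≤-reflexive (ring-134 b bm₁))) T₁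
                       T = bvs {S₁ = vI R} {S₂ = S.HS ++ S.C} (0≤* 0≤1-e 0≤xR) 0≤a′ wd (split-++ (vI R) (S.HS ++ S.C))
                             (bv 0≤xR (widen ≤-refl (≤-trans (b′≤b G) (≤-reflexive (ring-134 b bm₁))) (vPack R)) (vAll R) ≤-refl) T₂
                   in mk YF (vI R ++ (S.HS ++ S.C)) [] T 0≤YF (lin≤ (≤-trans 0≤b′ b′≤bm₁) (ring-114 b bm₁)) [] []
                        (≤-trans (≤-reflexive (cong₂ _+_ (+-identityʳ (sum h HC)) (+-identityʳ (sum h HC)))) 2HC≤) (0≤* 0≤η′ 0≤b′)
                        (λ f → trans (cong (_+ 0ℚ) (trans (sum-++ f (vI R) _) (cong (_+_ (sum f (vI R))) (sum-++ f S.HS S.C)))) (ring-135 (sum f (vI R)) (sum f S.HS) (sum f S.C)))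
                        (ℕₚ.≤-trans (ℕ.s≤s (ℕ.s≤s (ℕₚ.≤-trans (ℕₚ.≤-reflexive b₂) b₁))) (ℕₚ.≤-reflexive (ℕₚ.+-comm 4 k′)))
          where
          abstract
            wd : (1ℚ - e) * xR + a′ ≤ a - κ
            wd = lin≤ (κ≤ ⊕ a′≤a F) (ring-117 e a am₁ am₂ a′ κ)

        module Thin (κ> : xG + e * xR < κ) where
          abstract
            0≤a′-κ : 0ℚ ≤ a′ - κ
            0≤a′-κ = *-cancel-≤ 0<e (lin≤ (<⇒≤ κ> ⊕ ≤-reflexive κ≡ ⊕ (0≤e ⊛ F-x) ⊕ (0≤e ⊛ <⇒≤ d<a) ⊕ (0≤e ⊛ k₂+κ≤d) ⊕ (≤⇒0≤ (a′≤a G) ⊛ e≤1)) (ring-118 e a am₁ am₂ a′ κ k₁ k₂ d))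
            content-w : a′ - κ ≤ a - κ
            content-w = lin≤ (a′≤am₂ ⊕ a′≤a G ⊕ a′≤a F) (ring-119 a am₁ am₂ a′ κ)
          wS : All (λ i → w i ≤ a) S.HS
          wS = All.map (λ p → ≤-trans p (≤-trans a′≤am₂ (≤-trans (a′≤a G) (a′≤a F)))) S.wHS

          -- A tall strip at the start of `R` would reach beyond depth `k₂` and yield `κ`, so it is
          -- excluded. If `R` is empty, the free bands of the outer part and of the child add up. If
          -- it starts with a wide strip, the wide strips removed down to there leave a band of
          -- height `k₂`, which suffices by `η₂`. The sizes at the start of `R′` are variables so
          -- that `R′` can be matched.
          thin : ∀ {am bm} (R′ : Peels w h d am bm a′ b′) → vI R′ ≡ vI R → am ≡ am₂ → bm ≡ bm₂ → Stop (k₂ - (a - am₂)) (k₂ - (b - bm₂)) R′ → Result (k′ ℕ.+ 4)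
          thin [] vR _ _ _ = let (T , b≡) = widenB content-w hh S.content in
            mk (YF + S.Y) S.C S.HS T (0≤+ 0≤YF S.0≤Y) (lin≤ (S.Y≤b ⊕ b′≤bm₁) (ring-120 b bm₁ S.Y b′)) wS S.dHS
               (lin≤ (2HC≤ ⊕ S.2HS) (ring-121 (sum h HC) (sum h S.HS) YF S.Y)) S.HS≤
               (λ f → trans (sym (+-identityˡ _)) (cong (λ z → sum f z + (sum f S.C + sum f S.HS)) vR)) (ℕₚ.≤-trans (ℕₚ.≤-reflexive b≡) (ℕₚ.≤-trans S.bl≤ (ℕₚ.m≤m+n k′ 4)))
            where
            abstract
              hh : b′ - S.Y ≤ b - (YF + S.Y)
              hh = lin≤ b′≤bm₁ (ring-111 b bm₁ b′ S.Y)
          thin (pv {a = A₂} {c = c} u _ _ eq t) _ am≡ _ st = ⊥-elim (<⇒≱ κ> (≤-trans (≤-reflexive κ≡)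
              (lin≤ ((0≤e ⊛ <⇒≤ st) ⊕ (0≤e ⊛ a′≤a t) ⊕ (0≤e ⊛ F-x) ⊕ (≤⇒0≤ (a′≤a G) ⊛ e≤1)) (trans (ring-122 e a am₁ am₂ a′ A₂ c k₁ k₂) (cong (λ z → (e * c + (e * A₂ + (e * k₁ + (am₁ - am₂) * 1ℚ))) - (e * (k₂ - (a - am₂)) + (e * a′ + (e * (a - am₁) + (am₁ - am₂) * e))) + e * (z - (c + A₂))) (trans (sym am≡) eq) ▹ ring-123 (e * c + (e * A₂ + (e * k₁ + (am₁ - am₂) * 1ℚ))) (e * (k₂ - (a - am₂)) + (e * a′ + (e * (a - am₁) + (am₁ - am₂) * e))) e (c + A₂))))))
            where
            infixl 1 _▹_
            _▹_ : ∀ {x y z : ℚ} → x ≡ y → y ≡ z → x ≡ z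
            _▹_ = trans
          thin (ph {b = B₂} {c = c} u v r eq t) vR refl bm≡ st =
            let (T₁ , b₁) = widenB ≤-refl hC S.content
                T = bvs {S₁ = vI t} {S₂ = S.C} (0≤* 0≤1-e 0≤xR) 0≤a′-κ wd (split-++ (vI t) S.C)
                      (bv 0≤xR (widen ≤-refl B₂≤ (vPack t)) (vAll t) ≤-refl) T₁
            in mk k₂ (vI t ++ S.C) S.HS T 0≤k₂ k₂≤b wS S.dHS 2H S.HS≤
                 (λ f → trans (cong (_+ sum f S.HS) (trans (sum-++ f (vI t) S.C) (cong (λ z → sum f z + sum f S.C) vR))) (+-assoc (sum f (vI R)) (sum f S.C) (sum f S.HS)))
                 (ℕₚ.≤-trans (ℕ.s≤s (ℕ.s≤s (ℕₚ.≤-trans (ℕₚ.≤-reflexive b₁) S.bl≤))) (ℕₚ.≤-trans (ℕₚ.≤-reflexive (ℕₚ.+-comm 2 k′)) (ℕₚ.+-monoʳ-≤ k′ (ℕ.s≤s (ℕ.s≤s ℕ.z≤n)))))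
            where
            abstract
              bm-eq : bm₂ ≡ c + B₂
              bm-eq = trans (sym bm≡) eq
              B₂≤ : B₂ ≤ b - k₂
              B₂≤ = lin≤ (<⇒≤ st) (trans (ring-112 b k₂ B₂ c) (cong (λ z → c - (k₂ - (b - z))) (sym bm-eq)))
              k₂≤b : k₂ ≤ b
              k₂≤b = lin≤ (≤-trans 0≤b′ (≤-trans (b′≤b t) B₂≤)) (ring-113 b k₂)
              hC : b′ - S.Y ≤ b - k₂
              hC = ≤-trans (lin≤ S.0≤Y (ring-114 b′ S.Y)) (≤-trans (b′≤b t) B₂≤)
              wd : (1ℚ - e) * xR + (a′ - κ) ≤ a - κ
              wd = lin≤ (a′≤a G ⊕ a′≤a F ⊕ 0≤* 0≤e 0≤xR) (ring-115 e a am₁ am₂ a′ κ)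
              2H : (sum h HC + sum h S.HS) + (sum h HC + sum h S.HS) ≤ k₂
              2H = ≤-trans (lin≤ (HC≤ ⊕ HC≤ ⊕ S.HS≤ ⊕ S.HS≤ ⊕ (0≤+ 0≤η′ 0≤η′ ⊛ b′≤bm₁) ⊕ (0≤+ 0≤η′ 0≤η′ ⊛ b≤N)) (ring-116 (sum h HC) (sum h S.HS) η′ b bm₁ b′ N)) η₂

        runState : Result (k′ ℕ.+ 4)
        runState = decide (κ ≤? xG + e * xR)
          where
          decide : Dec (κ ≤ xG + e * xR) → Result (k′ ℕ.+ 4)
          decide (yes p) = thick p
          decide (no p) = Thin.thin (≰⇒> p) R refl refl refl stopR

      mutual
        state : ∀ {a b} (R : DRun w h d k₁ k₂ η a b) → a ≤ N → b ≤ N → State a b (λ f → total acr f R) (druns R) (druns R ℕ.* 12)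
        state (run p q Dc E) a≤N b≤N =
          let a′≤ = ≤-trans (a′≤a (Deco.R Dc)) (≤-trans (a′≤a (Deco.G Dc)) (a′≤a (Deco.F Dc)))
              b′≤ = ≤-trans (b′≤b (Deco.R Dc)) (≤-trans (b′≤b (Deco.G Dc)) (b′≤b (Deco.F Dc)))
              s = RunState.runState p q a≤N b≤N Dc (eA E) (eB E) (stateE E (≤-trans a′≤ a≤N) (≤-trans b′≤ b≤N))
          in record { State s ; bl≤ = ℕₚ.≤-trans (State.bl≤ s) (nat (drunsE E ℕ.* 12)) }
          where
          nat : ∀ x → x ℕ.+ 6 ℕ.+ 4 ℕ.≤ 12 ℕ.+ x
          nat x = ℕₚ.≤-trans (ℕₚ.≤-reflexive (trans (ℕₚ.+-assoc x 6 4) (ℕₚ.+-comm x 10))) (ℕₚ.+-monoˡ-≤ x (ℕₚ.≤-trans (ℕₚ.n≤1+n 10) (ℕₚ.n≤1+n 11)))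

        stateE : ∀ {a b} (E : DEnd w h d k₁ k₂ η a b) → a ≤ N → b ≤ N → State a b (λ f → totalE acr f E) (drunsE E) (drunsE E ℕ.* 12 ℕ.+ 6)
        stateE (term _ p) _ _ = stateTerm p
        stateE (vbr {a₁} {a₂} le R₁ R₂) a≤N b≤N = swapState (λ _ → refl) refl (cong (ℕ._+ 6) (sym (ℕₚ.*-distribʳ-+ 12 (druns R₁) (druns R₂))))
          (stateV (fA R₁) (fA R₂) le (≤-trans 0≤d (<⇒≤ (fB R₁)))
            (state R₁ (≤-trans (≤-trans (lin≤ (≤-trans 0≤d (<⇒≤ (fA R₂))) (ring-3 a₁ a₂)) le) a≤N) b≤N)
            (state R₂ (≤-trans (≤-trans (lin≤ (≤-trans 0≤d (<⇒≤ (fA R₁))) (ring-7 a₁ a₂)) le) a≤N) b≤N))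
        stateE (hbr {b₁} {b₂} le R₁ R₂) a≤N b≤N = swapState (λ _ → refl) refl (cong (ℕ._+ 6) (sym (ℕₚ.*-distribʳ-+ 12 (druns R₁) (druns R₂))))
          (stateH (≤-trans 0≤d (<⇒≤ (fB R₁))) (≤-trans 0≤d (<⇒≤ (fB R₂))) le
            (state R₁ a≤N (≤-trans (≤-trans (lin≤ (≤-trans 0≤d (<⇒≤ (fB R₂))) (ring-3 b₁ b₂)) le) b≤N))
            (state R₂ a≤N (≤-trans (≤-trans (lin≤ (≤-trans 0≤d (<⇒≤ (fB R₁))) (ring-7 b₁ b₂)) le) b≤N)))

        fA : ∀ {a b} → DRun w h d k₁ k₂ η a b → d < a
        fA (run p _ _ _) = p
        fB : ∀ {a b} → DRun w h d k₁ k₂ η a b → d < b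
        fB (run _ p _ _) = p
        eA : ∀ {a b} → DEnd w h d k₁ k₂ η a b → 0ℚ ≤ a
        eA (term p _) = p
        eA (vbr le R₁ R₂) = ≤-trans (0≤+ (≤-trans 0≤d (<⇒≤ (fA R₁))) (≤-trans 0≤d (<⇒≤ (fA R₂)))) le
        eA (hbr le R₁ R₂) = ≤-trans 0≤d (<⇒≤ (fA R₁))
        eB : ∀ {a b} → DEnd w h d k₁ k₂ η a b → 0ℚ ≤ b
        eB (term _ p) = p
        eB (vbr le R₁ R₂) = ≤-trans 0≤d (<⇒≤ (fB R₁))
        eB (hbr le R₁ R₂) = ≤-trans (0≤+ (≤-trans 0≤d (<⇒≤ (fB R₁))) (≤-trans 0≤d (<⇒≤ (fB R₂)))) le

-- Long items peeled into the boundary L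

module BoundaryL where

  open Packings
  open Counting
  open SizeClasses

  -- Long items peeled one by one from the left and from the bottom

  module _ {Item : Set} where

    data LNest (w h : Item → ℚ) (N : ℚ) : (a b a′ b′ : ℚ) → List Item → Set where
      []  : ∀ {a b} → LNest w h N a b a b []
      lv  : ∀ {a₀ a b a′ b′ i S} → N < h i + h i → h i ≤ b → a₀ ≡ w i + a → LNest w h N a b a′ b′ S → LNest w h N a₀ b a′ b′ (i ∷ S)
      lh  : ∀ {a b₀ b a′ b′ i S} → N < w i + w i → w i ≤ a → b₀ ≡ h i + b → LNest w h N a b a′ b′ S → LNest w h N a b₀ a′ b′ (i ∷ S)

    transposeN : ∀ {w h N a b a′ b′ S} → LNest w h N a b a′ b′ S → LNest h w N b a b′ a′ S
    transposeN [] = []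
    transposeN (lv p q r s) = lh p q r (transposeN s)
    transposeN (lh p q r s) = lv p q r (transposeN s)

    nest-≤ : ∀ {w h N a b a′ b′ L} → (∀ i → 0ℚ < w i) → (∀ i → 0ℚ < h i) → LNest w h N a b a′ b′ L → a′ ≤ a × b′ ≤ b
    nest-≤ w>0 h>0 [] = ≤-refl , ≤-refl
    nest-≤ w>0 h>0 (lv {i = i} _ _ refl s) = let (p , q) = nest-≤ w>0 h>0 s in ≤-trans (≤-reflexive (sym (+-identityˡ _))) (<⇒≤ (w>0 i) ⊕ p) , q
    nest-≤ w>0 h>0 (lh {i = i} _ _ refl s) = let (p , q) = nest-≤ w>0 h>0 s in p , ≤-trans (≤-reflexive (sym (+-identityˡ _))) (<⇒≤ (h>0 i) ⊕ q)

    module Tall (w h : Item → ℚ) (N : ℚ) where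

      LongV : Item → Set
      LongV i = N < h i + h i

      LongV? : ∀ i → Dec (LongV i)
      LongV? i = N <? h i + h i

      abstract
          two : ∀ {x y a₁ a₂ a} → N < x + x → N < y + y → x ≤ a₁ → y ≤ a₂ → a₁ + a₂ ≤ a → a ≤ N → ⊥
          two {x} {y} {a₁} {a₂} {a} p q r s t u = <⇒≱ (+-mono-< p q) (lin≤ ((r ⊕ r ⊕ s ⊕ s ⊕ t ⊕ t) ⊕ (u ⊕ u)) (ring-148 x y a₁ a₂ a N))
          ≤ˡ : ∀ {x y z} → 0ℚ ≤ y → x + y ≤ z → x ≤ z
          ≤ˡ {x} {y} p q = ≤-trans (lin≤ p (ring-3 x y)) q
          ≤ʳ : ∀ {x y z} → 0ℚ ≤ x → x + y ≤ z → y ≤ z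
          ≤ʳ {x} {y} p q = ≤-trans (lin≤ p (ring-7 x y)) q

      nonempty-sum : ∀ {S A B : List Item} → Split S A B → A ≡ [] → ∀ f → sum f S ≡ sum f B
      nonempty-sum s refl f = trans (s f) (+-identityˡ _)

      -- tall long items stand side by side
      tallW : ∀ {a b S} → a ≤ N → b ≤ N → 0ℚ ≤ a → Pack w h a b S → All LongV S → sum w S ≤ a
      tallW a≤ b≤ 0≤a nil _ = 0≤a
      tallW a≤ b≤ 0≤a (one {i} p _) _ = ≤-trans (≤-reflexive (+-identityʳ (w i))) p
      tallW {S = S} a≤ b≤ 0≤a (vcmp {S₁ = A} {B} x y z s P Q) al =
        ≤-trans (≤-reflexive (s w)) (≤-trans (tallW (≤-trans (≤ˡ y z) a≤) b≤ x P (All-splitˡ LongV? {S} {A} {B} s al) ⊕ tallW (≤-trans (≤ʳ x z) a≤) b≤ y Q (All-splitʳ LongV? {S} {A} {B} s al)) z)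
      tallW {S = S} a≤ b≤ 0≤a (hcmp {S₁ = []} {B} x y z s P Q) al =
        ≤-trans (≤-reflexive (nonempty-sum {S} {[]} {B} s refl w)) (tallW a≤ (≤-trans (≤ʳ x z) b≤) 0≤a Q (All-splitʳ LongV? {S} {[]} {B} s al))
      tallW {S = S} a≤ b≤ 0≤a (hcmp {S₁ = A@(_ ∷ _)} {[]} x y z s P Q) al =
        ≤-trans (≤-reflexive (trans (s w) (+-identityʳ (sum w A)))) (tallW a≤ (≤-trans (≤ˡ y z) b≤) 0≤a P (All-splitˡ LongV? {S} {A} {[]} s al))
      tallW {S = S} a≤ b≤ 0≤a (hcmp {S₁ = i ∷ A} {j ∷ B} x y z s P Q) al =
        ⊥-elim (two (All.head (All-splitˡ LongV? {S} {i ∷ A} {j ∷ B} s al)) (All.head (All-splitʳ LongV? {S} {i ∷ A} {j ∷ B} s al)) (proj₂ (All.head (fits P))) (proj₂ (All.head (fits Q))) z b≤)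

    module Nest (w h : Item → ℚ) (w>0 : ∀ i → 0ℚ < w i) (h>0 : ∀ i → 0ℚ < h i) (N : ℚ) where

      open Tall w h N
      open Tall h w N using () renaming (LongV to LongH)

      -- An item that is long in both directions counts as tall, so the two lists are complementary.
      vW hH : List Item → ℚ
      vW S = sum w (filter LongV? S)
      hH S = sum h (filter (¬? ∘ LongV?) S)

      Res : ℚ → ℚ → List Item → Set
      Res A B S = ∃ λ S′ → (∀ f → sum f S′ ≡ sum f S) × LNest w h N A B (A - vW S) (B - hH S) S′

      abstract
        all-V : ∀ {S} → All LongV S → vW S ≡ sum w S × hH S ≡ 0ℚ
        all-V {S} p = cong (sum w) (Listₚ.filter-all LongV? p) , cong (sum h) (Listₚ.filter-none (¬? ∘ LongV?) (All.map (λ x y → y x) p))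
          where import Data.List.Properties as Listₚ
        none-V : ∀ {S} → All (λ i → ¬ LongV i) S → hH S ≡ sum h S × vW S ≡ 0ℚ
        none-V {S} p = cong (sum h) (Listₚ.filter-all (¬? ∘ LongV?) p) , cong (sum w) (Listₚ.filter-none LongV? p)
          where import Data.List.Properties as Listₚ

      peelV : ∀ S₂ {A B a′ b′ S} → All LongV S₂ → All (λ i → h i ≤ B) S₂ → LNest w h N (A - sum w S₂) B a′ b′ S → LNest w h N A B a′ b′ (S₂ ++ S)
      peelV [] {A} {B} {a′} {b′} {S} _ _ L = subst (λ z → LNest w h N z B a′ b′ S) (ring-149 A) L
      peelV (i ∷ S₂) {A} {B} {a′} {b′} {S} (p ∷ ps) (q ∷ qs) L = lv p q (ring-82 A (w i)) (peelV S₂ ps qs (subst (λ z → LNest w h N z B a′ b′ S) (ring-20 A (w i) (sum w S₂)) L))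

      peelH : ∀ S₂ {A B a′ b′ S} → All LongH S₂ → All (λ i → w i ≤ A) S₂ → LNest w h N A (B - sum h S₂) a′ b′ S → LNest w h N A B a′ b′ (S₂ ++ S)
      peelH [] {A} {B} {a′} {b′} {S} _ _ L = subst (λ z → LNest w h N A z a′ b′ S) (ring-149 B) L
      peelH (i ∷ S₂) {A} {B} {a′} {b′} {S} (p ∷ ps) (q ∷ qs) L = lh p q (ring-82 B (h i)) (peelH S₂ ps qs (subst (λ z → LNest w h N A z a′ b′ S) (ring-20 B (h i) (sum h S₂)) L))

      private
        vW-split : ∀ {S A B} → Split S A B → vW S ≡ vW A + vW B
        vW-split {S} {A} {B} s = split-filter LongV? {S} {A} {B} s w
        hH-split : ∀ {S A B} → Split S A B → hH S ≡ hH A + hH B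
        hH-split {S} {A} {B} s = split-filter (¬? ∘ LongV?) {S} {A} {B} s h

      Long? : ∀ i → Dec (LongV i ⊎ LongH i)
      Long? i = LongV? i ⊎-dec (N <? w i + w i)
        where open import Relation.Nullary.Decidable using (_⊎-dec_)

      notAll : ∀ {P : Item → Set} (P? : ∀ i → Dec (P i)) S → ¬ All P S → ∃ λ i → i ∈ S × ¬ P i
      notAll P? [] q = ⊥-elim (q [])
      notAll P? (i ∷ S) q with P? i
      ... | no ¬p = i , here refl , ¬p
      ... | yes p = let (j , j∈ , ¬p) = notAll P? S (λ ps → q (p ∷ ps)) in j , there j∈ , ¬p

      toH : ∀ {i} → LongV i ⊎ LongH i → ¬ LongV i → LongH i
      toH (inj₁ p) q = ⊥-elim (q p)
      toH (inj₂ p) q = p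

      -- What is peeled earlier lies further out. The tall items of one side of a cut are peeled
      -- before the other side, whichever side they come from, and then have the full height `B` at
      -- their disposal.
      joinVL : ∀ {A B S S₁ S₂} → Split S S₁ S₂ → All LongV S₂ → All (λ i → h i ≤ B) S₂ → Res (A - sum w S₂) B S₁ → Res A B S
      joinVL {A} {B} {S} {S₁} {S₂} s al hB (S′ , e , L) = S₂ ++ S′ , (λ f → trans (sum-++ f S₂ S′) (trans (cong (_+_ (sum f S₂)) (e f)) (trans (+-comm (sum f S₂) (sum f S₁)) (sym (s f))))) ,
        peelV S₂ al hB (subst₂ (λ x y → LNest w h N (A - sum w S₂) B x y S′) eq₁ eq₂ L)
        where
        abstract
          eq₁ : (A - sum w S₂) - vW S₁ ≡ A - vW S
          eq₁ = trans (ring-150 A (sum w S₂) (vW S₁)) (cong (λ u → A - u) (sym (trans (vW-split {S} {S₁} {S₂} s) (cong (_+_ (vW S₁)) (proj₁ (all-V al))))))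
          eq₂ : B - hH S₁ ≡ B - hH S
          eq₂ = cong (λ u → B - u) (sym (trans (hH-split {S} {S₁} {S₂} s) (trans (cong (_+_ (hH S₁)) (proj₂ (all-V al))) (+-identityʳ (hH S₁)))))

      joinHL : ∀ {A B S S₁ S₂} → Split S S₁ S₂ → All (λ i → ¬ LongV i) S₂ → All LongH S₂ → All (λ i → w i ≤ A) S₂ → Res A (B - sum h S₂) S₁ → Res A B S
      joinHL {A} {B} {S} {S₁} {S₂} s ¬al al wA (S′ , e , L) = S₂ ++ S′ , (λ f → trans (sum-++ f S₂ S′) (trans (cong (_+_ (sum f S₂)) (e f)) (trans (+-comm (sum f S₂) (sum f S₁)) (sym (s f))))) ,
        peelH S₂ al wA (subst₂ (λ x y → LNest w h N A (B - sum h S₂) x y S′) eq₂ eq₁ L)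
        where
        abstract
          eq₁ : (B - sum h S₂) - hH S₁ ≡ B - hH S
          eq₁ = trans (ring-150 B (sum h S₂) (hH S₁)) (cong (λ u → B - u) (sym (trans (hH-split {S} {S₁} {S₂} s) (cong (_+_ (hH S₁)) (proj₁ (none-V ¬al))))))
          eq₂ : A - vW S₁ ≡ A - vW S
          eq₂ = cong (λ u → A - u) (sym (trans (vW-split {S} {S₁} {S₂} s) (trans (cong (_+_ (vW S₁)) (proj₂ (none-V ¬al))) (+-identityʳ (vW S₁)))))

      nilRes : ∀ {A B} → Res A B []
      nilRes {A} {B} = [] , (λ f → refl) , subst₂ (λ x y → LNest w h N A B x y []) (ring-151 A) (ring-151 B) []

      wideH : ∀ {a b S} → a ≤ N → b ≤ N → 0ℚ ≤ b → Pack w h a b S → All LongH S → sum h S ≤ b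
      wideH a≤ b≤ 0≤b P al = Tall.tallW h w N b≤ a≤ 0≤b (transposeP P) al

      -- Two items wider than half of the knapsack cannot lie on different sides of a vertical cut,
      -- so one side has tall items only, which are peeled; the other side is treated recursively.
      -- The box left after peeling is at least as large as the part of the original packing, hence
      -- the pairs `a ≤ A` and `b ≤ B`.
      nest : ∀ {a b S A B} → Pack w h a b S → All (λ i → LongV i ⊎ LongH i) S → 0ℚ ≤ a → 0ℚ ≤ b → a ≤ A → b ≤ B → A ≤ N → B ≤ N → Res A B S
      nest nil _ _ _ _ _ _ _ = nilRes
      nest {A = A} {B} (one {i} p q) (al ∷ []) _ _ a≤ b≤ _ _ with LongV? i
      ... | yes v = joinVL {A} {B} {i ∷ []} {[]} {i ∷ []} (split-[]ˡ (i ∷ [])) (v ∷ []) (≤-trans q b≤ ∷ []) nilRes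
      ... | no ¬v = joinHL {A} {B} {i ∷ []} {[]} {i ∷ []} (split-[]ˡ (i ∷ [])) (¬v ∷ []) (toH al ¬v ∷ []) (≤-trans p a≤ ∷ []) nilRes
      nest {a} {b} {S} {A} {B} (vcmp {a₁} {a₂} {S₁ = S₁} {S₂} x y z s P Q) al 0≤a 0≤b a≤ b≤ A≤ B≤ with All.all? LongV? S₂ | All.all? LongV? S₁
      ... | yes v₂ | _ = joinVL {A} {B} {S} {S₁} {S₂} s v₂ (All.map (λ p → ≤-trans (proj₂ p) b≤) (fits Q))
            (nest P (All-splitˡ Long? {S} {S₁} {S₂} s al) x 0≤b (lin≤ (tallW (≤-trans (≤ʳ x z) (≤-trans a≤ A≤)) (≤-trans b≤ B≤) y Q v₂ ⊕ z ⊕ a≤) (ring-152 A a a₁ a₂ (sum w S₂))) b≤ (≤-trans (lin≤ (sum-nonneg (<⇒≤ ∘ w>0) S₂) (ring-114 A (sum w S₂))) A≤) B≤)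
      ... | no _ | yes v₁ = joinVL {A} {B} {S} {S₂} {S₁} (split-swap {S = S} {S₁} {S₂} s) v₁ (All.map (λ p → ≤-trans (proj₂ p) b≤) (fits P))
            (nest Q (All-splitʳ Long? {S} {S₁} {S₂} s al) y 0≤b (lin≤ (tallW (≤-trans (≤ˡ y z) (≤-trans a≤ A≤)) (≤-trans b≤ B≤) x P v₁ ⊕ z ⊕ a≤) (ring-153 A a a₁ a₂ (sum w S₁))) b≤ (≤-trans (lin≤ (sum-nonneg (<⇒≤ ∘ w>0) S₁) (ring-114 A (sum w S₁))) A≤) B≤)
      ... | no ¬v₂ | no ¬v₁ = let (i , i∈ , ¬i) = notAll LongV? S₁ ¬v₁ ; (j , j∈ , ¬j) = notAll LongV? S₂ ¬v₂ in
            ⊥-elim (two (toH (All.lookup (All-splitˡ Long? {S} {S₁} {S₂} s al) i∈) ¬i) (toH (All.lookup (All-splitʳ Long? {S} {S₁} {S₂} s al) j∈) ¬j)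
                        (proj₁ (All.lookup (fits P) i∈)) (proj₁ (All.lookup (fits Q) j∈)) z (≤-trans a≤ A≤))
      nest {a} {b} {S} {A} {B} (hcmp {b₁} {b₂} {S₁ = S₁} {S₂} x y z s P Q) al 0≤a 0≤b a≤ b≤ A≤ B≤ with All.all? (¬? ∘ LongV?) S₂ | All.all? (¬? ∘ LongV?) S₁
      ... | yes v₂ | _ = joinHL {A} {B} {S} {S₁} {S₂} s v₂ H₂ (All.map (λ p → ≤-trans (proj₁ p) a≤) (fits Q))
            (nest P (All-splitˡ Long? {S} {S₁} {S₂} s al) 0≤a x a≤ (lin≤ (wideH (≤-trans a≤ A≤) (≤-trans (≤ʳ x z) (≤-trans b≤ B≤)) y Q H₂ ⊕ z ⊕ b≤) (ring-152 B b b₁ b₂ (sum h S₂))) A≤ (≤-trans (lin≤ (sum-nonneg (<⇒≤ ∘ h>0) S₂) (ring-114 B (sum h S₂))) B≤))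
        where
        H₂ : All LongH S₂
        H₂ = All.zipWith (λ (p , q) → toH p q) (All-splitʳ Long? {S} {S₁} {S₂} s al , v₂)
      ... | no _ | yes v₁ = joinHL {A} {B} {S} {S₂} {S₁} (split-swap {S = S} {S₁} {S₂} s) v₁ H₁ (All.map (λ p → ≤-trans (proj₁ p) a≤) (fits P))
            (nest Q (All-splitʳ Long? {S} {S₁} {S₂} s al) 0≤a y a≤ (lin≤ (wideH (≤-trans a≤ A≤) (≤-trans (≤ˡ y z) (≤-trans b≤ B≤)) x P H₁ ⊕ z ⊕ b≤) (ring-153 B b b₁ b₂ (sum h S₁))) A≤ (≤-trans (lin≤ (sum-nonneg (<⇒≤ ∘ h>0) S₁) (ring-114 B (sum h S₁))) B≤))
        where
        H₁ : All LongH S₁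
        H₁ = All.zipWith (λ (p , q) → toH p q) (All-splitˡ Long? {S} {S₁} {S₂} s al , v₁)
      ... | no ¬v₂ | no ¬v₁ = let (i , i∈ , ¬i) = notAll (¬? ∘ LongV?) S₁ ¬v₁ ; (j , j∈ , ¬j) = notAll (¬? ∘ LongV?) S₂ ¬v₂ in
            ⊥-elim (two (dn i ¬i) (dn j ¬j) (proj₂ (All.lookup (fits P) i∈)) (proj₂ (All.lookup (fits Q) j∈)) z (≤-trans b≤ B≤))
        where
        dn : ∀ i → ¬ (¬ LongV i) → LongV i
        dn i ¬i with LongV? i
        ... | yes p = p
        ... | no p = ⊥-elim (¬i p)

-- Candidate packings for a quarter of the items dropped

module FourCandidates where

  open Packings
  open Counting
  open ContainerTrees
  open Configurations
  open SizeClasses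
  open TallBoxes
  open PeelingRuns
  open BoxTrees
  open DecoratedRuns
  open WithoutCorner
  open WithCorner
  open BoundaryL

  module _ {Item : Set} where

    ListSelector : Set
    ListSelector = ∀ {w h : Item → ℚ} {d k₁ k₂ η a b a′ b′} → Deco w h d k₁ k₂ η a b a′ b′ → List Item

    hrL ggL : ListSelector
    hrL D = hI (Deco.Fy′ D) ++ hI (Deco.R D)
    ggL D = vI (Deco.G D) ++ hI (Deco.G D)

    mutual
      collect : ListSelector → ∀ {w h : Item → ℚ} {d k₁ k₂ η a b} → DRun w h d k₁ k₂ η a b → List Item
      collect s (run _ _ D e) = s D ++ collectE s e
      collectE : ListSelector → ∀ {w h : Item → ℚ} {d k₁ k₂ η a b} → DEnd w h d k₁ k₂ η a b → List Item
      collectE s (term _ _) = []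
      collectE s (vbr _ p q) = collect s p ++ collect s q
      collectE s (hbr _ p q) = collect s p ++ collect s q

    mutual
      sum-collect : (s : ListSelector) (t : Selector) → (∀ {w h : Item → ℚ} {d k₁ k₂ η a b a′ b′} f (D : Deco w h d k₁ k₂ η a b a′ b′) → sum f (s D) ≡ t f D) →
        ∀ {w h : Item → ℚ} {d k₁ k₂ η a b} f (R : DRun w h d k₁ k₂ η a b) → sum f (collect s R) ≡ total t f R
      sum-collect s t eq f (run _ _ D e) = trans (sum-++ f (s D) (collectE s e)) (cong₂ _+_ (eq f D) (sum-collectE s t eq f e))
      sum-collectE : (s : ListSelector) (t : Selector) → (∀ {w h : Item → ℚ} {d k₁ k₂ η a b a′ b′} f (D : Deco w h d k₁ k₂ η a b a′ b′) → sum f (s D) ≡ t f D) →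
        ∀ {w h : Item → ℚ} {d k₁ k₂ η a b} f (E : DEnd w h d k₁ k₂ η a b) → sum f (collectE s E) ≡ totalE t f E
      sum-collectE s t eq f (term _ _) = refl
      sum-collectE s t eq f (vbr _ p q) = trans (sum-++ f (collect s p) (collect s q)) (cong₂ _+_ (sum-collect s t eq f p) (sum-collect s t eq f q))
      sum-collectE s t eq f (hbr _ p q) = trans (sum-++ f (collect s p) (collect s q)) (cong₂ _+_ (sum-collect s t eq f p) (sum-collect s t eq f q))

    vcL : ListSelector
    vcL D = vI (Deco.Fx D)

  module Candidates {Item : Set} (_≟I_ : DecidableEquality Item) (ea : ℚ) (bp : BoxParams) (dp : DepthParams bp) where

    open BoxParams bp
    open DepthParams dp
    open VBox _≟I_ ea bp using (dropBound; leafBound)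

    ω : ℚ
    ω = e + e + e + e

    leafK : ℕ
    leafK = suc (suc leafBound)

    0≤e : 0ℚ ≤ e
    0≤e = <⇒≤ 0<e

    -- `us≤` adds the area of the containers and that of the boundary: together they are what small
    -- items cannot use. The part of `lost` is the class and the depth range that a candidate drops;
    -- the rest is lost in its boxes.
    record Cand (w h : Item → ℚ) (Sall : List Item) (lost : ℚ) (k : ℕ) : Set where
      field
        K Dp L C : List Item
        {a′ b′}  : ℚ
        splitS : Split Sall K Dp
        splitK : Split K L C
        nestL  : LNest w h N N N a′ b′ L
        0≤a′   : 0ℚ ≤ a′
        0≤b′   : 0ℚ ≤ b′
        tree   : CTree ea w h a′ b′ C
        lost≤  : card Dp ≤ lost + ((e + e + e) * card Sall + ⟦ k ℕ.* dropBound ⟧)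
        lv≤    : leaves tree ℕ.≤ k ℕ.* leafK ℕ.+ 4
        us≤    : used tree + (N * N - a′ * b′) ≤ sum (λ i → w i * h i) Sall + ω * (N * N)

    transposeCand : ∀ {w h S l k} → Cand w h S l k → Cand h w S l k
    transposeCand {w} {h} {S} c = record
      { K = K ; Dp = Dp ; L = L ; C = C ; splitS = splitS ; splitK = splitK ; nestL = transposeN nestL ; 0≤a′ = 0≤b′ ; 0≤b′ = 0≤a′
      ; tree = transposeC tree ; lost≤ = lost≤ ; lv≤ = ℕₚ.≤-trans (ℕₚ.≤-reflexive (leaves-transposeC tree)) lv≤
      ; us≤ = subst₂ _≤_ (cong₂ (λ u v → u + (N * N - v)) (sym (used-transposeC tree)) (*-comm a′ b′)) (cong (_+ ω * (N * N)) (swapA S)) us≤ }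
      where
      open Cand c
      swapA : ∀ S → sum (λ i → w i * h i) S ≡ sum (λ i → h i * w i) S
      swapA [] = refl
      swapA (i ∷ S) = cong₂ _+_ (*-comm (w i) (h i)) (swapA S)

    module _ (w h : Item → ℚ) (w>0 : ∀ i → 0ℚ < w i) (h>0 : ∀ i → 0ℚ < h i) (Sall : List Item) (once : ∀ i → sum (ind (_≟I i)) Sall ≤ 1ℚ) (pk : Pack w h N N Sall)
      (R : DRun w h d k₁ k₂ η N N) (sums : ∀ f → sum f Sall ≡ total vc f R + (total vr f R + (total hc f R + (total hr f R + total gg f R)))) where

      open Classes _≟I_ w h w>0 h>0 using (Once; once-disjoint; once-subˡ)
      open ToC _≟I_ ea bp w h w>0 h>0 d 0<d using (toC; TC)
      open AH w h w>0 h>0 dp using (BT; State; state; acr)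
      open DecM _≟I_ using (_∈?_)

      private
        area : Item → ℚ
        area i = w i * h i
        0≤area : ∀ i → 0ℚ ≤ area i
        0≤area i = 0≤* (<⇒≤ (w>0 i)) (<⇒≤ (h>0 i))

      -- Packings can be restricted to decidable predicates only. As no item occurs twice,
      -- membership in `T` selects exactly the multiset `T`.
      subPack : ∀ {T U : List Item} → Split Sall T U → ∃ λ T′ → (∀ f → sum f T′ ≡ sum f T) × Pack w h N N T′
      subPack {T} {U} s = filter (_∈? T) Sall , eq , restrictP (_∈? T) pk
        where
        onceTU : Once (T ++ U)
        onceTU i = ≤-trans (≤-reflexive (trans (sum-++ _ T U) (sym (s _)))) (once i)
        eq : ∀ f → sum f (filter (_∈? T) Sall) ≡ sum f T
        eq f = trans (split-filter (_∈? T) {Sall} {T} {U} s f) (trans (cong₂ _+_ (cong (sum f) (Listₚ.filter-all (_∈? T) (All.tabulate id)))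
                 (cong (sum f) (Listₚ.filter-none (_∈? T) (All.tabulate (λ {i} i∈U i∈T → once-disjoint {T} {U} onceTU i∈T i∈U))))) (+-identityʳ (sum f T)))

      candB : druns R ℕ.≤ T → Cand w h Sall (total vc (λ _ → 1ℚ) R + total gg (λ _ → 1ℚ) R) (T ℕ.* BV.KB w h dp)
      candB r≤ = result (BV.bV w h dp R ≤-refl ≤-refl)
        where
        KB = BV.KB w h dp
        result : (∃ λ S → (∀ f → sum f S ≡ total vr f R + (total hc f R + total hr f R)) × Σ (BT N N S) λ T → bl T ℕ.≤ druns R ℕ.* KB) → Cand w h Sall _ (T ℕ.* KB)
        result (S , I , Tr , b≤) =
          let (S′ , B , s , cB , U , lvs , us) = toC 0≤N 0≤N N≤ N≤ (once-subˡ {Sall} {S} {DD} sp once) Tr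
          in record
            { K = S′ ; Dp = B ++ DD ; L = [] ; C = S′
            ; splitS = λ f → trans (sp f) (trans (cong (_+ sum f DD) (s f)) (trans (+-assoc (sum f S′) (sum f B) (sum f DD)) (cong (_+_ (sum f S′)) (sym (sum-++ f B DD)))))
            ; splitK = split-[]ˡ S′ ; nestL = [] ; 0≤a′ = 0≤N ; 0≤b′ = 0≤N ; tree = U
            ; lost≤ = ≤-trans (≤-reflexive (trans (sum-++ _ B DD) (cong (_+_ (card B)) (trans (sum-++ _ VCs GGs) (cong₂ _+_ (sum-collect vcL vc (λ f D → refl) _ R) (sum-collect ggL gg (λ f D → sum-++ f (vI (Deco.G D)) (hI (Deco.G D))) _ R))))))
                        (lin≤ (cB ⊕ (0≤+ (0≤+ 0≤e 0≤e) 0≤e ⊛ split-≤ˡ {S = Sall} {S} {DD} sp (λ _ → 0≤1)) ⊕ ⟦⟧-mono (ℕₚ.*-monoˡ-≤ dropBound (ℕₚ.≤-trans b≤ (ℕₚ.*-monoˡ-≤ KB r≤))))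
                          (ring-155 (card B) (total vc (λ _ → 1ℚ) R + total gg (λ _ → 1ℚ) R) (e + e + e) (card S) (card Sall) ⟦ bl Tr ℕ.* dropBound ⟧ ⟦ T ℕ.* KB ℕ.* dropBound ⟧))
            ; lv≤ = ℕₚ.≤-trans lvs (ℕₚ.≤-trans (ℕₚ.*-monoˡ-≤ leafK (ℕₚ.≤-trans b≤ (ℕₚ.*-monoˡ-≤ KB r≤))) (ℕₚ.m≤m+n _ 4))
            ; us≤ = lin≤ (us ⊕ split-≤ˡ {S = Sall} {S} {DD} sp 0≤area ⊕ 0≤* (0≤+ 0≤e 0≤e) (0≤* 0≤N 0≤N)) (ring-156 (used U) N (sum area S) (sum area Sall) e) }
          where
          VCs = collect vcL R
          GGs = collect ggL R
          DD = VCs ++ GGs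
          abstract
            sp : Split Sall S DD
            sp f = trans (sums f) (trans (ring-154 (total vc f R) (total vr f R) (total hc f R) (total hr f R) (total gg f R))
                     (sym (cong₂ _+_ (I f) (trans (sum-++ f VCs GGs) (cong₂ _+_ (sum-collect vcL vc (λ f D → refl) f R) (sum-collect ggL gg (λ f D → sum-++ f (vI (Deco.G D)) (hI (Deco.G D))) f R))))))

      total-acr : ∀ f → total acr f R ≡ total vc f R + (total vr f R + total hc f R)
      total-acr f = go R
        where
        go : ∀ {a b} (R : DRun w h d k₁ k₂ η a b) → total acr f R ≡ total vc f R + (total vr f R + total hc f R)
        goE : ∀ {a b} (E : DEnd w h d k₁ k₂ η a b) → totalE acr f E ≡ totalE vc f E + (totalE vr f E + totalE hc f E)
        go (run _ _ Dc E) = trans (cong (_+_ (acr f Dc)) (goE E)) (ring-104 (vc f Dc) (vr f Dc) (hc f Dc) (totalE vc f E) (totalE vr f E) (totalE hc f E))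
        goE (term _ _) = refl
        goE (vbr _ p q) = trans (cong₂ _+_ (go p) (go q)) (ring-104 (total vc f p) (total vr f p) (total hc f p) (total vc f q) (total vr f q) (total hc f q))
        goE (hbr _ p q) = trans (cong₂ _+_ (go p) (go q)) (ring-104 (total vc f p) (total vr f p) (total hc f p) (total vc f q) (total vr f q) (total hc f q))

      each≤sum : ∀ {f : Item → ℚ} → (∀ i → 0ℚ ≤ f i) → ∀ S → All (λ i → f i ≤ sum f S) S
      each≤sum p [] = []
      each≤sum {f} p (i ∷ S) = lin≤ (sum-nonneg p S) (ring-3 (f i) (sum f S)) ∷ All.map (λ q → ≤-trans q (lin≤ (p i) (ring-7 (f i) (sum f S)))) (each≤sum p S)

      module CandA (r≤ : druns R ℕ.≤ T) where

        abstract
          st : State N N (λ f → total acr f R) (druns R) (druns R ℕ.* 12)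
          st = state R ≤-refl ≤-refl
        module S = State st

        τ : ℚ
        τ = sum h S.HS
        0≤h : ∀ i → 0ℚ ≤ h i
        0≤h i = <⇒≤ (h>0 i)
        0≤w : ∀ i → 0ℚ ≤ w i
        0≤w i = <⇒≤ (w>0 i)
        0≤τ : 0ℚ ≤ τ
        0≤τ = sum-nonneg 0≤h S.HS

        -- At the root, the homeless items need a band of height `τ` and `FV` a column of width `κ`.
        -- A homeless item of width at most `N - κ` fits beside the column, and a tall item of
        -- height at most `N - τ` fits above the wide part of the boundary. The others reach into
        -- the crossing of band and column; they are longer than half of the knapsack and form the
        -- boundary.
        wide? : ∀ i → Dec (N - κ < w i)
        wide? i = (N - κ) <? w i
        tall? : ∀ i → Dec (N - τ < h i)
        tall? i = (N - τ) <? h i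
        wide narrow tall low HR GG T₁ U : List Item
        wide = filter wide? S.HS
        narrow = filter (¬? ∘ wide?) S.HS
        tall = filter tall? S.FV
        low = filter (¬? ∘ tall?) S.FV
        HR = collect hrL R
        GG = collect ggL R
        T₁ = tall ++ wide
        U = S.C ++ (low ++ (narrow ++ (HR ++ GG)))

        open Nest w h w>0 h>0 N using (vW; hH; all-V; none-V; nest; Res)
        open Tall w h N using (LongV; LongV?)

        N₁ N₂ : ℚ
        N₁ = sum h wide
        N₂ = sum w tall

        hr-gg : ∀ f → sum f (HR ++ GG) ≡ total hr f R + total gg f R
        hr-gg f = trans (sum-++ f HR GG) (cong₂ _+_ (sum-collect hrL hr (λ f D → sum-++ f (hI (Deco.Fy′ D)) (hI (Deco.R D))) f R) (sum-collect ggL gg (λ f D → sum-++ f (vI (Deco.G D)) (hI (Deco.G D))) f R))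

        abstract
          spT : Split Sall T₁ U
          spT f = trans (sums f) (trans (ring-157 (total vc f R) (total vr f R) (total hc f R) (total hr f R + total gg f R))
            (trans (cong₂ _+_ (trans (sym (total-acr f)) (trans (sym (S.sums f)) (cong₂ (λ x y → sum f S.C + (x + y)) (split-partition wide? S.HS f) (split-partition tall? S.FV f)))) (sym (hr-gg f)))
            (trans (ring-158 (sum f S.C) (sum f wide) (sum f narrow) (sum f tall) (sum f low) (sum f (HR ++ GG)))
              (sym (cong₂ _+_ (sum-++ f tall wide) (trans (sum-++ f S.C _) (cong (_+_ (sum f S.C)) (trans (sum-++ f low _) (cong (_+_ (sum f low)) (sum-++ f narrow (HR ++ GG)))))))))))

          2τ≤N : τ + τ ≤ N
          2τ≤N = ≤-trans S.2HS S.Y≤b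

          tallV : All LongV tall
          tallV = All.map (λ {i} p → lin< (+-mono-<-≤ (+-mono-< p p) 2τ≤N) (ring-159 N τ (h i))) (Allₚ.all-filter tall? S.FV)
          wideH′ : All (λ i → N < w i + w i) wide
          wideH′ = All.map (λ {i} p → lin< (+-mono-<-≤ (+-mono-< p p) κ≤N) (ring-159 N κ (w i))) (Allₚ.all-filter wide? S.HS)
          wide¬V : All (λ i → ¬ LongV i) wide
          wide¬V = Allₚ.filter⁺ wide? (All.map (λ {i} p q → <⇒≱ q (≤-trans (p ⊕ p) 2τ≤N)) (each≤sum 0≤h S.HS))

        -- Tall and wide boundary items obstruct each other, so the order of peeling cannot be
        -- chosen freely; it is read off from the original packing, restricted to these items.
        sub : ∃ λ T′ → (∀ f → sum f T′ ≡ sum f T₁) × Pack w h N N T′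
        sub = subPack {T₁} {U} spT
        T′ : List Item
        T′ = proj₁ sub
        spT′ : Split T′ T₁ []
        spT′ f = trans (proj₁ (proj₂ sub) f) (sym (+-identityʳ (sum f T₁)))

        abstract
          vW≡ : vW T′ ≡ N₂
          vW≡ = trans (split-filter LongV? {T′} {T₁} {[]} spT′ w) (trans (+-identityʳ _)
                  (trans (split-filter LongV? {T₁} {tall} {wide} (split-++ tall wide) w) (trans (cong₂ _+_ (proj₁ (all-V tallV)) (proj₂ (none-V wide¬V))) (+-identityʳ N₂))))
          hH≡ : hH T′ ≡ N₁
          hH≡ = trans (split-filter (¬? ∘ LongV?) {T′} {T₁} {[]} spT′ h) (trans (+-identityʳ _)
                  (trans (split-filter (¬? ∘ LongV?) {T₁} {tall} {wide} (split-++ tall wide) h) (trans (cong₂ _+_ (proj₂ (all-V tallV)) (proj₁ (none-V wide¬V))) (+-identityˡ N₁))))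

          nested : ∃ λ L → (∀ f → sum f L ≡ sum f T₁) × LNest w h N N N (N - N₂) (N - N₁) L
          nested = let (L , e , n) = nest (proj₂ (proj₂ sub)) (All-merge (Nest.Long? w h w>0 h>0 N) {T′} {T₁} {[]} spT′ (Allₚ.++⁺ (All.map inj₁ tallV) (All.map inj₂ wideH′)) []) 0≤N 0≤N ≤-refl ≤-refl ≤-refl ≤-refl
                   in L , (λ f → trans (e f) (proj₁ (proj₂ sub) f)) , subst₂ (λ x y → LNest w h N N N (N - x) (N - y) L) vW≡ hH≡ n

          FV≤κ : sum w S.FV ≤ κ
          FV≤κ = ≤-trans S.FV≤ (≤-trans (lin≤ (0≤* (0≤⟦⟧ D) 0≤k₁ ⊛ ⟦⟧-mono r≤) (ring-136 ⟦ druns R ⟧ ⟦ T ⟧ (⟦ D ⟧ * k₁))) Tk₁)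
          low≤ : sum w low ≤ κ - N₂
          low≤ = lin≤ (≤-trans (≤-reflexive (sym (split-partition tall? S.FV w))) FV≤κ) (ring-40 κ N₂ (sum w low))
          0≤κ-N₂ : 0ℚ ≤ κ - N₂
          0≤κ-N₂ = ≤-trans (sum-nonneg 0≤w low) low≤
          narrow≡ : sum h narrow ≡ τ - N₁
          narrow≡ = trans (ring-30 N₁ (sum h narrow)) (cong (_- N₁) (sym (split-partition wide? S.HS h)))
          0≤τ-N₁ : 0ℚ ≤ τ - N₁
          0≤τ-N₁ = ≤-trans (sum-nonneg 0≤h narrow) (≤-reflexive narrow≡)
          τ≤Y : τ ≤ S.Y
          τ≤Y = lin≤ (S.2HS ⊕ 0≤τ) (ring-124 τ S.Y)
          0≤κ : 0ℚ ≤ κ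
          0≤κ = ≤-trans (sum-nonneg 0≤w S.FV) FV≤κ
          κ≤N′ : κ ≤ N
          κ≤N′ = lin≤ (κ≤N ⊕ 0≤κ) (ring-124 κ N)
          low-h : All (λ i → h i ≤ N - N₁) low
          low-h = All.map (λ {i} p → ≤-trans (≮⇒≥ p) (lin≤ 0≤τ-N₁ (ring-160 N τ N₁))) (Allₚ.all-filter (¬? ∘ tall?) S.FV)
          narrow-w : All (λ i → w i ≤ N - κ) narrow
          narrow-w = All.map ≮⇒≥ (Allₚ.all-filter (¬? ∘ wide?) S.HS)
          N-κ≤N : N - κ ≤ N
          N-κ≤N = lin≤ 0≤κ (ring-114 N κ)
          N-Y≤N : N - S.Y ≤ N
          N-Y≤N = lin≤ S.0≤Y (ring-114 N S.Y)

        spC : Split Sall S.C (T₁ ++ (low ++ (narrow ++ (HR ++ GG))))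
        spC f = trans (spT f) (trans (cong (_+_ (sum f T₁)) (sum-++ f S.C rest)) (trans (ring-2 (sum f T₁) (sum f S.C) (sum f rest)) (cong (_+_ (sum f S.C)) (sym (sum-++ f T₁ rest)))))
          where
          rest = low ++ (narrow ++ (HR ++ GG))

        abstract
          conv : TC (N - κ) (N - S.Y) S.C (bl S.content)
          conv = toC (≤⇒0≤ κ≤N′) (≤⇒0≤ S.Y≤b) (≤-trans N-κ≤N N≤) (≤-trans N-Y≤N N≤) (once-subˡ {Sall} {S.C} {T₁ ++ (low ++ (narrow ++ (HR ++ GG)))} spC once) S.content

        S′ B : List Item
        S′ = proj₁ conv
        B = proj₁ (proj₂ conv)
        Tc : CTree ea w h (N - κ) (N - S.Y) S′
        Tc = proj₁ (proj₂ (proj₂ (proj₂ (proj₂ conv))))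

        treeA : CTree ea w h (N - N₂) (N - N₁) (low ++ (narrow ++ S′))
        treeA = vs {S₁ = low} {S₂ = narrow ++ S′} 0≤κ-N₂ (≤⇒0≤ κ≤N′) (ring-161 κ N₂ N) (split-++ low (narrow ++ S′)) (vst low-h low≤)
                  (hs {S₁ = narrow} {S₂ = S′} 0≤τ-N₁ (≤⇒0≤ (≤-trans τ≤Y S.Y≤b)) (ring-161 τ N₁ N) (split-++ narrow S′) (hst narrow-w (≤-reflexive narrow≡))
                    (hs {S₁ = []} {S₂ = S′} (≤⇒0≤ τ≤Y) (≤⇒0≤ S.Y≤b) (ring-161 S.Y τ N) (split-[]ˡ S′) (free refl) Tc))

        candA : Cand w h Sall (total hr (λ _ → 1ℚ) R + total gg (λ _ → 1ℚ) R) (T ℕ.* 12)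
        candA = record
          { K = L ++ (low ++ (narrow ++ S′)) ; Dp = B ++ (HR ++ GG) ; L = L ; C = low ++ (narrow ++ S′)
          ; splitS = λ f → trans (spT f) (trans (cong₂ _+_ (sym (proj₁ (proj₂ nested) f)) (trans (sum-++ f S.C _) (cong₂ _+_ (proj₁ (proj₂ (proj₂ conv)) f) (trans (sum-++ f low _) (cong (_+_ (sum f low)) (sum-++ f narrow _))))))
              (trans (ring-162 (sum f L) (sum f S′) (sum f B) (sum f low) (sum f narrow) (sum f (HR ++ GG)))
                (sym (cong₂ _+_ (trans (sum-++ f L _) (cong (_+_ (sum f L)) (trans (sum-++ f low _) (cong (_+_ (sum f low)) (sum-++ f narrow S′))))) (sum-++ f B (HR ++ GG))))))
          ; splitK = split-++ L (low ++ (narrow ++ S′)) ; nestL = proj₂ (proj₂ nested)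
          ; 0≤a′ = ≤-trans (0≤+ 0≤κ-N₂ (≤⇒0≤ κ≤N′)) (≤-reflexive (ring-161 κ N₂ N)) ; 0≤b′ = ≤-trans (0≤+ 0≤τ-N₁ (≤⇒0≤ (≤-trans τ≤Y S.Y≤b))) (≤-reflexive (ring-161 τ N₁ N))
          ; tree = treeA
          ; lost≤ = ≤-trans (≤-reflexive (trans (sum-++ _ B (HR ++ GG)) (cong (_+_ (card B)) (hr-gg _))))
                     (lin≤ (proj₁ (proj₂ (proj₂ (proj₂ conv))) ⊕ (0≤+ (0≤+ 0≤e 0≤e) 0≤e ⊛ split-≤ˡ {S = Sall} {S.C} {T₁ ++ (low ++ (narrow ++ (HR ++ GG)))} spC (λ _ → 0≤1)) ⊕ ⟦⟧-mono (ℕₚ.*-monoˡ-≤ dropBound bl≤T))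
                       (ring-155 (card B) (total hr (λ _ → 1ℚ) R + total gg (λ _ → 1ℚ) R) (e + e + e) (card S.C) (card Sall) ⟦ bl S.content ℕ.* dropBound ⟧ ⟦ T ℕ.* 12 ℕ.* dropBound ⟧))
          ; lv≤ = ℕₚ.≤-trans (ℕ.s≤s (ℕ.s≤s (ℕ.s≤s (ℕₚ.≤-trans (proj₁ (proj₂ (proj₂ (proj₂ (proj₂ (proj₂ conv)))))) (ℕₚ.*-monoˡ-≤ leafK bl≤T))))) (ℕₚ.≤-trans (ℕₚ.≤-reflexive (ℕₚ.+-comm 3 (T ℕ.* 12 ℕ.* leafK))) (ℕₚ.+-monoʳ-≤ (T ℕ.* 12 ℕ.* leafK) (ℕₚ.n≤1+n 3)))
          -- Boundary, column and band cover at most κ N + τ N, where both `κ` and `τ` are at most e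
          -- N, and the boxes waste another 2 e N². This explains `ω` as four times `e`.
          ; us≤ = lin≤ (proj₂ (proj₂ (proj₂ (proj₂ (proj₂ (proj₂ conv))))) ⊕ split-≤ˡ {S = Sall} {S.C} {T₁ ++ (low ++ (narrow ++ (HR ++ GG)))} spC 0≤area ⊕ (0≤N ⊛ κ≤e) ⊕ (0≤N ⊛ S.HS≤) ⊕ (0≤* 0≤N 0≤N ⊛ η₃)
                         ⊕ 0≤* 0≤κ 0≤τ ⊕ (0≤* (0≤+ 0≤e 0≤e) (≤⇒0≤ S.Y≤b) ⊛ N-κ≤N) ⊕ (0≤* (0≤+ 0≤e 0≤e) 0≤N ⊛ N-Y≤N))
                        (ring-163 (used Tc) N κ τ S.Y N₁ N₂ e (sum area S.C) (sum area Sall) (⟦ D ⟧ * η)) }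
          where
          L = proj₁ nested
          bl≤T : bl S.content ℕ.≤ T ℕ.* 12
          bl≤T = ℕₚ.≤-trans S.bl≤ (ℕₚ.*-monoˡ-≤ 12 r≤)

-- Next-fit decreasing height in the free leaves

module SmallItems where

  open Packings
  open Counting
  open ContainerTrees
  open Configurations
  open SizeClasses

  -- Small items fill the free leaves by next-fit decreasing height.

  module NFDH {Item : Set} (_≟I_ : DecidableEquality Item) (w h : Item → ℚ) (w>0 : ∀ i → 0ℚ < w i) (h>0 : ∀ i → 0ℚ < h i) where

    private
      desc-++ : ∀ A {B} → Desc h (A ++ B) → All (λ i → All (λ j → h j ≤ h i) B) A × Desc h B
      desc-++ = Classes.desc-++ _≟I_ w h w>0 h>0
      area : Item → ℚ
      area i = w i * h i
      0≤area : ∀ i → 0ℚ ≤ area i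
      0≤area i = 0≤* (<⇒≤ (w>0 i)) (<⇒≤ (h>0 i))

    row : ∀ {b} S → All (λ i → h i ≤ b) S → Pack w h (sum w S) b S
    row [] [] = nil
    row (i ∷ S) (p ∷ ps) = vcmp {S₁ = i ∷ []} {S₂ = S} (<⇒≤ (w>0 i)) (sum-nonneg (<⇒≤ ∘ w>0) S) ≤-refl (λ f → cong (_+ sum f S) (sym (+-identityʳ (f i)))) (one ≤-refl p) (row S ps)

    module _ {p q A : ℚ} (0≤p : 0ℚ ≤ p) (0≤q : 0ℚ ≤ q) (p≤A : p ≤ A) where

      Out : ℚ → Item → List Item → Set
      Out B i S = ∃ λ S₁ → ∃ λ S₂ → Split S S₁ S₂ × Pack w h A B S₁ × (S₂ ≡ [] ⊎ (A - p) * ((B - h i) - q) ≤ sum area S₁)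

      -- A full shelf is wider than `A - p` and all its items are at least as high as the first item
      -- of the next shelf. So its area pays for the height of the next shelf, and only the heights
      -- of the first and of the rejected shelf stay unpaid. `n` is fuel for the recursion.
      shelves : ∀ n {i xs} B → 0ℚ ≤ B → length xs ℕ.≤ n → Desc h (i ∷ xs) → All (λ j → w j ≤ p × h j ≤ q) (i ∷ xs) → Out B i (i ∷ xs)
      shelves n {i} {xs} B 0≤B len d al with h i ≤? B
      ... | no ¬p = [] , i ∷ xs , split-[]ˡ (i ∷ xs) , nil ,
            inj₂ (lin≤ ((≤⇒0≤ p≤A ⊛ <⇒≤ (≰⇒> ¬p)) ⊕ 0≤* (≤⇒0≤ p≤A) 0≤q) (ring-169 A p B q (h i)))
      ... | yes hi≤B with greedy w (All.map proj₁ (All.tail al)) (A - w i) (≤⇒0≤ (≤-trans (proj₁ (All.head al)) p≤A))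
      ...   | X , [] , eq , X≤ , _ = i ∷ xs , [] , split-[]ʳ (i ∷ xs) ,
              widen (subst (λ z → w i + sum w z ≤ A) (sym (trans eq (Listₚ.++-identityʳ X))) (lin≤ X≤ (ring-20 A (w i) (sum w X)))) hi≤B (row (i ∷ xs) (≤-refl ∷ hd d)) , inj₁ refl
        where
        hd : Desc h (i ∷ xs) → All (λ j → h j ≤ h i) xs
        hd (q ∷ _) = q
      ...   | X , j ∷ ys , eq , X≤ , inj₁ ()
      shelves zero {i} {[]} B 0≤B len d al | yes hi≤B | [] , j ∷ ys , () , X≤ , inj₂ X>
      shelves zero {i} {[]} B 0≤B len d al | yes hi≤B | _ ∷ _ , j ∷ ys , () , X≤ , inj₂ X>
      shelves (suc n) {i} {xs} B 0≤B len d al | yes hi≤B | X , j ∷ ys , eq , X≤ , inj₂ X> =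
        let (S₁ , S₂ , s , P , alt) = shelves n {j} {ys} (B - h i) (≤⇒0≤ hi≤B) len′ (proj₂ dd) (Allₚ.++⁻ʳ (i ∷ X) al′)
        in (i ∷ X) ++ S₁ , S₂ ,
           (λ f → trans (cong (λ z → f i + sum f z) eq) (trans (cong (_+_ (f i)) (trans (sum-++ f X (j ∷ ys)) (cong (_+_ (sum f X)) (s f)))) (trans (ring-170 (f i) (sum f X) (sum f S₁) (sum f S₂)) (cong (_+ sum f S₂) (sym (sum-++ f (i ∷ X) S₁)))))) ,
           hcmp {S₁ = i ∷ X} {S₂ = S₁} (<⇒≤ (h>0 i)) (≤⇒0≤ hi≤B) (≤-reflexive (ring-41 (h i) B)) (split-++ (i ∷ X) S₁)
             (widen (lin≤ X≤ (ring-20 A (w i) (sum w X))) ≤-refl (row (i ∷ X) (≤-refl ∷ Allₚ.++⁻ˡ X (hd d′)))) P ,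
           map₂ (λ r → ≤-trans (lin≤ (r ⊕ shelf) (ring-171 A p B q (h i) (h j) (sum area S₁) (sum area (i ∷ X)))) (≤-reflexive (sym (sum-++ area (i ∷ X) S₁)))) alt
        where
        open import Data.Sum using (map₂)
        d′ : Desc h (i ∷ (X ++ j ∷ ys))
        d′ = subst (λ z → Desc h (i ∷ z)) eq d
        al′ : All (λ j → w j ≤ p × h j ≤ q) ((i ∷ X) ++ j ∷ ys)
        al′ = subst (λ z → All (λ j → w j ≤ p × h j ≤ q) (i ∷ z)) eq al
        dd : All (λ k → All (λ l → h l ≤ h k) (j ∷ ys)) (i ∷ X) × Desc h (j ∷ ys)
        dd = desc-++ (i ∷ X) d′
        hd : ∀ {zs} → Desc h (i ∷ zs) → All (λ j → h j ≤ h i) zs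
        hd (q ∷ _) = q
        len′ : length ys ℕ.≤ n
        len′ = ℕₚ.≤-pred (ℕₚ.≤-trans (ℕₚ.≤-trans (ℕₚ.m≤n+m (suc (length ys)) (length X)) (ℕₚ.≤-reflexive (trans (sym (Listₚ.length-++ X)) (cong length (sym eq))))) len)
        abstract
          shelf : (A - p) * h j ≤ sum area (i ∷ X)
          shelf = ≤-trans (lin≤ (<⇒≤ (h>0 j) ⊛ <⇒≤ X>) (ring-164 A p (h j) (w i) (sum w X)))
                  (≤-trans (≤-reflexive (sym (sum-scale (h j) w (i ∷ X)))) (sum-mono {f = λ k → h j * w k} {g = area} (i ∷ X) (All.map (λ {k} r → lin≤ (<⇒≤ (w>0 k) ⊛ All.head r) (ring-165 (w k) (h k) (h j))) (proj₁ dd))))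

      nfdh : ∀ B S → 0ℚ ≤ B → All (λ j → w j ≤ p × h j ≤ q) S → ∃ λ S₁ → ∃ λ S₂ → Split S S₁ S₂ × Pack w h A B S₁ × (S₂ ≡ [] ⊎ (A - p) * ((B - q) - q) ≤ sum area S₁)
      nfdh B S 0≤B al = go (sortD h S) (Desc-sortD h S) (All-sortD h al) (λ f → sum-sortD h f S)
        where
        go : ∀ xs → Desc h xs → All (λ j → w j ≤ p × h j ≤ q) xs → (∀ f → sum f xs ≡ sum f S) → ∃ λ S₁ → ∃ λ S₂ → Split S S₁ S₂ × Pack w h A B S₁ × (S₂ ≡ [] ⊎ (A - p) * ((B - q) - q) ≤ sum area S₁)
        go [] _ _ e = [] , [] , (λ f → sym (e f)) , nil , inj₁ refl
        go (i ∷ xs) d al e = let (S₁ , S₂ , s , P , alt) = shelves (length xs) B 0≤B ℕₚ.≤-refl d al in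
          S₁ , S₂ , (λ f → trans (sym (e f)) (s f)) , P , map₂ (≤-trans (lin≤ (≤⇒0≤ p≤A ⊛ proj₂ (All.head al)) (ring-172 A p B q (h i)))) alt
          where open import Data.Sum using (map₂)

    module FillM (ea p z N : ℚ) (0<ea : 0ℚ < ea) (ea≤1 : ea ≤ 1ℚ) (0≤p : 0ℚ ≤ p) (p≤z : p ≤ ea * z) (0≤N : 0ℚ ≤ N) where

      Small : Item → Set
      Small i = w i ≤ p × h i ≤ p
      Small? : ∀ i → Dec (Small i)
      Small? i = (w i ≤? p) ×-dec (h i ≤? p)

      -- A filled leaf wastes one strip of width `p` and two of height `p`, and `p` is at most `z`.
      -- A leaf in which items of size `p` would violate the area condition has a side shorter than
      -- `z` and stays free.
      loss : ℚ
      loss = (z + z + z) * N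

      private
        abstract
          0≤z : 0ℚ ≤ z
          0≤z = *-cancel-≤ 0<ea (≤-trans (≤-reflexive (*-zeroʳ ea)) (≤-trans 0≤p p≤z))
          p≤z′ : p ≤ z
          p≤z′ = ≤-trans p≤z (lin≤ (0≤z ⊛ ea≤1) (ring-166 ea z))
          0≤loss : 0ℚ ≤ loss
          0≤loss = 0≤* (0≤+ (0≤+ 0≤z 0≤z) 0≤z) 0≤N
          thin-loss : ∀ {a b} → 0ℚ ≤ a → 0ℚ ≤ b → b ≤ N → ea * a < p → a * b ≤ loss
          thin-loss {a} {b} 0≤a 0≤b b≤N q = lin≤ ((0≤N ⊛ a≤z) ⊕ (0≤a ⊛ b≤N) ⊕ 0≤* (0≤+ 0≤z 0≤z) 0≤N) (ring-167 a b z N)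
            where
            a≤z : a ≤ z
            a≤z = *-cancel-≤ 0<ea (≤-trans (<⇒≤ q) p≤z)
          leaf-loss : ∀ {a b s} → 0ℚ ≤ a → 0ℚ ≤ b → a ≤ N → b ≤ N → (a - p) * ((b - p) - p) ≤ s → a * b ≤ s + loss
          leaf-loss {a} {b} {s} 0≤a 0≤b a≤N b≤N q = lin≤ (q ⊕ (0≤a ⊛ p≤z′) ⊕ (0≤a ⊛ p≤z′) ⊕ (0≤b ⊛ p≤z′) ⊕ (0≤z ⊛ a≤N) ⊕ (0≤z ⊛ a≤N) ⊕ (0≤z ⊛ b≤N) ⊕ 0≤* 0≤p 0≤p ⊕ 0≤* 0≤p 0≤p) (ring-168 a b p s z N)

      -- If items remain, then the free area has been used up to one `loss` for each leaf. Thus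
      -- `fillAll` only has to compare areas to conclude that nothing remains.
      Filled : ∀ {a b C} → CTree ea w h a b C → List Item → Set
      Filled {a} {b} {C} T M = ∃ λ M₁ → ∃ λ M₂ → ∃ λ C′ → Split M M₁ M₂ × Split C′ C M₁ × (M₂ ≡ [] ⊎ a * b - used T ≤ sum area M₁ + ⟦ leaves T ⟧ * loss) × Σ (CTree ea w h a b C′) λ T′ → leaves T′ ≡ leaves T

      unchanged : ∀ {a b C} (T : CTree ea w h a b C) M → leaves T ≡ 1 → a * b - used T ≤ loss → Filled T M
      unchanged {a} {b} {C} T M lf le = [] , M , C , split-[]ˡ M , split-[]ʳ C , inj₂ (≤-trans le (≤-trans (≤-reflexive (ring-173 loss)) (≤-reflexive (cong (λ z → 0ℚ + ⟦ z ⟧ * loss) (sym lf))))) , T , refl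

      unchanged′ : ∀ {a b C} (T : CTree ea w h a b C) M → leaves T ≡ 1 → used T ≡ a * b → Filled T M
      unchanged′ {a} {b} T M lf e = unchanged T M lf (≤-trans (≤-reflexive (trans (cong (λ u → a * b - u) e) (+-inverseʳ (a * b)))) 0≤loss)

      fillM : ∀ {a b C} (T : CTree ea w h a b C) → 0ℚ ≤ a → 0ℚ ≤ b → a ≤ N → b ≤ N → ∀ M → All Small M → Filled T M
      fillM {a} {b} (free refl) 0≤a 0≤b a≤N b≤N M al with p ≤? ea * a | p ≤? ea * b
      ... | no ¬p | _ = unchanged (free refl) M refl (≤-trans (≤-reflexive (ring-149 (a * b))) (thin-loss 0≤a 0≤b b≤N (≰⇒> ¬p)))
      ... | yes _ | no ¬p = unchanged (free refl) M refl (≤-trans (≤-reflexive (trans (ring-149 (a * b)) (*-comm a b))) (thin-loss 0≤b 0≤a a≤N (≰⇒> ¬p)))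
      ... | yes pa | yes pb = let (M₁ , M₂ , s , P , alt) = nfdh 0≤p 0≤p (≤-trans pa (lin≤ (0≤a ⊛ ea≤1) (ring-166 ea a))) b M 0≤b al in
            M₁ , M₂ , M₁ , s , split-[]ˡ M₁ , map₂ (λ q → ≤-trans (≤-reflexive (ring-149 (a * b))) (≤-trans (leaf-loss 0≤a 0≤b a≤N b≤N q) (≤-reflexive (ring-174 (sum area M₁) loss)))) alt ,
            ars (All.map (λ (x , y) → ≤-trans x pa , ≤-trans y pb) (All-splitˡ Small? {M} {M₁} {M₂} s al)) P , refl
        where
        open import Data.Sum using (map₂)
      fillM T@(hst _ _) _ _ _ _ M al = unchanged′ T M refl refl
      fillM T@(vst _ _) _ _ _ _ M al = unchanged′ T M refl refl
      fillM T@(ars _ _) _ _ _ _ M al = unchanged′ T M refl refl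
      fillM {a} {b} {C} (vs {a₁} {a₂} {S₁ = A} {B} x y z s T₁ T₂) 0≤a 0≤b a≤N b≤N M al =
        two (fillM T₁ x 0≤b (≤-trans (≤-trans (lin≤ y (ring-3 a₁ a₂)) (≤-reflexive z)) a≤N) b≤N M al) (λ M₂ al₂ → fillM T₂ y 0≤b (≤-trans (≤-trans (lin≤ x (ring-7 a₁ a₂)) (≤-reflexive z)) a≤N) b≤N M₂ al₂)
        where
        two : Filled T₁ M → (∀ M₂ → All Small M₂ → Filled T₂ M₂) → Filled {a} {b} {C} (vs {a₁ = a₁} {a₂} {S₁ = A} {B} x y z s T₁ T₂) M
        two (M₁ , M₂ , C₁ , sM , sC , inj₁ refl , U₁ , lf) _ =
          M₁ , [] , C₁ ++ B , sM , (λ f → trans (sum-++ f C₁ B) (trans (cong (_+ sum f B) (sC f)) (trans (cong (_+_ (sum f A + sum f M₁)) (sym (+-identityʳ (sum f B)))) (trans (ring-31 (sum f A) (sum f M₁) (sum f B) 0ℚ) (cong₂ _+_ (sym (s f)) (+-identityʳ (sum f M₁))))))) ,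
          inj₁ refl , vs x y z (split-++ C₁ B) U₁ T₂ , cong (ℕ._+ leaves T₂) lf
        two (M₁ , M₂ , C₁ , sM , sC , inj₂ le₁ , U₁ , lf) g = let (M₃ , M₄ , C₂ , sM′ , sC′ , alt , U₂ , lf′) = g M₂ (All-splitʳ Small? {M} {M₁} {M₂} sM al) in
          M₁ ++ M₃ , M₄ , C₁ ++ C₂ ,
          (λ f → trans (sM f) (trans (cong (_+_ (sum f M₁)) (sM′ f)) (trans (sym (+-assoc (sum f M₁) (sum f M₃) (sum f M₄))) (cong (_+ sum f M₄) (sym (sum-++ f M₁ M₃)))))) ,
          (λ f → trans (sum-++ f C₁ C₂) (trans (cong₂ _+_ (sC f) (sC′ f)) (trans (ring-31 (sum f A) (sum f M₁) (sum f B) (sum f M₃)) (cong₂ _+_ (sym (s f)) (sym (sum-++ f M₁ M₃)))))) ,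
          map₂ (λ le₂ → lin≤ (le₁ ⊕ le₂) (trans (trans (cong₂ (λ u v → (u + ⟦ leaves T₁ ℕ.+ leaves T₂ ⟧ * loss) - (v * b - (used T₁ + used T₂))) (sum-++ area M₁ M₃) (sym z)) (cong (λ u → ((sum area M₁ + sum area M₃) + u * loss) - ((a₁ + a₂) * b - (used T₁ + used T₂))) (⟦⟧-+ (leaves T₁) (leaves T₂))))
                    (ring-175 a₁ a₂ b (used T₁) (used T₂) (sum area M₁) (sum area M₃) ⟦ leaves T₁ ⟧ ⟦ leaves T₂ ⟧ loss))) alt ,
          vs x y z (split-++ C₁ C₂) U₁ U₂ , cong₂ ℕ._+_ lf lf′
          where open import Data.Sum using (map₂)
      fillM {a} {b} {C} (hs {b₁} {b₂} {S₁ = A} {B} x y z s T₁ T₂) 0≤a 0≤b a≤N b≤N M al =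
        two (fillM T₁ 0≤a x a≤N (≤-trans (≤-trans (lin≤ y (ring-3 b₁ b₂)) (≤-reflexive z)) b≤N) M al) (λ M₂ al₂ → fillM T₂ 0≤a y a≤N (≤-trans (≤-trans (lin≤ x (ring-7 b₁ b₂)) (≤-reflexive z)) b≤N) M₂ al₂)
        where
        two : Filled T₁ M → (∀ M₂ → All Small M₂ → Filled T₂ M₂) → Filled {a} {b} {C} (hs {b₁ = b₁} {b₂} {S₁ = A} {B} x y z s T₁ T₂) M
        two (M₁ , M₂ , C₁ , sM , sC , inj₁ refl , U₁ , lf) _ =
          M₁ , [] , C₁ ++ B , sM , (λ f → trans (sum-++ f C₁ B) (trans (cong (_+ sum f B) (sC f)) (trans (cong (_+_ (sum f A + sum f M₁)) (sym (+-identityʳ (sum f B)))) (trans (ring-31 (sum f A) (sum f M₁) (sum f B) 0ℚ) (cong₂ _+_ (sym (s f)) (+-identityʳ (sum f M₁))))))) ,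
          inj₁ refl , hs x y z (split-++ C₁ B) U₁ T₂ , cong (ℕ._+ leaves T₂) lf
        two (M₁ , M₂ , C₁ , sM , sC , inj₂ le₁ , U₁ , lf) g = let (M₃ , M₄ , C₂ , sM′ , sC′ , alt , U₂ , lf′) = g M₂ (All-splitʳ Small? {M} {M₁} {M₂} sM al) in
          M₁ ++ M₃ , M₄ , C₁ ++ C₂ ,
          (λ f → trans (sM f) (trans (cong (_+_ (sum f M₁)) (sM′ f)) (trans (sym (+-assoc (sum f M₁) (sum f M₃) (sum f M₄))) (cong (_+ sum f M₄) (sym (sum-++ f M₁ M₃)))))) ,
          (λ f → trans (sum-++ f C₁ C₂) (trans (cong₂ _+_ (sC f) (sC′ f)) (trans (ring-31 (sum f A) (sum f M₁) (sum f B) (sum f M₃)) (cong₂ _+_ (sym (s f)) (sym (sum-++ f M₁ M₃)))))) ,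
          map₂ (λ le₂ → lin≤ (le₁ ⊕ le₂) (trans (trans (cong₂ (λ u v → (u + ⟦ leaves T₁ ℕ.+ leaves T₂ ⟧ * loss) - (a * v - (used T₁ + used T₂))) (sum-++ area M₁ M₃) (sym z)) (cong (λ u → ((sum area M₁ + sum area M₃) + u * loss) - (a * (b₁ + b₂) - (used T₁ + used T₂))) (⟦⟧-+ (leaves T₁) (leaves T₂))))
                    (ring-176 b₁ b₂ a (used T₁) (used T₂) (sum area M₁) (sum area M₃) ⟦ leaves T₁ ⟧ ⟦ leaves T₂ ⟧ loss))) alt ,
          hs x y z (split-++ C₁ C₂) U₁ U₂ , cong₂ ℕ._+_ lf lf′
          where open import Data.Sum using (map₂)

      fillAll : ∀ {a b C} (T : CTree ea w h a b C) → 0ℚ ≤ a → 0ℚ ≤ b → a ≤ N → b ≤ N → ∀ M → All Small M → sum area M + ⟦ leaves T ⟧ * loss < a * b - used T →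
        ∃ λ C′ → Split C′ C M × Σ (CTree ea w h a b C′) λ T′ → leaves T′ ≡ leaves T
      fillAll {C = C} T 0≤a 0≤b a≤N b≤N M al lt with fillM T 0≤a 0≤b a≤N b≤N M al
      ... | M₁ , M₂ , C′ , sM , sC , inj₁ refl , T′ , lf = C′ , (λ f → trans (sC f) (cong (_+_ (sum f C)) (sym (trans (sM f) (+-identityʳ (sum f M₁)))))) , T′ , lf
      ... | M₁ , M₂ , C′ , sM , sC , inj₂ le , T′ , lf = ⊥-elim (<⇒≱ lt (≤-trans le (lin≤ (sum-nonneg 0≤area M₂) (trans (cong (λ u → (u + ⟦ leaves T ⟧ * loss) - (sum area M₁ + ⟦ leaves T ⟧ * loss)) (sM area)) (ring-177 (sum area M₁) (sum area M₂) (⟦ leaves T ⟧ * loss))))))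

-- Trees of cuts between coordinates and guillotine separability

module Cuts where

  open import Defs using (Rect; rect; Disjoint; _⊆R_; Guillotine; single; vcut; hcut; x1; x2; y1; y2)
  open Packings
  open Counting

  filter-map-≡ : {A B : Set} {P : B → Set} (P? : ∀ b → Dec (P b)) (f : A → B) (xs : List A) → filter P? (map f xs) ≡ map f (filter (P? ∘ f) xs)
  filter-map-≡ P? f [] = refl
  filter-map-≡ P? f (x ∷ xs) with P? (f x)
  ... | yes _ = cong (f x ∷_) (filter-map-≡ P? f xs)
  ... | no _ = filter-map-≡ P? f xs

  -- Cuts along the border are allowed, and the objects are given by predicates instead of lists. So
  -- empty boxes need no special treatment, and the same notion serves items, containers and
  -- mixtures of both.
  data CutT {O : Set} (rc : O → Rect) : (O → Set) → Rect → Set₁ where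
    leaf : ∀ {In R} → (∀ o o′ → In o → In o′ → o ≡ o′) → CutT rc In R
    cutv : ∀ {In In₁ In₂ R} x → x1 R ≤ x → x ≤ x2 R → (∀ o → In o → (In₁ o × x2 (rc o) ≤ x) ⊎ (In₂ o × x ≤ x1 (rc o))) →
           CutT rc In₁ (rect (x1 R) (y1 R) x (y2 R)) → CutT rc In₂ (rect x (y1 R) (x2 R) (y2 R)) → CutT rc In R
    cuth : ∀ {In In₁ In₂ R} y → y1 R ≤ y → y ≤ y2 R → (∀ o → In o → (In₁ o × y2 (rc o) ≤ y) ⊎ (In₂ o × y ≤ y1 (rc o))) →
           CutT rc In₁ (rect (x1 R) (y1 R) (x2 R) y) → CutT rc In₂ (rect (x1 R) y (x2 R) (y2 R)) → CutT rc In R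

  module _ {O : Set} {rc : O → Rect} where

    CutT-cong : ∀ {O′ : Set} {rc′ : O′ → Rect} {In : O → Set} {In′ : O′ → Set} {R} (g : O′ → O) → (∀ {o o′} → g o ≡ g o′ → o ≡ o′) →
      (∀ o → In′ o → In (g o)) → (∀ o → In′ o → rc′ o ≡ rc (g o)) → CutT rc In R → CutT rc′ In′ R
    CutT-cong g inj f e (leaf p) = leaf (λ o o′ i i′ → inj (p (g o) (g o′) (f o i) (f o′ i′)))
    CutT-cong {O′} {rc′} {In} {In′} g inj f e (cutv {In₁ = In₁} {In₂} x p q s A B) = cutv {In₁ = λ o → In′ o × In₁ (g o)} {In₂ = λ o → In′ o × In₂ (g o)} x p q
      (λ o i → side o i (s (g o) (f o i))) (CutT-cong g inj (λ o → proj₂) (λ o i → e o (proj₁ i)) A) (CutT-cong g inj (λ o → proj₂) (λ o i → e o (proj₁ i)) B)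
      where
      side : ∀ o → In′ o → (In₁ (g o) × x2 (rc (g o)) ≤ x) ⊎ (In₂ (g o) × x ≤ x1 (rc (g o))) → ((In′ o × In₁ (g o)) × x2 (rc′ o) ≤ x) ⊎ ((In′ o × In₂ (g o)) × x ≤ x1 (rc′ o))
      side o i (inj₁ (a , b)) = inj₁ ((i , a) , subst (λ r → x2 r ≤ x) (sym (e o i)) b)
      side o i (inj₂ (a , b)) = inj₂ ((i , a) , subst (λ r → x ≤ x1 r) (sym (e o i)) b)
    CutT-cong {O′} {rc′} {In} {In′} g inj f e (cuth {In₁ = In₁} {In₂} x p q s A B) = cuth {In₁ = λ o → In′ o × In₁ (g o)} {In₂ = λ o → In′ o × In₂ (g o)} x p q
      (λ o i → side o i (s (g o) (f o i))) (CutT-cong g inj (λ o → proj₂) (λ o i → e o (proj₁ i)) A) (CutT-cong g inj (λ o → proj₂) (λ o i → e o (proj₁ i)) B)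
      where
      side : ∀ o → In′ o → (In₁ (g o) × y2 (rc (g o)) ≤ x) ⊎ (In₂ (g o) × x ≤ y1 (rc (g o))) → ((In′ o × In₁ (g o)) × y2 (rc′ o) ≤ x) ⊎ ((In′ o × In₂ (g o)) × x ≤ y1 (rc′ o))
      side o i (inj₁ (a , b)) = inj₁ ((i , a) , subst (λ r → y2 r ≤ x) (sym (e o i)) b)
      side o i (inj₂ (a , b)) = inj₂ ((i , a) , subst (λ r → x ≤ y1 r) (sym (e o i)) b)

    cut-disjoint : ∀ {In R} → CutT rc In R → ∀ {o o′} → In o → In o′ → o ≢ o′ → Disjoint (rc o) (rc o′)
    cut-disjoint (leaf p) i i′ ne = ⊥-elim (ne (p _ _ i i′))
    cut-disjoint (cutv x _ _ s A B) {o} {o′} i i′ ne with s o i | s o′ i′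
    ... | inj₁ (a , _) | inj₁ (b , _) = cut-disjoint A a b ne
    ... | inj₂ (a , _) | inj₂ (b , _) = cut-disjoint B a b ne
    ... | inj₁ (_ , p) | inj₂ (_ , q) = inj₁ (≤-trans p q)
    ... | inj₂ (_ , p) | inj₁ (_ , q) = inj₂ (inj₁ (≤-trans q p))
    cut-disjoint (cuth x _ _ s A B) {o} {o′} i i′ ne with s o i | s o′ i′
    ... | inj₁ (a , _) | inj₁ (b , _) = cut-disjoint A a b ne
    ... | inj₂ (a , _) | inj₂ (b , _) = cut-disjoint B a b ne
    ... | inj₁ (_ , p) | inj₂ (_ , q) = inj₂ (inj₂ (inj₁ (≤-trans p q)))
    ... | inj₂ (_ , p) | inj₁ (_ , q) = inj₂ (inj₂ (inj₂ (≤-trans q p)))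

    module _ (properX : ∀ o → x1 (rc o) < x2 (rc o)) (properY : ∀ o → y1 (rc o) < y2 (rc o)) where

      private
        filter-uniq : ∀ {P : O → Set} (P? : ∀ o → Dec (P o)) {T} → Unique T → Unique (filter P? T)
        filter-uniq P? u = AllPairsₚ.filter⁺ P? u

        atMost1 : ∀ {T : List O} {In : O → Set} → (∀ o o′ → In o → In o′ → o ≡ o′) → Unique T → All In T → length T ℕ.≤ 1
        atMost1 {[]} _ _ _ = ℕ.z≤n
        atMost1 {_ ∷ []} _ _ _ = ℕ.s≤s ℕ.z≤n
        atMost1 {x ∷ y ∷ T} p ((ne ∷ _) ∷ _) (a ∷ b ∷ _) = ⊥-elim (ne (p x y a b))

      -- An object of positive extent lies on one side of a cut only, so the filters by coordinates
      -- in `Guillotine` agree with the predicates of the tree.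
      cut⇒Guillotine : ∀ {In R} → CutT rc In R → ∀ T → Unique T → All In T → All (λ o → rc o ⊆R R) T → Guillotine R (map rc T)
      cut⇒Guillotine (leaf p) T u al ins = single (subst (ℕ._≤ 1) (sym (length-map rc T)) (atMost1 p u al))
      cut⇒Guillotine {In} {R} (cutv {In₁ = In₁} {In₂} x p q s A B) T u al ins with x1 R <? x | x <? x2 R
      ... | yes p′ | yes q′ = vcut x p′ q′ (Allₚ.map⁺ (All.map (λ {o} i → sd (s o i)) al))
            (subst (Guillotine _) (sym (filter-map-≡ (λ r → x2 r ≤? x) rc T)) (cut⇒Guillotine A (filter L? T) (filter-uniq L? u)
              (All.zipWith (λ {o} (i , r) → left (s o i) r) (Allₚ.filter⁺ L? al , Allₚ.all-filter L? T))
              (All.zipWith (λ ((a , b , c , d) , r) → a , r , c , d) (Allₚ.filter⁺ L? ins , Allₚ.all-filter L? T))))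
            (subst (Guillotine _) (sym (filter-map-≡ (λ r → x ≤? x1 r) rc T)) (cut⇒Guillotine B (filter R? T) (filter-uniq R? u)
              (All.zipWith (λ {o} (i , r) → right (s o i) r) (Allₚ.filter⁺ R? al , Allₚ.all-filter R? T))
              (All.zipWith (λ ((a , b , c , d) , r) → r , b , c , d) (Allₚ.filter⁺ R? ins , Allₚ.all-filter R? T))))
        where
        L? : ∀ o → Dec (x2 (rc o) ≤ x)
        L? o = x2 (rc o) ≤? x
        R? : ∀ o → Dec (x ≤ x1 (rc o))
        R? o = x ≤? x1 (rc o)
        sd : ∀ {o} → (In₁ o × x2 (rc o) ≤ x) ⊎ (In₂ o × x ≤ x1 (rc o)) → x2 (rc o) ≤ x ⊎ x ≤ x1 (rc o)
        sd (inj₁ (_ , r)) = inj₁ r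
        sd (inj₂ (_ , r)) = inj₂ r
        left : ∀ {o} → (In₁ o × x2 (rc o) ≤ x) ⊎ (In₂ o × x ≤ x1 (rc o)) → x2 (rc o) ≤ x → In₁ o
        left (inj₁ (i , _)) _ = i
        left {o} (inj₂ (_ , r)) r′ = ⊥-elim (<⇒≱ (properX o) (≤-trans r′ r))
        right : ∀ {o} → (In₁ o × x2 (rc o) ≤ x) ⊎ (In₂ o × x ≤ x1 (rc o)) → x ≤ x1 (rc o) → In₂ o
        right (inj₂ (i , _)) _ = i
        right {o} (inj₁ (_ , r)) r′ = ⊥-elim (<⇒≱ (properX o) (≤-trans r r′))
      -- A cut along the border has all objects on one side; it is skipped and the tree of that side
      -- is used for the same rectangle.
      ... | no ¬p | _ = subst (λ R′ → Guillotine R′ (map rc T)) (cong (λ z → rect z (y1 R) (x2 R) (y2 R)) (≤-antisym (≮⇒≥ ¬p) p))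
            (cut⇒Guillotine B T u (All.zipWith (λ {o} (i , (a , b , _)) → right (s o i) a) (al , ins)) (All.map (λ (a , r) → ≤-trans (≮⇒≥ ¬p) a , r) ins))
        where
        right : ∀ {o} → (In₁ o × x2 (rc o) ≤ x) ⊎ (In₂ o × x ≤ x1 (rc o)) → x1 R ≤ x1 (rc o) → In₂ o
        right (inj₂ (i , _)) _ = i
        right {o} (inj₁ (_ , r)) r′ = ⊥-elim (<⇒≱ (properX o) (≤-trans r (≤-trans (≮⇒≥ ¬p) r′)))
      ... | yes _ | no ¬q = subst (λ R′ → Guillotine R′ (map rc T)) (cong (λ z → rect (x1 R) (y1 R) z (y2 R)) (≤-antisym q (≮⇒≥ ¬q)))
            (cut⇒Guillotine A T u (All.zipWith (λ {o} (i , (a , b , _)) → left (s o i) b) (al , ins)) (All.map (λ (a , b , r) → a , ≤-trans b (≮⇒≥ ¬q) , r) ins))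
        where
        left : ∀ {o} → (In₁ o × x2 (rc o) ≤ x) ⊎ (In₂ o × x ≤ x1 (rc o)) → x2 (rc o) ≤ x2 R → In₁ o
        left (inj₁ (i , _)) _ = i
        left {o} (inj₂ (_ , r)) r′ = ⊥-elim (<⇒≱ (properX o) (≤-trans r′ (≤-trans (≮⇒≥ ¬q) r)))
      cut⇒Guillotine {In} {R} (cuth {In₁ = In₁} {In₂} x p q s A B) T u al ins with y1 R <? x | x <? y2 R
      ... | yes p′ | yes q′ = hcut x p′ q′ (Allₚ.map⁺ (All.map (λ {o} i → sd (s o i)) al))
            (subst (Guillotine _) (sym (filter-map-≡ (λ r → y2 r ≤? x) rc T)) (cut⇒Guillotine A (filter L? T) (filter-uniq L? u)
              (All.zipWith (λ {o} (i , r) → left (s o i) r) (Allₚ.filter⁺ L? al , Allₚ.all-filter L? T))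
              (All.zipWith (λ ((a , b , c , d) , r) → a , b , c , r) (Allₚ.filter⁺ L? ins , Allₚ.all-filter L? T))))
            (subst (Guillotine _) (sym (filter-map-≡ (λ r → x ≤? y1 r) rc T)) (cut⇒Guillotine B (filter R? T) (filter-uniq R? u)
              (All.zipWith (λ {o} (i , r) → right (s o i) r) (Allₚ.filter⁺ R? al , Allₚ.all-filter R? T))
              (All.zipWith (λ ((a , b , c , d) , r) → a , b , r , d) (Allₚ.filter⁺ R? ins , Allₚ.all-filter R? T))))
        where
        L? : ∀ o → Dec (y2 (rc o) ≤ x)
        L? o = y2 (rc o) ≤? x
        R? : ∀ o → Dec (x ≤ y1 (rc o))
        R? o = x ≤? y1 (rc o)
        sd : ∀ {o} → (In₁ o × y2 (rc o) ≤ x) ⊎ (In₂ o × x ≤ y1 (rc o)) → y2 (rc o) ≤ x ⊎ x ≤ y1 (rc o)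
        sd (inj₁ (_ , r)) = inj₁ r
        sd (inj₂ (_ , r)) = inj₂ r
        left : ∀ {o} → (In₁ o × y2 (rc o) ≤ x) ⊎ (In₂ o × x ≤ y1 (rc o)) → y2 (rc o) ≤ x → In₁ o
        left (inj₁ (i , _)) _ = i
        left {o} (inj₂ (_ , r)) r′ = ⊥-elim (<⇒≱ (properY o) (≤-trans r′ r))
        right : ∀ {o} → (In₁ o × y2 (rc o) ≤ x) ⊎ (In₂ o × x ≤ y1 (rc o)) → x ≤ y1 (rc o) → In₂ o
        right (inj₂ (i , _)) _ = i
        right {o} (inj₁ (_ , r)) r′ = ⊥-elim (<⇒≱ (properY o) (≤-trans r r′))
      ... | no ¬p | _ = subst (λ R′ → Guillotine R′ (map rc T)) (cong (λ z → rect (x1 R) z (x2 R) (y2 R)) (≤-antisym (≮⇒≥ ¬p) p))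
            (cut⇒Guillotine B T u (All.zipWith (λ {o} (i , (_ , _ , a , b)) → right (s o i) a) (al , ins)) (All.map (λ (a , b , c , r) → a , b , ≤-trans (≮⇒≥ ¬p) c , r) ins))
        where
        right : ∀ {o} → (In₁ o × y2 (rc o) ≤ x) ⊎ (In₂ o × x ≤ y1 (rc o)) → y1 R ≤ y1 (rc o) → In₂ o
        right (inj₂ (i , _)) _ = i
        right {o} (inj₁ (_ , r)) r′ = ⊥-elim (<⇒≱ (properY o) (≤-trans r (≤-trans (≮⇒≥ ¬p) r′)))
      ... | yes _ | no ¬q = subst (λ R′ → Guillotine R′ (map rc T)) (cong (λ z → rect (x1 R) (y1 R) (x2 R) z) (≤-antisym q (≮⇒≥ ¬q)))
            (cut⇒Guillotine A T u (All.zipWith (λ {o} (i , (_ , _ , a , b)) → left (s o i) b) (al , ins)) (All.map (λ (a , b , c , r) → a , b , c , ≤-trans r (≮⇒≥ ¬q)) ins))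
        where
        left : ∀ {o} → (In₁ o × y2 (rc o) ≤ x) ⊎ (In₂ o × x ≤ y1 (rc o)) → y2 (rc o) ≤ y2 R → In₁ o
        left (inj₁ (i , _)) _ = i
        left {o} (inj₂ (_ , r)) r′ = ⊥-elim (<⇒≱ (properY o) (≤-trans r′ (≤-trans (≮⇒≥ ¬q) r)))

  module Forget {Item : Set} (w h : Item → ℚ) (w>0 : ∀ i → 0ℚ < w i) (h>0 : ∀ i → 0ℚ < h i) (px py : Item → ℚ) where

    rc : Item → Rect
    rc i = rect (px i) (py i) (px i + w i) (py i + h i)

    private
      abstract
        grow : ∀ {x y} → 0ℚ < y → x < x + y
        grow {x} {y} p = lin< p (ring-3 x y)
        fit : ∀ {X X′ x y} → X ≤ x → x + y ≤ X′ → y ≤ X′ - X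
        fit {X} {X′} {x} {y} p q = lin≤ (p ⊕ q) (ring-178 X X′ x y)

      halves : ∀ {P Q : Item → Set} (P? : ∀ i → Dec (P i)) (Q? : ∀ i → Dec (Q i)) → (∀ i → P i → ¬ Q i) → ∀ T → All (λ i → P i ⊎ Q i) T → Split T (filter P? T) (filter Q? T)
      halves P? Q? ne [] [] f = refl
      halves P? Q? ne (i ∷ T) (a ∷ al) f with P? i | Q? i | a
      ... | yes p | yes q | _ = ⊥-elim (ne i p q)
      ... | yes p | no _ | _ = trans (cong (_+_ (f i)) (halves P? Q? ne T al f)) (sym (+-assoc (f i) (sum f (filter P? T)) (sum f (filter Q? T))))
      ... | no _ | yes q | _ = trans (cong (_+_ (f i)) (halves P? Q? ne T al f)) (ring-2 (f i) (sum f (filter P? T)) (sum f (filter Q? T)))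
      ... | no ¬p | no _ | inj₁ p = ⊥-elim (¬p p)
      ... | no _ | no ¬q | inj₂ q = ⊥-elim (¬q q)

    forget : ∀ {R rs} → Guillotine R rs → ∀ T → rs ≡ map rc T → All (λ i → rc i ⊆R R) T → Pack w h (x2 R - x1 R) (y2 R - y1 R) T
    forget (single _) [] _ _ = nil
    forget (single _) (i ∷ []) _ ((a , b , c , d) ∷ []) = one (fit a b) (fit c d)
    forget (single (ℕ.s≤s ())) (_ ∷ _ ∷ _) refl _
    forget {R} (vcut x p q al A B) T refl ins =
      vcmp (≤⇒0≤ (<⇒≤ p)) (≤⇒0≤ (<⇒≤ q)) (≤-reflexive (ring-179 (x1 R) (x2 R) x))
        (halves L? R? (λ i a b → <⇒≱ (grow (w>0 i)) (≤-trans a b)) T (Allₚ.map⁻ al))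
        (forget A (filter L? T) (filter-map-≡ (λ r → x2 r ≤? x) rc T) (All.zipWith (λ ((a , b , c , d) , r) → a , r , c , d) (Allₚ.filter⁺ L? ins , Allₚ.all-filter L? T)))
        (forget B (filter R? T) (filter-map-≡ (λ r → x ≤? x1 r) rc T) (All.zipWith (λ ((a , b , c , d) , r) → r , b , c , d) (Allₚ.filter⁺ R? ins , Allₚ.all-filter R? T)))
      where
      L? : ∀ i → Dec (x2 (rc i) ≤ x)
      L? i = x2 (rc i) ≤? x
      R? : ∀ i → Dec (x ≤ x1 (rc i))
      R? i = x ≤? x1 (rc i)
    forget {R} (hcut x p q al A B) T refl ins =
      hcmp (≤⇒0≤ (<⇒≤ p)) (≤⇒0≤ (<⇒≤ q)) (≤-reflexive (ring-179 (y1 R) (y2 R) x))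
        (halves L? R? (λ i a b → <⇒≱ (grow (h>0 i)) (≤-trans a b)) T (Allₚ.map⁻ al))
        (forget A (filter L? T) (filter-map-≡ (λ r → y2 r ≤? x) rc T) (All.zipWith (λ ((a , b , c , d) , r) → a , b , c , r) (Allₚ.filter⁺ L? ins , Allₚ.all-filter L? T)))
        (forget B (filter R? T) (filter-map-≡ (λ r → x ≤? y1 r) rc T) (All.zipWith (λ ((a , b , c , d) , r) → a , b , r , d) (Allₚ.filter⁺ R? ins , Allₚ.all-filter R? T)))
      where
      L? : ∀ i → Dec (y2 (rc i) ≤ x)
      L? i = y2 (rc i) ≤? x
      R? : ∀ i → Dec (x ≤ y1 (rc i))
      R? i = x ≤? y1 (rc i)

-- Coordinates for the items

module ItemPositions where

  open import Defs hiding (w; h; N; n)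
  import Defs
  open import Data.Integer using (+_)
  open Packings
  open Counting
  open ContainerTrees
  open Configurations
  open SizeClasses
  open BoundaryL
  open Cuts

  ℕ→ℚ≡⟦⟧ : ∀ n → ℕ→ℚ n ≡ ⟦ n ⟧
  ℕ→ℚ≡⟦⟧ zero = refl
  ℕ→ℚ≡⟦⟧ (suc n) = trans (toℚᵘ-injective (ℚᵘₚ.≃-trans (toℚᵘ-fromℚᵘ (ℚᵘ.mkℚᵘ (+ suc n) 0)) (ℚᵘₚ.≃-trans step (ℚᵘₚ.≃-sym (ℚᵘₚ.≃-trans (toℚᵘ-homo-+ 1ℚ (ℕ→ℚ n)) (ℚᵘₚ.+-congʳ (toℚᵘ 1ℚ) (toℚᵘ-fromℚᵘ (ℚᵘ.mkℚᵘ (+ n) 0)))))))) (cong (_+_ 1ℚ) (ℕ→ℚ≡⟦⟧ n))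
    where
    step : ℚᵘ.mkℚᵘ (+ suc n) 0 ℚᵘ.≃ toℚᵘ 1ℚ ℚᵘ.+ ℚᵘ.mkℚᵘ (+ n) 0
    step = ℚᵘ.*≡* (trans (ℤₚ.*-identityʳ (+ suc n)) (sym (trans (ℤₚ.*-identityʳ _) (cong (Data.Integer._+_ (+ 1)) (ℤₚ.*-identityʳ (+ n))))))
      where import Data.Integer

  -- Takes the decision as an argument, so that `pick-yes` and `pick-no` compute the positions in a
  -- joined packing item by item.
  pick : {P A : Set} → Dec P → A → A → A
  pick (yes _) a b = a
  pick (no _) a b = b

  pick-yes : {P A : Set} (d : Dec P) {a b : A} → P → pick d a b ≡ a
  pick-yes (yes _) _ = refl
  pick-yes (no ¬p) p = ⊥-elim (¬p p)

  pick-no : {P A : Set} (d : Dec P) {a b : A} → ¬ P → pick d a b ≡ b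
  pick-no (yes p) ¬p = ⊥-elim (¬p p)
  pick-no (no _) _ = refl

  module Realize (I : Instance) (ε ea : ℚ) (ea≤ε : ea ≤ ε) where

    Item : Set
    Item = Fin (Defs.n I)

    W H : Item → ℚ
    W i = ℕ→ℚ (Defs.w I i)
    H i = ℕ→ℚ (Defs.h I i)

    1≤⇒0< : ∀ {k} → 1 ℕ.≤ k → 0ℚ < ℕ→ℚ k
    1≤⇒0< {suc k} _ = subst (0ℚ <_) (sym (ℕ→ℚ≡⟦⟧ (suc k))) (0<⟦suc⟧ k)

    W>0 : ∀ i → 0ℚ < W i
    W>0 i = 1≤⇒0< (w-pos I i)
    H>0 : ∀ i → 0ℚ < H i
    H>0 i = 1≤⇒0< (h-pos I i)

    open Classes Fin._≟_ W H W>0 H>0 using (Once; once-disjoint; once-subˡ; ind-∈)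
    open DecM {A = Item} Fin._≟_ using (_∈?_)

    ind-∉ : ∀ {i : Item} (S : List Item) → ¬ i ∈ S → sum (ind (Fin._≟ i)) S ≡ 0ℚ
    ind-∉ [] _ = refl
    ind-∉ {i} (x ∷ S) p with x Fin.≟ i
    ... | yes refl = ⊥-elim (p (here refl))
    ... | no _ = trans (+-identityˡ _) (ind-∉ S (p ∘ there))

    -- Membership is recovered from sums: the multiplicity of `i` is positive in `S`, and would be
    -- zero if `i` were in neither part.
    split-∈ : ∀ {S A B : List Item} → Split S A B → ∀ {i} → i ∈ S → i ∈ A ⊎ i ∈ B
    split-∈ {S} {A} {B} s {i} p with i ∈? A | i ∈? B
    ... | yes a | _ = inj₁ a
    ... | no _ | yes b = inj₂ b
    ... | no a | no b = ⊥-elim (<⇒≱ 0<1 (≤-trans (ind-∈ S p) (≤-reflexive (trans (s _) (cong₂ _+_ (ind-∉ A a) (ind-∉ B b))))))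

    split-disjoint : ∀ {S A B} → Once S → Split S A B → ∀ {i} → i ∈ A → ¬ i ∈ B
    split-disjoint {S} {A} {B} o s = once-disjoint {A} {B} (λ i → ≤-trans (≤-reflexive (trans (sum-++ _ A B) (sym (s _)))) (o i))

    once-subʳ : ∀ {S A B} → Split S A B → Once S → Once B
    once-subʳ {S} {A} {B} s = once-subˡ {S} {B} {A} (split-swap {S = S} {A} {B} s)

    rcOf : (px py : Item → ℚ) → Item → Rect
    rcOf px py i = rect (px i) (py i) (px i + W i) (py i + H i)

    record ItemGeo (S : List Item) (R : Rect) : Set₁ where
      field
        gx gy : Item → ℚ
      rc : Item → Rect
      rc = rcOf gx gy
      field
        inside : ∀ {i} → i ∈ S → rc i ⊆R R
        cut    : CutT rc (_∈ S) R
    open ItemGeo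

    emptyGeo : ∀ R → ItemGeo [] R
    emptyGeo R = record { gx = λ _ → 0ℚ ; gy = λ _ → 0ℚ ; inside = λ () ; cut = leaf (λ _ _ ()) }

    singleGeo : ∀ {i X Y X′ Y′} → X + W i ≤ X′ → Y + H i ≤ Y′ → ItemGeo (i ∷ []) (rect X Y X′ Y′)
    singleGeo {X = X} {Y} p q = record { gx = λ _ → X ; gy = λ _ → Y ; inside = λ { (here refl) → ≤-refl , p , ≤-refl , q } ; cut = leaf (λ { _ _ (here refl) (here refl) → refl }) }

    private
      agree : ∀ {px py px′ py′ : Item → ℚ} {i} → px i ≡ px′ i → py i ≡ py′ i → rcOf px py i ≡ rcOf px′ py′ i
      agree {i = i} e f = cong₂ (λ u v → rect u v (u + W i) (v + H i)) e f

    -- The two agreements are kept because containment in boxes and the order within stacks, proved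
    -- for the parts, have to be transferred to the whole.
    Joined : ∀ {S₁ S₂ R₁ R₂} → List Item → Rect → ItemGeo S₁ R₁ → ItemGeo S₂ R₂ → Set₁
    Joined {S₁} {S₂} S R g₁ g₂ = Σ (ItemGeo S R) λ g → (∀ {i} → i ∈ S₁ → rc g i ≡ rc g₁ i) × (∀ {i} → i ∈ S₂ → rc g i ≡ rc g₂ i)

    module Join {S₁ S₂ R₁ R₂} (dis : ∀ {i} → i ∈ S₁ → ¬ i ∈ S₂) (g₁ : ItemGeo S₁ R₁) (g₂ : ItemGeo S₂ R₂) where
      jx jy : Item → ℚ
      jx i = pick (i ∈? S₁) (gx g₁ i) (gx g₂ i)
      jy i = pick (i ∈? S₁) (gy g₁ i) (gy g₂ i)
      e₁ : ∀ {i} → i ∈ S₁ → rcOf jx jy i ≡ rc g₁ i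
      e₁ {i} p = agree {jx} {jy} {gx g₁} {gy g₁} (pick-yes (i ∈? S₁) p) (pick-yes (i ∈? S₁) p)
      e₂ : ∀ {i} → i ∈ S₂ → rcOf jx jy i ≡ rc g₂ i
      e₂ {i} p = agree {jx} {jy} {gx g₂} {gy g₂} (pick-no (i ∈? S₁) (λ q → dis q p)) (pick-no (i ∈? S₁) (λ q → dis q p))

    joinV : ∀ {S S₁ S₂ X Y X′ Y′ x} → X ≤ x → x ≤ X′ → (∀ {i} → i ∈ S → i ∈ S₁ ⊎ i ∈ S₂) → (∀ {i} → i ∈ S₁ → ¬ i ∈ S₂) →
      (g₁ : ItemGeo S₁ (rect X Y x Y′)) (g₂ : ItemGeo S₂ (rect x Y X′ Y′)) → Joined S (rect X Y X′ Y′) g₁ g₂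
    joinV {S} {S₁} {S₂} {X} {Y} {X′} {Y′} {x} p q mem dis g₁ g₂ = record
      { gx = jx ; gy = jy
      ; inside = λ {i} i∈ → ins (mem i∈)
      ; cut = cutv x p q (λ i i∈ → side (mem i∈)) (CutT-cong id id (λ _ r → r) (λ _ r → e₁ r) (cut g₁)) (CutT-cong id id (λ _ r → r) (λ _ r → e₂ r) (cut g₂)) } , e₁ , e₂
      where
      open Join dis g₁ g₂
      ins : ∀ {i} → i ∈ S₁ ⊎ i ∈ S₂ → rcOf jx jy i ⊆R rect X Y X′ Y′
      ins (inj₁ r) = let (a , b , c , d) = inside g₁ r in subst (_⊆R rect X Y X′ Y′) (sym (e₁ r)) (a , ≤-trans b q , c , d)
      ins (inj₂ r) = let (a , b , c , d) = inside g₂ r in subst (_⊆R rect X Y X′ Y′) (sym (e₂ r)) (≤-trans p a , b , c , d)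
      side : ∀ {i} → i ∈ S₁ ⊎ i ∈ S₂ → (i ∈ S₁ × x2 (rcOf jx jy i) ≤ x) ⊎ (i ∈ S₂ × x ≤ x1 (rcOf jx jy i))
      side (inj₁ r) = let (a , b , c , d) = inside g₁ r in inj₁ (r , subst (λ z → x2 z ≤ x) (sym (e₁ r)) b)
      side (inj₂ r) = let (a , b , c , d) = inside g₂ r in inj₂ (r , subst (λ z → x ≤ x1 z) (sym (e₂ r)) a)

    joinH : ∀ {S S₁ S₂ X Y X′ Y′ y} → Y ≤ y → y ≤ Y′ → (∀ {i} → i ∈ S → i ∈ S₁ ⊎ i ∈ S₂) → (∀ {i} → i ∈ S₁ → ¬ i ∈ S₂) →
      (g₁ : ItemGeo S₁ (rect X Y X′ y)) (g₂ : ItemGeo S₂ (rect X y X′ Y′)) → Joined S (rect X Y X′ Y′) g₁ g₂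
    joinH {S} {S₁} {S₂} {X} {Y} {X′} {Y′} {x} p q mem dis g₁ g₂ = record
      { gx = jx ; gy = jy
      ; inside = λ {i} i∈ → ins (mem i∈)
      ; cut = cuth x p q (λ i i∈ → side (mem i∈)) (CutT-cong id id (λ _ r → r) (λ _ r → e₁ r) (cut g₁)) (CutT-cong id id (λ _ r → r) (λ _ r → e₂ r) (cut g₂)) } , e₁ , e₂
      where
      open Join dis g₁ g₂
      ins : ∀ {i} → i ∈ S₁ ⊎ i ∈ S₂ → rcOf jx jy i ⊆R rect X Y X′ Y′
      ins (inj₁ r) = let (a , b , c , d) = inside g₁ r in subst (_⊆R rect X Y X′ Y′) (sym (e₁ r)) (a , b , c , ≤-trans d q)
      ins (inj₂ r) = let (a , b , c , d) = inside g₂ r in subst (_⊆R rect X Y X′ Y′) (sym (e₂ r)) (a , b , ≤-trans p c , d)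
      side : ∀ {i} → i ∈ S₁ ⊎ i ∈ S₂ → (i ∈ S₁ × y2 (rcOf jx jy i) ≤ x) ⊎ (i ∈ S₂ × x ≤ y1 (rcOf jx jy i))
      side (inj₁ r) = let (a , b , c , d) = inside g₁ r in inj₁ (r , subst (λ z → y2 z ≤ x) (sym (e₁ r)) d)
      side (inj₂ r) = let (a , b , c , d) = inside g₂ r in inj₂ (r , subst (λ z → x ≤ y1 z) (sym (e₂ r)) c)

    private
      abstract
        add≤ : ∀ x y z → y ≤ z - x → x + y ≤ z
        add≤ x y z p = lin≤ p (ring-180 x y z)
        grow : ∀ {x y} → 0ℚ ≤ y → x ≤ x + y
        grow {x} {y} p = lin≤ p (ring-3 x y)
        w₂ : ∀ x z a b → a + b ≤ z - x → b ≤ z - (x + a)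
        w₂ x z a b p = lin≤ p (ring-181 x z a b)

    packGeo : ∀ {S a b X Y X′ Y′} → Once S → Pack W H a b S → a ≤ X′ - X → b ≤ Y′ - Y → ItemGeo S (rect X Y X′ Y′)
    packGeo o nil _ _ = emptyGeo _
    packGeo {X = X} {Y} {X′} {Y′} o (one {i} p q) u v = singleGeo (add≤ X (W i) X′ (≤-trans p u)) (add≤ Y (H i) Y′ (≤-trans q v))
    packGeo {S} {X = X} {Y} {X′} {Y′} o (vcmp {a₁} {a₂} {S₁ = A} {B} 0≤a₁ 0≤a₂ le s P Q) u v =
      proj₁ (joinV (grow 0≤a₁) (≤-trans (grow 0≤a₂) (≤-trans (≤-reflexive (+-assoc X a₁ a₂)) (add≤ X (a₁ + a₂) X′ (≤-trans le u)))) (split-∈ {S} {A} {B} s) (split-disjoint {S} {A} {B} o s)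
        (packGeo (once-subˡ {S} {A} {B} s o) P (≤-reflexive (sym (ring-182 X a₁))) v) (packGeo (once-subʳ {S} {A} {B} s o) Q (w₂ X X′ a₁ a₂ (≤-trans le u)) v))
    packGeo {S} {X = X} {Y} {X′} {Y′} o (hcmp {b₁} {b₂} {S₁ = A} {B} 0≤b₁ 0≤b₂ le s P Q) u v =
      proj₁ (joinH (grow 0≤b₁) (≤-trans (grow 0≤b₂) (≤-trans (≤-reflexive (+-assoc Y b₁ b₂)) (add≤ Y (b₁ + b₂) Y′ (≤-trans le v)))) (split-∈ {S} {A} {B} s) (split-disjoint {S} {A} {B} o s)
        (packGeo (once-subˡ {S} {A} {B} s o) P u (≤-reflexive (sym (ring-182 Y b₁)))) (packGeo (once-subʳ {S} {A} {B} s o) Q u (w₂ Y Y′ b₁ b₂ (≤-trans le v))))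

    once-head : ∀ {i S} → Once (i ∷ S) → ∀ {j} → j ∈ i ∷ [] → ¬ j ∈ S
    once-head {i} {S} o = once-disjoint {i ∷ []} {S} o

    once-tl : ∀ {i S} → Once (i ∷ S) → Once S
    once-tl {i} {S} o = once-subʳ {i ∷ S} {i ∷ []} {S} (λ f → cong (_+ sum f S) (sym (+-identityʳ (f i)))) o

    uncons : ∀ {i S} {j : Item} → j ∈ i ∷ S → j ∈ i ∷ [] ⊎ j ∈ S
    uncons (here refl) = inj₁ (here refl)
    uncons (there p) = inj₂ p

    stackH : ∀ S {X Y X′ Y′} → Once S → All (λ i → W i ≤ X′ - X) S → sum H S ≤ Y′ - Y →
      Σ (ItemGeo S (rect X Y X′ Y′)) λ g → ∀ {i j} → i ∈ S → j ∈ S → j ≢ i → (y2 (rc g i) ≤ y1 (rc g j)) ⊎ (y2 (rc g j) ≤ y1 (rc g i))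
    stackH [] _ _ _ = emptyGeo _ , λ ()
    stackH (i ∷ S) {X} {Y} {X′} {Y′} o (p ∷ ps) le =
      let (g₂ , d₂) = stackH S {X} {Y + H i} {X′} {Y′} (once-tl {i} {S} o) ps (w₂ Y Y′ (H i) (sum H S) le)
          g₁ = singleGeo {i} {X} {Y} {X′} {Y + H i} (add≤ X (W i) X′ p) ≤-refl
          (g , e₁ , e₂) = joinH {i ∷ S} {i ∷ []} {S} (grow (<⇒≤ (H>0 i))) (add≤ Y (H i) Y′ (≤-trans (grow {H i} (sum-nonneg (<⇒≤ ∘ H>0) S)) le)) uncons (once-head {i} {S} o) g₁ g₂
      in g , λ { (here refl) (here refl) ne → ⊥-elim (ne refl)
               ; (here refl) (there b) ne → inj₁ (subst₂ (λ u v → y2 u ≤ y1 v) (sym (e₁ (here refl))) (sym (e₂ b)) (proj₁ (proj₂ (proj₂ (inside g₂ b)))))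
               ; (there a) (here refl) ne → inj₂ (subst₂ (λ u v → y2 u ≤ y1 v) (sym (e₁ (here refl))) (sym (e₂ a)) (proj₁ (proj₂ (proj₂ (inside g₂ a)))))
               ; (there a) (there b) ne → subst₂ (λ u v → (y2 u ≤ y1 v) ⊎ (y2 v ≤ y1 u)) (sym (e₂ a)) (sym (e₂ b)) (d₂ a b ne) }

    stackV : ∀ S {X Y X′ Y′} → Once S → All (λ i → H i ≤ Y′ - Y) S → sum W S ≤ X′ - X →
      Σ (ItemGeo S (rect X Y X′ Y′)) λ g → ∀ {i j} → i ∈ S → j ∈ S → j ≢ i → (x2 (rc g i) ≤ x1 (rc g j)) ⊎ (x2 (rc g j) ≤ x1 (rc g i))
    stackV [] _ _ _ = emptyGeo _ , λ ()
    stackV (i ∷ S) {X} {Y} {X′} {Y′} o (p ∷ ps) le =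
      let (g₂ , d₂) = stackV S {X + W i} {Y} {X′} {Y′} (once-tl {i} {S} o) ps (w₂ X X′ (W i) (sum W S) le)
          g₁ = singleGeo {i} {X} {Y} {X + W i} {Y′} ≤-refl (add≤ Y (H i) Y′ p)
          (g , e₁ , e₂) = joinV {i ∷ S} {i ∷ []} {S} (grow (<⇒≤ (W>0 i))) (add≤ X (W i) X′ (≤-trans (grow {W i} (sum-nonneg (<⇒≤ ∘ W>0) S)) le)) uncons (once-head {i} {S} o) g₁ g₂
      in g , λ { (here refl) (here refl) ne → ⊥-elim (ne refl)
               ; (here refl) (there b) ne → inj₁ (subst₂ (λ u v → x2 u ≤ x1 v) (sym (e₁ (here refl))) (sym (e₂ b)) (proj₁ (inside g₂ b)))
               ; (there a) (here refl) ne → inj₂ (subst₂ (λ u v → x2 u ≤ x1 v) (sym (e₁ (here refl))) (sym (e₂ a)) (proj₁ (inside g₂ a)))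
               ; (there a) (there b) ne → subst₂ (λ u v → (x2 u ≤ x1 v) ⊎ (x2 v ≤ x1 u)) (sym (e₂ a)) (sym (e₂ b)) (d₂ a b ne) }

-- Coordinates for the containers

module ContainerPositions where

  open import Defs hiding (w; h; N; n; m; cont; loc)
  import Defs
  open Packings
  open Counting
  open ContainerTrees
  open Configurations
  open SizeClasses
  open BoundaryL
  open Cuts
  open ItemPositions

  -- A relation in place of the function of `CutT-cong`: the containers of one part correspond to
  -- only some of the indices of the whole, so there is no total map back.
  CutT-rel : {O O′ : Set} {rc : O → Rect} {rc′ : O′ → Rect} {In : O → Set} {In′ : O′ → Set} {R : Rect} (Rel : O′ → O → Set) →
    (∀ o′ → In′ o′ → ∃ λ o → Rel o′ o × In o) → (∀ {o o′ o″} → Rel o′ o → Rel o″ o → o′ ≡ o″) → (∀ {o′ o} → Rel o′ o → rc′ o′ ≡ rc o) →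
    CutT rc In R → CutT rc′ In′ R
  CutT-rel Rel t inj e (leaf p) = leaf λ o o′ i i′ → let (u , r , a) = t o i ; (v , s , b) = t o′ i′ in inj r (subst (Rel o′) (sym (p u v a b)) s)
  CutT-rel {rc = rc} {rc′} {In} {In′} Rel t inj e (cutv {In₁ = In₁} {In₂} x p q s A B) =
    cutv {In₁ = λ o′ → ∃ λ o → Rel o′ o × In₁ o} {In₂ = λ o′ → ∃ λ o → Rel o′ o × In₂ o} x p q
      (λ o′ i → let (o , r , a) = t o′ i in side r (s o a)) (CutT-rel Rel (λ _ i → i) inj e A) (CutT-rel Rel (λ _ i → i) inj e B)
    where
    side : ∀ {o′ o} → Rel o′ o → (In₁ o × x2 (rc o) ≤ x) ⊎ (In₂ o × x ≤ x1 (rc o)) → ((∃ λ o → Rel o′ o × In₁ o) × x2 (rc′ o′) ≤ x) ⊎ ((∃ λ o → Rel o′ o × In₂ o) × x ≤ x1 (rc′ o′))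
    side {o′} {o} r (inj₁ (a , b)) = inj₁ ((o , r , a) , subst (λ z → x2 z ≤ x) (sym (e r)) b)
    side {o′} {o} r (inj₂ (a , b)) = inj₂ ((o , r , a) , subst (λ z → x ≤ x1 z) (sym (e r)) b)
  CutT-rel {rc = rc} {rc′} {In} {In′} Rel t inj e (cuth {In₁ = In₁} {In₂} x p q s A B) =
    cuth {In₁ = λ o′ → ∃ λ o → Rel o′ o × In₁ o} {In₂ = λ o′ → ∃ λ o → Rel o′ o × In₂ o} x p q
      (λ o′ i → let (o , r , a) = t o′ i in side r (s o a)) (CutT-rel Rel (λ _ i → i) inj e A) (CutT-rel Rel (λ _ i → i) inj e B)
    where
    side : ∀ {o′ o} → Rel o′ o → (In₁ o × y2 (rc o) ≤ x) ⊎ (In₂ o × x ≤ y1 (rc o)) → ((∃ λ o → Rel o′ o × In₁ o) × y2 (rc′ o′) ≤ x) ⊎ ((∃ λ o → Rel o′ o × In₂ o) × x ≤ y1 (rc′ o′))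
    side {o′} {o} r (inj₁ (a , b)) = inj₁ ((o , r , a) , subst (λ z → y2 z ≤ x) (sym (e r)) b)
    side {o′} {o} r (inj₂ (a , b)) = inj₂ ((o , r , a) , subst (λ z → x ≤ y1 z) (sym (e r)) b)

  -- Quantified over the objects, because the same line must separate containers alone as well as
  -- boundary items together with containers.
  CutInto : Rect → Rect → Rect → Set₁
  CutInto R R₁ R₂ = ∀ {O : Set} {rc : O → Rect} {In In₁ In₂ : O → Set} → (∀ o → In o → (In₁ o × rc o ⊆R R₁) ⊎ (In₂ o × rc o ⊆R R₂)) →
    CutT rc In₁ R₁ → CutT rc In₂ R₂ → CutT rc In R

  cutIntoV : ∀ {X Y X′ Y′ x} → X ≤ x → x ≤ X′ → CutInto (rect X Y X′ Y′) (rect X Y x Y′) (rect x Y X′ Y′)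
  cutIntoV {x = x} p q s A B = cutv x p q (λ o i → side (s o i)) A B
    where
    side : ∀ {P Q : Set} {r R₁ R₂} → (P × r ⊆R R₁) ⊎ (Q × r ⊆R R₂) → (P × x2 r ≤ x2 R₁) ⊎ (Q × x1 R₂ ≤ x1 r)
    side (inj₁ (a , (_ , b , _))) = inj₁ (a , b)
    side (inj₂ (a , (b , _))) = inj₂ (a , b)

  cutIntoH : ∀ {X Y X′ Y′ y} → Y ≤ y → y ≤ Y′ → CutInto (rect X Y X′ Y′) (rect X Y X′ y) (rect X y X′ Y′)
  cutIntoH {y = x} p q s A B = cuth x p q (λ o i → side (s o i)) A B
    where
    side : ∀ {P Q : Set} {r R₁ R₂} → (P × r ⊆R R₁) ⊎ (Q × r ⊆R R₂) → (P × y2 r ≤ y2 R₁) ⊎ (Q × y1 R₂ ≤ y1 r)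
    side (inj₁ (a , (_ , _ , _ , b))) = inj₁ (a , b)
    side (inj₂ (a , (_ , _ , b , _))) = inj₂ (a , b)

  ⊆R-trans : ∀ {r s t} → r ⊆R s → s ⊆R t → r ⊆R t
  ⊆R-trans (a , b , c , d) (a′ , b′ , c′ , d′) = ≤-trans a′ a , ≤-trans b b′ , ≤-trans c′ c , ≤-trans d d′

  module Realize₂ (I : Instance) (ε ea : ℚ) (ea≤ε : ea ≤ ε) where
    open Realize I ε ea ea≤ε
    open ItemGeo
    open DecM {A = Item} Fin._≟_ using (_∈?_)
    open Classes Fin._≟_ W H W>0 H>0 using (Once; once-subˡ)

    packOf : ∀ S {R} {S′ : List Item} → ItemGeo S′ R → Packing I
    packOf S g = record { sel = S ; px = gx g ; py = gy g }

    transfer : ∀ {m m′} (P P′ : Packing I) (loc : Item → Loc m) (loc′ : Item → Loc m′) k k′ C i →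
      (∀ j → j ∈ sel P′ → loc′ j ≡ inC k′ → j ∈ sel P × loc j ≡ inC k × itemRect P′ j ≡ itemRect P j) → itemRect P′ i ≡ itemRect P i →
      KindOK I ε P loc k C i → KindOK I ε P′ loc′ k′ C i
    transfer P P′ loc loc′ k k′ C i g e ok with kind C
    ... | large = λ j j∈ l → let (a , b , _) = g j j∈ l in ok j a b
    ... | horizontal = λ j j∈ l ne → let (a , b , c) = g j j∈ l in subst₂ (λ u v → (y2 u ≤ y1 v) ⊎ (y2 v ≤ y1 u)) (sym e) (sym c) (ok j a b ne)
    ... | vertical = λ j j∈ l ne → let (a , b , c) = g j j∈ l in subst₂ (λ u v → (x2 u ≤ x1 v) ⊎ (x2 v ≤ x1 u)) (sym e) (sym c) (ok j a b ne)
    ... | area = ok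

    record Geo (S : List Item) (R : Rect) : Set₁ where
      field
        ig   : ItemGeo S R
        m    : ℕ
        cont : Fin m → Container
        loc  : Item → Loc m
        locS : ∀ {i} → i ∈ S → ∃ λ k → loc i ≡ inC k
        insC : ∀ {i k} → i ∈ S → loc i ≡ inC k → rc ig i ⊆R box (cont k)
        kok  : ∀ {i k} → i ∈ S → loc i ≡ inC k → KindOK I ε (packOf S ig) loc k (cont k) i
        contIn : ∀ k → box (cont k) ⊆R R
        proper : ∀ k → x1 (box (cont k)) < x2 (box (cont k)) × y1 (box (cont k)) < y2 (box (cont k))
        contCut : CutT (λ k → box (cont k)) (λ _ → ⊤) R

    noGeo : ∀ R → Geo [] R
    noGeo R = record { ig = emptyGeo R ; m = 0 ; cont = λ () ; loc = λ _ → inL ; locS = λ () ; insC = λ () ; kok = λ () ; contIn = λ () ; proper = λ () ; contCut = leaf (λ ()) }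

    oneCont : ∀ {S R} (g : ItemGeo S R) (K : Kind) → (∀ {i} → i ∈ S → KindOK I ε (packOf S g) (λ _ → inC {1} Fin.zero) Fin.zero (record { box = R ; kind = K }) i) →
      x1 R < x2 R → y1 R < y2 R → Geo S R
    oneCont {S} {R} g K ok p q = record
      { ig = g ; m = 1 ; cont = λ _ → record { box = R ; kind = K } ; loc = λ _ → inC Fin.zero ; locS = λ _ → Fin.zero , refl
      ; insC = λ i∈ _ → inside g i∈ ; kok = λ { {k = Fin.zero} i∈ _ → ok i∈ } ; contIn = λ _ → ≤-refl , ≤-refl , ≤-refl , ≤-refl ; proper = λ _ → p , q
      ; contCut = leaf (λ { Fin.zero Fin.zero _ _ → refl }) }

    injL : ∀ {m₁} m₂ → Loc m₁ → Loc (m₁ ℕ.+ m₂)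
    injL m₂ inL = inL
    injL m₂ (inC k) = inC (k ↑ˡ m₂)
    injR : ∀ m₁ {m₂} → Loc m₂ → Loc (m₁ ℕ.+ m₂)
    injR m₁ inL = inL
    injR m₁ (inC k) = inC (m₁ ↑ʳ k)

    inC-inj : ∀ {m} {k k′ : Fin m} → inC k ≡ inC k′ → k ≡ k′
    inC-inj refl = refl

    joinGeo : ∀ {S S₁ S₂ R R₁ R₂} → (∀ {i} → i ∈ S → i ∈ S₁ ⊎ i ∈ S₂) → (∀ {i} → i ∈ S₁ → ¬ i ∈ S₂) → R₁ ⊆R R → R₂ ⊆R R → CutInto R R₁ R₂ →
      (G₁ : Geo S₁ R₁) (G₂ : Geo S₂ R₂) → Joined S R (Geo.ig G₁) (Geo.ig G₂) → Σ (Geo S R) λ G → Geo.m G ≡ Geo.m G₁ ℕ.+ Geo.m G₂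
    joinGeo {S} {S₁} {S₂} {R} {R₁} {R₂} mem dis in₁ in₂ ci G₁ G₂ (g , e₁ , e₂) = record
      { ig = g ; m = m₁ ℕ.+ m₂ ; cont = ct ; loc = lc
      ; locS = λ i∈ → locS′ (mem i∈)
      ; insC = λ i∈ l → insC′ (mem i∈) l
      ; kok = λ i∈ l → kok′ (mem i∈) l
      ; contIn = contIn′ ; proper = proper′
      ; contCut = ci {In = λ _ → ⊤} {In₁ = λ k → ∃ λ k₁ → k ≡ k₁ ↑ˡ m₂} {In₂ = λ k → ∃ λ k₂ → k ≡ m₁ ↑ʳ k₂} (λ k _ → side k (splitAt m₁ k) refl)
          (CutT-rel (λ k k₁ → k ≡ k₁ ↑ˡ m₂) (λ { k (k₁ , e) → k₁ , e , tt }) (λ { refl refl → refl }) (λ {k} {k₁} → λ { refl → cong box (ct-l k₁) }) G₁.contCut)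
          (CutT-rel (λ k k₂ → k ≡ m₁ ↑ʳ k₂) (λ { k (k₂ , e) → k₂ , e , tt }) (λ { refl refl → refl }) (λ {k} {k₂} → λ { refl → cong box (ct-r k₂) }) G₂.contCut) } , refl
      where
      module G₁ = Geo G₁
      module G₂ = Geo G₂
      m₁ = G₁.m
      m₂ = G₂.m
      ct : Fin (m₁ ℕ.+ m₂) → Container
      ct k = [ G₁.cont , G₂.cont ]′ (splitAt m₁ k)
      ct-l : ∀ k₁ → ct (k₁ ↑ˡ m₂) ≡ G₁.cont k₁
      ct-l k₁ = cong [ G₁.cont , G₂.cont ]′ (Finₚ.splitAt-↑ˡ m₁ k₁ m₂)
      ct-r : ∀ k₂ → ct (m₁ ↑ʳ k₂) ≡ G₂.cont k₂
      ct-r k₂ = cong [ G₁.cont , G₂.cont ]′ (Finₚ.splitAt-↑ʳ m₁ m₂ k₂)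
      l≢r : ∀ {k₁ k₂} → k₁ ↑ˡ m₂ ≢ m₁ ↑ʳ k₂
      l≢r {k₁} {k₂} e with trans (sym (Finₚ.splitAt-↑ˡ m₁ k₁ m₂)) (trans (cong (splitAt m₁) e) (Finₚ.splitAt-↑ʳ m₁ m₂ k₂))
      ... | ()
      lc : Item → Loc (m₁ ℕ.+ m₂)
      lc i = pick (i ∈? S₁) (injL m₂ (G₁.loc i)) (injR m₁ (G₂.loc i))
      lc₁ : ∀ {i} → i ∈ S₁ → ∃ λ k → G₁.loc i ≡ inC k × lc i ≡ inC (k ↑ˡ m₂)
      lc₁ {i} p = let (k , e) = G₁.locS p in k , e , trans (pick-yes (i ∈? S₁) p) (cong (injL m₂) e)
      lc₂ : ∀ {i} → i ∈ S₂ → ∃ λ k → G₂.loc i ≡ inC k × lc i ≡ inC (m₁ ↑ʳ k)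
      lc₂ {i} p = let (k , e) = G₂.locS p in k , e , trans (pick-no (i ∈? S₁) (λ q → dis q p)) (cong (injR m₁) e)
      locS′ : ∀ {i} → i ∈ S₁ ⊎ i ∈ S₂ → ∃ λ k → lc i ≡ inC k
      locS′ (inj₁ p) = let (k , _ , e) = lc₁ p in _ , e
      locS′ (inj₂ p) = let (k , _ , e) = lc₂ p in _ , e
      insC′ : ∀ {i k} → i ∈ S₁ ⊎ i ∈ S₂ → lc i ≡ inC k → rc g i ⊆R box (ct k)
      insC′ {i} {k} (inj₁ p) l = let (k₁ , a , b) = lc₁ p in
        subst₂ _⊆R_ (sym (e₁ p)) (cong box (trans (sym (ct-l k₁)) (cong ct (inC-inj (trans (sym b) l))))) (G₁.insC p a)
      insC′ {i} {k} (inj₂ p) l = let (k₂ , a , b) = lc₂ p in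
        subst₂ _⊆R_ (sym (e₂ p)) (cong box (trans (sym (ct-r k₂)) (cong ct (inC-inj (trans (sym b) l))))) (G₂.insC p a)
      kok′ : ∀ {i k} → i ∈ S₁ ⊎ i ∈ S₂ → lc i ≡ inC k → KindOK I ε (packOf S g) lc k (ct k) i
      kok′ {i} {k} (inj₁ p) l = let (k₁ , a , b) = lc₁ p ; k≡ = inC-inj (trans (sym b) l) in
        subst (λ z → KindOK I ε (packOf S g) lc z (ct z) i) k≡ (subst (λ C → KindOK I ε (packOf S g) lc (k₁ ↑ˡ m₂) C i) (sym (ct-l k₁))
          (transfer (packOf S₁ G₁.ig) (packOf S g) G₁.loc lc k₁ (k₁ ↑ˡ m₂) (G₁.cont k₁) i (λ j j∈ e → back (mem j∈) e) (e₁ p) (G₁.kok p a)))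
        where
        back : ∀ {j k₁} → j ∈ S₁ ⊎ j ∈ S₂ → lc j ≡ inC (k₁ ↑ˡ m₂) → j ∈ S₁ × G₁.loc j ≡ inC k₁ × rc g j ≡ rc G₁.ig j
        back (inj₁ q) e = let (k′ , a , b) = lc₁ q in q , trans a (cong inC (Finₚ.↑ˡ-injective m₂ k′ _ (inC-inj (trans (sym b) e)))) , e₁ q
        back (inj₂ q) e = let (k′ , a , b) = lc₂ q in ⊥-elim (l≢r (inC-inj (trans (sym e) b)))
      kok′ {i} {k} (inj₂ p) l = let (k₂ , a , b) = lc₂ p ; k≡ = inC-inj (trans (sym b) l) in
        subst (λ z → KindOK I ε (packOf S g) lc z (ct z) i) k≡ (subst (λ C → KindOK I ε (packOf S g) lc (m₁ ↑ʳ k₂) C i) (sym (ct-r k₂))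
          (transfer (packOf S₂ G₂.ig) (packOf S g) G₂.loc lc k₂ (m₁ ↑ʳ k₂) (G₂.cont k₂) i (λ j j∈ e → back (mem j∈) e) (e₂ p) (G₂.kok p a)))
        where
        back : ∀ {j k₂} → j ∈ S₁ ⊎ j ∈ S₂ → lc j ≡ inC (m₁ ↑ʳ k₂) → j ∈ S₂ × G₂.loc j ≡ inC k₂ × rc g j ≡ rc G₂.ig j
        back (inj₂ q) e = let (k′ , a , b) = lc₂ q in q , trans a (cong inC (Finₚ.↑ʳ-injective m₁ k′ _ (inC-inj (trans (sym b) e)))) , e₂ q
        back (inj₁ q) e = let (k′ , a , b) = lc₁ q in ⊥-elim (l≢r (inC-inj (trans (sym b) e)))
      byCase : ∀ {P : Container → Set} → (∀ k → P (G₁.cont k)) → (∀ k → P (G₂.cont k)) → ∀ k → P (ct k)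
      byCase {P} f₁ f₂ k with splitAt m₁ k
      ... | inj₁ k₁ = f₁ k₁
      ... | inj₂ k₂ = f₂ k₂
      contIn′ : ∀ k → box (ct k) ⊆R R
      contIn′ = byCase {λ C → box C ⊆R R} (λ k → ⊆R-trans (G₁.contIn k) in₁) (λ k → ⊆R-trans (G₂.contIn k) in₂)
      proper′ : ∀ k → x1 (box (ct k)) < x2 (box (ct k)) × y1 (box (ct k)) < y2 (box (ct k))
      proper′ = byCase {λ C → x1 (box C) < x2 (box C) × y1 (box C) < y2 (box C)} G₁.proper G₂.proper
      side : ∀ k z → splitAt m₁ k ≡ z → ((∃ λ k₁ → k ≡ k₁ ↑ˡ m₂) × box (ct k) ⊆R R₁) ⊎ ((∃ λ k₂ → k ≡ m₁ ↑ʳ k₂) × box (ct k) ⊆R R₂)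
      side k (inj₁ k₁) e = inj₁ ((k₁ , sym (Finₚ.splitAt⁻¹-↑ˡ e)) , subst (λ z → box ([ G₁.cont , G₂.cont ]′ z) ⊆R R₁) (sym e) (G₁.contIn k₁))
      side k (inj₂ k₂) e = inj₂ ((k₂ , sym (Finₚ.splitAt⁻¹-↑ʳ e)) , subst (λ z → box ([ G₁.cont , G₂.cont ]′ z) ⊆R R₂) (sym e) (G₂.contIn k₂))

    private
      abstract
        pos-gap : ∀ {x y z} → 0ℚ < z → z ≤ y - x → x < y
        pos-gap {x} {y} {z} p q = lin< (<-≤-trans p q) (ring-183 x y)
        up : ∀ {x y} → 0ℚ ≤ y → x ≤ x + y
        up {x} {y} p = lin≤ p (ring-3 x y)
        cutpos : ∀ {X X′ a₁ a₂ a} → 0ℚ ≤ a₂ → a₁ + a₂ ≡ a → a ≡ X′ - X → X + a₁ ≤ X′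
        cutpos {X} {X′} {a₁} {a₂} {a} p refl q = lin≤ (p ⊕ ≤-reflexive q) (ring-184 X X′ a₁ a₂)
        rest : ∀ {X X′ a₁ a₂ a} → a₁ + a₂ ≡ a → a ≡ X′ - X → a₂ ≡ X′ - (X + a₁)
        rest {X} {X′} {a₁} {a₂} {a} refl q = trans (sym (ring-182 a₁ a₂)) (trans (cong (_- a₁) q) (ring-185 X X′ a₁))

    -- A leaf without items yields no container: its box may be degenerate, while an item inside
    -- proves the positive extent that `proper` demands. Hence the inequality between the number of
    -- containers and that of leaves.
    geo : ∀ {a b S X Y X′ Y′} (T : CTree ea W H a b S) → Once S → a ≡ X′ - X → b ≡ Y′ - Y → Σ (Geo S (rect X Y X′ Y′)) λ G → Geo.m G ℕ.≤ leaves T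
    geo {X = X} {Y} {X′} {Y′} (free refl) o _ _ = noGeo _ , ℕ.z≤n
    geo {S = []} (hst _ _) o _ _ = noGeo _ , ℕ.z≤n
    geo {S = i ∷ S} (hst (p ∷ ps) q) o refl refl = let (g , dis) = stackH (i ∷ S) o (p ∷ ps) q in
      oneCont g horizontal (λ i∈ j j∈ _ ne → dis i∈ j∈ ne) (pos-gap (W>0 i) p) (pos-gap (H>0 i) (≤-trans (up (sum-nonneg (<⇒≤ ∘ H>0) S)) q)) , ℕₚ.≤-refl
    geo {S = []} (vst _ _) o _ _ = noGeo _ , ℕ.z≤n
    geo {S = i ∷ S} (vst (p ∷ ps) q) o refl refl = let (g , dis) = stackV (i ∷ S) o (p ∷ ps) q in
      oneCont g vertical (λ i∈ j j∈ _ ne → dis i∈ j∈ ne) (pos-gap (W>0 i) (≤-trans (up (sum-nonneg (<⇒≤ ∘ W>0) S)) q)) (pos-gap (H>0 i) p) , ℕₚ.≤-refl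
    geo {S = []} (ars _ _) o _ _ = noGeo _ , ℕ.z≤n
    geo {a} {b} {S = i ∷ S} (ars al P) o refl refl =
      oneCont (packGeo o P ≤-refl ≤-refl) area (λ i∈ → let (u , v) = All.lookup al i∈ in ≤-trans u (mono 0≤a) , ≤-trans v (mono 0≤b))
        (pos-gap (W>0 i) (proj₁ (All.head (fits P)))) (pos-gap (H>0 i) (proj₂ (All.head (fits P)))) , ℕₚ.≤-refl
      where
      0≤a : 0ℚ ≤ a
      0≤a = ≤-trans (<⇒≤ (W>0 i)) (proj₁ (All.head (fits P)))
      0≤b : 0ℚ ≤ b
      0≤b = ≤-trans (<⇒≤ (H>0 i)) (proj₂ (All.head (fits P)))
      mono : ∀ {x} → 0ℚ ≤ x → ea * x ≤ ε * x
      mono {x} p = subst₂ _≤_ (*-comm x ea) (*-comm x ε) (p ⊛ ea≤ε)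
    geo {S = S} {X} {Y} {X′} {Y′} (vs {a₁} {a₂} {S₁ = A} {B} 0≤a₁ 0≤a₂ e s T₁ T₂) o ea′ eb =
      let (G₁ , l₁) = geo {X = X} {Y} {X + a₁} {Y′} T₁ (once-subˡ {S} {A} {B} s o) (ring-30 X a₁) eb
          (G₂ , l₂) = geo {X = X + a₁} {Y} {X′} {Y′} T₂ (once-subʳ {S} {A} {B} s o) (rest {X} {X′} e ea′) eb
          u = up 0≤a₁
          v = cutpos {X} {X′} 0≤a₂ e ea′
          mem = λ {i} → split-∈ {S} {A} {B} s {i}
          dis = λ {i} → split-disjoint {S} {A} {B} o s {i}
          (G , e′) = joinGeo mem dis (≤-refl , v , ≤-refl , ≤-refl) (u , ≤-refl , ≤-refl , ≤-refl) (cutIntoV u v) G₁ G₂ (joinV u v mem dis (Geo.ig G₁) (Geo.ig G₂))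
      in G , ℕₚ.≤-trans (ℕₚ.≤-reflexive e′) (ℕₚ.+-mono-≤ l₁ l₂)
    geo {S = S} {X} {Y} {X′} {Y′} (hs {b₁} {b₂} {S₁ = A} {B} 0≤b₁ 0≤b₂ e s T₁ T₂) o ea′ eb =
      let (G₁ , l₁) = geo {X = X} {Y} {X′} {Y + b₁} T₁ (once-subˡ {S} {A} {B} s o) ea′ (ring-30 Y b₁)
          (G₂ , l₂) = geo {X = X} {Y + b₁} {X′} {Y′} T₂ (once-subʳ {S} {A} {B} s o) ea′ (rest {Y} {Y′} e eb)
          u = up 0≤b₁
          v = cutpos {Y} {Y′} 0≤b₂ e eb
          mem = λ {i} → split-∈ {S} {A} {B} s {i}
          dis = λ {i} → split-disjoint {S} {A} {B} o s {i}
          (G , e′) = joinGeo mem dis (≤-refl , ≤-refl , ≤-refl , v) (≤-refl , ≤-refl , u , ≤-refl) (cutIntoH u v) G₁ G₂ (joinH u v mem dis (Geo.ig G₁) (Geo.ig G₂))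
      in G , ℕₚ.≤-trans (ℕₚ.≤-reflexive e′) (ℕₚ.+-mono-≤ l₁ l₂)

-- Assembling boundary and containers

module LCRealisation where

  open import Defs hiding (w; h; N; n; m; cont; loc)
  import Defs
  open import Data.Bool using (T)
  open Packings
  open Counting
  open ContainerTrees
  open Configurations
  open SizeClasses
  open BoundaryL
  open Cuts
  open ItemPositions
  open ContainerPositions

  module Realize₃ (I : Instance) (ε ea : ℚ) (ea≤ε : ea ≤ ε) where
    open Realize I ε ea ea≤ε
    open Realize₂ I ε ea ea≤ε
    open ItemGeo
    open DecM {A = Item} Fin._≟_ using (_∈?_)
    open Classes Fin._≟_ W H W>0 H>0 using (Once; once-disjoint; once-subˡ)

    N : ℚ
    N = ℕ→ℚ (Defs.N I)

    -- The guillotine condition concerns boundary items and containers together, while the items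
    -- inside containers are hidden.
    rcO : ∀ {m} → (Item → Rect) → (Fin m → Container) → Item ⊎ Fin m → Rect
    rcO r c (inj₁ i) = r i
    rcO r c (inj₂ k) = box (c k)

    InO : ∀ {m} → List Item → Item ⊎ Fin m → Set
    InO L (inj₁ i) = i ∈ L
    InO L (inj₂ k) = ⊤

    record LGeo (L C : List Item) (X₀ Y₀ : ℚ) (R : Rect) : Set₁ where
      field
        ig   : ItemGeo (L ++ C) R
        m    : ℕ
        cont : Fin m → Container
        loc  : Item → Loc m
        locL : ∀ {i} → i ∈ L → loc i ≡ inL
        locC : ∀ {i} → i ∈ C → ∃ λ k → loc i ≡ inC k
        insC : ∀ {i k} → i ∈ C → loc i ≡ inC k → rc ig i ⊆R box (cont k)
        kok  : ∀ {i k} → i ∈ C → loc i ≡ inC k → KindOK I ε (packOf (L ++ C) ig) loc k (cont k) i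
        contIn : ∀ k → box (cont k) ⊆R rect X₀ Y₀ (x2 R) (y2 R)
        proper : ∀ k → x1 (box (cont k)) < x2 (box (cont k)) × y1 (box (cont k)) < y2 (box (cont k))
        insL : ∀ {i} → i ∈ L → y2 (rc ig i) ≤ Y₀ ⊎ x2 (rc ig i) ≤ X₀
        longL : ∀ {i} → i ∈ L → N < W i + W i ⊎ N < H i + H i
        X≤ : x1 R ≤ X₀
        Y≤ : y1 R ≤ Y₀
        bigCut : CutT (rcO (rc ig) cont) (InO L) R

    start : ∀ {C X₀ Y₀ X′ Y′} (G : Geo C (rect X₀ Y₀ X′ Y′)) → Σ (LGeo [] C X₀ Y₀ (rect X₀ Y₀ X′ Y′)) λ L → LGeo.m L ≡ Geo.m G
    start G = record
      { ig = G.ig ; m = G.m ; cont = G.cont ; loc = G.loc ; locL = λ () ; locC = G.locS ; insC = G.insC ; kok = G.kok ; contIn = G.contIn ; proper = G.proper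
      ; insL = λ () ; longL = λ () ; X≤ = ≤-refl ; Y≤ = ≤-refl
      ; bigCut = CutT-rel (λ o k → o ≡ inj₂ k) (λ { (inj₂ k) _ → k , refl , tt }) (λ { refl refl → refl }) (λ { refl → refl }) G.contCut } , refl
      where module G = Geo G

    addItem : ∀ {i L C X₀ Y₀ R R₁ R₂} → Once (i ∷ L ++ C) → CutInto R R₁ R₂ → x2 R₂ ≡ x2 R → y2 R₂ ≡ y2 R → x1 R ≤ x1 R₂ → y1 R ≤ y1 R₂ →
      (s : ItemGeo (i ∷ []) R₁) (G : LGeo L C X₀ Y₀ R₂) → Joined (i ∷ L ++ C) R s (LGeo.ig G) → (N < W i + W i ⊎ N < H i + H i) →
      (y2 (rc s i) ≤ Y₀ ⊎ x2 (rc s i) ≤ X₀) → Σ (LGeo (i ∷ L) C X₀ Y₀ R) λ G′ → LGeo.m G′ ≡ LGeo.m G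
    addItem {i} {L} {C} {X₀} {Y₀} {R} {R₁} {R₂} once ci ex ey lx ly s G (g , e₁ , e₂) lg insI = record
      { ig = g ; m = G.m ; cont = G.cont ; loc = lc
      ; locL = λ { (here refl) → pick-yes (i ∈? (i ∷ [])) (here refl) ; (there p) → trans (old (∈-++⁺ˡ p)) (G.locL p) }
      ; locC = λ p → let (k , e) = G.locC p in k , trans (old (∈-++⁺ʳ L p)) e
      ; insC = λ {j} {k} p e → subst (_⊆R box (G.cont k)) (sym (e₂ (∈-++⁺ʳ L p))) (G.insC p (trans (sym (old (∈-++⁺ʳ L p))) e))
      ; kok = λ {j} {k} p e → transfer (packOf (L ++ C) G.ig) (packOf (i ∷ L ++ C) g) G.loc lc k k (G.cont k) j back (e₂ (∈-++⁺ʳ L p)) (G.kok p (trans (sym (old (∈-++⁺ʳ L p))) e))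
      ; contIn = λ k → let (a , b , c , d) = G.contIn k in a , ≤-trans b (≤-reflexive ex) , c , ≤-trans d (≤-reflexive ey)
      ; proper = G.proper
      ; insL = λ { (here refl) → subst (λ z → y2 z ≤ Y₀ ⊎ x2 z ≤ X₀) (sym (e₁ (here refl))) insI
                 ; (there p) → subst (λ z → y2 z ≤ Y₀ ⊎ x2 z ≤ X₀) (sym (e₂ (∈-++⁺ˡ p))) (G.insL p) }
      ; longL = λ { (here refl) → lg ; (there p) → G.longL p }
      ; X≤ = ≤-trans lx G.X≤ ; Y≤ = ≤-trans ly G.Y≤
      ; bigCut = ci {In = InO (i ∷ L)} {In₁ = λ o → o ≡ inj₁ i} {In₂ = InO L}
          (λ { (inj₁ _) (here refl) → inj₁ (refl , subst (_⊆R R₁) (sym (e₁ (here refl))) (inside s (here refl)))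
             ; (inj₁ j) (there p) → inj₂ (p , subst (_⊆R R₂) (sym (e₂ (∈-++⁺ˡ p))) (inside G.ig (∈-++⁺ˡ p)))
             ; (inj₂ k) _ → inj₂ (tt , let (a , b , c , d) = G.contIn k in ≤-trans G.X≤ a , b , ≤-trans G.Y≤ c , d) })
          (leaf (λ { _ _ refl refl → refl }))
          (CutT-rel (λ o′ o → o′ ≡ o × InO L o′) (λ o p → o , (refl , p) , p) (λ { (refl , _) (refl , _) → refl }) (λ { {inj₁ j} (refl , p) → e₂ (∈-++⁺ˡ p) ; {inj₂ k} (refl , _) → refl }) G.bigCut) } , refl
      where
      module G = LGeo G
      lc : Item → Loc G.m
      lc j = pick (j ∈? (i ∷ [])) inL (G.loc j)
      old : ∀ {j} → j ∈ L ++ C → lc j ≡ G.loc j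
      old {j} p = pick-no (j ∈? (i ∷ [])) (λ q → once-head {i} {L ++ C} once q p)
      back : ∀ {k} j → j ∈ i ∷ L ++ C → lc j ≡ inC k → j ∈ L ++ C × G.loc j ≡ inC k × rc g j ≡ rc G.ig j
      back j (there p) e = p , trans (sym (old p)) e , e₂ p
      back j (here refl) e with trans (sym (pick-yes (i ∈? (i ∷ [])) (here refl))) e
      ... | ()

    private
      abstract
        n₁ : ∀ {x y} → x ≤ y → N - y ≤ N - x
        n₁ {x} {y} p = lin≤ p (ring-186 N x y)
        n₂ : ∀ {x} → 0ℚ ≤ x → N - x ≤ N
        n₂ {x} p = lin≤ p (ring-114 N x)
        n₃ : ∀ w a → (N - (w + a)) + w ≡ N - a
        n₃ w a = ring-187 N w a
        n₄ : ∀ {h b} → h ≤ b → (N - b) + h ≤ N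
        n₄ {h} {b} p = lin≤ p (ring-188 N h b)
        n₅ : ∀ {w} a → 0ℚ ≤ w → a ≤ w + a
        n₅ {w} a p = lin≤ p (ring-7 w a)
        n₆ : ∀ a → a ≡ N - (N - a)
        n₆ a = ring-134 N a

    -- Peeling never moves the upper right corner, so a remaining box with sides `a` and `b` starts
    -- at N - a and N - b. Peeled items are therefore left of or below the final box, as required of
    -- the boundary.
    lgeo : ∀ {a b a′ b′ L C} → 0ℚ ≤ a′ → 0ℚ ≤ b′ → LNest W H N a b a′ b′ L → Once (L ++ C) → (G : Geo C (rect (N - a′) (N - b′) N N)) →
      Σ (LGeo L C (N - a′) (N - b′) (rect (N - a) (N - b) N N)) λ G′ → LGeo.m G′ ≡ Geo.m G
    lgeo 0≤a′ 0≤b′ [] o G = start G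
    lgeo {b = b} {C = C} 0≤a′ 0≤b′ (lv {a = a} {a′ = a′} {b′} {i} {S = L} p q refl nst) o G =
      let (G₂ , e) = lgeo 0≤a′ 0≤b′ nst (once-tl {i} {L ++ C} o) G
          s = singleGeo {i} {N - (W i + a)} {N - b} {N - a} {N} (≤-reflexive (n₃ (W i) a)) (n₄ q)
          u = n₁ (n₅ a (<⇒≤ (W>0 i)))
          v = n₂ (≤-trans 0≤a′ (proj₁ (nest-≤ W>0 H>0 nst)))
          (G₃ , e′) = addItem o (cutIntoV u v) refl refl u ≤-refl s G₂ (joinV u v uncons (once-head {i} {L ++ C} o) s (LGeo.ig G₂)) (inj₂ p) (inj₂ (≤-trans (≤-reflexive (n₃ (W i) a)) (n₁ (proj₁ (nest-≤ W>0 H>0 nst)))))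
      in G₃ , trans e′ e
    lgeo {a = a} {C = C} 0≤a′ 0≤b′ (lh {b = b} {a′ = a′} {b′} {i} {S = L} p q refl nst) o G =
      let (G₂ , e) = lgeo 0≤a′ 0≤b′ nst (once-tl {i} {L ++ C} o) G
          s = singleGeo {i} {N - a} {N - (H i + b)} {N} {N - b} (n₄ q) (≤-reflexive (n₃ (H i) b))
          u = n₁ (n₅ b (<⇒≤ (H>0 i)))
          v = n₂ (≤-trans 0≤b′ (proj₂ (nest-≤ W>0 H>0 nst)))
          (G₃ , e′) = addItem o (cutIntoH u v) refl refl ≤-refl u s G₂ (joinH u v uncons (once-head {i} {L ++ C} o) s (LGeo.ig G₂)) (inj₁ p) (inj₁ (≤-trans (≤-reflexive (n₃ (H i) b)) (n₁ (proj₂ (nest-≤ W>0 H>0 nst)))))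
      in G₃ , trans e′ e

    once⇒unique : ∀ {S} → Once S → Unique S
    once⇒unique {[]} o = []
    once⇒unique {i ∷ S} o = All.tabulate (λ {j} j∈ e → once-head {i} {S} o (here (sym e)) j∈) ∷ once⇒unique (once-tl {i} {S} o)

    ⟦⟧-< : ∀ {m n} → ⟦ m ⟧ < ⟦ n ⟧ → m ℕ.< n
    ⟦⟧-< {m} {n} p with m ℕ.<? n
    ... | yes q = q
    ... | no ¬q = ⊥-elim (<⇒≱ p (⟦⟧-mono (ℕₚ.≮⇒≥ ¬q)))

    long-ℕ : ∀ {k} → N < ℕ→ℚ k + ℕ→ℚ k → Defs.N I ℕ.< 2 ℕ.* k
    long-ℕ {k} p = ⟦⟧-< (subst₂ _<_ (ℕ→ℚ≡⟦⟧ (Defs.N I)) (trans (cong₂ _+_ (ℕ→ℚ≡⟦⟧ k) (trans (ℕ→ℚ≡⟦⟧ k) (cong ⟦_⟧ (sym (ℕₚ.+-identityʳ k))))) (sym (⟦⟧-+ k (k ℕ.+ 0)))) p)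

    module Assemble {L C : List Item} {X₀ Y₀ : ℚ} {bound : ℚ → ℕ} (X₀≤N : X₀ ≤ N) (Y₀≤N : Y₀ ≤ N) (o : Once (L ++ C)) (lg : LGeo L C X₀ Y₀ (knapsack I)) (m≤ : LGeo.m lg ℕ.≤ bound ε) where
      private module G = LGeo lg
      P : Packing I
      P = packOf (L ++ C) G.ig
      unique : Unique (L ++ C)
      unique = once⇒unique o
      abstract
        up : ∀ {x y} → 0ℚ < y → x < x + y
        up {x} {y} p = lin< p (ring-3 x y)
      pairs : ∀ S → Unique S → (∀ {i} → i ∈ S → i ∈ L ++ C) → AllPairs (λ i j → Disjoint (itemRect P i) (itemRect P j)) S
      pairs [] [] _ = []
      pairs (i ∷ S) (u ∷ us) f = All.tabulate (λ {j} j∈ → cut-disjoint (cut G.ig) (f (here refl)) (f (there j∈)) (All.lookup u j∈)) ∷ pairs S us (f ∘ there)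
      isL∈ : ∀ {i} → i ∈ L ++ C → G.loc i ≡ inL → i ∈ L
      isL∈ p e with ∈-++⁻ L p
      ... | inj₁ q = q
      ... | inj₂ q with trans (sym e) (proj₂ (G.locC q))
      ...   | ()
      isC∈ : ∀ {i k} → i ∈ L ++ C → G.loc i ≡ inC k → i ∈ C
      isC∈ p e with ∈-++⁻ L p
      ... | inj₂ q = q
      ... | inj₁ q with trans (sym e) (G.locL q)
      ...   | ()
      long : ∀ {i} → N < W i + W i ⊎ N < H i + H i → Long I i
      long {i} (inj₁ p) = inj₁ (long-ℕ {Defs.w I i} p)
      long {i} (inj₂ p) = inj₂ (long-ℕ {Defs.h I i} p)
      L? : ∀ i → Dec (T (isL (G.loc i)))
      L? i = T? (isL (G.loc i))
      F = filter L? (L ++ C)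
      isL⇒ : ∀ {m} (l : Loc m) → T (isL l) → l ≡ inL
      isL⇒ inL _ = refl
      selL : ∀ {i} → i ∈ F → i ∈ L
      selL {i} p = let (q , t) = ∈-filter⁻ L? {xs = L ++ C} p in isL∈ q (isL⇒ (G.loc i) t)
      objs : List (Item ⊎ Fin G.m)
      objs = map inj₁ F ++ map inj₂ (allFin G.m)
      objs-unique : Unique objs
      objs-unique = Uniqueₚ.++⁺ (Uniqueₚ.map⁺ inj₁-injective (Uniqueₚ.filter⁺ L? unique)) (Uniqueₚ.map⁺ inj₂-injective (Uniqueₚ.allFin⁺ G.m)) (λ { (p , q) → dj p q })
        where
        dj : ∀ {x} → x ∈ map inj₁ F → ¬ x ∈ map inj₂ (allFin G.m)
        dj p q with ∈-map⁻ inj₁ p | ∈-map⁻ inj₂ q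
        ... | _ , _ , refl | _ , _ , ()
      listEq : map (rcO (rc G.ig) G.cont) objs ≡ map (itemRect P) F ++ map (λ k → box (G.cont k)) (allFin G.m)
      listEq = trans (Listₚ.map-++ (rcO (rc G.ig) G.cont) (map inj₁ F) (map inj₂ (allFin G.m))) (cong₂ _++_ (sym (Listₚ.map-∘ F)) (sym (Listₚ.map-∘ (allFin G.m))))

      result : LCPacking I ε bound
      result = record
          { packing = P ; N₁ = Y₀ ; N₂ = X₀
          ; N₁-range = G.Y≤ , Y₀≤N ; N₂-range = G.X≤ , X₀≤N
          ; m = G.m ; m-bound = m≤
          ; cont = G.cont ; loc = G.loc
          ; feasible = unique , All.tabulate (inside G.ig) , pairs (L ++ C) unique id , cut⇒Guillotine (λ i → up (W>0 i)) (λ i → up (H>0 i)) (cut G.ig) (L ++ C) unique (All.tabulate id) (All.tabulate (inside G.ig))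
          ; cont-in = λ k → let (a , b , c , d) = G.contIn k in ≤-trans G.X≤ a , b , ≤-trans G.Y≤ c , d
          ; cont-notL = λ k → let (a , b , c , d) = G.contIn k in c , a
          ; cont-disj = λ k l ne → cut-disjoint G.bigCut {inj₂ k} {inj₂ l} tt tt (ne ∘ inj₂-injective)
          ; L-long = λ i i∈ e → long (G.longL (isL∈ i∈ e))
          ; L-inside = λ i i∈ e → G.insL (isL∈ i∈ e)
          ; C-inside = λ i k i∈ e → G.insC (isC∈ i∈ e) e
          ; C-kind = λ i k i∈ e → G.kok (isC∈ i∈ e) e
          ; guill = subst (Guillotine (knapsack I)) listEq
              (cut⇒Guillotine (λ { (inj₁ i) → up (W>0 i) ; (inj₂ k) → proj₁ (G.proper k) }) (λ { (inj₁ i) → up (H>0 i) ; (inj₂ k) → proj₂ (G.proper k) }) G.bigCut objs objs-unique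
                (Allₚ.++⁺ (Allₚ.map⁺ (All.tabulate (λ i∈ → selL i∈))) (Allₚ.map⁺ (All.universal (λ _ → tt) (allFin G.m))))
                (Allₚ.++⁺ (Allₚ.map⁺ (All.tabulate (λ i∈ → inside G.ig (∈-++⁺ˡ (selL i∈))))) (Allₚ.map⁺ (All.universal (λ k → let (a , b , c , d) = G.contIn k in ≤-trans G.X≤ a , b , ≤-trans G.Y≤ c , d) (allFin G.m))))) }

    lcPacking : ∀ {a′ b′ L C bound} → 0ℚ ≤ a′ → 0ℚ ≤ b′ → LNest W H N N N a′ b′ L → (T : CTree ea W H a′ b′ C) → leaves T ℕ.≤ bound ε → Once (L ++ C) →
      Σ (LCPacking I ε bound) λ P → profit (packing P) ≡ length (L ++ C)
    lcPacking {a′} {b′} {L} {C} {bound} 0≤a′ 0≤b′ nst Tr lv≤ o =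
      Assemble.result {bound = bound} (n₂ 0≤a′) (n₂ 0≤b′) o (proj₁ lg) (ℕₚ.≤-trans (ℕₚ.≤-reflexive (proj₂ lg)) (ℕₚ.≤-trans (proj₂ gg) lv≤)) , refl
      where
      X₀ = N - a′
      Y₀ = N - b′
      gg : Σ (Geo C (rect X₀ Y₀ N N)) λ G → Geo.m G ℕ.≤ leaves Tr
      gg = geo Tr (once-subʳ {L ++ C} {L} {C} (split-++ L C) o) (n₆ a′) (n₆ b′)
      lg : Σ (LGeo L C X₀ Y₀ (knapsack I)) λ G′ → LGeo.m G′ ≡ Geo.m (proj₁ gg)
      lg = subst (λ R → Σ (LGeo L C X₀ Y₀ R) λ G′ → LGeo.m G′ ≡ Geo.m (proj₁ gg)) (cong₂ (λ x y → rect x y N N) (+-inverseʳ N) (+-inverseʳ N)) (lgeo 0≤a′ 0≤b′ nst o (proj₁ gg))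

-- Averaging over the depth of the dropped strips

module DepthAveraging where

  open Packings
  open Counting
  open PeelingRuns
  open DecoratedRuns

  -- If every one of the `suc L` differences exceeded the average, their telescoping sum
  -- `g 0 - g (suc L)` would exceed `g 0`.
  smallStep : (L : ℕ) (g : ℕ → ℚ) → 0ℚ ≤ g (suc L) → ∃ λ i → i ℕ.≤ L × ⟦ suc L ⟧ * (g i - g (suc i)) ≤ g 0
  smallStep L g 0≤g = search
    where
    K = ⟦ suc L ⟧
    Res = ∃ λ i → i ℕ.≤ L × K * (g i - g (suc i)) ≤ g 0
    walk : ∀ n → n ℕ.≤ L → Res ⊎ (⟦ n ⟧ * g 0 ≤ K * (g 0 - g n))
    walk zero _ = inj₂ (≤-reflexive (ring-195 K (g 0)))
    walk (suc n) n<L with K * (g n - g (suc n)) ≤? g 0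
    ... | yes p = inj₁ (n , ℕₚ.<⇒≤ n<L , p)
    ... | no ¬p with walk n (ℕₚ.<⇒≤ n<L)
    ...   | inj₁ r = inj₁ r
    ...   | inj₂ le = inj₂ (lin≤ (le ⊕ <⇒≤ (≰⇒> ¬p)) (ring-194 K (g 0) (g n) (g (suc n)) ⟦ n ⟧))
    search : Res
    search with K * (g L - g (suc L)) ≤? g 0
    ... | yes p = L , ℕₚ.≤-refl , p
    ... | no ¬p with walk L ℕₚ.≤-refl
    ...   | inj₁ r = r
    ...   | inj₂ le = ⊥-elim (<⇒≱ {K * g 0} {K * (g 0 - g (suc L))} (lin< (+-mono-≤-< le (≰⇒> ¬p)) (ring-194 K (g 0) (g L) (g (suc L)) ⟦ L ⟧)) (lin≤ (0≤* (0≤⟦⟧ (suc L)) 0≤g) (ring-196 K (g 0) (g (suc L)))))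

  module _ {Item : Set} where

    module _ {w h : Item → ℚ} {d : ℚ} where

      preSum : ∀ {a b a′ b′} kx ky (p : 0ℚ ≤ kx) (q : 0ℚ ≤ ky) (s : Peels w h d a b a′ b′) f →
        sum f (vI (Cut.pre (cut kx ky p q s))) + sum f (hI (Cut.pre (cut kx ky p q s))) ≡ sum f (preItems kx ky s)
      preSum kx ky p q [] f = refl
      preSum kx ky p q (pv {c = c} {S = S} x y z refl t) f with c ≤? kx
      ... | no _ = refl
      ... | yes c≤ = trans (cong (_+ sum f (hI (Cut.pre C))) (sum-++ f S (vI (Cut.pre C)))) (trans (+-assoc (sum f S) (sum f (vI (Cut.pre C))) (sum f (hI (Cut.pre C)))) (trans (cong (_+_ (sum f S)) (preSum (kx - c) ky (≤⇒0≤ c≤) q t f)) (sym (sum-++ f S _))))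
        where C = cut (kx - c) ky (≤⇒0≤ c≤) q t
      preSum kx ky p q (ph {c = c} {S = S} x y z refl t) f with c ≤? ky
      ... | no _ = refl
      ... | yes c≤ = trans (cong (_+_ (sum f (vI (Cut.pre C)))) (sum-++ f S (hI (Cut.pre C)))) (trans (ring-2 (sum f (vI (Cut.pre C))) (sum f S) (sum f (hI (Cut.pre C)))) (trans (cong (_+_ (sum f S)) (preSum kx (ky - c) p (≤⇒0≤ c≤) t f)) (sym (sum-++ f S _))))
        where
        C = cut kx (ky - c) p (≤⇒0≤ c≤) t

      private
        abstract
          sub≤ : ∀ {x y} c → x ≤ y → x - c ≤ y - c
          sub≤ {x} {y} c p = lin≤ p (ring-189 x y c)

      -- `G` arises by cutting a prefix a second time. A shallower cut does not see that the strips
      -- beyond the deeper one are gone, so the weight of `G` becomes the difference of two depth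
      -- counts of the same run.
      prePre : ∀ {a b a′ b′} {jx jy} kx ky (p : 0ℚ ≤ kx) (q : 0ℚ ≤ ky) → jx ≤ kx → jy ≤ ky → (s : Peels w h d a b a′ b′) →
        preItems jx jy (Cut.pre (cut kx ky p q s)) ≡ preItems jx jy s
      prePre kx ky p q u v [] = refl
      prePre {jx = jx} {jy} kx ky p q u v (pv {c = c} {S = S} x y z refl t) with c ≤? kx
      prePre {jx = jx} {jy} kx ky p q u v (pv {c = c} {S = S} x y z refl t) | no c≰ with c ≤? jx
      ... | yes c≤ = ⊥-elim (c≰ (≤-trans c≤ u))
      ... | no _ = refl
      prePre {jx = jx} {jy} kx ky p q u v (pv {c = c} {S = S} x y z refl t) | yes c≤ with c ≤? jx
      ... | yes _ = cong (S ++_) (prePre (kx - c) ky (≤⇒0≤ c≤) q (sub≤ c u) v t)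
      ... | no _ = refl
      prePre {jx = jx} {jy} kx ky p q u v (ph {c = c} {S = S} x y z refl t) with c ≤? ky
      prePre {jx = jx} {jy} kx ky p q u v (ph {c = c} {S = S} x y z refl t) | no c≰ with c ≤? jy
      ... | yes c≤ = ⊥-elim (c≰ (≤-trans c≤ v))
      ... | no _ = refl
      prePre {jx = jx} {jy} kx ky p q u v (ph {c = c} {S = S} x y z refl t) | yes c≤ with c ≤? jy
      ... | yes _ = cong (S ++_) (prePre kx (ky - c) p (≤⇒0≤ c≤) u (sub≤ c v) t)
      ... | no _ = refl

      -- A wide strip cannot exceed a vertical limit that equals the whole remaining height, so only
      -- a tall strip ends the cut.
      toV : ∀ {a b a′ b′ kx B} (s : Peels w h d a b a′ b′) → Stop kx ((B - b′) - (B - b)) s → VStop kx s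
      toV [] _ = tt
      toV (pv _ _ _ _ _) st = st
      toV {b = b₀} {b′ = b′} {B = B} (ph {b = b} {c = c} _ _ _ e t) st = <⇒≱ st (lin≤ (b′≤b t) (trans (cong (λ z → ((B - b′) - (B - z)) - c) e) (ring-91 B b′ b c)))

      toH : ∀ {a b a′ b′ ky A} (s : Peels w h d a b a′ b′) → Stop ((A - a′) - (A - a)) ky s → HStop ky s
      toH [] _ = tt
      toH (ph _ _ _ _ _) st = st
      toH {a = a₀} {a′ = a′} {A = A} (pv {a = a} {c = c} _ _ _ e t) st = <⇒≱ st (lin≤ (a′≤a t) (trans (cong (λ z → ((A - a′) - (A - z)) - c) e) (ring-91 A a′ a c)))

      module Decorate {k₁ k₂ η : ℚ} (0≤k₁ : 0ℚ ≤ k₁) (k₁≤k₂ : k₁ ≤ k₂) (0≤η : 0ℚ ≤ η) where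

        0≤k₂ : 0ℚ ≤ k₂
        0≤k₂ = ≤-trans 0≤k₁ k₁≤k₂

        deco : ∀ {a b a′ b′} (s : Peels w h d a b a′ b′) → Deco w h d k₁ k₂ η a b a′ b′
        deco {a} {b} s = record
          { F = F ; G = C₁.post ; R = C₂.post ; Fx = Cx.pre ; Fx′ = Cx.post ; Fy = Cy.pre ; Fy′ = Cy.post
          ; F-x = C₁.x≤ ; F-y = C₁.y≤ ; stopR = C₂.stop ; Fx≤ = Cx.x≤ ; Fy≤ = Cy.y≤
          ; stopX = toV {B = b} Cx.post Cx.stop ; stopY = toH {A = a} Cy.post Cy.stop
          ; vFx = λ f → trans (cong (sum f) Cx.veq) (sum-++ f (vI Cx.pre) (vI Cx.post)) ; hFx = λ f → trans (cong (sum f) Cx.heq) (sum-++ f (hI Cx.pre) (hI Cx.post))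
          ; vFy = λ f → trans (cong (sum f) Cy.veq) (sum-++ f (vI Cy.pre) (vI Cy.post)) ; hFy = λ f → trans (cong (sum f) Cy.heq) (sum-++ f (hI Cy.pre) (hI Cy.post)) }
          where
          module C₂ = Cut (cut k₂ k₂ 0≤k₂ 0≤k₂ s)
          module C₁ = Cut (cut k₁ k₁ 0≤k₁ 0≤k₁ C₂.pre)
          F = C₁.pre
          0≤X : 0ℚ ≤ a - C₁.am
          0≤X = ≤⇒0≤ (a′≤a F)
          0≤Y : 0ℚ ≤ b - C₁.bm
          0≤Y = ≤⇒0≤ (b′≤b F)
          module Cx = Cut (cut (η * (a - C₁.am)) (b - C₁.bm) (0≤* 0≤η 0≤X) 0≤Y F)
          module Cy = Cut (cut (a - C₁.am) (η * (b - C₁.bm)) 0≤X (0≤* 0≤η 0≤Y) F)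

        all5 : ∀ {a b a′ b′} f (s : Peels w h d a b a′ b′) → vc f (deco s) + (vr f (deco s) + (hc f (deco s) + (hr f (deco s) + gg f (deco s)))) ≡ sum f (vI s) + sum f (hI s)
        all5 f s = trans (ring-190 (sum f (vI D.Fx)) (sum f (vI D.Fx′)) (sum f (vI D.R)) (sum f (hI D.Fy)) (sum f (hI D.Fy′)) (sum f (hI D.R)) (sum f (vI D.G)) (sum f (hI D.G)))
            (cong₂ _+_ (trans (cong (λ z → (z + sum f (vI D.G)) + sum f (vI D.R)) (sym (D.vFx f))) (sym v)) (trans (cong (λ z → (z + sum f (hI D.G)) + sum f (hI D.R)) (sym (D.hFy f))) (sym hh)))
          where
          module D = Deco (deco s)
          module C₂ = Cut (cut k₂ k₂ 0≤k₂ 0≤k₂ s)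
          module C₁ = Cut (cut k₁ k₁ 0≤k₁ 0≤k₁ C₂.pre)
          v : sum f (vI s) ≡ (sum f (vI D.F) + sum f (vI D.G)) + sum f (vI D.R)
          v = trans (cong (sum f) C₂.veq) (trans (sum-++ f (vI C₂.pre) (vI C₂.post)) (cong (_+ sum f (vI C₂.post)) (trans (cong (sum f) C₁.veq) (sum-++ f (vI C₁.pre) (vI C₁.post)))))
          hh : sum f (hI s) ≡ (sum f (hI D.F) + sum f (hI D.G)) + sum f (hI D.R)
          hh = trans (cong (sum f) C₂.heq) (trans (sum-++ f (hI C₂.pre) (hI C₂.post)) (cong (_+ sum f (hI C₂.post)) (trans (cong (sum f) C₁.heq) (sum-++ f (hI C₁.pre) (hI C₁.post)))))

        ggCount : ∀ {a b a′ b′} f (s : Peels w h d a b a′ b′) → gg f (deco s) ≡ sum f (preItems k₂ k₂ s) - sum f (preItems k₁ k₁ s)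
        ggCount f s = trans (ring-191 (sum f (vI C₁.pre)) (sum f (vI C₁.post)) (sum f (hI C₁.pre)) (sum f (hI C₁.post)))
            (cong₂ _-_ (trans (cong₂ _+_ (trans (sym (sum-++ f (vI C₁.pre) (vI C₁.post))) (cong (sum f) (sym C₁.veq))) (trans (sym (sum-++ f (hI C₁.pre) (hI C₁.post))) (cong (sum f) (sym C₁.heq)))) (preSum k₂ k₂ 0≤k₂ 0≤k₂ s f))
                       (trans (preSum k₁ k₁ 0≤k₁ 0≤k₁ C₂.pre f) (cong (sum f) (prePre k₂ k₂ 0≤k₂ 0≤k₂ k₁≤k₂ k₁≤k₂ s))))
          where
          module C₂ = Cut (cut k₂ k₂ 0≤k₂ 0≤k₂ s)
          module C₁ = Cut (cut k₁ k₁ 0≤k₁ 0≤k₁ C₂.pre)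

        mutual
          decorate : ∀ {a b} → Run w h d a b → DRun w h d k₁ k₂ η a b
          decorate (run p q s E) = run p q (deco s) (decorateE E)
          decorateE : ∀ {a b} → End w h d a b → DEnd w h d k₁ k₂ η a b
          decorateE (term p q) = term p q
          decorateE (vbr p R₁ R₂) = vbr p (decorate R₁) (decorate R₂)
          decorateE (hbr p R₁ R₂) = hbr p (decorate R₁) (decorate R₂)

        mutual
          druns≡ : ∀ {a b} (R : Run w h d a b) → druns (decorate R) ≡ runs R
          druns≡ (run _ _ _ E) = cong suc (drunsE≡ E)
          drunsE≡ : ∀ {a b} (E : End w h d a b) → drunsE (decorateE E) ≡ runsE E
          drunsE≡ (term _ _) = refl
          drunsE≡ (vbr _ p q) = cong₂ ℕ._+_ (druns≡ p) (druns≡ q)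
          drunsE≡ (hbr _ p q) = cong₂ ℕ._+_ (druns≡ p) (druns≡ q)

        mutual
          totals : ∀ {a b} f (R : Run w h d a b) → sum f (items R) ≡ total vc f (decorate R) + (total vr f (decorate R) + (total hc f (decorate R) + (total hr f (decorate R) + total gg f (decorate R))))
          totals f (run p q s E) = trans (trans (sum-++ f (vI s ++ hI s) (itemsE E)) (cong₂ _+_ (trans (sum-++ f (vI s) (hI s)) (sym (all5 f s))) (totalsE f E)))
            (sym (ring-192 (vc f D) (vr f D) (hc f D) (hr f D) (gg f D) (totalE vc f E′) (totalE vr f E′) (totalE hc f E′) (totalE hr f E′) (totalE gg f E′)))
            where
            D = deco s
            E′ = decorateE E
          totalsE : ∀ {a b} f (E : End w h d a b) → sum f (itemsE E) ≡ totalE vc f (decorateE E) + (totalE vr f (decorateE E) + (totalE hc f (decorateE E) + (totalE hr f (decorateE E) + totalE gg f (decorateE E))))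
          totalsE f (term _ _) = refl
          totalsE f (vbr _ p q) = trans (trans (sum-++ f (items p) (items q)) (cong₂ _+_ (totals f p) (totals f q)))
            (sym (ring-192 (total vc f P) (total vr f P) (total hc f P) (total hr f P) (total gg f P) (total vc f Q) (total vr f Q) (total hc f Q) (total hr f Q) (total gg f Q)))
            where
            P = decorate p
            Q = decorate q
          totalsE f (hbr _ p q) = trans (trans (sum-++ f (items p) (items q)) (cong₂ _+_ (totals f p) (totals f q)))
            (sym (ring-192 (total vc f P) (total vr f P) (total hc f P) (total hr f P) (total gg f P) (total vc f Q) (total vr f Q) (total hc f Q) (total hr f Q) (total gg f Q)))
            where
            P = decorate p
            Q = decorate q

      mutual
        -- Adds up all runs of the tree at a common depth, so that the averaging chooses one pair of
        -- depths for all runs at once; `T` and `κ` refer to all runs.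
        depthCount : ∀ {a b} → (Item → ℚ) → ℚ → Run w h d a b → ℚ
        depthCount f k (run _ _ s E) = sum f (preItems k k s) + depthCountE f k E
        depthCountE : ∀ {a b} → (Item → ℚ) → ℚ → End w h d a b → ℚ
        depthCountE f k (term _ _) = 0ℚ
        depthCountE f k (vbr _ p q) = depthCount f k p + depthCount f k q
        depthCountE f k (hbr _ p q) = depthCount f k p + depthCount f k q

      mutual
        ggTotal : ∀ {k₁ k₂ η a b} (x : 0ℚ ≤ k₁) (y : k₁ ≤ k₂) (z : 0ℚ ≤ η) f (R : Run w h d a b) → total gg f (Decorate.decorate x y z R) ≡ depthCount f k₂ R - depthCount f k₁ R
        ggTotal {k₁} {k₂} x y z f (run _ _ s E) = trans (cong₂ _+_ (Decorate.ggCount x y z f s) (ggTotalE x y z f E)) (ring-193 (sum f (preItems k₂ k₂ s)) (sum f (preItems k₁ k₁ s)) (depthCountE f k₂ E) (depthCountE f k₁ E))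
        ggTotalE : ∀ {k₁ k₂ η a b} (x : 0ℚ ≤ k₁) (y : k₁ ≤ k₂) (z : 0ℚ ≤ η) f (E : End w h d a b) → totalE gg f (Decorate.decorateE x y z E) ≡ depthCountE f k₂ E - depthCountE f k₁ E
        ggTotalE x y z f (term _ _) = refl
        ggTotalE {k₁} {k₂} x y z f (vbr _ p q) = trans (cong₂ _+_ (ggTotal x y z f p) (ggTotal x y z f q)) (ring-193 (depthCount f k₂ p) (depthCount f k₁ p) (depthCount f k₂ q) (depthCount f k₁ q))
        ggTotalE {k₁} {k₂} x y z f (hbr _ p q) = trans (cong₂ _+_ (ggTotal x y z f p) (ggTotal x y z f q)) (ring-193 (depthCount f k₂ p) (depthCount f k₁ p) (depthCount f k₂ q) (depthCount f k₁ q))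

-- Choice of the constants

module Constants where

  open import Defs using (ℕ→ℚ)
  open Packings
  open Counting
  open Configurations
  open ItemPositions using (ℕ→ℚ≡⟦⟧)

  abstract
    -- The denominator of `x` is a witness, because the numerator is at least one.
    arch : ∀ x → 0ℚ < x → ∃ λ n → 1ℚ ≤ ⟦ n ⟧ * x
    arch (mkℚ (ℤ.+ zero) d c) (*<* (ℤ.+<+ ()))
    arch (mkℚ (ℤ.-[1+ _ ]) d c) (*<* ())
    arch x@(mkℚ (ℤ.+ suc p) d c) _ = suc d , subst (λ z → 1ℚ ≤ z * x) (ℕ→ℚ≡⟦⟧ (suc d))
      (toℚᵘ-cancel-≤ (ℚᵘₚ.≤-respʳ-≃ (ℚᵘₚ.≃-sym (ℚᵘₚ.≃-trans (toℚᵘ-homo-* (ℕ→ℚ (suc d)) x) (ℚᵘₚ.*-congʳ {toℚᵘ x} (toℚᵘ-fromℚᵘ (ℚᵘ.mkℚᵘ (ℤ.+ suc d) 0)))))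
        (ℚᵘ.*≤* (ℤ.+≤+ (ℕₚ.≤-trans (ℕₚ.≤-reflexive (trans (ℕₚ.+-identityʳ _) (cong suc (ℕₚ.+-identityʳ d)))) (ℕₚ.≤-trans (ℕₚ.m≤m*n (suc d) (suc p)) (ℕₚ.≤-reflexive (sym (ℕₚ.*-identityʳ (suc d ℕ.* suc p))))))))))

    inv : ℕ → ℚ
    inv n = (1/ ⟦ suc n ⟧) ⦃ pos⇒nonZero ⟦ suc n ⟧ ⦃ positive (0<⟦suc⟧ n) ⦄ ⦄

    inv-* : ∀ n → inv n * ⟦ suc n ⟧ ≡ 1ℚ
    inv-* n = *-inverseˡ ⟦ suc n ⟧ ⦃ pos⇒nonZero ⟦ suc n ⟧ ⦃ positive (0<⟦suc⟧ n) ⦄ ⦄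

    0<inv : ∀ n → 0ℚ < inv n
    0<inv n = *-cancelˡ-<-nonNeg ⟦ suc n ⟧ ⦃ nonNegative (0≤⟦⟧ (suc n)) ⦄
      (subst₂ _<_ (sym (*-zeroʳ ⟦ suc n ⟧)) (trans (sym (inv-* n)) (*-comm (inv n) ⟦ suc n ⟧)) 0<1)

    inv≤ : ∀ n {x} → 1ℚ ≤ ⟦ suc n ⟧ * x → inv n ≤ x
    inv≤ n p = *-cancel-≤ (0<⟦suc⟧ n) (≤-trans (≤-reflexive (trans (*-comm ⟦ suc n ⟧ (inv n)) (inv-* n))) p)

    inv≤1 : ∀ n → inv n ≤ 1ℚ
    inv≤1 n = inv≤ n (≤-trans (lin≤ (0≤⟦⟧ n) (ring-1 ⟦ n ⟧)) (≤-reflexive (sym (*-identityʳ ⟦ suc n ⟧))))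

  abstract
    0<third : 0ℚ < third
    0<third = positive⁻¹ third
    0<half : 0ℚ < half
    0<half = positive⁻¹ half
    0<quarter : 0ℚ < quarter
    0<quarter = positive⁻¹ quarter
    half≤1 : half ≤ 1ℚ
    half≤1 = lin≤ (<⇒≤ 0<half) refl

  sumTo : ℕ → (ℕ → ℕ) → ℕ
  sumTo zero f = f 0
  sumTo (suc L) f = f (suc L) ℕ.+ sumTo L f

  ≤sumTo : ∀ {i} L f → i ℕ.≤ L → f i ℕ.≤ sumTo L f
  ≤sumTo zero f ℕ.z≤n = ℕₚ.≤-refl
  ≤sumTo {i} (suc L) f p with i ℕ.≟ suc L
  ... | yes refl = ℕₚ.m≤m+n (f (suc L)) (sumTo L f)
  ... | no ne = ℕₚ.≤-trans (≤sumTo L f (ℕₚ.≤-pred (ℕₚ.≤∧≢⇒< p ne))) (ℕₚ.m≤n+m (sumTo L f) (f (suc L)))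

  -- e = 1 / (12 q) and ea = 1 / q for q = suc q′.

  module Precision (q′ : ℕ) where

    Q : ℕ
    -- Here `suc Q` is four times `suc q′`, so that `e₀` is a quarter of `ea` and `eQ` holds for the
    -- third of `e₀`.
    Q = q′ ℕ.+ 3 ℕ.* suc q′

    e₀ e ea : ℚ
    e₀ = inv Q
    e = third * e₀
    -- Twelve times `e`: freeing this fraction of the knapsack pays 4 e for boxes and boundary and 3
    -- e for the leaves, with something left for strictness.
    ea = e₀ + e₀ + e₀ + e₀

    abstract
      0<e : 0ℚ < e
      0<e = 0<* 0<third (0<inv Q)
      e3 : e + e + e ≡ e₀
      e3 = ring-212 e₀
      eQ : (e + e + e) * ⟦ suc Q ⟧ ≡ 1ℚ
      eQ = trans (cong (_* ⟦ suc Q ⟧) e3) (inv-* Q)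
      e≤1 : e ≤ 1ℚ
      e≤1 = lin≤ (inv≤1 Q ⊕ <⇒≤ 0<e ⊕ <⇒≤ 0<e) (l e e₀ e3)
        where
        l : ∀ x y → x + x + x ≡ y → 1ℚ - x ≡ (1ℚ + (x + x)) - (y + (0ℚ + 0ℚ))
        l x y refl = ring-213 x
      0<ea : 0ℚ < ea
      0<ea = +-mono-< (+-mono-< (+-mono-< (0<inv Q) (0<inv Q)) (0<inv Q)) (0<inv Q)
      ea-* : ea * ⟦ suc q′ ⟧ ≡ 1ℚ
      ea-* = trans (ring-214 e₀ ⟦ suc q′ ⟧) (trans (cong (e₀ *_) (sym (trans (⟦⟧-+ (suc q′) (3 ℕ.* suc q′)) (cong (_+_ ⟦ suc q′ ⟧) (trans (⟦⟧-+ (suc q′) (2 ℕ.* suc q′)) (cong (_+_ ⟦ suc q′ ⟧) (trans (⟦⟧-+ (suc q′) (1 ℕ.* suc q′)) (cong (_+_ ⟦ suc q′ ⟧) (cong ⟦_⟧ (ℕₚ.*-identityˡ (suc q′))))))))))) (inv-* Q))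
      ea≤1 : ea ≤ 1ℚ
      ea≤1 = ≤-trans (lin≤ (0≤* (<⇒≤ 0<ea) (0≤⟦⟧ q′)) (ring-215 ea ⟦ q′ ⟧)) (≤-reflexive ea-*)
      ea≡12e : ea ≡ (e + e + e) + (e + e + e) + (e + e + e) + (e + e + e)
      ea≡12e = sym (cong₂ _+_ (cong₂ _+_ (cong₂ _+_ e3 e3) e3) e3)

    0≤e : 0ℚ ≤ e
    0≤e = <⇒≤ 0<e

    module Level (D′ : ℕ) where

      D T : ℕ
      D = suc D′
      -- The bound of `runs-≤` on the number of runs for a square knapsack with sides D d.
      T = 2 ℕ.* (D ℕ.* D)

      γ μ : ℚ
      γ = quarter * e
      abstract
        0<γ : 0ℚ < γ
        0<γ = 0<* 0<quarter 0<e
      n NB : ℕ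
      n = D ℕ.* proj₁ (arch γ 0<γ)
      NB = length (configs n D)
      -- `inv NB` is 1 / (NB + 1), so the widenings of at most `NB` blocks together with one further
      -- `μ` amount to `e * γ`.
      μ = e * γ * inv NB
      abstract
        0<μ : 0ℚ < μ
        0<μ = 0<* (0<* 0<e 0<γ) (0<inv NB)
      Cw : ℕ
      Cw = D ℕ.* proj₁ (arch μ 0<μ)

      abstract
        scale : ∀ m {x} → 1ℚ ≤ ⟦ m ⟧ * x → ⟦ D ⟧ ≤ ⟦ D ℕ.* m ⟧ * x
        scale m {x} p = subst₂ _≤_ (*-identityʳ ⟦ D ⟧) (trans (sym (*-assoc ⟦ D ⟧ ⟦ m ⟧ x)) (cong (_* x) (sym (⟦⟧-* D m)))) (0≤⟦⟧ D ⊛ p)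
        D≤n : ⟦ D ⟧ ≤ ⟦ n ⟧ * γ
        D≤n = scale (proj₁ (arch γ 0<γ)) (proj₂ (arch γ 0<γ))
        D≤Cw : ⟦ D ⟧ ≤ ⟦ Cw ⟧ * μ
        D≤Cw = scale (proj₁ (arch μ 0<μ)) (proj₂ (arch μ 0<μ))
        μ≤ : μ ≤ e * γ
        μ≤ = lin≤ (0≤* 0≤e (<⇒≤ 0<γ) ⊛ inv≤1 NB) (ring-205 (e * γ) (inv NB))
        small : ⟦ NB ⟧ * μ + γ + μ ≤ e
        small = ≤-trans (≤-reflexive (trans (ring-206 ⟦ NB ⟧ (e * γ) (inv NB) γ) (cong (λ z → e * γ * z + γ) (inv-* NB)))) (lin≤ ((<⇒≤ 0<γ ⊛ e≤1) ⊕ 0≤* (<⇒≤ 0<half) 0≤e) (ring-207 e))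

      -- The ratio of consecutive depths. With the denominator T D + 1, the T D copies of the
      -- smaller depth fit into `e` times the gap to the larger one, see `x-gap`.
      ρ : ℚ
      ρ = e * inv (T ℕ.* D)

      -- the peeling depths, relative to the knapsack
      x : ℕ → ℚ
      -- Half of d / N: since `κ` is at most `k₂`, this gives k₂ + κ ≤ d.
      x zero = half * inv D′
      x (suc i) = x i * ρ

      -- Chosen such that 2 D η is e times the depth, from which `η₁`, `η₂` and `η₃` follow at once.
      η : ℕ → ℚ
      η i = x i * (e * (half * inv D′))

      abstract
        0<ρ : 0ℚ < ρ
        0<ρ = 0<* 0<e (0<inv (T ℕ.* D))
        ρ≤1 : ρ ≤ 1ℚ
        ρ≤1 = ≤-trans (0≤e ⊛ inv≤1 (T ℕ.* D)) (≤-trans (≤-reflexive (*-identityʳ e)) e≤1)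
        0<x : ∀ i → 0ℚ < x i
        0<x zero = 0<* 0<half (0<inv D′)
        0<x (suc i) = 0<* (0<x i) 0<ρ
        x-step : ∀ i → x (suc i) ≤ x i
        x-step i = ≤-trans (<⇒≤ (0<x i) ⊛ ρ≤1) (≤-reflexive (*-identityʳ (x i)))
        x≤ : ∀ i → x i ≤ half * inv D′
        x≤ zero = ≤-refl
        x≤ (suc i) = ≤-trans (x-step i) (x≤ i)
        x-gap : ∀ i → ⟦ T ℕ.* D ⟧ * x (suc i) ≤ e * (x i - x (suc i))
        x-gap i = lin≤ (0≤* (<⇒≤ (0<x i)) (<⇒≤ 0<ρ) ⊛ e≤1)
          (trans (ring-208 (x i) e (inv (T ℕ.* D)) ⟦ T ℕ.* D ⟧) (trans (cong (λ z → (x i * ρ * 1ℚ - x i * ρ * e) + x i * (e - z)) e≡) (ring-209 (x i * ρ * 1ℚ - x i * ρ * e) (x i) e)))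
          where
          e≡ : e * (inv (T ℕ.* D) * (1ℚ + ⟦ T ℕ.* D ⟧)) ≡ e
          e≡ = trans (cong (e *_) (inv-* (T ℕ.* D))) (*-identityʳ e)
        0<η : ∀ i → 0ℚ < η i
        0<η i = 0<* (0<x i) (0<* 0<e (0<* 0<half (0<inv D′)))
        0<eη : ∀ i → 0ℚ < e * η i
        0<eη i = 0<* 0<e (0<η i)
        0<gap : ∀ i → 0ℚ < e * (x i - x (suc i))
        0<gap i = <-≤-trans (0<* {⟦ T ℕ.* D ⟧} (0<⟦suc⟧ (ℕ.pred (T ℕ.* D))) (0<x (suc i))) (x-gap i)

      m₁ m₂ : ℕ → ℕ
      m₁ i = proj₁ (arch (e * η i) (0<eη i))
      m₂ i = proj₁ (arch (e * (x i - x (suc i))) (0<gap i))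

      leafK dropBound : ℕ
      leafK = suc (suc (NB ℕ.* suc D ℕ.+ 3))
      dropBound = n ℕ.+ Cw

      KB kmax LV const : ℕ → ℕ
      KB i = suc ((2 ℕ.+ suc (m₁ i) ℕ.* 6) ℕ.+ (2 ℕ.+ (2 ℕ.+ suc (m₂ i) ℕ.* 6)))
      kmax i = T ℕ.* KB i ℕ.+ T ℕ.* 12
      LV i = kmax i ℕ.* leafK ℕ.+ 4
      -- One for the incomplete group of `drop-heavy`, D² for the items longer than `d` in both
      -- directions, and the additive losses of all boxes.
      const i = 1 ℕ.+ (D ℕ.* D ℕ.+ kmax i ℕ.* dropBound)

      -- Free leaves thinner than ζ N may be wasted: the number of leaves times `ζ` is at most `e`,
      -- for each of the depths that may be chosen at this scale.
      ζ : ℚ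
      ζ = e * inv (sumTo q′ LV)

      abstract
        0<ζ : 0ℚ < ζ
        0<ζ = 0<* 0<e (0<inv (sumTo q′ LV))
        LV*ζ : ∀ {i} → i ℕ.≤ q′ → ⟦ LV i ⟧ * ζ ≤ e
        LV*ζ {i} i≤ = ≤-trans (lin≤ (<⇒≤ 0<ζ ⊛ ≤-trans (⟦⟧-mono (≤sumTo q′ LV i≤)) (⟦⟧-mono (ℕₚ.n≤1+n (sumTo q′ LV)))) (ring-210 ζ ⟦ LV i ⟧ ⟦ suc (sumTo q′ LV) ⟧))
                 (≤-reflexive (trans (*-assoc e (inv (sumTo q′ LV)) ⟦ suc (sumTo q′ LV) ⟧) (trans (cong (e *_) (inv-* (sumTo q′ LV))) (*-identityʳ e))))
        0<eaζ : 0ℚ < ea * ζ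
        0<eaζ = 0<* 0<ea 0<ζ

      -- The next scale depends on the number of leaves at this one: items below it must be small in
      -- comparison with every free leaf that is not thinner than ζ N.
      nextD′ : ℕ
      nextD′ = D′ ℕ.+ proj₁ (arch (ea * ζ) 0<eaζ)

      abstract
        next≤ : inv nextD′ ≤ ea * ζ
        next≤ = inv≤ nextD′ (≤-trans (proj₂ (arch (ea * ζ) 0<eaζ)) (lin≤ (<⇒≤ 0<eaζ ⊛ ⟦⟧-mono (ℕₚ.≤-trans (ℕₚ.m≤n+m (proj₁ (arch (ea * ζ) 0<eaζ)) D′) (ℕₚ.n≤1+n nextD′))) (ring-211 (ea * ζ) ⟦ proj₁ (arch (ea * ζ) 0<eaζ) ⟧ ⟦ suc nextD′ ⟧)))

      module Scaled {N : ℚ} (0<N : 0ℚ < N) (i : ℕ) where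

        d k₁ k₂ κ : ℚ
        d = N * inv D′
        k₁ = N * x (suc i)
        k₂ = N * x i
        κ = e * (k₂ - k₁)

        abstract
          0≤N : 0ℚ ≤ N
          0≤N = <⇒≤ 0<N
          0<d : 0ℚ < d
          0<d = 0<* 0<N (0<inv D′)
          D*d : ⟦ D ⟧ * d ≡ N
          D*d = trans (ring-197 ⟦ D ⟧ N (inv D′)) (trans (cong (N *_) (inv-* D′)) (*-identityʳ N))
          N≤ : N ≤ ⟦ D ⟧ * d
          N≤ = ≤-reflexive (sym D*d)
          0≤k₁ : 0ℚ ≤ k₁
          0≤k₁ = 0≤* 0≤N (<⇒≤ (0<x (suc i)))
          k₁≤k₂ : k₁ ≤ k₂
          k₁≤k₂ = 0≤N ⊛ x-step i
          κ≤k₂ : κ ≤ k₂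
          κ≤k₂ = lin≤ ((≤⇒0≤ k₁≤k₂ ⊛ e≤1) ⊕ 0≤k₁) (ring-198 e k₁ k₂)
          2k₂≤d : k₂ + k₂ ≤ d
          2k₂≤d = lin≤ ((0≤N ⊛ x≤ i) ⊕ (0≤N ⊛ x≤ i)) (ring-199 N (inv D′) (x i))
          k₂+κ≤d : k₂ + κ ≤ d
          k₂+κ≤d = ≤-trans (≤-refl {k₂} ⊕ κ≤k₂) 2k₂≤d
          d≤N : d ≤ N
          d≤N = ≤-trans (0≤N ⊛ inv≤1 D′) (≤-reflexive (*-identityʳ N))
          κ≤N : κ + κ ≤ N
          κ≤N = ≤-trans (κ≤k₂ ⊕ κ≤k₂) (≤-trans 2k₂≤d d≤N)
          κ≤e : κ ≤ e * N
          κ≤e = 0≤e ⊛ lin≤ (2k₂≤d ⊕ d≤N ⊕ 0≤k₁ ⊕ ≤-trans 0≤k₁ k₁≤k₂) (ring-200 k₁ k₂ N d)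
          Dη : ⟦ D ⟧ * η i + ⟦ D ⟧ * η i ≡ x i * e
          Dη = trans (ring-201 ⟦ D ⟧ (x i) e (inv D′)) (trans (cong (x i * e *_) (inv-* D′)) (*-identityʳ (x i * e)))
          xe≤x : x i * e ≤ x i
          xe≤x = ≤-trans (<⇒≤ (0<x i) ⊛ e≤1) (≤-reflexive (*-identityʳ (x i)))
          x≤1 : x i ≤ 1ℚ
          x≤1 = ≤-trans (x≤ i) (≤-trans (<⇒≤ 0<half ⊛ inv≤1 D′) (≤-trans (≤-reflexive (*-identityʳ half)) half≤1))
          η₁ : ⟦ D ⟧ * η i + ⟦ D ⟧ * η i ≤ 1ℚ
          η₁ = ≤-trans (≤-reflexive Dη) (≤-trans xe≤x x≤1)
          η₂ : (⟦ D ⟧ * η i + ⟦ D ⟧ * η i) * N ≤ k₂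
          η₂ = ≤-trans (≤-reflexive (trans (cong (_* N) Dη) (*-comm (x i * e) N))) (0≤N ⊛ xe≤x)
          η₃ : ⟦ D ⟧ * η i ≤ e
          η₃ = lin≤ ((0≤e ⊛ x≤1) ⊕ ≤-reflexive Dη ⊕ 0≤* (0≤⟦⟧ D) (<⇒≤ (0<η i))) (ring-202 e (x i) (⟦ D ⟧ * η i))
          hm₁ : 1ℚ ≤ ⟦ m₁ i ⟧ * (e * η i)
          hm₁ = proj₂ (arch (e * η i) (0<eη i))
          hm₂ : N ≤ ⟦ m₂ i ⟧ * (e * (k₂ - k₁))
          hm₂ = lin≤ (0≤N ⊛ proj₂ (arch (e * (x i - x (suc i))) (0<gap i))) (ring-203 N ⟦ m₂ i ⟧ e (x i) (x (suc i)))
          Tk₁ : ⟦ T ⟧ * (⟦ D ⟧ * k₁) ≤ κ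
          Tk₁ = lin≤ (0≤N ⊛ x-gap i) (trans (ring-204 N ⟦ T ⟧ ⟦ D ⟧ e (x i) (x (suc i))) (cong (λ z → N * (e * (x i - x (suc i))) - N * (z * x (suc i))) (sym (⟦⟧-* T D))))

    dseq : ℕ → ℕ
    -- The first `d` is N / 2; a positive start is needed for d < N, so that the whole knapsack can
    -- be a run.
    dseq zero = 1
    dseq (suc j) = Level.nextD′ (dseq j)

    -- `Kmax` is the number of items from which every additive constant is at most the fraction `ea`
    -- of them, for all scales and depths that averaging may select. Both depend on `q′` only, since
    -- the constants are relative to the knapsack.
    Kmax LVmax : ℕ
    Kmax = sumTo q′ λ j → sumTo q′ λ i → suc q′ ℕ.* Level.const (dseq j) i
    LVmax = sumTo q′ λ j → sumTo q′ (Level.LV (dseq j))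

  abstract
    precision : ∀ ε → 0ℚ < ε → ∃ λ q′ → Precision.ea q′ ≤ ε
    precision ε 0<ε = q′ , *-cancel-≤ {⟦ suc q′ ⟧} (0<⟦suc⟧ q′) (≤-trans (≤-reflexive (trans (*-comm ⟦ suc q′ ⟧ (Precision.ea q′)) (Precision.ea-* q′)))
        (≤-trans (proj₂ (arch ε 0<ε)) (lin≤ (<⇒≤ 0<ε ⊛ ⟦⟧-mono (ℕₚ.n≤1+n q′)) (ring-211 ε ⟦ q′ ⟧ ⟦ suc q′ ⟧))))
      where
      q′ : ℕ
      q′ = proj₁ (arch ε 0<ε)

-- Keeping three quarters of the tall and wide items

module StripSelection where

  open Packings
  open Counting
  open ContainerTrees
  open SizeClasses
  open TallBoxes
  open PeelingRuns
  open DecoratedRuns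
  open WithoutCorner
  open BoundaryL
  open FourCandidates
  open SmallItems
  open DepthAveraging
  open Constants

  module _ {Item : Set} where

    gg-transpose : ∀ {w h : Item → ℚ} {d k₁ k₂ η a b a′ b′} f (D : Deco w h d k₁ k₂ η a b a′ b′) → gg f (transposeD D) ≡ gg f D
    gg-transpose f D = trans (cong₂ _+_ (cong (sum f) (vI-transposeS (Deco.G D))) (cong (sum f) (hI-transposeS (Deco.G D)))) (+-comm (sum f (hI (Deco.G D))) (sum f (vI (Deco.G D))))

    total-gg≥0 : ∀ {w h : Item → ℚ} {d k₁ k₂ η a b f} → (∀ i → 0ℚ ≤ f i) → (R : DRun w h d k₁ k₂ η a b) → 0ℚ ≤ total gg f R
    total-gg≥0 {f = f} p R = ≤-trans (sum-nonneg p (collect ggL R)) (≤-reflexive (sum-collect ggL gg (λ f D → sum-++ f (vI (Deco.G D)) (hI (Deco.G D))) f R))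

    module _ {w h : Item → ℚ} {d : ℚ} {f : Item → ℚ} (0≤f : ∀ i → 0ℚ ≤ f i) where

      pre≤ : ∀ {a b a′ b′} kx ky (s : Peels w h d a b a′ b′) → sum f (preItems kx ky s) ≤ sum f (vI s) + sum f (hI s)
      pre≤ kx ky [] = ≤-refl
      pre≤ kx ky (pv {c = c} {S = S} _ _ _ _ t) with c ≤? kx
      ... | no _ = 0≤+ (sum-nonneg 0≤f (S ++ vI t)) (sum-nonneg 0≤f (hI t))
      ... | yes _ = ≤-trans (≤-reflexive (sum-++ f S _)) (≤-trans (≤-refl {sum f S} ⊕ pre≤ (kx - c) ky t)
                      (≤-reflexive (trans (sym (+-assoc (sum f S) (sum f (vI t)) (sum f (hI t)))) (cong (_+ sum f (hI t)) (sym (sum-++ f S (vI t)))))))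
      pre≤ kx ky (ph {c = c} {S = S} _ _ _ _ t) with c ≤? ky
      ... | no _ = 0≤+ (sum-nonneg 0≤f (vI t)) (sum-nonneg 0≤f (S ++ hI t))
      ... | yes _ = ≤-trans (≤-reflexive (sum-++ f S _)) (≤-trans (≤-refl {sum f S} ⊕ pre≤ kx (ky - c) t)
                      (≤-reflexive (trans (ring-2 (sum f S) (sum f (vI t)) (sum f (hI t))) (cong (_+_ (sum f (vI t))) (sym (sum-++ f S (hI t)))))))

      mutual
        depth≤ : ∀ {a b} k (R : Run w h d a b) → depthCount f k R ≤ sum f (items R)
        depth≤ k (run _ _ s E) = ≤-trans (pre≤ k k s ⊕ depthE≤ k E) (≤-reflexive (sym (trans (sum-++ f (vI s ++ hI s) (itemsE E)) (cong (_+ sum f (itemsE E)) (sum-++ f (vI s) (hI s))))))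
        depthE≤ : ∀ {a b} k (E : End w h d a b) → depthCountE f k E ≤ sum f (itemsE E)
        depthE≤ k (term _ _) = ≤-refl
        depthE≤ k (vbr _ p q) = ≤-trans (depth≤ k p ⊕ depth≤ k q) (≤-reflexive (sym (sum-++ f (items p) (items q))))
        depthE≤ k (hbr _ p q) = ≤-trans (depth≤ k p ⊕ depth≤ k q) (≤-reflexive (sym (sum-++ f (items p) (items q))))

      mutual
        depth≥0 : ∀ {a b} k (R : Run w h d a b) → 0ℚ ≤ depthCount f k R
        depth≥0 k (run _ _ s E) = 0≤+ (sum-nonneg 0≤f (preItems k k s)) (depthE≥0 k E)
        depthE≥0 : ∀ {a b} k (E : End w h d a b) → 0ℚ ≤ depthCountE f k E
        depthE≥0 k (term _ _) = ≤-refl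
        depthE≥0 k (vbr _ p q) = 0≤+ (depth≥0 k p) (depth≥0 k q)
        depthE≥0 k (hbr _ p q) = 0≤+ (depth≥0 k p) (depth≥0 k q)

  abstract
    inv-anti : ∀ {m n} → m ℕ.≤ n → inv n ≤ inv m
    inv-anti {m} {n} p = inv≤ n (≤-trans (≤-reflexive (sym (inv-* m))) (lin≤ (<⇒≤ (0<inv m) ⊛ ⟦⟧-mono (ℕ.s≤s p)) (ring-223 (inv m) ⟦ suc m ⟧ ⟦ suc n ⟧)))

    inv1≤half : inv 1 ≤ half
    inv1≤half = inv≤ 1 ≤-refl

    next-mono : ∀ q′ D′ → D′ ℕ.≤ Precision.Level.nextD′ q′ D′
    next-mono q′ D′ = ℕₚ.m≤m+n D′ _

    1≤dseq : ∀ q′ j → 1 ℕ.≤ Precision.dseq q′ j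
    1≤dseq q′ zero = ℕₚ.≤-refl
    1≤dseq q′ (suc j) = ℕₚ.≤-trans (1≤dseq q′ j) (next-mono q′ (Precision.dseq q′ j))

  module Core {Item : Set} (_≟I_ : DecidableEquality Item) (w h : Item → ℚ) (w>0 : ∀ i → 0ℚ < w i) (h>0 : ∀ i → 0ℚ < h i) (q′ : ℕ) {N : ℚ} (0<N : 0ℚ < N) where

    open Precision q′
    open DecM _≟I_ using (_∈?_)
    open Classes _≟I_ w h w>0 h>0 using (Once)

    area : Item → ℚ
    area i = w i * h i
    0≤area : ∀ i → 0ℚ ≤ area i
    0≤area i = 0≤* (<⇒≤ (w>0 i)) (<⇒≤ (h>0 i))

    unit : Item → ℚ
    unit _ = 1ℚ

    abstract
      ea-bound : ∀ {x y} → ⟦ suc q′ ⟧ * x ≤ y → x ≤ ea * y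
      ea-bound {x} {y} p = ≤-trans (≤-reflexive (trans (sym (*-identityˡ x)) (trans (cong (_* x) (sym ea-*)) (*-assoc ea ⟦ suc q′ ⟧ x)))) (<⇒≤ 0<ea ⊛ p)

      3e≤ea : e + e + e ≤ ea
      3e≤ea = ≤-trans (≤-reflexive e3) (lin≤ (0≤+ (0≤+ (<⇒≤ (0<inv Q)) (<⇒≤ (0<inv Q))) (<⇒≤ (0<inv Q))) (ring-222 e₀))

    module AtLevel (D′ : ℕ) (1≤D′ : 1 ℕ.≤ D′) where

      open Level D′

      d : ℚ
      d = N * inv D′

      bp : BoxParams
      bp = record { D = D ; n = n ; Q = Q ; Cw = Cw ; e = e ; γ = γ ; μ = μ ; 0<e = 0<e ; 0<γ = 0<γ ; 0<μ = 0<μ ; eQ = eQ ; μ≤ = μ≤ ; D≤n = D≤n ; D≤Cw = D≤Cw ; small = small }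

      abstract
        0<d′ : 0ℚ < d
        0<d′ = Scaled.0<d 0<N 0
        d<N : d < N
        d<N = lin< (+-mono-<-≤ (0<* 0<N 0<half) (<⇒≤ 0<N ⊛ ≤-trans (inv-anti 1≤D′) inv1≤half)) (ring-221 N (inv D′))

      record Kept (S : List Item) (i : ℕ) : Set where
        field
          K Dp L C : List Item
          {a′ b′} : ℚ
          splitS : Split S K Dp
          splitK : Split K L C
          nestL  : LNest w h N N N a′ b′ L
          0≤a′   : 0ℚ ≤ a′
          0≤b′   : 0ℚ ≤ b′
          tree   : CTree ea w h a′ b′ C
          lost≤  : card Dp ≤ (quarter + ea + ea) * card S + ⟦ kmax i ℕ.* dropBound ⟧
          lv≤    : leaves tree ℕ.≤ LV i
          us≤    : used tree + (N * N - a′ * b′) ≤ sum area S + (e + e + e + e) * (N * N)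

      module Strips {S : List Item} (once : Once S) (pk : Pack w h N N S) (R : Run w h d N N) (sumsR : ∀ f → sum f S ≡ sum f (items R)) where

        abstract
          -- With N = D d, `runs-≤` bounds d² (runs + 1) by 2 D² d².
          runs≤T : runs R ℕ.≤ T
          runs≤T = ⟦⟧-cancel (<-≤-trans (lin< 0<1 (ring-219 ⟦ runs R ⟧)) (≤-trans (*-cancel-≤ (0<* 0<d′ 0<d′) (≤-trans (runs-≤ 0<d′ R) (≤-reflexive eq))) (⟦⟧-mono (ℕₚ.n≤1+n T))))
            where
            eq : (1ℚ + 1ℚ) * (N * N) ≡ d * d * ⟦ T ⟧
            eq = trans (cong (λ z → (1ℚ + 1ℚ) * (z * z)) (sym (Scaled.D*d 0<N 0))) (trans (ring-220 ⟦ D ⟧ d) (cong (d * d *_) (sym (trans (⟦⟧-* 2 (D ℕ.* D)) (cong (⟦ 2 ⟧ *_) (⟦⟧-* D D))))))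

        module Depth (i : ℕ) (small-gg : depthCount unit (N * x i) R - depthCount unit (N * x (suc i)) R ≤ ea * card S) where

          open Scaled 0<N i hiding (d)

          0≤η : 0ℚ ≤ η i
          0≤η = <⇒≤ (0<η i)

          dp : DepthParams bp
          dp = record
            { d = d ; N = N ; k₁ = k₁ ; k₂ = k₂ ; η = η i ; κ = κ ; m₁ = m₁ i ; m₂ = m₂ i ; T = T ; 0<d = 0<d ; N≤ = N≤ ; 0≤N = 0≤N ; e≤1 = e≤1
            ; 0≤k₁ = 0≤k₁ ; k₁≤k₂ = k₁≤k₂ ; 0≤η = 0≤η ; κ≡ = refl ; k₂+κ≤d = k₂+κ≤d ; η₁ = η₁ ; η₂ = η₂ ; η₃ = η₃ ; hm₁ = hm₁ ; hm₂ = hm₂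
            ; Tk₁ = Tk₁ ; κ≤N = κ≤N ; κ≤e = κ≤e }

          open Candidates _≟I_ ea bp dp
            hiding (leafK; 0≤e)

          Rd : DRun w h d k₁ k₂ (η i) N N
          Rd = Decorate.decorate 0≤k₁ k₁≤k₂ 0≤η R

          Rt : DRun h w d k₁ k₂ (η i) N N
          Rt = transposeDR Rd

          abstract
            r≤ : druns Rd ℕ.≤ T
            r≤ = ℕₚ.≤-trans (ℕₚ.≤-reflexive (Decorate.druns≡ 0≤k₁ k₁≤k₂ 0≤η R)) runs≤T
            rt≤ : druns Rt ℕ.≤ T
            rt≤ = ℕₚ.≤-trans (ℕₚ.≤-reflexive (druns-transpose Rd)) r≤
            sums : ∀ f → sum f S ≡ total vc f Rd + (total vr f Rd + (total hc f Rd + (total hr f Rd + total gg f Rd)))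
            sums f = trans (sumsR f) (Decorate.totals 0≤k₁ k₁≤k₂ 0≤η f R)
            tvc : ∀ f → total vc f Rt ≡ total hc f Rd
            tvc f = total-transpose vc hc vc-transpose f Rd
            thc : ∀ f → total hc f Rt ≡ total vc f Rd
            thc f = total-transpose hc vc hc-transpose f Rd
            tvr : ∀ f → total vr f Rt ≡ total hr f Rd
            tvr f = total-transpose vr hr vr-transpose f Rd
            thr : ∀ f → total hr f Rt ≡ total vr f Rd
            thr f = total-transpose hr vr hr-transpose f Rd
            tgg : ∀ f → total gg f Rt ≡ total gg f Rd
            tgg f = total-transpose gg gg gg-transpose f Rd
            sumsT : ∀ f → sum f S ≡ total vc f Rt + (total vr f Rt + (total hc f Rt + (total hr f Rt + total gg f Rt)))
            sumsT f = trans (sums f) (trans (ring-217 (total vc f Rd) (total vr f Rd) (total hc f Rd) (total hr f Rd) (total gg f Rd))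
                (sym (cong₂ _+_ (tvc f) (cong₂ _+_ (tvr f) (cong₂ _+_ (thc f) (cong₂ _+_ (thr f) (tgg f)))))))
            gg≤ : total gg unit Rd ≤ ea * card S
            gg≤ = ≤-trans (≤-reflexive (ggTotal 0≤k₁ k₁≤k₂ 0≤η unit R)) small-gg
            ggt≤ : total gg unit Rt ≤ ea * card S
            ggt≤ = ≤-trans (≤-reflexive (tgg unit)) gg≤

          keep : ∀ {x g k} → Cand w h S (x + g) k → k ℕ.≤ kmax i → g ≤ ea * card S → x ≤ quarter * card S → Kept S i
          keep {x} {g} {k} c k≤ g≤ x≤ = record
            { K = Cand.K c ; Dp = Cand.Dp c ; L = Cand.L c ; C = Cand.C c ; splitS = Cand.splitS c ; splitK = Cand.splitK c
            ; nestL = Cand.nestL c ; 0≤a′ = Cand.0≤a′ c ; 0≤b′ = Cand.0≤b′ c ; tree = Cand.tree c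
            -- The quarter is the dropped class; one `ea` is for the strips of the dropped depth
            -- range and one for the 3 e lost in the boxes.
            ; lost≤ = ≤-trans (Cand.lost≤ c) (lin≤ (x≤ ⊕ g≤ ⊕ (card-nonneg S ⊛ 3e≤ea) ⊕ ⟦⟧-mono (ℕₚ.*-monoˡ-≤ dropBound k≤)) (ring-218 x g (e + e + e) ea (card S) ⟦ k ℕ.* dropBound ⟧ ⟦ kmax i ℕ.* dropBound ⟧))
            ; lv≤ = ℕₚ.≤-trans (Cand.lv≤ c) (ℕₚ.+-monoˡ-≤ 4 (ℕₚ.*-monoˡ-≤ leafK k≤))
            ; us≤ = Cand.us≤ c }

          kB≤ : T ℕ.* KB i ℕ.≤ kmax i
          kB≤ = ℕₚ.m≤m+n (T ℕ.* KB i) (T ℕ.* 12)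
          kA≤ : T ℕ.* 12 ℕ.≤ kmax i
          kA≤ = ℕₚ.m≤n+m (T ℕ.* 12) (T ℕ.* KB i)

          -- If three of the four classes contain more than a quarter of the items each, the fourth
          -- does not. Two candidates serve the four cases, as transposition exchanges tall with
          -- wide.
          kept : Kept S i
          kept with total vc unit Rd ≤? quarter * card S | total hc unit Rd ≤? quarter * card S | total vr unit Rd ≤? quarter * card S
          ... | yes p | _ | _ = keep (candB w h w>0 h>0 S once pk Rd sums r≤) kB≤ gg≤ p
          ... | no _ | yes p | _ = keep (transposeCand (candB h w h>0 w>0 S once (transposeP pk) Rt sumsT rt≤)) kB≤ ggt≤ (≤-trans (≤-reflexive (tvc unit)) p)
          ... | no _ | no _ | yes p = keep (transposeCand (CandA.candA h w h>0 w>0 S once (transposeP pk) Rt sumsT rt≤)) kA≤ ggt≤ (≤-trans (≤-reflexive (thr unit)) p)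
          ... | no a | no b | no c = keep (CandA.candA w h w>0 h>0 S once pk Rd sums r≤) kA≤ gg≤ hr≤
            where
            abstract
              l : ∀ a b c d g s → s ≡ a + (b + (c + (d + g))) → quarter * s - d ≡ (a + (b + (c + g))) - (quarter * s + (quarter * s + (quarter * s + 0ℚ)))
              l a b c d g _ refl = ring-216 a b c d g
              hr≤ : total hr unit Rd ≤ quarter * card S
              hr≤ = lin≤ (<⇒≤ (≰⇒> a) ⊕ <⇒≤ (≰⇒> c) ⊕ <⇒≤ (≰⇒> b) ⊕ total-gg≥0 (λ _ → 0≤1) Rd)
                      (l (total vc unit Rd) (total vr unit Rd) (total hc unit Rd) (total hr unit Rd) (total gg unit Rd) (card S) (sums unit))

        -- Among `suc q′` consecutive pairs of depths, `smallStep` finds one between which at most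
        -- the fraction `ea` of the items lies.
        keptStrips : ∃ λ i → i ℕ.≤ q′ × Kept S i
        keptStrips = let (i , i≤ , le) = smallStep q′ (λ i → depthCount unit (N * x i) R) (depth≥0 (λ _ → 0≤1) (N * x (suc q′)) R)
                     in i , i≤ , Depth.kept i (ea-bound (≤-trans le (≤-trans (depth≤ (λ _ → 0≤1) (N * x 0) R) (≤-reflexive (sym (sumsR unit))))))

-- Instances with many items: choice of the scale and return of the small items

module ManyItems where

  open Packings
  open Counting
  open ContainerTrees
  open SizeClasses
  open PeelingRuns
  open DecoratedRuns
  open BoundaryL
  open FourCandidates
  open SmallItems
  open DepthAveraging
  open Constants
  open StripSelection

  module Core₂ {Item : Set} (_≟I_ : DecidableEquality Item) (w h : Item → ℚ) (w>0 : ∀ i → 0ℚ < w i) (h>0 : ∀ i → 0ℚ < h i) (q′ : ℕ) {N : ℚ} (0<N : 0ℚ < N) where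

    open Precision q′
    open Core _≟I_ w h w>0 h>0 q′ 0<N
    open DecM _≟I_ using (_∈?_)
    open Classes _≟I_ w h w>0 h>0 using (Once; once-disjoint; once-subˡ)

    Small : ℕ → Item → Set
    Small D′ i = w i ≤ N * inv D′ × h i ≤ N * inv D′
    Small? : ∀ D′ i → Dec (Small D′ i)
    Small? D′ i = (w i ≤? (N * inv D′)) ×-dec (h i ≤? (N * inv D′))

    record Out (S : List Item) (slack : ℚ) : Set where
      field
        L C : List Item
        {a′ b′} : ℚ
        nestL : LNest w h N N N a′ b′ L
        0≤a′  : 0ℚ ≤ a′
        0≤b′  : 0ℚ ≤ b′
        tree  : CTree ea w h a′ b′ C
        lv≤   : leaves tree ℕ.≤ LVmax
        once  : Once (L ++ C)
        count : card S ≤ card (L ++ C) + slack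

    module Classify (D′ : ℕ) (1≤D′ : 1 ℕ.≤ D′) {S : List Item} (once : Once S) (pk : Pack w h N N S)
      (area≤′ : sum area S ≤ N * N - ea * (N * N)) where

      open Level D′
      open AtLevel D′ 1≤D′

      private
        NN = N * N

      VH? : ∀ i → Dec (VorH {w = w} {h} (<⇒≤ 0<d′) i)
      VH? = VorH? (<⇒≤ 0<d′)

      M X mid Y VH big : List Item
      M = filter (Small? nextD′) S
      X = filter (¬? ∘ Small? nextD′) S
      mid = filter (Small? D′) X
      Y = filter (¬? ∘ Small? D′) X
      VH = filter VH? Y
      big = filter (¬? ∘ VH?) Y

      abstract
        parts : ∀ f → sum f S ≡ sum f M + (sum f mid + (sum f VH + sum f big))
        parts f = trans (split-partition (Small? nextD′) S f) (cong (_+_ (sum f M)) (trans (split-partition (Small? D′) X f) (cong (_+_ (sum f mid)) (split-partition VH? Y f))))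

        -- As a difference of two counts of small items, so that `smallStep` can select a scale with
        -- few items of medium size.
        mid≡ : card mid ≡ card (filter (Small? D′) S) - card M
        mid≡ = sym (trans (cong (_- card M) (trans (split-filter (Small? D′) {S} {M} {X} (split-partition (Small? nextD′) S) unit) (cong (_+ card mid) (cong card (Listₚ.filter-all (Small? D′) M⊆))))) (ring-182 (card M) (card mid)))
          where
          p≤d : N * inv nextD′ ≤ N * inv D′
          p≤d = <⇒≤ 0<N ⊛ inv-anti (next-mono q′ D′)
          M⊆ : All (Small D′) M
          M⊆ = All.map (λ (p , q) → ≤-trans p p≤d , ≤-trans q p≤d) (Allₚ.all-filter (Small? nextD′) S)

        bigs : All (λ i → d < w i × d < h i) big
        bigs = All.map conv (All.zip (Allₚ.filter⁺ (¬? ∘ VH?) (Allₚ.all-filter (¬? ∘ Small? D′) X) , Allₚ.all-filter (¬? ∘ VH?) Y))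
          where
          conv : ∀ {i} → (¬ Small D′ i) × (¬ VorH {w = w} {h} (<⇒≤ 0<d′) i) → d < w i × d < h i
          conv {i} (p , q) with d <? w i | d <? h i
          ... | yes a | yes b = a , b
          ... | yes a | no b = ⊥-elim (q (inj₂ (a , ≮⇒≥ b)))
          ... | no a | yes b = ⊥-elim (q (inj₁ (b , ≮⇒≥ a)))
          ... | no a | no b = ⊥-elim (p (≮⇒≥ a , ≮⇒≥ b))

        area-parts : sum area M + sum area VH ≤ NN - ea * NN
        area-parts = ≤-trans (lin≤ (sum-nonneg 0≤area mid ⊕ sum-nonneg 0≤area big) (trans (cong (_- (sum area M + sum area VH)) (parts area)) (ring-230 (sum area M) (sum area mid) (sum area VH) (sum area big)))) area≤′

        big≤ : card big ≤ ⟦ D ℕ.* D ⟧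
        big≤ = *-cancel-≤ (0<* 0<d′ 0<d′) (≤-trans (≤-reflexive (sym (sum-scale (d * d) unit big)))
            (≤-trans (sum-mono big (All.map (λ {i} (p , q) → lin≤ ((<⇒≤ 0<d′ ⊛ <⇒≤ p) ⊕ (<⇒≤ (w>0 i) ⊛ <⇒≤ q)) (ring-231 d (w i) (h i))) bigs))
            (≤-trans (lin≤ (sum-nonneg 0≤area M ⊕ sum-nonneg 0≤area mid ⊕ sum-nonneg 0≤area VH) (trans (cong (_- sum area big) (parts area)) (ring-232 (sum area M) (sum area mid) (sum area VH) (sum area big))))
            (≤-trans (area≤ w>0 h>0 (<⇒≤ 0<N) (<⇒≤ 0<N) pk) (≤-reflexive (trans (cong (λ z → z * z) (sym (Scaled.D*d 0<N 0))) (trans (ring-233 ⟦ D ⟧ d) (cong (d * d *_) (sym (⟦⟧-* D D))))))))))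

      strips : ∃ λ i → i ℕ.≤ q′ × Kept VH i
      strips = let (R , eq) = build (<⇒≤ 0<d′) d<N d<N pkVH (Allₚ.all-filter VH? Y)
               in Strips.keptStrips (once-subˡ {S} {VH} {M ++ (mid ++ big)} (λ f → trans (parts f) (trans (ring-234 (sum f M) (sum f mid) (sum f VH) (sum f big)) (cong (_+_ (sum f VH)) (sym (trans (sum-++ f M (mid ++ big)) (cong (_+_ (sum f M)) (sum-++ f mid big))))))) once) pkVH R eq
        where
        pkVH : Pack w h N N VH
        pkVH = restrictP VH? (restrictP (¬? ∘ Small? D′) (restrictP (¬? ∘ Small? nextD′) pk))

      module Finish (i : ℕ) (i≤ : i ℕ.≤ q′) (LV≤ : LV i ℕ.≤ LVmax) (kp : Kept VH i) where

        open Kept kp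

        z p : ℚ
        z = N * ζ
        p = N * inv nextD′

        abstract
          p≤z : p ≤ ea * z
          p≤z = ≤-trans (<⇒≤ 0<N ⊛ next≤) (≤-reflexive (ring-225 N ea ζ))
          0≤p : 0ℚ ≤ p
          0≤p = <⇒≤ (0<* 0<N (0<inv nextD′))

        open NFDH _≟I_ w h w>0 h>0 using (module FillM)
        open FillM ea p z N 0<ea ea≤1 0≤p p≤z (<⇒≤ 0<N) using (fillAll; loss)

        abstract
          0≤NN : 0ℚ ≤ NN
          0≤NN = 0≤* (<⇒≤ 0<N) (<⇒≤ 0<N)
          loss≤ : ⟦ leaves tree ⟧ * loss ≤ (e + e + e) * NN
          loss≤ = lin≤ ((0≤* (0≤+ (0≤+ 0≤NN 0≤NN) 0≤NN) (<⇒≤ 0<ζ) ⊛ ⟦⟧-mono lv≤) ⊕ (0≤+ (0≤+ 0≤NN 0≤NN) 0≤NN ⊛ LV*ζ i≤)) (ring-226 ⟦ leaves tree ⟧ ⟦ LV i ⟧ N ζ e)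
          -- The free fraction 12 e covers the 4 e of boxes and boundary and the 3 e of the leaves.
          -- Of the remaining five, one makes the inequality strict.
          room : sum area M + ⟦ leaves tree ⟧ * loss < a′ * b′ - used tree
          room = lin< (+-mono-<-≤ (0<* 0<e (0<* 0<N 0<N)) (us≤ ⊕ area-parts ⊕ loss≤ ⊕ (0≤e ⊛ 0≤NN) ⊕ (0≤e ⊛ 0≤NN) ⊕ (0≤e ⊛ 0≤NN) ⊕ (0≤e ⊛ 0≤NN)))
                   (trans (ring-227 (sum area M) (⟦ leaves tree ⟧ * loss) (a′ * b′) (used tree) (sum area VH) NN e) (cong (λ u → (e * NN + ((sum area VH + (e + e + e + e) * NN) + ((NN - u * NN) + ((e + e + e) * NN + (e * NN + (e * NN + (e * NN + e * NN))))))) - (0ℚ + ((used tree + (NN - a′ * b′)) + ((sum area M + sum area VH) + (⟦ leaves tree ⟧ * loss + (e * 0ℚ + (e * 0ℚ + (e * 0ℚ + e * 0ℚ)))))))) (sym ea≡12e)))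

        filled : ∃ λ C′ → Split C′ C M × Σ (CTree ea w h a′ b′ C′) λ T′ → leaves T′ ≡ leaves tree
        filled = fillAll tree 0≤a′ 0≤b′ (proj₁ (nest-≤ w>0 h>0 nestL)) (proj₂ (nest-≤ w>0 h>0 nestL)) M (Allₚ.all-filter (Small? nextD′) S) room

        C′ : List Item
        C′ = proj₁ filled

        abstract
          whole : Split S (L ++ C′) (mid ++ (Dp ++ big))
          whole f = trans (parts f) (trans (cong (λ z → sum f M + (sum f mid + (z + sum f big))) (trans (splitS f) (cong (_+ sum f Dp) (splitK f))))
            (trans (ring-228 (sum f M) (sum f mid) (sum f L) (sum f C) (sum f Dp) (sum f big))
              (sym (cong₂ _+_ (trans (sum-++ f L C′) (cong (_+_ (sum f L)) (proj₁ (proj₂ filled) f))) (trans (sum-++ f mid _) (cong (_+_ (sum f mid)) (sum-++ f Dp big)))))))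

        out : ∀ {g} → card mid ≤ g → Out S (g + ((quarter + ea + ea) * card S + ⟦ D ℕ.* D ℕ.+ kmax i ℕ.* dropBound ⟧))
        out {g} mid≤ = record
          { L = L ; C = C′ ; nestL = nestL ; 0≤a′ = 0≤a′ ; 0≤b′ = 0≤b′ ; tree = proj₁ (proj₂ (proj₂ filled))
          ; lv≤ = ℕₚ.≤-trans (ℕₚ.≤-reflexive (proj₂ (proj₂ (proj₂ filled)))) (ℕₚ.≤-trans lv≤ LV≤)
          ; once = once-subˡ {S} {L ++ C′} {mid ++ (Dp ++ big)} whole once
          ; count = ≤-trans (≤-reflexive (trans (whole unit) (cong (_+_ (card (L ++ C′))) (trans (sum-++ unit mid (Dp ++ big)) (cong (_+_ (card mid)) (sum-++ unit Dp big))))))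
              (lin≤ (mid≤ ⊕ lost≤ ⊕ big≤ ⊕ (0≤+ (0≤+ (<⇒≤ 0<quarter) (<⇒≤ 0<ea)) (<⇒≤ 0<ea) ⊛ VH≤) ⊕ ≤-reflexive (sym (⟦⟧-+ (D ℕ.* D) (kmax i ℕ.* dropBound))))
                (ring-229 (card (L ++ C′)) (card mid) (card Dp) (card big) g (quarter + ea + ea) (card S) (card VH) ⟦ D ℕ.* D ⟧ ⟦ kmax i ℕ.* dropBound ⟧ ⟦ D ℕ.* D ℕ.+ kmax i ℕ.* dropBound ⟧)) }
          where
          abstract
            VH≤ : card VH ≤ card S
            VH≤ = lin≤ (card-nonneg M ⊕ card-nonneg mid ⊕ card-nonneg big) (trans (cong (_- card VH) (parts unit)) (ring-224 (card M) (card mid) (card VH) (card big)))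

    abstract
      LV≤LVmax : ∀ {i j} → i ℕ.≤ q′ → j ℕ.≤ q′ → Level.LV (dseq j) i ℕ.≤ LVmax
      LV≤LVmax {i} {j} i≤ j≤ = ℕₚ.≤-trans (≤sumTo q′ (Level.LV (dseq j)) i≤) (≤sumTo q′ (λ j → sumTo q′ (Level.LV (dseq j))) j≤)

      const≤Kmax : ∀ {i j} → i ℕ.≤ q′ → j ℕ.≤ q′ → suc q′ ℕ.* Level.const (dseq j) i ℕ.≤ Kmax
      const≤Kmax {i} {j} i≤ j≤ = ℕₚ.≤-trans (≤sumTo q′ (λ i → suc q′ ℕ.* Level.const (dseq j) i) i≤) (≤sumTo q′ (λ j → sumTo q′ λ i → suc q′ ℕ.* Level.const (dseq j) i) j≤)

    weaken : ∀ {S s S′ s′} → (∀ c → card S ≤ c + s → card S′ ≤ c + s′) → Out S s → Out S′ s′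
    weaken f o = record { L = O.L ; C = O.C ; nestL = O.nestL ; 0≤a′ = O.0≤a′ ; 0≤b′ = O.0≤b′ ; tree = O.tree ; lv≤ = O.lv≤ ; once = O.once ; count = f (card (O.L ++ O.C)) O.count }
      where module O = Out o

    module Many {S : List Item} (once : Once S) (pk : Pack w h N N S) (K≤ : ⟦ Kmax ⟧ ≤ card S) (A B : List Item) (s : Split S A B)
      (cB : ⟦ suc q′ ⟧ * card B ≤ card S + ⟦ suc q′ ⟧) (aB : sum area S ≤ ⟦ suc q′ ⟧ * sum area B) where

      -- The items of `A` as a filter of `S`, since packings are restricted by predicates.
      S₁ : List Item
      S₁ = filter (_∈? A) S

      abstract
        eq : ∀ f → sum f S₁ ≡ sum f A
        eq f = trans (split-filter (_∈? A) {S} {A} {B} s f) (trans (cong₂ _+_ (cong (sum f) (Listₚ.filter-all (_∈? A) (All.tabulate id)))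
                   (cong (sum f) (Listₚ.filter-none (_∈? A) (All.tabulate (λ {i} i∈B i∈A → once-disjoint {A} {B} onceAB i∈A i∈B))))) (+-identityʳ (sum f A)))
          where
          onceAB : Once (A ++ B)
          onceAB i = ≤-trans (≤-reflexive (trans (sum-++ _ A B) (sym (s _)))) (once i)

        -- the heaviest of suc q′ groups was dropped, which leaves room for the small items
        remaining : sum area S₁ ≤ N * N - ea * (N * N)
        remaining = ≤-trans (≤-reflexive (eq area)) (lin≤ ((<⇒≤ 0<ea ⊛ aB) ⊕ (≤⇒0≤ ea≤1 ⊛ area≤ w>0 h>0 (<⇒≤ 0<N) (<⇒≤ 0<N) pk))
            (l (N * N) ea ⟦ suc q′ ⟧ (sum area A) (sum area B) (sum area S) (s area) ea-*))
          where
          l : ∀ n e q a b s → s ≡ a + b → e * q ≡ 1ℚ → (n - e * n) - a ≡ (e * (q * b) + (1ℚ - e) * n) - (e * s + (1ℚ - e) * s)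
          l n e q a b _ refl eq = trans (ring-235 n e a b) (cong (λ u → (u + (1ℚ - e) * n) - (e * (a + b) + (1ℚ - e) * (a + b))) (trans (cong (_* b) (sym eq)) (*-assoc e q b)))

        S₁≤S : card S₁ ≤ card S
        S₁≤S = ≤-trans (≤-reflexive (eq unit)) (split-≤ˡ {S = S} {A} {B} s (λ _ → 0≤1))

        once₁ : Once S₁
        once₁ = once-subˡ {S} {S₁} {B} (λ f → trans (s f) (cong (_+ sum f B) (sym (eq f)))) once

        pk₁ : Pack w h N N S₁
        pk₁ = restrictP (_∈? A) pk

        -- The five summands `ea` are: medium items, two from the strips, the items of `B`, and the
        -- additive constants. The last also cover the one by which `B` may exceed its share.
        bound : ∀ {X c} → 1ℚ + X ≤ ea * card S → card S₁ ≤ c + (ea * card S₁ + ((quarter + ea + ea) * card S₁ + X)) → card S ≤ c + (quarter + (ea + ea + ea + ea + ea)) * card S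
        bound {X} {c} const≤ le =
          lin≤ (le ⊕ ea-bound cB ⊕ (0≤+ (<⇒≤ 0<ea) (0≤+ (0≤+ (<⇒≤ 0<quarter) (<⇒≤ 0<ea)) (<⇒≤ 0<ea)) ⊛ S₁≤S) ⊕ const≤)
            (l ea c (card S₁) (card B) (card S) X ⟦ suc q′ ⟧ (trans (s unit) (cong (_+ card B) (sym (eq unit)))) ea-*)
          where
          l : ∀ e c a b s x q → s ≡ a + b → e * q ≡ 1ℚ → (c + (quarter + (e + e + e + e + e)) * s) - s ≡
            ((c + (e * a + ((quarter + e + e) * a + x))) + (e * (s + q) + ((e + (quarter + e + e)) * s + e * s))) - (a + (b + ((e + (quarter + e + e)) * a + (1ℚ + x))))
          l e c a b _ x q refl eq = trans (ring-236 e c a b x) (cong (λ u → ((c + (e * a + ((quarter + e + e) * a + x))) + (u + ((e + (quarter + e + e)) * (a + b) + e * (a + b)))) - (a + (b + ((e + (quarter + e + e)) * a + (1ℚ + x)))))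
            (trans (cong (_+_ (e * (a + b))) (sym eq)) (sym (*-distribˡ-+ e (a + b) q))))

      smallCount : ℕ → ℚ
      smallCount j = card (filter (Small? (dseq j)) S₁)

      module Pick (j : ℕ) (j≤ : j ℕ.≤ q′) (step : ⟦ suc q′ ⟧ * (smallCount j - smallCount (suc j)) ≤ smallCount 0) where

        module Cl = Classify (dseq j) (1≤dseq q′ j) once₁ pk₁ remaining

        abstract
          mid≤ : card Cl.mid ≤ ea * card S₁
          mid≤ = ≤-trans (≤-reflexive Cl.mid≡) (ea-bound (≤-trans step (split-≤ˡ {S = S₁} {A = filter (Small? (dseq 0)) S₁} {B = filter (¬? ∘ Small? (dseq 0)) S₁} {f = unit} (split-partition (Small? (dseq 0)) S₁) (λ _ → 0≤1))))

          const≤ : ∀ {i} → i ℕ.≤ q′ → 1ℚ + ⟦ Level.D (dseq j) ℕ.* Level.D (dseq j) ℕ.+ Level.kmax (dseq j) i ℕ.* Level.dropBound (dseq j) ⟧ ≤ ea * card S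
          const≤ {i} i≤ = ea-bound (≤-trans (≤-reflexive (sym (⟦⟧-* (suc q′) (Level.const (dseq j) i)))) (≤-trans (⟦⟧-mono (const≤Kmax i≤ j≤)) K≤))

        result : Out S ((quarter + (ea + ea + ea + ea + ea)) * card S)
        result = finish Cl.strips
          where
          finish : (∃ λ i → i ℕ.≤ q′ × Core.AtLevel.Kept _≟I_ w h w>0 h>0 q′ 0<N (dseq j) (1≤dseq q′ j) Cl.VH i) → Out S ((quarter + (ea + ea + ea + ea + ea)) * card S)
          finish (i , i≤ , kp) = weaken (λ c → bound {⟦ Level.D (dseq j) ℕ.* Level.D (dseq j) ℕ.+ Level.kmax (dseq j) i ℕ.* Level.dropBound (dseq j) ⟧} {c} (const≤ i≤)) (Cl.Finish.out i i≤ (LV≤LVmax i≤ j≤) kp mid≤)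

      result : Out S ((quarter + (ea + ea + ea + ea + ea)) * card S)
      result = pick (smallStep q′ smallCount (card-nonneg (filter (Small? (dseq (suc q′))) S₁)))
        where
        pick : (∃ λ j → j ℕ.≤ q′ × ⟦ suc q′ ⟧ * (smallCount j - smallCount (suc j)) ≤ smallCount 0) → Out S ((quarter + (ea + ea + ea + ea + ea)) * card S)
        pick (j , j≤ , step) = Pick.result j j≤ step

    manyItems : ∀ {S} → Once S → Pack w h N N S → ⟦ Kmax ⟧ ≤ card S → Out S ((quarter + (ea + ea + ea + ea + ea)) * card S)
    manyItems {S} once pk K≤ with drop-heavy area 0≤area q′ S
    ... | A , B , s , cB , aB = Many.result once pk K≤ A B s cB aB

-- Instances with few items, the bound on the containers, and the theorem

open import Defs hiding (w; h; N; n)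
import Defs
import Data.Nat
open import Data.Integer using (+_)
open Packings
open Counting
open ContainerTrees
open SizeClasses
open BoundaryL
open Cuts
open ItemPositions
open LCRealisation
open Constants
open StripSelection
open ManyItems

module _ {Item : Set} where

  card≤⇒length≤ : {A B : List Item} → card A ≤ card B → length A ℕ.≤ length B
  card≤⇒length≤ {A} {B} p = ⟦⟧-cancel (≤-<-trans (subst₂ _≤_ (card≡length A) (card≡length B) p) (lin< 0<1 (ring-54 ⟦ length B ⟧)))

  module _ {ea : ℚ} where

    private
      -- The number of items, but at least one, because an empty box is still a free leaf.
      Res : (w h : Item → ℚ) → ℚ → ℚ → List Item → Set
      Res w h a b S = ∃ λ S′ → (∀ f → sum f S′ ≡ sum f S) × Σ (CTree ea w h a b S′) λ T → leaves T ℕ.≤ suc (length S ℕ.∸ 1)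

      transposeRes : ∀ S {w h a b} → Res w h a b S → Res h w b a S
      transposeRes S (S′ , eq , T , l) = S′ , eq , transposeC T , ℕₚ.≤-trans (ℕₚ.≤-reflexive (leaves-transposeC T)) l

      n≤ : ∀ n → n ℕ.≤ suc (n ℕ.∸ 1)
      n≤ zero = ℕ.z≤n
      n≤ (suc n) = ℕₚ.≤-refl

      relabel : ∀ S A {w h a b} → (∀ f → sum f A ≡ sum f S) → Res w h a b A → Res w h a b S
      relabel S A e (S′ , eq , T , l) = S′ , (λ f → trans (eq f) (e f)) , T , ℕₚ.≤-trans l (ℕ.s≤s (ℕₚ.∸-monoˡ-≤ 1 (card≤⇒length≤ {A} {S} (≤-reflexive (e _)))))

      -- A part without items is absorbed by the other one, so that no leaf is spent on it and the
      -- bound by the number of items survives the recursion.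
      combine : ∀ {w h a₁ a₂ a b S} S₁ S₂ → 0ℚ ≤ a₁ → 0ℚ ≤ a₂ → a₁ + a₂ ≤ a → Split S S₁ S₂ →
        (∀ {x} → a₁ ≤ x → Res w h x b S₁) → (∀ {x} → a₂ ≤ x → Res w h x b S₂) → Res w h a b S
      combine {a₁ = a₁} {a₂} {S = S} [] S₂ p q le s f g = relabel S S₂ (λ k → sym (trans (s k) (+-identityˡ (sum k S₂)))) (g (≤-trans (≤-trans (≤-reflexive (sym (+-identityˡ a₂))) (p ⊕ ≤-refl {a₂})) le))
      combine {a₁ = a₁} {a₂} {S = S} S₁@(_ ∷ _) [] p q le s f g = relabel S S₁ (λ k → sym (trans (s k) (+-identityʳ (sum k S₁)))) (f (≤-trans (≤-trans (≤-reflexive (sym (+-identityʳ a₁))) (≤-refl {a₁} ⊕ q)) le))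
      combine {a₁ = a₁} {a₂} {a} {S = S} S₁@(_ ∷ _) S₂@(_ ∷ _) p q le s f g =
        let (S₁′ , eq₁ , T₁ , l₁) = f ≤-refl
            (S₂′ , eq₂ , T₂ , l₂) = g a₂≤
        in S₁′ ++ S₂′ , (λ k → trans (sum-++ k S₁′ S₂′) (trans (cong₂ _+_ (eq₁ k) (eq₂ k)) (sym (s k)))) ,
           vs p (≤-trans q a₂≤) (ring-41 a₁ a) (split-++ S₁′ S₂′) T₁ T₂ ,
           ℕₚ.≤-trans (ℕₚ.+-mono-≤ l₁ l₂) (ℕₚ.≤-trans (ℕₚ.≤-reflexive (sym (Listₚ.length-++ S₁))) (ℕₚ.≤-trans (card≤⇒length≤ {S₁ ++ S₂} {S} (≤-reflexive (trans (sum-++ (λ _ → 1ℚ) S₁ S₂) (sym (s (λ _ → 1ℚ)))))) (n≤ (length S))))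
        where
        abstract
          a₂≤ : a₂ ≤ a - a₁
          a₂≤ = lin≤ le (ring-237 a₁ a₂ a)

    -- Every item becomes a container of its own.
    singletons : ∀ {w h : Item → ℚ} {a b a₀ b₀ S} → a ≤ a₀ → b ≤ b₀ → Pack w h a b S →
      ∃ λ S′ → (∀ f → sum f S′ ≡ sum f S) × Σ (CTree ea w h a₀ b₀ S′) λ T → leaves T ℕ.≤ suc (length S ℕ.∸ 1)
    singletons p q nil = [] , (λ _ → refl) , free refl , ℕₚ.≤-refl
    singletons {h = h} p q (one {i} x y) = i ∷ [] , (λ _ → refl) , hst (≤-trans x p ∷ []) (≤-trans (≤-reflexive (+-identityʳ (h i))) (≤-trans y q)) , ℕₚ.≤-refl
    singletons p q (vcmp {S = S} {S₁} {S₂} 0≤a₁ 0≤a₂ le s P Q) = combine {S = S} S₁ S₂ 0≤a₁ 0≤a₂ (≤-trans le p) s (λ r → singletons r q P) (λ r → singletons r q Q)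
    singletons p q (hcmp {S = S} {S₁} {S₂} 0≤b₁ 0≤b₂ le s P Q) = transposeRes S (combine {S = S} S₁ S₂ 0≤b₁ 0≤b₂ (≤-trans le q) s (λ r → transposeRes S₁ (singletons p r P)) (λ r → transposeRes S₂ (singletons p r Q)))

-- The first summand serves instances with at most `Kmax` items, one container for each; the second
-- serves all others.
boundOf : ℕ → ℕ
boundOf q′ = suc (Precision.Kmax q′) ℕ.+ Precision.LVmax q′

-- The bound has to be defined for every rational; zero is a default outside of the range of the
-- theorem. The decision is an argument so that `bound-≥` can distinguish its cases.
boundDec : ∀ ε → Dec (0ℚ < ε) → ℕ
boundDec ε (yes p) = boundOf (proj₁ (precision ε p))
boundDec ε (no _) = 0

bound : ℚ → ℕ
bound ε = boundDec ε (0ℚ <? ε)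

bound-≥ : ∀ ε → 0ℚ < ε → ∃ λ q′ → Precision.ea q′ ≤ ε × boundOf q′ ℕ.≤ bound ε
bound-≥ ε 0<ε = go (0ℚ <? ε)
  where
  go : (d : Dec (0ℚ < ε)) → ∃ λ q′ → Precision.ea q′ ≤ ε × boundOf q′ ℕ.≤ boundDec ε d
  go (yes p) = proj₁ (precision ε p) , proj₂ (precision ε p) , ℕₚ.≤-refl
  go (no ¬p) = ⊥-elim (¬p 0<ε)

unique⇒once : ∀ {n} {S : List (Fin n)} → Unique S → ∀ i → sum (ind (Fin._≟ i)) S ≤ 1ℚ
unique⇒once [] i = 0≤1
unique⇒once {S = x ∷ S} (p ∷ u) i with x Fin.≟ i
... | yes refl = ≤-reflexive (trans (cong (_+_ 1ℚ) (absent p)) (+-identityʳ 1ℚ))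
  where
  absent : ∀ {S} → All (x ≢_) S → sum (ind (Fin._≟ x)) S ≡ 0ℚ
  absent [] = refl
  absent {y ∷ S} (q ∷ qs) with y Fin.≟ x
  ... | yes y≡x = ⊥-elim (q (sym y≡x))
  ... | no _ = trans (+-identityˡ _) (absent qs)
... | no _ = ≤-trans (≤-reflexive (+-identityˡ _)) (unique⇒once u i)

-- One for each loss beyond the quarter: heavy items, medium items, strips in the dropped depth
-- range, items lost in boxes, and additive constants.
five : ℚ
five = + 5 / 1

module Theorem (ε : ℚ) (0<ε : 0ℚ < ε) (q′ : ℕ) (ea≤ε : Precision.ea q′ ≤ ε) (b≤ : boundOf q′ ℕ.≤ bound ε) (I : Instance) (OPT : Packing I) (feas : Feasible I OPT) where

  open Precision q′ using (ea; Kmax; LVmax)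
  open Realize I ε ea ea≤ε
  open Realize₃ I ε ea ea≤ε using (N; lcPacking)
  open Classes Fin._≟_ W H W>0 H>0 using (Once)

  S : List Item
  S = sel OPT

  once : Once S
  once = unique⇒once (proj₁ feas)

  0≤N : 0ℚ ≤ N
  0≤N = subst (0ℚ ≤_) (sym (ℕ→ℚ≡⟦⟧ (Defs.N I))) (0≤⟦⟧ (Defs.N I))

  pk : Pack W H N N S
  pk = widen N-0 N-0 (Forget.forget W H W>0 H>0 (px OPT) (py OPT) (proj₂ (proj₂ (proj₂ feas))) S refl (proj₁ (proj₂ feas)))
    where
    abstract
      N-0 : N - 0ℚ ≤ N
      N-0 = ≤-reflexive (ring-149 N)

  Result : Set
  Result = Σ (LCPacking I ε bound) λ P → ((+ 3 / 4) - five * ε) * card S ≤ ⟦ profit (packing P) ⟧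

  few : length S ℕ.≤ Kmax → Result
  few len≤ = realise (singletons {ea = ea} ≤-refl ≤-refl pk)
    where
    abstract
      l : ∀ e s → s - ((+ 3 / 4) - five * e) * s ≡ (quarter * s + five * e * s) - (0ℚ + 0ℚ)
      l = solve-∀ ℚring
      le : ((+ 3 / 4) - five * ε) * card S ≤ card S
      le = lin≤ (0≤* (<⇒≤ 0<quarter) (card-nonneg S) ⊕ 0≤* (0≤* (nonNegative⁻¹ five) (<⇒≤ 0<ε)) (card-nonneg S)) (l ε (card S))
    realise : (∃ λ S′ → (∀ f → sum f S′ ≡ sum f S) × Σ (CTree ea W H N N S′) λ T → leaves T ℕ.≤ suc (length S ℕ.∸ 1)) → Result
    realise (S′ , eq , T , l≤) =
      let (P , pr) = lcPacking 0≤N 0≤N [] T (ℕₚ.≤-trans l≤ (ℕₚ.≤-trans (ℕ.s≤s (ℕₚ.≤-trans (ℕₚ.m∸n≤m (length S) 1) len≤)) (ℕₚ.≤-trans (ℕₚ.m≤m+n (suc Kmax) LVmax) b≤)))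
                       (λ i → ≤-trans (≤-reflexive (eq (ind (Fin._≟ i)))) (once i))
      in P , ≤-trans le (≤-reflexive (trans (sym (eq _)) (trans (card≡length S′) (cong ⟦_⟧ (sym pr)))))

  many : 0ℚ < N → ⟦ Kmax ⟧ ≤ card S → Result
  many 0<N K≤ = realise (Core₂.manyItems Fin._≟_ W H W>0 H>0 q′ 0<N once pk K≤)
    where
    open Core₂ Fin._≟_ W H W>0 H>0 q′ 0<N using (Out)
    abstract
      l : ∀ e f s c → c - ((+ 3 / 4) - five * e) * s ≡ ((c + (quarter + (f + f + f + f + f)) * s) + (five * s) * e) - (s + (five * s) * f)
      l = solve-∀ ℚring
      le : ∀ {c} → card S ≤ c + (quarter + (ea + ea + ea + ea + ea)) * card S → ((+ 3 / 4) - five * ε) * card S ≤ c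
      le {c} p = lin≤ (p ⊕ (0≤* (nonNegative⁻¹ five) (card-nonneg S) ⊛ ea≤ε)) (l ε ea (card S) c)
    realise : Out S ((quarter + (ea + ea + ea + ea + ea)) * card S) → Result
    realise o =
      let (P , pr) = lcPacking (Out.0≤a′ o) (Out.0≤b′ o) (Out.nestL o) (Out.tree o) (ℕₚ.≤-trans (Out.lv≤ o) (ℕₚ.≤-trans (ℕₚ.m≤n+m LVmax (suc Kmax)) b≤)) (Out.once o)
      in P , ≤-trans (le (Out.count o)) (≤-reflexive (trans (card≡length (Out.L o ++ Out.C o)) (cong ⟦_⟧ (sym pr))))

  result : Result
  result = decide (0ℚ <? N) (⟦ Kmax ⟧ ≤? card S)
    where
    empty : ¬ 0ℚ < N → ∀ T → All (λ i → W i ≤ N × H i ≤ N) T → length T ℕ.≤ Kmax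
    empty ¬N [] _ = ℕ.z≤n
    empty ¬N (i ∷ _) ((p , _) ∷ _) = ⊥-elim (¬N (<-≤-trans (W>0 i) p))
    decide : Dec (0ℚ < N) → Dec (⟦ Kmax ⟧ ≤ card S) → Result
    decide (yes 0<N) (yes K≤) = many 0<N K≤
    decide (yes _) (no ¬K) = few (⟦⟧-cancel (subst (_< ⟦ suc Kmax ⟧) (card≡length S) (<-≤-trans (≰⇒> ¬K) (⟦⟧-mono (ℕₚ.n≤1+n Kmax)))))
    -- A knapsack of size zero holds no item of positive width, so this is an instance with few
    -- items.
    decide (no ¬N) _ = few (empty ¬N S (fits pk))

mainTheorem8 : Σ ℚ λ c → Σ (ℚ → ℕ) λ bound →
    ∀ (ε : ℚ) → 0ℚ < ε →
    (I : Instance) (OPT : Packing I) → Optimal I OPT →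
    (LC : LCPacking I ε bound) →
    (∀ (LC′ : LCPacking I ε bound) → profit (packing LC′) Data.Nat.≤ profit (packing LC)) →
    ((+ 3 / 4) - c * ε) * ℕ→ℚ (profit OPT) ≤ ℕ→ℚ (profit (packing LC))
mainTheorem8 = five , bound , λ ε 0<ε I OPT opt LC best →
  let (q′ , ea≤ε , b≤) = bound-≥ ε 0<ε
      (P , le) = Theorem.result ε 0<ε q′ ea≤ε b≤ I OPT (proj₁ opt)
  in ≤-trans (≤-reflexive (cong (((+ 3 / 4) - five * ε) *_) (trans (ℕ→ℚ≡⟦⟧ (profit OPT)) (sym (card≡length (sel OPT))))))
       (≤-trans le (≤-trans (⟦⟧-mono (best P)) (≤-reflexive (sym (ℕ→ℚ≡⟦⟧ (profit (packing LC)))))))
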